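{- Suppose there is an algorithm which, given any integer linear recurrence sequence $\langle u_n\rangle_{n=0}^\infty$ of order $6$, decides whether there exists $N$ such that $u_n\ge 0$ for all $n\ge N$ (i.e. the Ultimate Positivity Problem is decidable for integer LRS of order $6$). Then for every $t\in\mathcal{T}$, the Lagrange constant $L_\infty(t)$ is a computable real number.
   Context: An integer linear recurrence sequence (LRS) of order $k$ is a sequence $\langle u_n\rangle_{n=0}^\infty$ of integers for which there are integers $a_1,\ldots,a_k$ with $a_k\ne 0$ such that $u_{n+k}=a_1u_{n+k-1}+\cdots+a_ku_n$ for all $n\ge0$; it is given as input by the $2k$-tuple $(a_1,\ldots,a_k,u_0,\ldots,u_{k-1})$. For a real number $x$, the Lagrange constant is $L_\infty(x)=\inf\{c\in\mathbb{R}: |x-\frac{n}{m}|<\frac{c}{m^2} \text{ for infinitely many pairs } (n,m) \text{ with } n,m\in\mathbb{Z},\ m\neq 0\}$. Let $\mathcal{A}=\{p+qi\in\mathbb{C}: p,q\in\mathbb{Q},\ p^2+q^2=1,\ p\neq 0,\ q\neq 0\}$, and let $\mathcal{T}=\{\frac{\arg\alpha}{2\pi}:\alpha\in\mathcal{A}\}$, where $\arg$ denotes the principal argument with values in $(-\pi,\pi]$. A real number $x$ is computable if there is an algorithm which, given any rational $\varepsilon>0$, returns a rational $q$ with $|q-x|<\varepsilon$. -}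

module Defs where

open import Data.Nat.Base as ℕ using (ℕ; zero; suc; _!)
import Data.Nat.Properties as ℕ
open import Data.Integer.Base as ℤ using (ℤ; -[1+_]; +[1+_]; 0ℤ; 1ℤ; -1ℤ)
import Data.Integer.Properties as ℤ
open import Data.Rational.Base as ℚ using (ℚ; 0ℚ; 1ℚ; ½)
import Data.Rational.Properties as ℚ
open import Data.Rational.Solver using (module +-*-Solver)
open import Data.Fin.Base as Fin using (Fin; toℕ; opposite)
open import Data.Vec.Base using (Vec; []; _∷_; _++_; lookup; tabulate)
open import Data.List.Membership.Propositional using (_∈_)
open import Data.Product.Base using (Σ; ∃; ∃₂; _×_; _,_; proj₁; proj₂)
open import Data.Sum.Base using (_⊎_; inj₁; inj₂)
open import Algebra.Definitions.RawMonoid ℤ.+-0-rawMonoid using (sum)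
open import Relation.Nullary using (¬_)
open import Relation.Binary.PropositionalEquality
  using (_≡_; _≢_; refl; sym; trans; cong; subst)

IsCauchy : (ℕ → ℚ) → Set
IsCauchy s = ∀ ε → 0ℚ ℚ.< ε →
  ∃ λ N → ∀ m n → N ℕ.≤ m → N ℕ.≤ n → ℚ.∣ s m ℚ.- s n ∣ ℚ.< ε

record ℝ : Set where
  constructor mkℝ
  field
    seq    : ℕ → ℚ
    cauchy : IsCauchy seq

open ℝ public

private
  half-pos : ∀ {ε} → 0ℚ ℚ.< ε → 0ℚ ℚ.< ½ ℚ.* ε
  half-pos {ε} ε>0 = subst (ℚ._< ½ ℚ.* ε) (ℚ.*-zeroʳ ½) (ℚ.*-monoʳ-<-pos ½ ε>0)

  halves : ∀ ε → ½ ℚ.* ε ℚ.+ ½ ℚ.* ε ≡ ε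
  halves ε = trans (sym (ℚ.*-distribʳ-+ ε ½ ½)) (ℚ.*-identityˡ ε)

  open +-*-Solver

  sum-diff : ∀ a b c d → (a ℚ.+ b) ℚ.- (c ℚ.+ d) ≡ (a ℚ.- c) ℚ.+ (b ℚ.- d)
  sum-diff = solve 4 (λ a b c d → (a :+ b) :- (c :+ d) := (a :- c) :+ (b :- d)) refl

  neg-diff : ∀ a b → ℚ.- a ℚ.- ℚ.- b ≡ ℚ.- (a ℚ.- b)
  neg-diff = solve 2 (λ a b → :- a :- :- b := :- (a :- b)) refl

  prod-diff : ∀ a b c d →
    a ℚ.* b ℚ.- c ℚ.* d ≡ a ℚ.* (b ℚ.- d) ℚ.+ d ℚ.* (a ℚ.- c)
  prod-diff = solve 4
    (λ a b c d → a :* b :- c :* d := a :* (b :- d) :+ d :* (a :- c)) refl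

  split : ∀ a b → a ≡ (a ℚ.- b) ℚ.+ b
  split = solve 2 (λ a b → a := (a :- b) :+ b) refl

  cancel : ∀ a b → (a ℚ.+ b) ℚ.- b ≡ a
  cancel = solve 2 (λ a b → (a :+ b) :- b := a) refl

  flip : ∀ a b → b ℚ.- a ≡ ℚ.- (a ℚ.- b)
  flip = solve 2 (λ a b → b :- a := :- (a :- b)) refl

  ∣∣-triangle : ∀ a b → ℚ.∣ a ∣ ℚ.- ℚ.∣ b ∣ ℚ.≤ ℚ.∣ a ℚ.- b ∣
  ∣∣-triangle a b = begin
    ℚ.∣ a ∣ ℚ.- ℚ.∣ b ∣
      ≡⟨ cong (λ z → ℚ.∣ z ∣ ℚ.- ℚ.∣ b ∣) (split a b) ⟩
    ℚ.∣ (a ℚ.- b) ℚ.+ b ∣ ℚ.- ℚ.∣ b ∣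
      ≤⟨ ℚ.+-monoˡ-≤ (ℚ.- ℚ.∣ b ∣) (ℚ.∣p+q∣≤∣p∣+∣q∣ (a ℚ.- b) b) ⟩
    (ℚ.∣ a ℚ.- b ∣ ℚ.+ ℚ.∣ b ∣) ℚ.- ℚ.∣ b ∣
      ≡⟨ cancel ℚ.∣ a ℚ.- b ∣ ℚ.∣ b ∣ ⟩
    ℚ.∣ a ℚ.- b ∣ ∎
    where open ℚ.≤-Reasoning

  ∣∣-sym : ∀ a b → ℚ.∣ b ℚ.- a ∣ ≡ ℚ.∣ a ℚ.- b ∣
  ∣∣-sym a b = trans (cong ℚ.∣_∣ (flip a b)) (ℚ.∣-p∣≡∣p∣ (a ℚ.- b))

  ∣∣-lipschitz : ∀ a b → ℚ.∣ ℚ.∣ a ∣ ℚ.- ℚ.∣ b ∣ ∣ ℚ.≤ ℚ.∣ a ℚ.- b ∣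
  ∣∣-lipschitz a b with ℚ.∣p∣≡p∨∣p∣≡-p (ℚ.∣ a ∣ ℚ.- ℚ.∣ b ∣)
  ... | inj₁ eq = subst (ℚ._≤ ℚ.∣ a ℚ.- b ∣) (sym eq) (∣∣-triangle a b)
  ... | inj₂ eq = subst (ℚ._≤ ℚ.∣ a ℚ.- b ∣)
    (trans (flip ℚ.∣ a ∣ ℚ.∣ b ∣) (sym eq))
    (subst (ℚ.∣ b ∣ ℚ.- ℚ.∣ a ∣ ℚ.≤_) (∣∣-sym a b) (∣∣-triangle b a))

  divide : ∀ {B ε} → 0ℚ ℚ.< B → 0ℚ ℚ.< ε → ∃ λ δ → 0ℚ ℚ.< δ × B ℚ.* δ ≡ ε
  divide {B} {ε} B>0 ε>0 = 1/B ℚ.* ε , δ>0 , (begin-equality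
    B ℚ.* (1/B ℚ.* ε)  ≡⟨ ℚ.*-assoc B 1/B ε ⟨
    B ℚ.* 1/B ℚ.* ε    ≡⟨ cong (ℚ._* ε) (ℚ.*-inverseʳ B) ⟩
    1ℚ ℚ.* ε           ≡⟨ ℚ.*-identityˡ ε ⟩
    ε                  ∎)
    where
    open ℚ.≤-Reasoning
    instance
      B-pos : ℚ.Positive B
      B-pos = ℚ.positive B>0
      B-nonZero : ℚ.NonZero B
      B-nonZero = ℚ.pos⇒nonZero B
    1/B : ℚ
    1/B = ℚ.1/ B
    δ>0 : 0ℚ ℚ.< 1/B ℚ.* ε
    δ>0 = subst (ℚ._< 1/B ℚ.* ε) (ℚ.*-zeroʳ 1/B)
      (ℚ.*-monoʳ-<-pos 1/B {{ℚ.1/pos⇒pos B}} ε>0)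

  product-< : ∀ u v {B δ} → 0ℚ ℚ.< δ → ℚ.∣ u ∣ ℚ.< B → ℚ.∣ v ∣ ℚ.< δ →
              ℚ.∣ u ℚ.* v ∣ ℚ.< B ℚ.* δ
  product-< u v {B} {δ} δ>0 u<B v<δ = begin-strict
    ℚ.∣ u ℚ.* v ∣
      ≡⟨ ℚ.∣p*q∣≡∣p∣*∣q∣ u v ⟩
    ℚ.∣ u ∣ ℚ.* ℚ.∣ v ∣
      ≤⟨ ℚ.*-monoˡ-≤-nonNeg ℚ.∣ u ∣ {{ℚ.∣-∣-nonNeg u}} (ℚ.<⇒≤ v<δ) ⟩
    ℚ.∣ u ∣ ℚ.* δ
      <⟨ ℚ.*-monoˡ-<-pos δ {{ℚ.positive δ>0}} u<B ⟩
    B ℚ.* δ ∎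
    where open ℚ.≤-Reasoning

  product-close : ∀ a b c d {A D δ} → 0ℚ ℚ.< δ →
    ℚ.∣ a ∣ ℚ.< A → ℚ.∣ d ∣ ℚ.< D →
    ℚ.∣ a ℚ.- c ∣ ℚ.< δ → ℚ.∣ b ℚ.- d ∣ ℚ.< δ →
    ℚ.∣ a ℚ.* b ℚ.- c ℚ.* d ∣ ℚ.< (A ℚ.+ D) ℚ.* δ
  product-close a b c d {A} {D} {δ} δ>0 a<A d<D ac<δ bd<δ = begin-strict
    ℚ.∣ a ℚ.* b ℚ.- c ℚ.* d ∣
      ≡⟨ cong ℚ.∣_∣ (prod-diff a b c d) ⟩
    ℚ.∣ a ℚ.* (b ℚ.- d) ℚ.+ d ℚ.* (a ℚ.- c) ∣
      ≤⟨ ℚ.∣p+q∣≤∣p∣+∣q∣ (a ℚ.* (b ℚ.- d)) (d ℚ.* (a ℚ.- c)) ⟩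
    ℚ.∣ a ℚ.* (b ℚ.- d) ∣ ℚ.+ ℚ.∣ d ℚ.* (a ℚ.- c) ∣
      <⟨ ℚ.+-mono-< (product-< a (b ℚ.- d) δ>0 a<A bd<δ)
                    (product-< d (a ℚ.- c) δ>0 d<D ac<δ) ⟩
    A ℚ.* δ ℚ.+ D ℚ.* δ
      ≡⟨ ℚ.*-distribʳ-+ δ A D ⟨
    (A ℚ.+ D) ℚ.* δ ∎
    where open ℚ.≤-Reasoning

  0<1 : 0ℚ ℚ.< 1ℚ
  0<1 = ℚ.positive⁻¹ 1ℚ

  EventuallyBounded : (ℕ → ℚ) → Set
  EventuallyBounded s =
    ∃₂ λ N B → 0ℚ ℚ.< B × (∀ n → N ℕ.≤ n → ℚ.∣ s n ∣ ℚ.< B)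

  eventually-bounded : ∀ {s} → IsCauchy s → EventuallyBounded s
  eventually-bounded {s} cs = bounded (cs 1ℚ 0<1)
    where
    open ℚ.≤-Reasoning
    bounded : (∃ λ N → ∀ m n → N ℕ.≤ m → N ℕ.≤ n → ℚ.∣ s m ℚ.- s n ∣ ℚ.< 1ℚ) →
              EventuallyBounded s
    bounded (N , close) =
      N , 1ℚ ℚ.+ ℚ.∣ s N ∣ , ℚ.+-mono-<-≤ 0<1 (ℚ.0≤∣p∣ (s N)) , λ n N≤n → begin-strict
        ℚ.∣ s n ∣                     ≡⟨ cong ℚ.∣_∣ (split (s n) (s N)) ⟩
        ℚ.∣ (s n ℚ.- s N) ℚ.+ s N ∣   ≤⟨ ℚ.∣p+q∣≤∣p∣+∣q∣ (s n ℚ.- s N) (s N) ⟩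
        ℚ.∣ s n ℚ.- s N ∣ ℚ.+ ℚ.∣ s N ∣
          <⟨ ℚ.+-monoˡ-< ℚ.∣ s N ∣ (close n N N≤n ℕ.≤-refl) ⟩
        1ℚ ℚ.+ ℚ.∣ s N ∣              ∎

  cauchy-* : ∀ {s t} → IsCauchy s → IsCauchy t → IsCauchy (λ n → s n ℚ.* t n)
  cauchy-* {s} {t} cs ct ε ε>0 =
    combine (eventually-bounded cs) (eventually-bounded ct)
    where
    combine : EventuallyBounded s → EventuallyBounded t →
      ∃ λ N → ∀ m n → N ℕ.≤ m → N ℕ.≤ n → ℚ.∣ s m ℚ.* t m ℚ.- s n ℚ.* t n ∣ ℚ.< ε
    combine (Ms , S , S>0 , s<S) (Mt , T , T>0 , t<T) =
      M ℕ.⊔ N , λ m n ≤m ≤n →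
        let M≤m = ℕ.m⊔n≤o⇒m≤o M N ≤m
            M≤n = ℕ.m⊔n≤o⇒m≤o M N ≤n
            N≤m = ℕ.m⊔n≤o⇒n≤o M N ≤m
            N≤n = ℕ.m⊔n≤o⇒n≤o M N ≤n
        in subst (ℚ.∣ s m ℚ.* t m ℚ.- s n ℚ.* t n ∣ ℚ.<_) (proj₂ (proj₂ quotient))
             (product-close (s m) (t m) (s n) (t n) δ>0
               (s<S m (ℕ.m⊔n≤o⇒m≤o Ms Mt M≤m))
               (t<T n (ℕ.m⊔n≤o⇒n≤o Ms Mt M≤n))
               (proj₂ ds m n (ℕ.m⊔n≤o⇒m≤o Ns Nt N≤m) (ℕ.m⊔n≤o⇒m≤o Ns Nt N≤n))
               (proj₂ dt m n (ℕ.m⊔n≤o⇒n≤o Ns Nt N≤m) (ℕ.m⊔n≤o⇒n≤o Ns Nt N≤n)))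
      where
      quotient : ∃ λ δ → 0ℚ ℚ.< δ × (S ℚ.+ T) ℚ.* δ ≡ ε
      quotient = divide (ℚ.+-mono-< S>0 T>0) ε>0
      δ : ℚ
      δ = proj₁ quotient
      δ>0 : 0ℚ ℚ.< δ
      δ>0 = proj₁ (proj₂ quotient)
      ds = cs δ δ>0
      dt = ct δ δ>0
      Ns = proj₁ ds
      Nt = proj₁ dt
      M = Ms ℕ.⊔ Mt
      N = Ns ℕ.⊔ Nt

ι : ℚ → ℝ
ι q = mkℝ (λ _ → q) λ ε ε>0 → 0 , λ _ _ _ _ →
  subst (λ z → ℚ.∣ z ∣ ℚ.< ε) (sym (ℚ.+-inverseʳ q)) ε>0

infixl 6 _+_ _-_
infixl 7 _*_
infix  8 -_

_+_ : ℝ → ℝ → ℝ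
x + y = mkℝ (λ n → seq x n ℚ.+ seq y n) isCauchy
  where
  isCauchy : IsCauchy (λ n → seq x n ℚ.+ seq y n)
  isCauchy ε ε>0 = Nx ℕ.⊔ Ny , λ m n N≤m N≤n → begin-strict
    ℚ.∣ (seq x m ℚ.+ seq y m) ℚ.- (seq x n ℚ.+ seq y n) ∣
      ≡⟨ cong ℚ.∣_∣ (sum-diff (seq x m) (seq y m) (seq x n) (seq y n)) ⟩
    ℚ.∣ (seq x m ℚ.- seq x n) ℚ.+ (seq y m ℚ.- seq y n) ∣
      ≤⟨ ℚ.∣p+q∣≤∣p∣+∣q∣ (seq x m ℚ.- seq x n) (seq y m ℚ.- seq y n) ⟩
    ℚ.∣ seq x m ℚ.- seq x n ∣ ℚ.+ ℚ.∣ seq y m ℚ.- seq y n ∣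
      <⟨ ℚ.+-mono-<
           (proj₂ cx m n (ℕ.m⊔n≤o⇒m≤o Nx Ny N≤m) (ℕ.m⊔n≤o⇒m≤o Nx Ny N≤n))
           (proj₂ cy m n (ℕ.m⊔n≤o⇒n≤o Nx Ny N≤m) (ℕ.m⊔n≤o⇒n≤o Nx Ny N≤n)) ⟩
    ½ ℚ.* ε ℚ.+ ½ ℚ.* ε
      ≡⟨ halves ε ⟩
    ε ∎
    where
    open ℚ.≤-Reasoning
    cx = cauchy x (½ ℚ.* ε) (half-pos ε>0)
    cy = cauchy y (½ ℚ.* ε) (half-pos ε>0)
    Nx = proj₁ cx
    Ny = proj₁ cy

-_ : ℝ → ℝ
- x = mkℝ (λ n → ℚ.- seq x n) λ ε ε>0 →
  let N , c = cauchy x ε ε>0 in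
  N , λ m n N≤m N≤n → subst (ℚ._< ε)
    (sym (trans (cong ℚ.∣_∣ (neg-diff (seq x m) (seq x n)))
                (ℚ.∣-p∣≡∣p∣ (seq x m ℚ.- seq x n))))
    (c m n N≤m N≤n)

_-_ : ℝ → ℝ → ℝ
x - y = x + - y

∣_∣ : ℝ → ℝ
∣ x ∣ = mkℝ (λ n → ℚ.∣ seq x n ∣) λ ε ε>0 →
  let N , c = cauchy x ε ε>0 in
  N , λ m n N≤m N≤n →
    ℚ.≤-<-trans (∣∣-lipschitz (seq x m) (seq x n)) (c m n N≤m N≤n)

_*_ : ℝ → ℝ → ℝ
x * y = mkℝ (λ n → seq x n ℚ.* seq y n) (cauchy-* {seq x} {seq y} (cauchy x) (cauchy y))

infix 4 _≈_ _<_ _≤_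

_≈_ : ℝ → ℝ → Set
x ≈ y = ∀ ε → 0ℚ ℚ.< ε →
  ∃ λ N → ∀ n → N ℕ.≤ n → ℚ.∣ seq x n ℚ.- seq y n ∣ ℚ.< ε

_<_ : ℝ → ℝ → Set
x < y = ∃ λ ε → 0ℚ ℚ.< ε ×
  ∃ λ N → ∀ n → N ℕ.≤ n → seq x n ℚ.+ ε ℚ.≤ seq y n

_≤_ : ℝ → ℝ → Set
x ≤ y = ¬ (y < x)

IsInfimum : (ℝ → Set) → ℝ → Set
IsInfimum S l = (∀ c → S c → l ≤ c) × (∀ b → (∀ c → S c → b ≤ c) → b ≤ l)

infixr 8 _^_

_^_ : ℝ → ℕ → ℝ
x ^ zero  = ι 1ℚ
x ^ suc k = x * x ^ k

partialSum : (ℕ → ℝ) → ℕ → ℝ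
partialSum f zero    = ι 0ℚ
partialSum f (suc n) = partialSum f n + f n

_ConvergesTo_ : (ℕ → ℝ) → ℝ → Set
s ConvergesTo l = ∀ ε → 0ℚ ℚ.< ε → ∃ λ N → ∀ n → N ℕ.≤ n → ∣ s n - l ∣ < ι ε

coeff : ℕ → ℕ → ℚ
coeff k n = ((-1ℤ ℤ.^ k) ℚ./ (n !)) {{n ℕ.!≢0}}

infix 4 Cos_≈_ Sin_≈_

Cos_≈_ : ℝ → ℝ → Set
Cos x ≈ y = partialSum (λ k → ι (coeff k (2 ℕ.* k)) * x ^ (2 ℕ.* k)) ConvergesTo y

Sin_≈_ : ℝ → ℝ → Set
Sin x ≈ y =
  partialSum (λ k → ι (coeff k (suc (2 ℕ.* k))) * x ^ suc (2 ℕ.* k)) ConvergesTo y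

-- π is the least positive zero of the sine.
IsPi : ℝ → Set
IsPi π = ι 0ℚ < π × Sin π ≈ ι 0ℚ × (∀ x → ι 0ℚ < x → x < π → ¬ Sin x ≈ ι 0ℚ)

record 𝒜 : Set where
  field
    p q    : ℚ
    unit   : p ℚ.* p ℚ.+ q ℚ.* q ≡ 1ℚ
    p≢0    : p ≢ 0ℚ
    q≢0    : q ≢ 0ℚ

-- Elements of 𝒜 have modulus 1, so θ is an argument of p + qi exactly when
-- p + qi = cos θ + i sin θ.
IsArg : (π : ℝ) → 𝒜 → ℝ → Set
IsArg π α θ = - π < θ × θ ≤ π × Cos θ ≈ ι (𝒜.p α) × Sin θ ≈ ι (𝒜.q α)

𝒯 : ℝ → Set
𝒯 t = ∃ λ π → IsPi π × ∃₂ λ α θ → IsArg π α θ × ι (1ℚ ℚ.+ 1ℚ) * π * t ≈ θ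

-- Infinitude is the negation of finiteness, as in classical mathematics; it is
-- not strengthened to an enumeration of infinitely many elements.
Finite : {A : Set} → (A → Set) → Set
Finite P = ∃ λ xs → ∀ x → P x → x ∈ xs

Infinite : {A : Set} → (A → Set) → Set
Infinite P = ¬ Finite P

infixl 7 _÷_

_÷_ : ℤ → (m : ℤ) → .{{ℤ.NonZero m}} → ℚ
n ÷ +[1+ m ] = n ℚ./ suc m
n ÷ -[1+ m ] = (ℤ.- n) ℚ./ suc m

Approximates : ℝ → ℝ → ℤ × ℤ → Set
Approximates x c (n , m) = Σ (ℤ.NonZero m) λ m≢0 →
  ∣ x - ι ((n ÷ m) {{m≢0}}) ∣
    < c * ι ((1ℤ ÷ (m ℤ.* m)) {{ℤ.i*j≢0 m m {{m≢0}} {{m≢0}}}})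

IsLagrangeConstant : ℝ → ℝ → Set
IsLagrangeConstant x = IsInfimum (λ c → Infinite (Approximates x c))

-- "Algorithm" means a partial recursive function, given by its code, and not an
-- Agda function: a Cauchy sequence ℕ → ℚ in ℝ carries no computability claim.
data Rec : ℕ → Set where
  zeroᵣ : Rec 0
  sucᵣ  : Rec 1
  proj  : ∀ {n} → Fin n → Rec n
  comp  : ∀ {m n} → Rec m → Vec (Rec n) m → Rec n
  prec  : ∀ {n} → Rec n → Rec (2 ℕ.+ n) → Rec (1 ℕ.+ n)
  min   : ∀ {n} → Rec (1 ℕ.+ n) → Rec n

infix 4 _[_]⇓_ _[_]⇓*_

mutual
  -- f [ xs ]⇓ y : the computation of f on input xs halts with output y.
  data _[_]⇓_ : ∀ {n} → Rec n → Vec ℕ n → ℕ → Set where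
    ⇓zero : zeroᵣ [ [] ]⇓ 0
    ⇓suc  : ∀ {x} → sucᵣ [ x ∷ [] ]⇓ suc x
    ⇓proj : ∀ {n} {i : Fin n} {xs} → proj i [ xs ]⇓ lookup xs i
    ⇓comp : ∀ {m n} {f : Rec m} {gs : Vec (Rec n) m} {xs ys z} →
            gs [ xs ]⇓* ys → f [ ys ]⇓ z → comp f gs [ xs ]⇓ z
    ⇓prec-zero : ∀ {n} {f : Rec n} {g xs y} →
                 f [ xs ]⇓ y → prec f g [ 0 ∷ xs ]⇓ y
    ⇓prec-suc  : ∀ {n} {f : Rec n} {g k xs y z} →
                 prec f g [ k ∷ xs ]⇓ y → g [ k ∷ y ∷ xs ]⇓ z →
                 prec f g [ suc k ∷ xs ]⇓ z
    ⇓min  : ∀ {n} {f : Rec (1 ℕ.+ n)} {xs k} →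
            (∀ j → j ℕ.< k → ∃ λ y → f [ j ∷ xs ]⇓ suc y) →
            f [ k ∷ xs ]⇓ 0 → min f [ xs ]⇓ k

  data _[_]⇓*_ {n} : ∀ {m} → Vec (Rec n) m → Vec ℕ n → Vec ℕ m → Set where
    []  : ∀ {xs} → [] [ xs ]⇓* []
    _∷_ : ∀ {m} {g : Rec n} {gs : Vec (Rec n) m} {xs y ys} →
          g [ xs ]⇓ y → gs [ xs ]⇓* ys → g ∷ gs [ xs ]⇓* y ∷ ys

-- Integers are coded as 0, -1, 1, -2, 2, … ↦ 0, 1, 2, 3, 4, …
⌜_⌝ : ℤ → ℕ
⌜ ℤ.+ n    ⌝ = 2 ℕ.* n
⌜ -[1+ n ] ⌝ = suc (2 ℕ.* n)

-- A rational may be presented by any fraction, not only in lowest terms.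
data _Codes_ : Vec ℕ 2 → ℚ → Set where
  fraction : ∀ a d → (⌜ a ⌝ ∷ d ∷ []) Codes (a ℚ./ suc d)

ComputableReal : ℝ → Set
ComputableReal x = Σ (Vec (Rec 2) 2) λ f →
  ∀ ε → 0ℚ ℚ.< ε → ∀ c → c Codes ε →
  ∃₂ λ d q → f [ c ]⇓* d × d Codes q × ∣ ι q - x ∣ < ι ε

-- The coefficient a_j of the recurrence is a i for toℕ i = j - 1, and then
-- toℕ (opposite i) = k - j.
record LRS (k : ℕ) : Set where
  field
    u          : ℕ → ℤ
    a          : Fin k → ℤ
    last≢0     : ∀ i → suc (toℕ i) ≡ k → a i ≢ 0ℤ
    recurrence : ∀ n → u (n ℕ.+ k) ≡ sum (λ i → a i ℤ.* u (n ℕ.+ toℕ (opposite i)))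

  input : Vec ℕ (k ℕ.+ k)
  input = tabulate (λ i → ⌜ a i ⌝) ++ tabulate (λ i → ⌜ u (toℕ i) ⌝)

UltimatelyPositive : (ℕ → ℤ) → Set
UltimatelyPositive u = ∃ λ N → ∀ n → N ℕ.≤ n → 0ℤ ℤ.≤ u n

UltimatePositivityDecidable : ℕ → Set
UltimatePositivityDecidable k = Σ (Rec (k ℕ.+ k)) λ f → (s : LRS k) →
  (f [ LRS.input s ]⇓ 1 × UltimatelyPositive (LRS.u s)) ⊎
  (f [ LRS.input s ]⇓ 0 × ¬ UltimatelyPositive (LRS.u s))

-- Let α = p + qi have argument 2πt. Up to a factor tending to 1, |t − k/m| < c/m²
-- says that m · tan(d/2) < πc, where d is the distance of 2πmt from 2πℤ, and this
-- is m (1 − Re αᵐ) < πc |Im αᵐ|. After multiplication by dᵐ, where d is a common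
-- denominator of p and q, the sequences m (1 − Re αᵐ) ± r Im αᵐ become integer
-- linear recurrences with characteristic polynomial (x − d)² (x² − 2pd x + d²)², so
-- the Ultimate Positivity oracle decides whether π L∞(t) lies above or below r,
-- except at equality, where either answer is harmless. A search over a grid of
-- values r = j π̃ / N, where π̃ is a computed approximation of π, then approximates
-- L∞(t). It terminates because Dirichlet's theorem bounds π L∞(t), and α is not a
-- root of unity. Since r enters only linearly, the search is a recursive function.
--
-- The approximation π̃ comes from the least j such that a Taylor polynomial of the
-- cosine is ≤ 0 at j / N.

module Submission where

open import Defs renaming
  ( _+_ to _+ᴿ_; _*_ to _*ᴿ_; -_ to -ᴿ_; _-_ to _-ᴿ_; ∣_∣ to ∣_∣ᴿ; _^_ to _^ᴿ_
  ; _<_ to _<ᴿ_; _≤_ to _≤ᴿ_ )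
open import Data.Nat.Base as ℕ using (ℕ; zero; suc; _!)
import Data.Nat.Properties as ℕ
open import Data.Integer.Base as ℤ using (ℤ; -[1+_]; +[1+_]; 0ℤ; _⊖_)
import Data.Integer.Properties as ℤ
open import Data.Rational.Base as ℚ using (ℚ; 0ℚ; 1ℚ; ½; _/_)
import Data.Rational.Properties as ℚ
open import Data.Product.Base using (Σ; ∃; ∃₂; _×_; _,_; proj₁; proj₂)
open import Data.Sum.Base using (_⊎_; inj₁; inj₂; [_,_]′)
open import Data.Empty using (⊥-elim)
open import Relation.Nullary using (¬_; Dec; yes; no)
open import Relation.Binary.PropositionalEquality
open import Tactic.RingSolver using (solve-∀)

-- The reals are Cauchy sequences of rationals without a modulus, so neither their order nor the
-- infinitude of a set of approximations can be decided. Estimates are therefore made on the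
-- rational terms, from some index on, and infinitude is used as the refutation of finiteness. The
-- hinge is `Far r`, which says r² (1 + Re αⁿ) ≤ n² (1 - Re αⁿ) for all large n. It does not mention
-- the sign of Im αⁿ, it is equivalent to the conjunction of the two oracle questions, and it
-- compares with |t - k/m| through 1 - cos x alone, where x = 2π(mt - k). The bounds x²/2 - x⁴/24 ≤
-- 1 - cos x ≤ x²/2 then suffice; they are available for x² ≤ 12, which covers |x| ≤ π with some
-- room. `IsPi` carries no rate of convergence, so a zero of the cosine in [1, 2] is computed
-- independently and identified with π/2. That α is no root of unity is arithmetic: the denominator
-- of p would have to divide a power of 2, but it is odd and different from 1.

-- Ordered-field arithmetic of the rationals, and rounding to integers.

module Rationals where

  open import Data.Rational.Base using (_+_; _-_; _*_; -_; _≤_; _<_; ∣_∣)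
  import Data.Rational.Unnormalised.Base as ℚᵘ
  import Data.Rational.Unnormalised.Properties as ℚᵘ
  open import Relation.Nullary.Decidable using (dec⇒maybe)
  open import Level using (0ℓ)
  open import Tactic.RingSolver.Core.AlmostCommutativeRing using (AlmostCommutativeRing; fromCommutativeRing)

  ℚ-ring : AlmostCommutativeRing 0ℓ 0ℓ
  ℚ-ring = fromCommutativeRing ℚ.+-*-commutativeRing (λ x → dec⇒maybe (0ℚ ℚ.≟ x))

  2ℚ 3ℚ 4ℚ 6ℚ : ℚ
  2ℚ = 1ℚ + 1ℚ
  3ℚ = 1ℚ + 2ℚ
  4ℚ = 1ℚ + 3ℚ
  6ℚ = 2ℚ * 3ℚ

  private variable
    a b c d : ℚ

  ≤⇒0≤- : a ≤ b → 0ℚ ≤ b - a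
  ≤⇒0≤- {a} {b} a≤b = subst (_≤ b - a) (ℚ.+-inverseʳ a) (ℚ.+-monoˡ-≤ (- a) a≤b)

  <⇒0<- : a < b → 0ℚ < b - a
  <⇒0<- {a} {b} a<b = subst (_< b - a) (ℚ.+-inverseʳ a) (ℚ.+-monoˡ-< (- a) a<b)

  private
    re-add : ∀ a b → (b - a) + a ≡ b
    re-add = solve-∀ ℚ-ring

  -- Polynomial inequalities are proved by exhibiting the difference of the two
  -- sides as a visibly nonnegative expression.
  ≤-from : 0ℚ ≤ c → b - a ≡ c → a ≤ b
  ≤-from {c} {b} {a} 0≤c eq = subst₂ _≤_ (ℚ.+-identityˡ a) (re-add a b)
    (ℚ.+-monoˡ-≤ a (subst (0ℚ ≤_) (sym eq) 0≤c))

  0≤-⇒≤ : 0ℚ ≤ b - a → a ≤ b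
  0≤-⇒≤ h = ≤-from h refl

  <-from : 0ℚ < c → b - a ≡ c → a < b
  <-from {c} {b} {a} 0<c eq = subst₂ _<_ (ℚ.+-identityˡ a) (re-add a b)
    (ℚ.+-monoˡ-< a (subst (0ℚ <_) (sym eq) 0<c))

  infixl 6 _⊕_ _⊕⁺_ _⁺⊕_
  infixl 7 _⊗_ _⊗⁺_

  -- The names mirror the ring operations, so the term that proves a certificate nonnegative has the
  -- shape of the certificate itself; the superscript marks strictness.
  _⊕_ : 0ℚ ≤ a → 0ℚ ≤ b → 0ℚ ≤ a + b
  _⊕_ = ℚ.+-mono-≤

  _⊕⁺_ : 0ℚ ≤ a → 0ℚ < b → 0ℚ < a + b
  _⊕⁺_ = ℚ.+-mono-≤-<

  _⁺⊕_ : 0ℚ < a → 0ℚ ≤ b → 0ℚ < a + b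
  _⁺⊕_ = ℚ.+-mono-<-≤

  _⊗_ : 0ℚ ≤ a → 0ℚ ≤ b → 0ℚ ≤ a * b
  _⊗_ {a} {b} 0≤a 0≤b =
    subst (_≤ a * b) (ℚ.*-zeroʳ a) (ℚ.*-monoˡ-≤-nonNeg a {{ℚ.nonNegative 0≤a}} 0≤b)

  _⊗⁺_ : 0ℚ < a → 0ℚ < b → 0ℚ < a * b
  _⊗⁺_ {a} {b} 0<a 0<b =
    subst (_< a * b) (ℚ.*-zeroʳ a) (ℚ.*-monoʳ-<-pos a {{ℚ.positive 0<a}} 0<b)

  square≥0 : ∀ a → 0ℚ ≤ a * a
  square≥0 a with ℚ.≤-total 0ℚ a
  ... | inj₁ 0≤a = 0≤a ⊗ 0≤a
  ... | inj₂ a≤0 = subst (0ℚ ≤_) (neg-square a) (0≤-a ⊗ 0≤-a)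
    where
    neg-square : ∀ a → (- a) * (- a) ≡ a * a
    neg-square = solve-∀ ℚ-ring
    0≤-a : 0ℚ ≤ - a
    0≤-a = ℚ.neg-antimono-≤ a≤0

  0≤1 : 0ℚ ≤ 1ℚ
  0≤1 = ℚ.nonNegative⁻¹ 1ℚ

  0<1 : 0ℚ < 1ℚ
  0<1 = ℚ.positive⁻¹ 1ℚ

  0≤2 : 0ℚ ≤ 2ℚ
  0≤2 = ℚ.nonNegative⁻¹ 2ℚ

  0<2 : 0ℚ < 2ℚ
  0<2 = ℚ.positive⁻¹ 2ℚ

  0<½ : 0ℚ < ½
  0<½ = ℚ.positive⁻¹ ½

  0≤½ : 0ℚ ≤ ½
  0≤½ = ℚ.<⇒≤ 0<½

  *-mono : 0ℚ ≤ a → a ≤ b → 0ℚ ≤ c → c ≤ d → a * c ≤ b * d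
  *-mono {a} {b} {c} {d} 0≤a a≤b 0≤c c≤d = ≤-from
    (≤⇒0≤- a≤b ⊗ 0≤c ⊕ ℚ.≤-trans 0≤a a≤b ⊗ ≤⇒0≤- c≤d) (eq a b c d)
    where
    eq : ∀ a b c d → b * d - a * c ≡ (b - a) * c + b * (d - c)
    eq = solve-∀ ℚ-ring

  *-cancel-≤ : 0ℚ < c → a * c ≤ b * c → a ≤ b
  *-cancel-≤ {c} 0<c = ℚ.*-cancelʳ-≤-pos c {{ℚ.positive 0<c}}

  *-cancel-< : 0ℚ ≤ c → a * c < b * c → a < b
  *-cancel-< {c} 0≤c = ℚ.*-cancelʳ-<-nonNeg c {{ℚ.nonNegative 0≤c}}

  *-mono-< : 0ℚ < c → a < b → a * c < b * c
  *-mono-< {c} 0<c = ℚ.*-monoˡ-<-pos c {{ℚ.positive 0<c}}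

  reciprocal : 0ℚ < b → ∃ λ c → 0ℚ < c × c * b ≡ 1ℚ
  reciprocal {b} 0<b = (ℚ.1/ b) {{nz}} ,
    ℚ.positive⁻¹ _ {{ℚ.1/pos⇒pos b {{ℚ.positive 0<b}}}} , ℚ.*-inverseˡ b {{nz}}
    where
    nz = ℚ.pos⇒nonZero b {{ℚ.positive 0<b}}

  half-positive : 0ℚ < a → 0ℚ < ½ * a
  half-positive = 0<½ ⊗⁺_

  ∣∣-≤ : a ≤ b → - a ≤ b → ∣ a ∣ ≤ b
  ∣∣-≤ {a} {b} a≤b -a≤b with ℚ.∣p∣≡p∨∣p∣≡-p a
  ... | inj₁ eq = subst (_≤ b) (sym eq) a≤b
  ... | inj₂ eq = subst (_≤ b) (sym eq) -a≤b

  p≤∣p∣ : ∀ a → a ≤ ∣ a ∣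
  p≤∣p∣ a with ℚ.≤-total 0ℚ a
  ... | inj₁ 0≤a = ℚ.≤-reflexive (sym (ℚ.0≤p⇒∣p∣≡p 0≤a))
  ... | inj₂ a≤0 = ℚ.≤-trans a≤0 (ℚ.0≤∣p∣ a)

  -p≤∣p∣ : ∀ a → - a ≤ ∣ a ∣
  -p≤∣p∣ a = subst (- a ≤_) (ℚ.∣-p∣≡∣p∣ a) (p≤∣p∣ (- a))

  ∣∣-sym : ∀ a b → ∣ a - b ∣ ≡ ∣ b - a ∣
  ∣∣-sym a b = trans (cong ∣_∣ (flip a b)) (ℚ.∣-p∣≡∣p∣ (b - a))
    where
    flip : ∀ a b → a - b ≡ - (b - a)
    flip = solve-∀ ℚ-ring

  ∣-∣-triangle : ∀ a b c → ∣ a - c ∣ ≤ ∣ a - b ∣ + ∣ b - c ∣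
  ∣-∣-triangle a b c = subst (λ z → ∣ z ∣ ≤ ∣ a - b ∣ + ∣ b - c ∣) (eq a b c)
    (ℚ.∣p+q∣≤∣p∣+∣q∣ (a - b) (b - c))
    where
    eq : ∀ a b c → (a - b) + (b - c) ≡ a - c
    eq = solve-∀ ℚ-ring

  ∣∣² : ∀ a → ∣ a ∣ * ∣ a ∣ ≡ a * a
  ∣∣² a = trans (sym (ℚ.∣p*q∣≡∣p∣*∣q∣ a a)) (ℚ.0≤p⇒∣p∣≡p (square≥0 a))

  -- Unary recursion makes `fromℕ (suc n)` reduce to `1ℚ + fromℕ n`, a form that ring identities can
  -- use; the fraction n / 1 would be stuck behind its normalisation by a gcd.
  fromℕ : ℕ → ℚ
  fromℕ zero    = 0ℚ
  fromℕ (suc n) = 1ℚ + fromℕ n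

  fromℤ : ℤ → ℚ
  fromℤ (ℤ.+ n)    = fromℕ n
  fromℤ (-[1+ n ]) = - fromℕ (suc n)

  fromℕ≥0 : ∀ n → 0ℚ ≤ fromℕ n
  fromℕ≥0 zero    = ℚ.≤-refl
  fromℕ≥0 (suc n) = 0≤1 ⊕ fromℕ≥0 n

  fromℕ>0 : ∀ n → 0ℚ < fromℕ (suc n)
  fromℕ>0 n = 0<1 ⁺⊕ fromℕ≥0 n

  fromℕ-≥1 : ∀ n → 1ℚ ≤ fromℕ (suc n)
  fromℕ-≥1 n = ≤-from (fromℕ≥0 n) (eq (fromℕ n))
    where
    eq : ∀ x → 1ℚ + x - 1ℚ ≡ x
    eq = solve-∀ ℚ-ring

  fromℕ-+ : ∀ m n → fromℕ (m ℕ.+ n) ≡ fromℕ m + fromℕ n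
  fromℕ-+ zero    n = sym (ℚ.+-identityˡ _)
  fromℕ-+ (suc m) n = trans (cong (1ℚ +_) (fromℕ-+ m n)) (sym (ℚ.+-assoc 1ℚ (fromℕ m) (fromℕ n)))

  fromℕ-* : ∀ m n → fromℕ (m ℕ.* n) ≡ fromℕ m * fromℕ n
  fromℕ-* zero    n = sym (ℚ.*-zeroˡ (fromℕ n))
  fromℕ-* (suc m) n = trans (fromℕ-+ n (m ℕ.* n))
    (trans (cong (fromℕ n +_) (fromℕ-* m n)) (eq (fromℕ m) (fromℕ n)))
    where
    eq : ∀ x y → y + x * y ≡ (1ℚ + x) * y
    eq = solve-∀ ℚ-ring

  fromℕ-mono : ∀ {m n} → m ℕ.≤ n → fromℕ m ≤ fromℕ n
  fromℕ-mono {n = n} ℕ.z≤n = fromℕ≥0 n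
  fromℕ-mono (ℕ.s≤s m≤n) = ℚ.+-monoʳ-≤ 1ℚ (fromℕ-mono m≤n)

  fromℕ-mono-< : ∀ {m n} → m ℕ.< n → fromℕ m < fromℕ n
  fromℕ-mono-< {m} m<n = ℚ.<-≤-trans
    (<-from 0<1 (eq (fromℕ m))) (fromℕ-mono m<n)
    where
    eq : ∀ x → 1ℚ + x - x ≡ 1ℚ
    eq = solve-∀ ℚ-ring

  fromℕ-cancel-≤ : ∀ {m n} → fromℕ m ≤ fromℕ n → m ℕ.≤ n
  fromℕ-cancel-≤ {m} {n} le with m ℕ.≤? n
  ... | yes m≤n = m≤n
  ... | no m≰n = ⊥-elim (ℚ.<-irrefl refl (ℚ.<-≤-trans (fromℕ-mono-< (ℕ.≰⇒> m≰n)) le))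

  private
    /-+ : ∀ a b → (a / 1) + (b / 1) ≡ (a ℤ.+ b) / 1
    /-+ a b = ℚ.toℚᵘ-injective (ℚᵘ.≃-trans (ℚ.toℚᵘ-homo-+ (a / 1) (b / 1))
      (ℚᵘ.≃-trans (ℚᵘ.+-cong (ℚ.toℚᵘ-fromℚᵘ (ℚᵘ.mkℚᵘ a 0)) (ℚ.toℚᵘ-fromℚᵘ (ℚᵘ.mkℚᵘ b 0)))
      (ℚᵘ.≃-trans (ℚᵘ.*≡* (cong (ℤ._* ℤ.1ℤ) (cong₂ ℤ._+_ (ℤ.*-identityʳ a) (ℤ.*-identityʳ b))))
                  (ℚᵘ.≃-sym (ℚ.toℚᵘ-fromℚᵘ (ℚᵘ.mkℚᵘ (a ℤ.+ b) 0))))))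

  fromℕ≡/ : ∀ n → fromℕ n ≡ ℤ.+ n / 1
  fromℕ≡/ zero    = refl
  fromℕ≡/ (suc n) = trans (cong (1ℚ +_) (fromℕ≡/ n)) (/-+ ℤ.1ℤ (ℤ.+ n))

  fromℤ≡/ : ∀ z → fromℤ z ≡ z / 1
  fromℤ≡/ (ℤ.+ n)    = fromℕ≡/ n
  fromℤ≡/ (-[1+ n ]) = cong -_ (fromℕ≡/ (suc n))

  fromℤ-+ : ∀ a b → fromℤ (a ℤ.+ b) ≡ fromℤ a + fromℤ b
  fromℤ-+ a b = trans (fromℤ≡/ (a ℤ.+ b))
    (trans (sym (/-+ a b)) (sym (cong₂ _+_ (fromℤ≡/ a) (fromℤ≡/ b))))

  fromℤ-* : ∀ a b → fromℤ (a ℤ.* b) ≡ fromℤ a * fromℤ b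
  fromℤ-* a b = trans (fromℤ≡/ (a ℤ.* b)) (trans (sym /-*) (sym (cong₂ _*_ (fromℤ≡/ a) (fromℤ≡/ b))))
    where
    /-* : (a / 1) * (b / 1) ≡ (a ℤ.* b) / 1
    /-* = ℚ.toℚᵘ-injective (ℚᵘ.≃-trans (ℚ.toℚᵘ-homo-* (a / 1) (b / 1))
      (ℚᵘ.≃-trans (ℚᵘ.*-cong (ℚ.toℚᵘ-fromℚᵘ (ℚᵘ.mkℚᵘ a 0)) (ℚ.toℚᵘ-fromℚᵘ (ℚᵘ.mkℚᵘ b 0)))
                  (ℚᵘ.≃-sym (ℚ.toℚᵘ-fromℚᵘ (ℚᵘ.mkℚᵘ (a ℤ.* b) 0)))))

  fromℤ-neg : ∀ a → fromℤ (ℤ.- a) ≡ - fromℤ a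
  fromℤ-neg (ℤ.+ zero)  = refl
  fromℤ-neg ℤ.+[1+ n ]  = refl
  fromℤ-neg (-[1+ n ]) = eq (fromℕ (suc n))
    where
    eq : ∀ x → x ≡ - (- x)
    eq = solve-∀ ℚ-ring

  fromℤ-- : ∀ a b → fromℤ (a ℤ.- b) ≡ fromℤ a - fromℤ b
  fromℤ-- a b = trans (fromℤ-+ a (ℤ.- b)) (cong (fromℤ a +_) (fromℤ-neg b))

  /-*-fromℕ : ∀ a d → (a / suc d) * fromℕ (suc d) ≡ fromℤ a
  /-*-fromℕ a d = trans (cong ((a / suc d) *_) (fromℕ≡/ (suc d)))
    (trans (ℚ.toℚᵘ-injective
      (ℚᵘ.≃-trans (ℚ.toℚᵘ-homo-* (a / suc d) (ℤ.+ suc d / 1))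
      (ℚᵘ.≃-trans (ℚᵘ.*-cong (ℚ.toℚᵘ-fromℚᵘ (ℚᵘ.mkℚᵘ a d)) (ℚ.toℚᵘ-fromℚᵘ (ℚᵘ.mkℚᵘ (ℤ.+ suc d) 0)))
      (ℚᵘ.≃-trans (ℚᵘ.*≡* (ℤ.*-assoc a (ℤ.+ suc d) ℤ.1ℤ ))
                  (ℚᵘ.≃-sym (ℚ.toℚᵘ-fromℚᵘ (ℚᵘ.mkℚᵘ a 0)))))))
    (sym (fromℤ≡/ a)))

  fromℤ≥0 : ∀ {a} → ℤ.0ℤ ℤ.≤ a → 0ℚ ≤ fromℤ a
  fromℤ≥0 {ℤ.+ n} _ = fromℕ≥0 n

  fromℤ-cancel-≥0 : ∀ a → 0ℚ ≤ fromℤ a → ℤ.0ℤ ℤ.≤ a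
  fromℤ-cancel-≥0 (ℤ.+ n)    _ = ℤ.+≤+ ℕ.z≤n
  fromℤ-cancel-≥0 (-[1+ n ]) h =
    ⊥-elim (ℚ.<-irrefl refl (ℚ.<-≤-trans (ℚ.neg-antimono-< (fromℕ>0 n)) h))

  fromℤ-mono : ∀ {a b} → a ℤ.≤ b → fromℤ a ≤ fromℤ b
  fromℤ-mono {a} {b} a≤b = ≤-from
    (fromℤ≥0 (ℤ.i≤j⇒0≤j-i a≤b)) (sym (fromℤ-- b a))

  fromℤ-cancel-≤ : ∀ {a b} → fromℤ a ≤ fromℤ b → a ℤ.≤ b
  fromℤ-cancel-≤ {a} {b} le = ℤ.0≤i-j⇒j≤i
    (fromℤ-cancel-≥0 (b ℤ.- a) (subst (0ℚ ≤_) (sym (fromℤ-- b a)) (≤⇒0≤- le)))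

  fromℤ-injective : ∀ {a b} → fromℤ a ≡ fromℤ b → a ≡ b
  fromℤ-injective eq = ℤ.≤-antisym
    (fromℤ-cancel-≤ (ℚ.≤-reflexive eq)) (fromℤ-cancel-≤ (ℚ.≤-reflexive (sym eq)))

  -- This is 1/(n + 1), where the shift spares all nonzero side conditions. Being abstract, it keeps
  -- conversion checking away from the gcd inside the fraction.
  abstract
    inv : ℕ → ℚ
    inv n = ℤ.1ℤ / suc n

    inv≡/ : ∀ n → inv n ≡ ℤ.1ℤ / suc n
    inv≡/ n = refl

    inv-* : ∀ n → inv n * fromℕ (suc n) ≡ 1ℚ
    inv-* n = trans (/-*-fromℕ ℤ.1ℤ n) refl

  inv>0 : ∀ n → 0ℚ < inv n
  inv>0 n = *-cancel-< (fromℕ≥0 (suc n))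
    (subst₂ _<_ (sym (ℚ.*-zeroˡ (fromℕ (suc n)))) (sym (inv-* n)) 0<1)

  inv≥0 : ∀ n → 0ℚ ≤ inv n
  inv≥0 n = ℚ.<⇒≤ (inv>0 n)

  ≤-div : ∀ {a c} n → a * fromℕ (suc n) ≤ c → a ≤ c * inv n
  ≤-div {a} {c} n h = *-cancel-≤ (fromℕ>0 n) (ℚ.≤-trans h (ℚ.≤-reflexive
    (trans (sym (trans (cong (c *_) (inv-* n)) (ℚ.*-identityʳ c))) (sym (ℚ.*-assoc c (inv n) _)))))

  inv-antimono : ∀ {m n} → m ℕ.≤ n → inv n ≤ inv m
  inv-antimono {m} {n} m≤n = subst (inv n ≤_) (ℚ.*-identityˡ _)
    (≤-div m (subst (inv n * fromℕ (suc m) ≤_) (inv-* n)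
    (ℚ.*-monoˡ-≤-nonNeg (inv n) {{ℚ.nonNegative (inv≥0 n)}} (fromℕ-mono (ℕ.s≤s m≤n)))))

  /≡*inv : ∀ a d → a / suc d ≡ fromℤ a * inv d
  /≡*inv a d = trans (sym (trans (cong ((a / suc d) *_) (trans (ℚ.*-comm (fromℕ (suc d)) _) (inv-* d))) (ℚ.*-identityʳ _)))
    (trans (sym (ℚ.*-assoc (a / suc d) _ _)) (cong (_* inv d) (/-*-fromℕ a d)))

  archimedean : ∀ q → ∃ λ n → q ≤ fromℕ n
  archimedean q with ℚ.≤-total q 0ℚ
  ... | inj₁ q≤0 = 0 , q≤0
  ... | inj₂ 0≤q = n , *-cancel-≤ (fromℕ>0 k) (ℚ.≤-trans (ℚ.≤-reflexive eq)
      (ℚ.≤-trans (fromℤ-mono (i≤+∣i∣ (ℚ.↥ q)))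
        (subst (_≤ fromℕ n * fromℕ (suc k)) (ℚ.*-identityʳ (fromℕ n))
          (ℚ.*-monoˡ-≤-nonNeg (fromℕ n) {{ℚ.nonNegative (fromℕ≥0 n)}} (fromℕ-≥1 k)))))
    where
    k = ℚ.denominator-1 q
    n = ℤ.∣ ℚ.↥ q ∣
    eq : q * fromℕ (suc k) ≡ fromℤ (ℚ.↥ q)
    eq = trans (cong (_* fromℕ (suc k)) (sym (ℚ.↥p/↧p≡p q))) (/-*-fromℕ (ℚ.↥ q) k)
    i≤+∣i∣ : ∀ i → i ℤ.≤ ℤ.+ ℤ.∣ i ∣
    i≤+∣i∣ (ℤ.+ n) = ℤ.≤-refl
    i≤+∣i∣ (-[1+ n ]) = ℤ.-≤+

  inv-small : ∀ {ε} → 0ℚ < ε → ∃ λ n → inv n < ε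
  inv-small {ε} 0<ε with reciprocal 0<ε
  ... | r , 0<r , rε≡1 with archimedean r
  ... | n , r≤n = n , *-cancel-< (fromℕ≥0 (suc n)) (ℚ.≤-<-trans
    (ℚ.≤-reflexive (trans (inv-* n) (sym (trans (ℚ.*-comm ε r) rε≡1))))
    (ℚ.*-monoʳ-<-pos ε {{ℚ.positive 0<ε}} (ℚ.≤-<-trans r≤n (fromℕ-mono-< (ℕ.n<1+n n)))))

  <⇒≱ : ∀ {a b} → a < b → ¬ b ≤ a
  <⇒≱ a<b b≤a = ℚ.<-irrefl refl (ℚ.<-≤-trans a<b b≤a)

  -- Stands in for |y| ≤ x without square roots: x + y < 0 would give -y > x ≥ 0, hence y² > x².
  square-≤⇒0≤+ : ∀ {x y} → 0ℚ ≤ x → y * y ≤ x * x → 0ℚ ≤ x + y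
  square-≤⇒0≤+ {x} {y} 0≤x h = ℚ.≮⇒≥ λ x+y<0 → <⇒≱ (negative x+y<0) h
    where
    lem : ∀ x y → y * y - x * x ≡ (0ℚ - (x + y)) * ((x + x) + (0ℚ - (x + y)))
    lem = solve-∀ ℚ-ring
    negative : x + y < 0ℚ → x * x < y * y
    negative lt = <-from {b = y * y} {a = x * x} (<⇒0<- lt ⊗⁺ ((0≤x ⊕ 0≤x) ⊕⁺ <⇒0<- lt)) (lem x y)

  floor : ∀ m {z} → 0ℚ ≤ z → z < fromℕ (suc m) → ∃ λ k → k ℕ.< suc m × fromℕ k ≤ z × z < fromℕ (suc k)
  floor zero    0≤z z< = 0 , ℕ.s≤s ℕ.z≤n , 0≤z , z<
  floor (suc m) {z} 0≤z z< = decide (fromℕ (suc m) ℚ.≤? z)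
    where
    decide : Dec (fromℕ (suc m) ≤ z) → ∃ λ k → k ℕ.< 2 ℕ.+ m × fromℕ k ≤ z × z < fromℕ (suc k)
    decide (yes le) = suc m , ℕ.≤-refl , le , z<
    decide (no ≰) = let k , k< , lower , upper = floor m 0≤z (ℚ.≰⇒> ≰) in k , ℕ.m<n⇒m<1+n k< , lower , upper

  nearest : ∀ z → ∃ λ k → ∣ z - fromℤ k ∣ ≤ ½
  nearest z =
    -- The shift by `M` makes the number nonnegative, so that `floor` applies; comparison with k + ½
    -- then picks the floor or its successor.
    let M , -z≤M = archimedean (- z)
        L , z+M≤L = archimedean (z + fromℕ M)
        k , _ , k≤ , <1+k = floor L {z + fromℕ M} (≤-from (≤⇒0≤- -z≤M) (shift z (fromℕ M)))
          (ℚ.≤-<-trans z+M≤L (fromℕ-mono-< (ℕ.n<1+n L)))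
    in [ below M k k≤ , above M k <1+k ]′ (ℚ.≤-total (z + fromℕ M) (fromℕ k + ½))
    where
    shift : ∀ z m → z + m - 0ℚ ≡ m - - z
    shift = solve-∀ ℚ-ring
    rewritten : ∀ k M → fromℤ (ℤ.+ k ℤ.- ℤ.+ M) ≡ fromℕ k - fromℕ M
    rewritten k M = fromℤ-- (ℤ.+ k) (ℤ.+ M)
    below : ∀ M k → fromℕ k ≤ z + fromℕ M → z + fromℕ M ≤ fromℕ k + ½ → ∃ λ k → ∣ z - fromℤ k ∣ ≤ ½
    below M k k≤ ≤½ = ℤ.+ k ℤ.- ℤ.+ M , subst (λ x → ∣ z - x ∣ ≤ ½) (sym (rewritten k M))
      (∣∣-≤ (≤-from (≤⇒0≤- ≤½) (eq₁ z (fromℕ k) (fromℕ M))) (≤-from (≤⇒0≤- k≤ ⊕ 0≤½) (eq₂ z (fromℕ k) (fromℕ M))))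
      where
      eq₁ : ∀ z k m → ½ - (z - (k - m)) ≡ k + ½ - (z + m)
      eq₁ = solve-∀ ℚ-ring
      eq₂ : ∀ z k m → ½ - - (z - (k - m)) ≡ z + m - k + ½
      eq₂ = solve-∀ ℚ-ring
    above : ∀ M k → z + fromℕ M < fromℕ (suc k) → fromℕ k + ½ ≤ z + fromℕ M → ∃ λ k → ∣ z - fromℤ k ∣ ≤ ½
    above M k <1+k ½≤ = ℤ.+ suc k ℤ.- ℤ.+ M , subst (λ x → ∣ z - x ∣ ≤ ½) (sym (rewritten (suc k) M))
      (∣∣-≤ (≤-from (≤⇒0≤- (ℚ.<⇒≤ <1+k) ⊕ 0≤½) (eq₁ z (fromℕ k) (fromℕ M))) (≤-from (≤⇒0≤- ½≤) (eq₂ z (fromℕ k) (fromℕ M))))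
      where
      eq₁ : ∀ z k m → ½ - (z - (1ℚ + k - m)) ≡ 1ℚ + k - (z + m) + ½
      eq₁ = solve-∀ ℚ-ring
      eq₂ : ∀ z k m → ½ - - (z - (1ℚ + k - m)) ≡ z + m - (k + ½)
      eq₂ = solve-∀ ℚ-ring

-- Combinators for building codes of total recursive functions.

module Recursive where

  open import Data.Nat.Base using (ℕ; zero; suc; _+_; _*_; _∸_; _≤_; _<_; pred; z≤n; s≤s)
  open import Data.Fin.Base using (Fin; zero; suc)
  open import Data.Vec.Base using (Vec; []; _∷_; lookup; tabulate)

  -- Pairs a code with the total function that it computes, so that one combinator builds a
  -- composite code together with the value it returns.
  Computable : ∀ {n} → (Vec ℕ n → ℕ) → Set
  Computable {n} f = Σ (Rec n) λ r → ∀ xs → r [ xs ]⇓ f xs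

  private variable
    n m : ℕ
    f g h : Vec ℕ n → ℕ

  cast : (∀ xs → f xs ≡ g xs) → Computable f → Computable g
  cast eq (r , e) = r , λ xs → subst (r [ xs ]⇓_) (eq xs) (e xs)

  var : (i : Fin n) → Computable (λ xs → lookup xs i)
  var i = proj i , λ _ → ⇓proj

  sub₁ : ∀ {f : Vec ℕ 1 → ℕ} → Computable f → Computable g → Computable (λ xs → f (g xs ∷ []))
  sub₁ (r , e) (s , d) = comp r (s ∷ []) , λ xs → ⇓comp (d xs ∷ []) (e _)

  sub₂ : ∀ {f : Vec ℕ 2 → ℕ} → Computable f → Computable g → Computable h →
         Computable (λ xs → f (g xs ∷ h xs ∷ []))
  sub₂ (r , e) (s , d) (s′ , d′) = comp r (s ∷ s′ ∷ []) , λ xs → ⇓comp (d xs ∷ d′ xs ∷ []) (e _)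

  sub₃ : ∀ {f : Vec ℕ 3 → ℕ} {i : Vec ℕ n → ℕ} → Computable f → Computable g → Computable h →
         Computable i → Computable (λ xs → f (g xs ∷ h xs ∷ i xs ∷ []))
  sub₃ (r , e) (s , d) (s′ , d′) (s″ , d″) = comp r (s ∷ s′ ∷ s″ ∷ []) ,
    λ xs → ⇓comp (d xs ∷ d′ xs ∷ d″ xs ∷ []) (e _)

  subs : {fs : Fin m → Vec ℕ n → ℕ} → (∀ i → Computable (fs i)) →
         Σ (Vec (Rec n) m) λ rs → ∀ xs → rs [ xs ]⇓* tabulate (λ i → fs i xs)
  subs {zero}  cs = [] , λ _ → []
  subs {suc m} cs with cs zero | subs (λ i → cs (suc i))
  ... | r , e | rs , es = r ∷ rs , λ xs → e xs ∷ es xs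

  const : ∀ k → Computable {n} (λ _ → k)
  const zero    = comp zeroᵣ [] , λ _ → ⇓comp [] ⇓zero
  const (suc k) = comp sucᵣ (proj₁ (const k) ∷ []) , λ xs → ⇓comp (proj₂ (const k) xs ∷ []) ⇓suc

  sucᶜ : Computable f → Computable (λ xs → suc (f xs))
  sucᶜ (r , e) = comp sucᵣ (r ∷ []) , λ xs → ⇓comp (e xs ∷ []) ⇓suc

  iterate : (Vec ℕ n → ℕ) → (Vec ℕ (2 + n) → ℕ) → Vec ℕ (suc n) → ℕ
  iterate f g (zero ∷ xs)  = f xs
  iterate f g (suc k ∷ xs) = g (k ∷ iterate f g (k ∷ xs) ∷ xs)

  iterateᶜ : {g : Vec ℕ (2 + n) → ℕ} → Computable f → Computable g → Computable (iterate f g)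
  iterateᶜ {f = f} {g} (r , e) (s , d) = prec r s , run
    where
    run : ∀ xs → prec r s [ xs ]⇓ iterate f g xs
    run (zero ∷ xs)  = ⇓prec-zero (e xs)
    run (suc k ∷ xs) = ⇓prec-suc (run (k ∷ xs)) (d _)

  private
    binary : (ℕ → ℕ → ℕ) → Vec ℕ 2 → ℕ
    binary _∙_ (x ∷ y ∷ []) = x ∙ y

    lift : {_∙_ : ℕ → ℕ → ℕ} → Computable (binary _∙_) → Computable f → Computable g →
           Computable (λ xs → f xs ∙ g xs)
    lift = sub₂

    add : Computable (binary _+_)
    add = cast eq (iterateᶜ (var zero) (sucᶜ (var (suc zero))))
      where
      eq : ∀ xs → iterate (λ xs → lookup xs zero) (λ xs → suc (lookup xs (suc zero))) xs ≡ binary _+_ xs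
      eq (zero ∷ y ∷ [])  = refl
      eq (suc x ∷ y ∷ []) = cong suc (eq (x ∷ y ∷ []))

  infixl 6 _+ᶜ_ _∸ᶜ_
  infixl 7 _*ᶜ_

  _+ᶜ_ : Computable f → Computable g → Computable (λ xs → f xs + g xs)
  _+ᶜ_ = lift add

  private
    mul : Computable (binary _*_)
    mul = cast eq (iterateᶜ (const 0) (var (suc (suc zero)) +ᶜ var (suc zero)))
      where
      eq : ∀ xs → iterate (λ _ → 0) (λ xs → lookup xs (suc (suc zero)) + lookup xs (suc zero)) xs
                  ≡ binary _*_ xs
      eq (zero ∷ y ∷ [])  = refl
      eq (suc x ∷ y ∷ []) = cong (y +_) (eq (x ∷ y ∷ []))

  _*ᶜ_ : Computable f → Computable g → Computable (λ xs → f xs * g xs)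
  _*ᶜ_ = lift mul

  private
    predᶜ : Computable f → Computable (λ xs → pred (f xs))
    predᶜ = sub₁ {f = unary} (cast eq (iterateᶜ (const 0) (var zero)))
      where
      unary : Vec ℕ 1 → ℕ
      unary (x ∷ []) = pred x
      eq : ∀ xs → iterate (λ _ → 0) (λ xs → lookup xs zero) xs ≡ unary xs
      eq (zero ∷ [])  = refl
      eq (suc x ∷ []) = refl

    -- Primitive recursion runs on the first argument, so the subtrahend comes first; `_∸ᶜ_`
    -- restores the order.
    monus : Computable (binary λ x y → y ∸ x)
    monus = cast eq (iterateᶜ (var zero) (predᶜ (var (suc zero))))
      where
      eq : ∀ xs → iterate (λ xs → lookup xs zero) (λ xs → pred (lookup xs (suc zero))) xs
                  ≡ binary (λ x y → y ∸ x) xs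
      eq (zero ∷ y ∷ [])  = refl
      eq (suc x ∷ y ∷ []) = trans (cong pred (eq (x ∷ y ∷ []))) (ℕ.pred[m∸n]≡m∸[1+n] y x)

  _∸ᶜ_ : Computable f → Computable g → Computable (λ xs → f xs ∸ g xs)
  cf ∸ᶜ cg = lift monus cg cf

  least-zero : ∀ (p : ℕ → ℕ) b → p b ≡ 0 →
    ∃ λ k → k ≤ b × p k ≡ 0 × (∀ j → j < k → p j ≢ 0)
  least-zero p zero    pb = 0 , z≤n , pb , λ _ ()
  least-zero p (suc b) pb with p 0 in p0
  ... | zero = 0 , z≤n , p0 , λ _ ()
  ... | suc y with least-zero (λ j → p (suc j)) b pb
  ...   | k , k≤b , pk , below = suc k , s≤s k≤b , pk , λ
          { zero _ p0≡0 → ℕ.1+n≢0 (trans (sym p0) p0≡0)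
          ; (suc j) (s≤s j<k) → below j j<k }

  -- The least zero is supplied from outside; the totality of `p` provides the halting computations
  -- that `⇓min` demands below it.
  minᶜ : {p : Vec ℕ (suc n) → ℕ} → Computable p → (k : Vec ℕ n → ℕ) →
         (∀ xs → p (k xs ∷ xs) ≡ 0) → (∀ xs j → j < k xs → p (j ∷ xs) ≢ 0) → Computable k
  minᶜ {p = p} (r , e) k pk below = min r , λ xs → ⇓min
    (λ j j<k → pred (p (j ∷ xs)) , subst (r [ j ∷ xs ]⇓_) (nonzero _ (below xs j j<k)) (e _))
    (subst (r [ k xs ∷ xs ]⇓_) (pk xs) (e _))
    where
    nonzero : ∀ x → x ≢ 0 → x ≡ suc (pred x)
    nonzero zero    x≢0 with () ← x≢0 refl
    nonzero (suc x) _   = refl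

-- Power series of exp, cos and sin over the rationals: products, tails and Lipschitz bounds.

module Series where

  open Rationals
  open import Data.Rational.Base using (_+_; _-_; _*_; -_; _≤_; ∣_∣)

  open ≡-Reasoning

  sum : ℕ → (ℕ → ℚ) → ℚ
  sum zero    f = 0ℚ
  sum (suc n) f = sum n f + f n

  sum-cong : ∀ n {f g} → (∀ i → i ℕ.< n → f i ≡ g i) → sum n f ≡ sum n g
  sum-cong zero    eq = refl
  sum-cong (suc n) eq =
    cong₂ _+_ (sum-cong n (λ i i<n → eq i (ℕ.m<n⇒m<1+n i<n))) (eq n (ℕ.n<1+n n))

  sum-mono : ∀ n {f g} → (∀ i → i ℕ.< n → f i ≤ g i) → sum n f ≤ sum n g
  sum-mono zero    le = ℚ.≤-refl
  sum-mono (suc n) le =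
    ℚ.+-mono-≤ (sum-mono n (λ i i<n → le i (ℕ.m<n⇒m<1+n i<n))) (le n (ℕ.n<1+n n))

  sum-+ : ∀ n f g → sum n (λ i → f i + g i) ≡ sum n f + sum n g
  sum-+ zero    f g = refl
  sum-+ (suc n) f g = trans (cong (_+ (f n + g n)) (sum-+ n f g)) (eq (sum n f) (sum n g) (f n) (g n))
    where
    eq : ∀ a b c d → a + b + (c + d) ≡ (a + c) + (b + d)
    eq = solve-∀ ℚ-ring

  sum-*ˡ : ∀ n c f → sum n (λ i → c * f i) ≡ c * sum n f
  sum-*ˡ zero    c f = sym (ℚ.*-zeroʳ c)
  sum-*ˡ (suc n) c f = trans (cong (_+ c * f n) (sum-*ˡ n c f)) (sym (ℚ.*-distribˡ-+ c _ _))

  sum-*ʳ : ∀ n c f → sum n (λ i → f i * c) ≡ sum n f * c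
  sum-*ʳ n c f = trans (sum-cong n (λ i _ → ℚ.*-comm (f i) c)) (trans (sum-*ˡ n c f) (ℚ.*-comm c _))

  sum-- : ∀ n f g → sum n (λ i → f i - g i) ≡ sum n f - sum n g
  sum-- zero    f g = refl
  sum-- (suc n) f g = trans (cong (_+ (f n - g n)) (sum-- n f g)) (eq (sum n f) (sum n g) (f n) (g n))
    where
    eq : ∀ a b c d → a - b + (c - d) ≡ (a + c) - (b + d)
    eq = solve-∀ ℚ-ring

  sum-head : ∀ n f → sum (suc n) f ≡ f 0 + sum n (λ i → f (suc i))
  sum-head zero    f = ℚ.+-comm 0ℚ (f 0)
  sum-head (suc n) f = trans (cong (_+ f (suc n)) (sum-head n f)) (ℚ.+-assoc (f 0) _ _)

  ∣sum∣ : ∀ n f → ∣ sum n f ∣ ≤ sum n (λ i → ∣ f i ∣)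
  ∣sum∣ zero    f = ℚ.≤-refl
  ∣sum∣ (suc n) f = ℚ.≤-trans (ℚ.∣p+q∣≤∣p∣+∣q∣ (sum n f) (f n)) (ℚ.+-monoˡ-≤ ∣ f n ∣ (∣sum∣ n f))

  private
    telescope : ∀ a b c → (a + b) - c ≡ (a - c) + b
    telescope = solve-∀ ℚ-ring

  sum-≤ : ∀ {m n} f → (∀ i → 0ℚ ≤ f i) → m ℕ.≤ n → 0ℚ ≤ sum n f - sum m f
  sum-≤ {m} f f≥0 m≤n = go (ℕ.≤⇒≤′ m≤n)
    where
    go : ∀ {n} → m ℕ.≤′ n → 0ℚ ≤ sum n f - sum m f
    go ℕ.≤′-refl = ℚ.≤-reflexive (sym (ℚ.+-inverseʳ (sum m f)))
    go (ℕ.≤′-step {n} m≤n) = subst (0ℚ ≤_) (sym (telescope (sum n f) (f n) (sum m f))) (go m≤n ⊕ f≥0 n)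

  sum-≥0 : ∀ n f → (∀ i → 0ℚ ≤ f i) → 0ℚ ≤ sum n f
  sum-≥0 zero    f f≥0 = ℚ.≤-refl
  sum-≥0 (suc n) f f≥0 = sum-≥0 n f f≥0 ⊕ f≥0 n

  ∣sum-sum∣ : ∀ {m n f F} → (∀ i → ∣ f i ∣ ≤ F i) → m ℕ.≤ n →
              ∣ sum n f - sum m f ∣ ≤ sum n F - sum m F
  ∣sum-sum∣ {m} {n} {f} {F} f≤F m≤n = go (ℕ.≤⇒≤′ m≤n)
    where
    go : ∀ {n} → m ℕ.≤′ n → ∣ sum n f - sum m f ∣ ≤ sum n F - sum m F
    go ℕ.≤′-refl = ℚ.≤-reflexive (trans (cong ∣_∣ (ℚ.+-inverseʳ (sum m f))) (sym (ℚ.+-inverseʳ (sum m F))))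
    go (ℕ.≤′-step {n} m≤n) = subst₂ _≤_
      (cong ∣_∣ (sym (telescope (sum n f) (f n) (sum m f)))) (sym (telescope (sum n F) (F n) (sum m F)))
      (ℚ.≤-trans (ℚ.∣p+q∣≤∣p∣+∣q∣ (sum n f - sum m f) (f n)) (ℚ.+-mono-≤ (go m≤n) (f≤F n)))

  ∣*∣-≤ : ∀ {a b A B} → ∣ a ∣ ≤ A → ∣ b ∣ ≤ B → ∣ a * b ∣ ≤ A * B
  ∣*∣-≤ {a} {b} {A} {B} a≤A b≤B = subst (_≤ A * B) (sym (ℚ.∣p*q∣≡∣p∣*∣q∣ a b))
    (*-mono (ℚ.0≤∣p∣ a) a≤A (ℚ.0≤∣p∣ b) b≤B)

  -- The coefficients of the Cauchy product of two series.
  conv : (ℕ → ℚ) → (ℕ → ℚ) → ℕ → ℚ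
  conv f g k = sum (suc k) (λ i → f i * g (k ℕ.∸ i))

  sum-conv : ∀ n f g → sum n (conv f g) ≡ sum n (λ i → f i * sum (n ℕ.∸ i) g)
  sum-conv zero    f g = refl
  sum-conv (suc n) f g = begin
    sum n (conv f g) + conv f g n
      ≡⟨ cong (_+ conv f g n) (sum-conv n f g) ⟩
    sum n (λ i → f i * sum (n ℕ.∸ i) g) + (sum n (λ i → f i * g (n ℕ.∸ i)) + f n * g (n ℕ.∸ n))
      ≡⟨ ℚ.+-assoc (sum n (λ i → f i * sum (n ℕ.∸ i) g)) _ _ ⟨
    sum n (λ i → f i * sum (n ℕ.∸ i) g) + sum n (λ i → f i * g (n ℕ.∸ i)) + f n * g (n ℕ.∸ n)
      ≡⟨ cong₂ _+_ (sum-+ n _ _) last ⟨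
    sum n (λ i → f i * sum (n ℕ.∸ i) g + f i * g (n ℕ.∸ i)) + f n * sum (suc n ℕ.∸ n) g
      ≡⟨ cong (_+ f n * sum (suc n ℕ.∸ n) g) (sum-cong n step) ⟩
    sum n (λ i → f i * sum (suc n ℕ.∸ i) g) + f n * sum (suc n ℕ.∸ n) g ∎
    where
    last : f n * sum (suc n ℕ.∸ n) g ≡ f n * g (n ℕ.∸ n)
    last = cong (f n *_) (trans (cong (λ k → sum k g) (ℕ.m+n∸n≡m 1 n))
      (trans (ℚ.+-identityˡ (g 0)) (cong g (sym (ℕ.n∸n≡0 n)))))
    step : ∀ i → i ℕ.< n → f i * sum (n ℕ.∸ i) g + f i * g (n ℕ.∸ i) ≡ f i * sum (suc n ℕ.∸ i) g
    step i i<n = trans (sym (ℚ.*-distribˡ-+ (f i) _ _))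
      (cong (λ k → f i * sum k g) (sym (ℕ.+-∸-assoc 1 (ℕ.<⇒≤ i<n))))

  -- The square {i, j < n} differs from the triangle {i + j < n} by pairs lying
  -- in the larger triangle {i + j < 2n}.
  product-conv : ∀ {f g F G} → (∀ i → ∣ f i ∣ ≤ F i) → (∀ i → ∣ g i ∣ ≤ G i) → ∀ n →
    ∣ sum n f * sum n g - sum n (conv f g) ∣ ≤ sum (n ℕ.+ n) (conv F G) - sum n (conv F G)
  product-conv {f} {g} {F} {G} f≤F g≤G n = ℚ.≤-trans (subst (_≤ sum n (λ i → F i * (sum n G - sum (n ℕ.∸ i) G))) (cong ∣_∣ (sym (diff f g))) bound)
    (subst (_≤ sum (n ℕ.+ n) (conv F G) - sum n (conv F G)) (diff F G) larger)
    where
    F≥0 : ∀ i → 0ℚ ≤ F i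
    F≥0 i = ℚ.≤-trans (ℚ.0≤∣p∣ (f i)) (f≤F i)
    G≥0 : ∀ i → 0ℚ ≤ G i
    G≥0 i = ℚ.≤-trans (ℚ.0≤∣p∣ (g i)) (g≤G i)
    diff : ∀ f g → sum n f * sum n g - sum n (conv f g) ≡ sum n (λ i → f i * (sum n g - sum (n ℕ.∸ i) g))
    diff f g = begin
      sum n f * sum n g - sum n (conv f g)
        ≡⟨ cong₂ _-_ (sym (sum-*ʳ n (sum n g) f)) (sum-conv n f g) ⟩
      sum n (λ i → f i * sum n g) - sum n (λ i → f i * sum (n ℕ.∸ i) g)
        ≡⟨ sum-- n _ _ ⟨
      sum n (λ i → f i * sum n g - f i * sum (n ℕ.∸ i) g)
        ≡⟨ sum-cong n (λ i _ → eq (f i) (sum n g) (sum (n ℕ.∸ i) g)) ⟩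
      sum n (λ i → f i * (sum n g - sum (n ℕ.∸ i) g)) ∎
      where
      eq : ∀ a b c → a * b - a * c ≡ a * (b - c)
      eq = solve-∀ ℚ-ring
    bound : ∣ sum n (λ i → f i * (sum n g - sum (n ℕ.∸ i) g)) ∣ ≤ sum n (λ i → F i * (sum n G - sum (n ℕ.∸ i) G))
    bound = ℚ.≤-trans (∣sum∣ n _) (sum-mono n (λ i _ →
      ∣*∣-≤ {f i} (f≤F i) (∣sum-sum∣ g≤G (ℕ.m∸n≤m n i))))
    larger : sum n F * sum n G - sum n (conv F G) ≤ sum (n ℕ.+ n) (conv F G) - sum n (conv F G)
    larger = ℚ.+-monoˡ-≤ _ (subst₂ _≤_ (sum-*ʳ n (sum n G) F) (sym (sum-conv (n ℕ.+ n) F G))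
      (ℚ.≤-trans
        (sum-mono n (λ i i<n → *-mono (F≥0 i) ℚ.≤-refl (sum-≥0 n G G≥0)
          (0≤-⇒≤ (sum-≤ G G≥0 (subst (ℕ._≤ n ℕ.+ n ℕ.∸ i) (ℕ.m+n∸n≡m n n)
            (ℕ.∸-monoʳ-≤ (n ℕ.+ n) (ℕ.<⇒≤ i<n)))))))
        (0≤-⇒≤ (sum-≤ {n} {n ℕ.+ n} _ (λ i → F≥0 i ⊗ sum-≥0 (n ℕ.+ n ℕ.∸ i) G G≥0) (ℕ.m≤m+n n n)))))

  -- The term xᵏ/k!, built by its recurrence so that neither a factorial nor a power occurs.
  e : ℕ → ℚ → ℚ
  e zero    x = 1ℚ
  e (suc k) x = x * e k x * inv k

  e-suc : ∀ k x → fromℕ (suc k) * e (suc k) x ≡ x * e k x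
  e-suc k x = trans (eq (fromℕ (suc k)) (x * e k x) (inv k)) (trans (cong (x * e k x *_) (inv-* k)) (ℚ.*-identityʳ _))
    where
    eq : ∀ a b c → a * (b * c) ≡ b * (c * a)
    eq = solve-∀ ℚ-ring

  e≥0 : ∀ {x} → 0ℚ ≤ x → ∀ k → 0ℚ ≤ e k x
  e≥0 x≥0 zero    = 0≤1
  e≥0 x≥0 (suc k) = x≥0 ⊗ e≥0 x≥0 k ⊗ inv≥0 k

  ∣e∣ : ∀ {x X} → ∣ x ∣ ≤ X → ∀ k → ∣ e k x ∣ ≤ e k X
  ∣e∣ x≤X zero    = ℚ.≤-refl
  ∣e∣ {x} {X} x≤X (suc k) = ∣*∣-≤ {x * e k x} (∣*∣-≤ {x} x≤X (∣e∣ x≤X k)) (ℚ.≤-reflexive (ℚ.0≤p⇒∣p∣≡p (inv≥0 k)))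

  -- The binomial theorem with the factorials divided in. Scaling by k + 1 = i + (k + 1 - i) splits
  -- the sum in two; by `e-suc` one factor absorbs i, or the other k + 1 - i, and loses one degree,
  -- which leaves (a + b) times the case k.
  conv-e : ∀ a b k → conv (λ i → e i a) (λ i → e i b) k ≡ e k (a + b)
  conv-e a b zero    = refl
  conv-e a b (suc k) = ℚ.≤-antisym (*-cancel-≤ pos (ℚ.≤-reflexive scaled)) (*-cancel-≤ pos (ℚ.≤-reflexive (sym scaled)))
    where
    pos = fromℕ>0 k
    f g : ℕ → ℚ
    f i = e i a
    g i = e i b
    lower : sum (2 ℕ.+ k) (λ i → fromℕ i * (f i * g (suc k ℕ.∸ i))) ≡ a * conv f g k
    lower = begin
      sum (2 ℕ.+ k) (λ i → fromℕ i * (f i * g (suc k ℕ.∸ i)))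
        ≡⟨ sum-head (suc k) _ ⟩
      0ℚ * (f 0 * g (suc k)) + sum (suc k) (λ i → fromℕ (suc i) * (f (suc i) * g (k ℕ.∸ i)))
        ≡⟨ cong₂ _+_ (ℚ.*-zeroˡ (f 0 * g (suc k))) (sum-cong (suc k) (λ i _ → trans (sym (ℚ.*-assoc (fromℕ (suc i)) (f (suc i)) _))
            (trans (cong (_* g (k ℕ.∸ i)) (e-suc i a)) (ℚ.*-assoc a (f i) _)))) ⟩
      0ℚ + sum (suc k) (λ i → a * (f i * g (k ℕ.∸ i)))
        ≡⟨ trans (ℚ.+-identityˡ _) (sum-*ˡ (suc k) a _) ⟩
      a * conv f g k ∎
    upper : sum (2 ℕ.+ k) (λ i → fromℕ (suc k ℕ.∸ i) * (f i * g (suc k ℕ.∸ i))) ≡ b * conv f g k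
    upper = begin
      sum (suc k) (λ i → fromℕ (suc k ℕ.∸ i) * (f i * g (suc k ℕ.∸ i))) + fromℕ (k ℕ.∸ k) * (f (suc k) * g (k ℕ.∸ k))
        ≡⟨ cong₂ _+_ (sum-cong (suc k) step) (trans (cong (λ n → fromℕ n * (f (suc k) * g (k ℕ.∸ k))) (ℕ.n∸n≡0 k)) (ℚ.*-zeroˡ (f (suc k) * g (k ℕ.∸ k)))) ⟩
      sum (suc k) (λ i → b * (f i * g (k ℕ.∸ i))) + 0ℚ
        ≡⟨ trans (ℚ.+-identityʳ _) (sum-*ˡ (suc k) b _) ⟩
      b * conv f g k ∎
      where
      swap : ∀ x y z → x * (y * z) ≡ y * (x * z)
      swap = solve-∀ ℚ-ring
      step : ∀ i → i ℕ.< suc k → fromℕ (suc k ℕ.∸ i) * (f i * g (suc k ℕ.∸ i)) ≡ b * (f i * g (k ℕ.∸ i))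
      step i (ℕ.s≤s i≤k) rewrite ℕ.+-∸-assoc 1 i≤k =
        trans (swap (fromℕ (suc (k ℕ.∸ i))) (f i) _) (trans (cong (f i *_) (e-suc (k ℕ.∸ i) b)) (swap (f i) b (g (k ℕ.∸ i))))
    scaled : conv f g (suc k) * fromℕ (suc k) ≡ e (suc k) (a + b) * fromℕ (suc k)
    scaled = begin
      conv f g (suc k) * fromℕ (suc k)
        ≡⟨ ℚ.*-comm (conv f g (suc k)) _ ⟩
      fromℕ (suc k) * conv f g (suc k)
        ≡⟨ sum-*ˡ (2 ℕ.+ k) (fromℕ (suc k)) _ ⟨
      sum (2 ℕ.+ k) (λ i → fromℕ (suc k) * (f i * g (suc k ℕ.∸ i)))
        ≡⟨ sum-cong (2 ℕ.+ k) weights ⟩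
      sum (2 ℕ.+ k) (λ i → fromℕ i * (f i * g (suc k ℕ.∸ i)) + fromℕ (suc k ℕ.∸ i) * (f i * g (suc k ℕ.∸ i)))
        ≡⟨ trans (sum-+ (2 ℕ.+ k) _ _) (cong₂ _+_ lower upper) ⟩
      a * conv f g k + b * conv f g k
        ≡⟨ ℚ.*-distribʳ-+ (conv f g k) a b ⟨
      (a + b) * conv f g k
        ≡⟨ cong ((a + b) *_) (conv-e a b k) ⟩
      (a + b) * e k (a + b)
        ≡⟨ e-suc k (a + b) ⟨
      fromℕ (suc k) * e (suc k) (a + b)
        ≡⟨ ℚ.*-comm (fromℕ (suc k)) _ ⟩
      e (suc k) (a + b) * fromℕ (suc k) ∎
      where
      weights : ∀ i → i ℕ.< 2 ℕ.+ k → fromℕ (suc k) * (f i * g (suc k ℕ.∸ i)) ≡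
        fromℕ i * (f i * g (suc k ℕ.∸ i)) + fromℕ (suc k ℕ.∸ i) * (f i * g (suc k ℕ.∸ i))
      weights i (ℕ.s≤s i≤1+k) = trans
        (cong (_* (f i * g (suc k ℕ.∸ i))) (trans (cong fromℕ (sym (ℕ.m+[n∸m]≡n i≤1+k))) (fromℕ-+ i (suc k ℕ.∸ i))))
        (ℚ.*-distribʳ-+ (f i * g (suc k ℕ.∸ i)) (fromℕ i) _)

  exp : ℕ → ℚ → ℚ
  exp n x = sum n (λ i → e i x)

  exp≥0 : ∀ {X} → 0ℚ ≤ X → ∀ n → 0ℚ ≤ exp n X
  exp≥0 X≥0 n = sum-≥0 n _ (e≥0 X≥0)

  exp-mono : ∀ {X m n} → 0ℚ ≤ X → m ℕ.≤ n → exp m X ≤ exp n X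
  exp-mono X≥0 m≤n = ≤-from (sum-≤ _ (e≥0 X≥0) m≤n) refl

  module Tail {X : ℚ} (X≥0 : 0ℚ ≤ X) where

    private
      m₀ : ℕ
      m₀ = proj₁ (archimedean (2ℚ * X))

      2X≤m₀ : 2ℚ * X ≤ fromℕ m₀
      2X≤m₀ = proj₂ (archimedean (2ℚ * X))

      eX≥0 : ∀ k → 0ℚ ≤ e k X
      eX≥0 = e≥0 X≥0

      halving : ∀ j → 2ℚ * e (suc (j ℕ.+ m₀)) X ≤ e (j ℕ.+ m₀) X
      halving j = *-cancel-≤ (fromℕ>0 k) (≤-from (≤⇒0≤- 2X≤k ⊗ eX≥0 k)
        (trans (cong (λ z → e k X * fromℕ (suc k) - z) (trans (eq₁ (e (suc k) X) (fromℕ (suc k))) (cong (2ℚ *_) (e-suc k X))))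
          (eq₂ (e k X) (fromℕ (suc k)) X)))
        where
        k = j ℕ.+ m₀
        2X≤k : 2ℚ * X ≤ fromℕ (suc k)
        2X≤k = ℚ.≤-trans 2X≤m₀ (fromℕ-mono (ℕ.m≤n⇒m≤1+n (ℕ.m≤n+m m₀ j)))
        eq₁ : ∀ a b → 2ℚ * a * b ≡ 2ℚ * (b * a)
        eq₁ = solve-∀ ℚ-ring
        eq₂ : ∀ a b x → a * b - 2ℚ * (x * a) ≡ (b - 2ℚ * x) * a
        eq₂ = solve-∀ ℚ-ring

      -- Each term beyond `m₀` is at most half the one before it, so the partial sum plus twice the
      -- next term never increases. This bounds all partial sums, and each tail by twice its first
      -- term.
      potential : ∀ d j → exp (d ℕ.+ (j ℕ.+ m₀)) X + 2ℚ * e (d ℕ.+ (j ℕ.+ m₀)) X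
                        ≤ exp (j ℕ.+ m₀) X + 2ℚ * e (j ℕ.+ m₀) X
      potential zero    j = ℚ.≤-refl
      potential (suc d) j = ℚ.≤-trans (≤-from (≤⇒0≤- step) (eq (exp k X) (e k X) (e (suc k) X))) (potential d j)
        where
        k = d ℕ.+ (j ℕ.+ m₀)
        step : 2ℚ * e (suc k) X ≤ e k X
        step = subst (λ k → 2ℚ * e (suc k) X ≤ e k X) (ℕ.+-assoc d j m₀) (halving (d ℕ.+ j))
        eq : ∀ s a b → s + 2ℚ * a - (s + a + 2ℚ * b) ≡ a - 2ℚ * b
        eq = solve-∀ ℚ-ring

      -- The true decay is geometric; the factor 1/(j + 1) is enough for a rate of the form
      -- `K * inv n`, and it follows from `halving` because j + 2 ≤ 2 (j + 1).
      decay : ∀ j → fromℕ (suc j) * e (j ℕ.+ m₀) X ≤ e m₀ X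
      decay zero    = ℚ.≤-reflexive (eq (e m₀ X))
        where
        eq : ∀ x → (1ℚ + 0ℚ) * x ≡ x
        eq = solve-∀ ℚ-ring
      decay (suc j) = ℚ.≤-trans (≤-from
          ((fromℕ≥0 j ⊗ eX≥0 (suc (j ℕ.+ m₀))) ⊕ (fromℕ≥0 (suc j) ⊗ ≤⇒0≤- (halving j)))
          (eq (fromℕ j) (e (suc (j ℕ.+ m₀)) X) (e (j ℕ.+ m₀) X)))
        (decay j)
        where
        eq : ∀ j a b → (1ℚ + j) * b - (1ℚ + (1ℚ + j)) * a ≡ j * a + (1ℚ + j) * (b - 2ℚ * a)
        eq = solve-∀ ℚ-ring

    exp-bound : ℚ
    exp-bound = exp m₀ X + 2ℚ * e m₀ X

    exp-bound≥0 : 0ℚ ≤ exp-bound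
    exp-bound≥0 = exp≥0 X≥0 m₀ ⊕ 0≤2 ⊗ eX≥0 m₀

    private
      beyond : ∀ d → exp (d ℕ.+ m₀) X ≤ exp-bound
      beyond d = ℚ.≤-trans (≤-from (0≤2 ⊗ eX≥0 (d ℕ.+ m₀)) (eq (exp (d ℕ.+ m₀) X) (2ℚ * e (d ℕ.+ m₀) X))) (potential d 0)
        where
        eq : ∀ x y → (x + y) - x ≡ y
        eq = solve-∀ ℚ-ring

    exp≤bound : ∀ n → exp n X ≤ exp-bound
    exp≤bound n = ℚ.≤-trans (exp-mono X≥0 (ℕ.m≤m+n n m₀)) (beyond n)

    -- The first summand serves n ≥ `m₀`, where the tail is at most twice its first term; the second
    -- serves n ≤ `m₀`, where the whole sum is bounded by `exp-bound` and n by `m₀`.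
    tail-bound : ℚ
    tail-bound = (1ℚ + fromℕ m₀) * (2ℚ * e m₀ X) + fromℕ m₀ * exp-bound

    tail-bound≥0 : 0ℚ ≤ tail-bound
    tail-bound≥0 = (0≤1 ⊕ fromℕ≥0 m₀) ⊗ (0≤2 ⊗ eX≥0 m₀) ⊕ fromℕ≥0 m₀ ⊗ exp-bound≥0

    tail : ∀ {n m} → n ℕ.≤ m → (exp m X - exp n X) * fromℕ n ≤ tail-bound
    tail {n} {m} n≤m with ℕ.≤-total m₀ n
    ... | inj₂ n≤m₀ = ℚ.≤-trans
      (*-mono (sum-≤ _ eX≥0 n≤m) (ℚ.≤-trans (≤-from (exp≥0 X≥0 n) (eq₂ (exp m X) (exp n X))) (exp≤bound m))
        (fromℕ≥0 n) (fromℕ-mono n≤m₀))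
      (≤-from ((0≤1 ⊕ fromℕ≥0 m₀) ⊗ (0≤2 ⊗ eX≥0 m₀)) (eq₃ _ exp-bound (fromℕ m₀)))
      where
      eq₂ : ∀ x y → x - (x - y) ≡ y
      eq₂ = solve-∀ ℚ-ring
      eq₃ : ∀ a b c → (a + c * b) - b * c ≡ a
      eq₃ = solve-∀ ℚ-ring
    ... | inj₁ m₀≤n = subst (_≤ tail-bound) (cong₂ (λ m n → (exp m X - exp n X) * fromℕ n)
          (trans (cong (m ℕ.∸ n ℕ.+_) j+m₀≡n) (ℕ.m∸n+n≡m n≤m)) j+m₀≡n)
        (ℚ.≤-trans
          (*-mono (sum-≤ _ eX≥0 (ℕ.m≤n+m (j ℕ.+ m₀) d)) tail≤ (fromℕ≥0 (j ℕ.+ m₀)) (ℚ.≤-reflexive (fromℕ-+ j m₀)))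
          (≤-from (0≤2 ⊗ ≤⇒0≤- (decay j) ⊕ 0≤2 ⊗ fromℕ≥0 m₀ ⊗ ≤⇒0≤- decreasing ⊕ 0≤2 ⊗ eX≥0 (j ℕ.+ m₀) ⊕ fromℕ≥0 m₀ ⊗ exp-bound≥0)
            (eq (fromℕ j) (fromℕ m₀) (e (j ℕ.+ m₀) X) (e m₀ X) exp-bound)))
      where
      j = n ℕ.∸ m₀
      d = m ℕ.∸ n
      j+m₀≡n : j ℕ.+ m₀ ≡ n
      j+m₀≡n = ℕ.m∸n+n≡m m₀≤n
      decreasing : e (j ℕ.+ m₀) X ≤ e m₀ X
      decreasing = ℚ.≤-trans (≤-from (fromℕ≥0 j ⊗ eX≥0 (j ℕ.+ m₀)) (eq₁ (fromℕ j) (e (j ℕ.+ m₀) X))) (decay j)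
        where
        eq₁ : ∀ j x → (1ℚ + j) * x - x ≡ j * x
        eq₁ = solve-∀ ℚ-ring
      tail≤ : exp (d ℕ.+ (j ℕ.+ m₀)) X - exp (j ℕ.+ m₀) X ≤ 2ℚ * e (j ℕ.+ m₀) X
      tail≤ = ≤-from (≤⇒0≤- (potential d j) ⊕ 0≤2 ⊗ eX≥0 (d ℕ.+ (j ℕ.+ m₀)))
        (eq₂ (exp (j ℕ.+ m₀) X) (e (j ℕ.+ m₀) X) (exp (d ℕ.+ (j ℕ.+ m₀)) X) (e (d ℕ.+ (j ℕ.+ m₀)) X))
        where
        eq₂ : ∀ a b c f → 2ℚ * b - (c - a) ≡ (a + 2ℚ * b - (c + 2ℚ * f)) + 2ℚ * f
        eq₂ = solve-∀ ℚ-ring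
      eq : ∀ j m x y b → (1ℚ + m) * (2ℚ * y) + m * b - (2ℚ * x) * (j + m) ≡
           2ℚ * (y - (1ℚ + j) * x) + 2ℚ * m * (y - x) + 2ℚ * x + m * b
      eq = solve-∀ ℚ-ring

    tail-inv : ∀ {n m} → suc n ℕ.≤ m → exp m X - exp (suc n) X ≤ tail-bound * inv n
    tail-inv {n} n<m = ≤-div n (tail n<m)

  -- Real and imaginary part of iⁿ.
  reⁱ imⁱ : ℕ → ℚ
  reⁱ zero    = 1ℚ
  reⁱ (suc n) = - imⁱ n
  imⁱ zero    = 0ℚ
  imⁱ (suc n) = reⁱ n

  iⁿ-+ : ∀ m n → reⁱ (m ℕ.+ n) ≡ reⁱ m * reⁱ n - imⁱ m * imⁱ n ×
                 imⁱ (m ℕ.+ n) ≡ imⁱ m * reⁱ n + reⁱ m * imⁱ n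
  iⁿ-+ zero    n = eq₁ (reⁱ n) (imⁱ n) , eq₂ (reⁱ n) (imⁱ n)
    where
    eq₁ : ∀ a b → a ≡ 1ℚ * a - 0ℚ * b
    eq₁ = solve-∀ ℚ-ring
    eq₂ : ∀ a b → b ≡ 0ℚ * a + 1ℚ * b
    eq₂ = solve-∀ ℚ-ring
  iⁿ-+ (suc m) n with iⁿ-+ m n
  ... | re , im = trans (cong -_ im) (eq (imⁱ m) (reⁱ m) (reⁱ n) (imⁱ n)) ,
                  trans re (eq′ (imⁱ m) (reⁱ m) (reⁱ n) (imⁱ n))
    where
    eq : ∀ a b c d → - (a * c + b * d) ≡ (- a) * c - b * d
    eq = solve-∀ ℚ-ring
    eq′ : ∀ a b c d → b * c - a * d ≡ b * c + (- a) * d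
    eq′ = solve-∀ ℚ-ring

  iⁿ-bounded : ∀ n → ∣ reⁱ n ∣ ≤ 1ℚ × ∣ imⁱ n ∣ ≤ 1ℚ
  iⁿ-bounded zero    = ℚ.≤-refl , 0≤1
  iⁿ-bounded (suc n) with iⁿ-bounded n
  ... | re , im = subst (_≤ 1ℚ) (sym (ℚ.∣-p∣≡∣p∣ (imⁱ n))) im , re

  cosₙ sinₙ : ℕ → ℚ → ℚ
  cosₙ n x = sum n (λ i → reⁱ i * e i x)
  sinₙ n x = sum n (λ i → imⁱ i * e i x)

  ∣re*e∣ : ∀ {x X} → ∣ x ∣ ≤ X → ∀ i → ∣ reⁱ i * e i x ∣ ≤ e i X
  ∣re*e∣ {x} {X} x≤X i = subst (∣ reⁱ i * e i x ∣ ≤_) (ℚ.*-identityˡ (e i X))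
    (∣*∣-≤ {reⁱ i} (proj₁ (iⁿ-bounded i)) (∣e∣ x≤X i))

  ∣im*e∣ : ∀ {x X} → ∣ x ∣ ≤ X → ∀ i → ∣ imⁱ i * e i x ∣ ≤ e i X
  ∣im*e∣ {x} {X} x≤X i = subst (∣ imⁱ i * e i x ∣ ≤_) (ℚ.*-identityˡ (e i X))
    (∣*∣-≤ {imⁱ i} (proj₂ (iⁿ-bounded i)) (∣e∣ x≤X i))

  module _ {a b A B : ℚ} (a≤A : ∣ a ∣ ≤ A) (b≤B : ∣ b ∣ ≤ B) (n : ℕ) where
    private
      re im : ℚ → ℕ → ℚ
      re x i = reⁱ i * e i x
      im x i = imⁱ i * e i x

      re-conv : ∀ k → re (a + b) k ≡ conv (re a) (re b) k - conv (im a) (im b) k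
      re-conv k = begin
        reⁱ k * e k (a + b)
          ≡⟨ cong (reⁱ k *_) (sym (conv-e a b k)) ⟩
        reⁱ k * conv (λ i → e i a) (λ i → e i b) k
          ≡⟨ sum-*ˡ (suc k) (reⁱ k) _ ⟨
        sum (suc k) (λ i → reⁱ k * (e i a * e (k ℕ.∸ i) b))
          ≡⟨ sum-cong (suc k) step ⟩
        sum (suc k) (λ i → re a i * re b (k ℕ.∸ i) - im a i * im b (k ℕ.∸ i))
          ≡⟨ sum-- (suc k) _ _ ⟩
        conv (re a) (re b) k - conv (im a) (im b) k ∎
        where
        eq : ∀ r s t u x y → (r * t - s * u) * (x * y) ≡ (r * x) * (t * y) - (s * x) * (u * y)
        eq = solve-∀ ℚ-ring
        step : ∀ i → i ℕ.< suc k → reⁱ k * (e i a * e (k ℕ.∸ i) b) ≡ re a i * re b (k ℕ.∸ i) - im a i * im b (k ℕ.∸ i)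
        step i (ℕ.s≤s i≤k) = trans
          (cong (_* (e i a * e (k ℕ.∸ i) b)) (trans (cong reⁱ (sym (ℕ.m+[n∸m]≡n i≤k))) (proj₁ (iⁿ-+ i (k ℕ.∸ i)))))
          (eq (reⁱ i) (imⁱ i) (reⁱ (k ℕ.∸ i)) (imⁱ (k ℕ.∸ i)) (e i a) (e (k ℕ.∸ i) b))

      im-conv : ∀ k → im (a + b) k ≡ conv (im a) (re b) k + conv (re a) (im b) k
      im-conv k = begin
        imⁱ k * e k (a + b)
          ≡⟨ cong (imⁱ k *_) (sym (conv-e a b k)) ⟩
        imⁱ k * conv (λ i → e i a) (λ i → e i b) k
          ≡⟨ sum-*ˡ (suc k) (imⁱ k) _ ⟨
        sum (suc k) (λ i → imⁱ k * (e i a * e (k ℕ.∸ i) b))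
          ≡⟨ sum-cong (suc k) step ⟩
        sum (suc k) (λ i → im a i * re b (k ℕ.∸ i) + re a i * im b (k ℕ.∸ i))
          ≡⟨ sum-+ (suc k) _ _ ⟩
        conv (im a) (re b) k + conv (re a) (im b) k ∎
        where
        eq : ∀ r s t u x y → (s * t + r * u) * (x * y) ≡ (s * x) * (t * y) + (r * x) * (u * y)
        eq = solve-∀ ℚ-ring
        step : ∀ i → i ℕ.< suc k → imⁱ k * (e i a * e (k ℕ.∸ i) b) ≡ im a i * re b (k ℕ.∸ i) + re a i * im b (k ℕ.∸ i)
        step i (ℕ.s≤s i≤k) = trans
          (cong (_* (e i a * e (k ℕ.∸ i) b)) (trans (cong imⁱ (sym (ℕ.m+[n∸m]≡n i≤k))) (proj₂ (iⁿ-+ i (k ℕ.∸ i)))))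
          (eq (reⁱ i) (imⁱ i) (reⁱ (k ℕ.∸ i)) (imⁱ (k ℕ.∸ i)) (e i a) (e (k ℕ.∸ i) b))

      T : ℚ
      T = exp (n ℕ.+ n) (A + B) - exp n (A + B)

      close : ∀ {f g} → (∀ i → ∣ f i ∣ ≤ e i A) → (∀ i → ∣ g i ∣ ≤ e i B) →
              ∣ sum n f * sum n g - sum n (conv f g) ∣ ≤ T
      close {f} {g} f≤ g≤ = subst (∣ sum n f * sum n g - sum n (conv f g) ∣ ≤_)
        (cong₂ _-_ (sum-cong (n ℕ.+ n) (λ k _ → conv-e A B k)) (sum-cong n (λ k _ → conv-e A B k)))
        (product-conv f≤ g≤ n)

      double : ∀ x → x + x ≡ 2ℚ * x
      double = solve-∀ ℚ-ring

      combine : ∀ {p q z} → ∣ p ∣ ≤ T → ∣ q ∣ ≤ T → p - q ≡ z → ∣ z ∣ ≤ 2ℚ * T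
      combine {p} {q} {z} p≤ q≤ eq = subst (λ z → ∣ z ∣ ≤ 2ℚ * T) eq
        (subst (∣ p - q ∣ ≤_) (double T) (ℚ.≤-trans (ℚ.∣p-q∣≤∣p∣+∣q∣ p q) (ℚ.+-mono-≤ p≤ q≤)))

      cc ss sc cs : ℚ
      cc = sum n (conv (re a) (re b))
      ss = sum n (conv (im a) (im b))
      sc = sum n (conv (im a) (re b))
      cs = sum n (conv (re a) (im b))

      cosₙ-conv : cosₙ n (a + b) ≡ cc - ss
      cosₙ-conv = trans (sum-cong n {re (a + b)} {λ k → conv (re a) (re b) k - conv (im a) (im b) k} (λ k _ → re-conv k)) (sum-- n (conv (re a) (re b)) (conv (im a) (im b)))

      sinₙ-conv : sinₙ n (a + b) ≡ sc + cs
      sinₙ-conv = trans (sum-cong n {im (a + b)} {λ k → conv (im a) (re b) k + conv (re a) (im b) k} (λ k _ → im-conv k)) (sum-+ n (conv (im a) (re b)) (conv (re a) (im b)))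

      cc-close : ∣ cosₙ n a * cosₙ n b - cc ∣ ≤ T
      cc-close = close (∣re*e∣ a≤A) (∣re*e∣ b≤B)
      ss-close : ∣ sinₙ n a * sinₙ n b - ss ∣ ≤ T
      ss-close = close (∣im*e∣ a≤A) (∣im*e∣ b≤B)
      sc-close : ∣ sinₙ n a * cosₙ n b - sc ∣ ≤ T
      sc-close = close (∣im*e∣ a≤A) (∣re*e∣ b≤B)
      cs-close : ∣ cs - cosₙ n a * sinₙ n b ∣ ≤ T
      cs-close = subst (_≤ T) (∣∣-sym (cosₙ n a * sinₙ n b) cs) (close (∣re*e∣ a≤A) (∣im*e∣ b≤B))

    -- Truncation spoils the addition formula only through the two Cauchy products involved; each is
    -- off by at most `T`, by `product-conv` with the majorants Aⁱ/i! and Bⁱ/i!.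
    cosₙ-+ : ∣ cosₙ n (a + b) - (cosₙ n a * cosₙ n b - sinₙ n a * sinₙ n b) ∣ ≤ 2ℚ * T
    cosₙ-+ = combine ss-close cc-close
      (trans (eq (sinₙ n a * sinₙ n b) (cosₙ n a * cosₙ n b) cc ss)
        (cong (λ z → z - (cosₙ n a * cosₙ n b - sinₙ n a * sinₙ n b)) (sym cosₙ-conv)))
      where
      eq : ∀ s c p q → (s - q) - (c - p) ≡ (p - q) - (c - s)
      eq = solve-∀ ℚ-ring

    sinₙ-+ : ∣ sinₙ n (a + b) - (sinₙ n a * cosₙ n b + cosₙ n a * sinₙ n b) ∣ ≤ 2ℚ * T
    sinₙ-+ = combine cs-close sc-close
      (trans (eq (sinₙ n a * cosₙ n b) (cosₙ n a * sinₙ n b) sc cs)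
        (cong (λ z → z - (sinₙ n a * cosₙ n b + cosₙ n a * sinₙ n b)) (sym sinₙ-conv)))
      where
      eq : ∀ s c p q → (q - c) - (s - p) ≡ (p + q) - (s + c)
      eq = solve-∀ ℚ-ring

  module _ {x y X : ℚ} (x≤X : ∣ x ∣ ≤ X) (y≤X : ∣ y ∣ ≤ X) where
    private
      X≥0 : 0ℚ ≤ X
      X≥0 = ℚ.≤-trans (ℚ.0≤∣p∣ x) x≤X

      -- The derivative of xᵏ⁺¹/(k + 1)! is xᵏ/k!. In the induction `X * e k X` equals k + 1 times
      -- `e (suc k) X`, so the two parts of the product rule add up to the factor k + 2 that the
      -- next denominator cancels.
      e-lipschitz : ∀ k → ∣ e (suc k) x - e (suc k) y ∣ ≤ ∣ x - y ∣ * e k X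
      e-lipschitz zero    = ℚ.≤-reflexive (trans (cong ∣_∣ (trans (eq₁ x y (inv 0)) (trans (cong ((x - y) *_) (trans (sym (ℚ.*-identityʳ (inv 0))) (inv-* 0))) (ℚ.*-identityʳ (x - y)))))
          (sym (ℚ.*-identityʳ ∣ x - y ∣)))
        where
        eq₁ : ∀ x y i → x * 1ℚ * i - y * 1ℚ * i ≡ (x - y) * i
        eq₁ = solve-∀ ℚ-ring
      e-lipschitz (suc k) = subst₂ _≤_ (cong ∣_∣ (eq₁ (x * e (suc k) x) (y * e (suc k) y) (inv (suc k)))) eq₃
        (∣*∣-≤ {x * e (suc k) x - y * e (suc k) y} numerator (ℚ.≤-reflexive (ℚ.0≤p⇒∣p∣≡p (inv≥0 (suc k)))))
        where
        eq₁ : ∀ p q i → (p - q) * i ≡ p * i - q * i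
        eq₁ = solve-∀ ℚ-ring
        eq₂ : ∀ x y p q → (x - y) * p + y * (p - q) ≡ x * p - y * q
        eq₂ = solve-∀ ℚ-ring
        D = ∣ x - y ∣
        numerator : ∣ x * e (suc k) x - y * e (suc k) y ∣ ≤ D * e (suc k) X + X * (D * e k X)
        numerator = subst (λ z → ∣ z ∣ ≤ D * e (suc k) X + X * (D * e k X)) (eq₂ x y (e (suc k) x) (e (suc k) y))
          (ℚ.≤-trans (ℚ.∣p+q∣≤∣p∣+∣q∣ ((x - y) * e (suc k) x) _)
            (ℚ.+-mono-≤ (∣*∣-≤ {x - y} ℚ.≤-refl (∣e∣ x≤X (suc k))) (∣*∣-≤ {y} y≤X (e-lipschitz k))))
        eq₄ : ∀ d a X b i → (d * a + X * (d * b)) * i ≡ (a + X * b) * (d * i)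
        eq₄ = solve-∀ ℚ-ring
        eq₅ : ∀ a n d i → (a + n * a) * (d * i) ≡ d * a * (i * (1ℚ + n))
        eq₅ = solve-∀ ℚ-ring
        eq₃ : (D * e (suc k) X + X * (D * e k X)) * inv (suc k) ≡ D * e (suc k) X
        eq₃ = begin
          (D * e (suc k) X + X * (D * e k X)) * inv (suc k)
            ≡⟨ eq₄ D (e (suc k) X) X (e k X) (inv (suc k)) ⟩
          (e (suc k) X + X * e k X) * (D * inv (suc k))
            ≡⟨ cong (λ z → (e (suc k) X + z) * (D * inv (suc k))) (sym (e-suc k X)) ⟩
          (e (suc k) X + fromℕ (suc k) * e (suc k) X) * (D * inv (suc k))
            ≡⟨ eq₅ (e (suc k) X) (fromℕ (suc k)) D (inv (suc k)) ⟩
          D * e (suc k) X * (inv (suc k) * fromℕ (2 ℕ.+ k))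
            ≡⟨ trans (cong (D * e (suc k) X *_) (inv-* (suc k))) (ℚ.*-identityʳ _) ⟩
          D * e (suc k) X ∎

      weighted : ∀ {w : ℕ → ℚ} → (∀ i → ∣ w i ∣ ≤ 1ℚ) → ∀ n →
        ∣ sum n (λ i → w i * e i x) - sum n (λ i → w i * e i y) ∣ ≤ ∣ x - y ∣ * exp n X
      weighted {w} w≤1 n = ℚ.≤-trans (go n) (*-mono (ℚ.0≤∣p∣ (x - y)) ℚ.≤-refl (exp≥0 X≥0 (n ℕ.∸ 1)) (exp-mono X≥0 (ℕ.m∸n≤m n 1)))
        where
        eq₁ : ∀ w → 0ℚ + w * 1ℚ - (0ℚ + w * 1ℚ) ≡ 0ℚ
        eq₁ = solve-∀ ℚ-ring
        eq₂ : ∀ s t w a b → (s - t) + w * (a - b) ≡ (s + w * a) - (t + w * b)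
        eq₂ = solve-∀ ℚ-ring
        go : ∀ n → ∣ sum n (λ i → w i * e i x) - sum n (λ i → w i * e i y) ∣ ≤ ∣ x - y ∣ * exp (n ℕ.∸ 1) X
        go zero          = ℚ.≤-reflexive (sym (ℚ.*-zeroʳ ∣ x - y ∣))
        go (suc zero)    = ℚ.≤-reflexive (trans (cong ∣_∣ (eq₁ (w 0))) (sym (ℚ.*-zeroʳ ∣ x - y ∣)))
        go (suc (suc n)) = subst₂ _≤_ (cong ∣_∣ (eq₂ (sum (suc n) (λ i → w i * e i x)) (sum (suc n) (λ i → w i * e i y)) (w (suc n)) (e (suc n) x) (e (suc n) y)))
          (sym (ℚ.*-distribˡ-+ ∣ x - y ∣ (exp n X) (e n X)))
          (ℚ.≤-trans (ℚ.∣p+q∣≤∣p∣+∣q∣ (sum (suc n) (λ i → w i * e i x) - sum (suc n) (λ i → w i * e i y)) (w (suc n) * (e (suc n) x - e (suc n) y)))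
            (ℚ.+-mono-≤ (go (suc n)) (subst (∣ w (suc n) * (e (suc n) x - e (suc n) y) ∣ ≤_) (ℚ.*-identityˡ _)
              (∣*∣-≤ {w (suc n)} (w≤1 (suc n)) (e-lipschitz n)))))

    cosₙ-lipschitz : ∀ n → ∣ cosₙ n x - cosₙ n y ∣ ≤ ∣ x - y ∣ * exp n X
    cosₙ-lipschitz = weighted (λ i → proj₁ (iⁿ-bounded i))

    sinₙ-lipschitz : ∀ n → ∣ sinₙ n x - sinₙ n y ∣ ≤ ∣ x - y ∣ * exp n X
    sinₙ-lipschitz = weighted (λ i → proj₂ (iⁿ-bounded i))

  cosₙ-neg : ∀ n x → cosₙ n (- x) ≡ cosₙ n x
  sinₙ-neg : ∀ n x → sinₙ n (- x) ≡ - sinₙ n x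
  private
    parity : ∀ k x → reⁱ k * e k (- x) ≡ reⁱ k * e k x × imⁱ k * e k (- x) ≡ - (imⁱ k * e k x)
    parity zero    x = refl , eq 1ℚ
      where
      eq : ∀ y → 0ℚ * y ≡ - (0ℚ * y)
      eq = solve-∀ ℚ-ring
    parity (suc k) x with parity k x
    ... | re , im =
      trans (eq (imⁱ k) x (e k (- x)) (inv k)) (trans (cong (λ z → x * z * inv k) im) (eq′ (imⁱ k) x (e k x) (inv k))) ,
      trans (eq″ (reⁱ k) x (e k (- x)) (inv k)) (trans (cong (λ z → - (x * z * inv k)) re) (cong -_ (eq‴ (reⁱ k) x (e k x) (inv k))))
      where
      eq : ∀ s x a i → (- s) * ((- x) * a * i) ≡ x * (s * a) * i
      eq = solve-∀ ℚ-ring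
      eq′ : ∀ s x a i → x * - (s * a) * i ≡ (- s) * (x * a * i)
      eq′ = solve-∀ ℚ-ring
      eq″ : ∀ s x a i → s * ((- x) * a * i) ≡ - (x * (s * a) * i)
      eq″ = solve-∀ ℚ-ring
      eq‴ : ∀ s x a i → x * (s * a) * i ≡ s * (x * a * i)
      eq‴ = solve-∀ ℚ-ring
  cosₙ-neg n x = sum-cong n (λ i _ → proj₁ (parity i x))
  sinₙ-neg zero    x = refl
  sinₙ-neg (suc n) x = trans (cong₂ _+_ (sinₙ-neg n x) (proj₂ (parity n x))) (sym (ℚ.neg-distrib-+ (sinₙ n x) (imⁱ n * e n x)))

  ∣cosₙ-cosₙ∣ : ∀ {x X m n} → ∣ x ∣ ≤ X → m ℕ.≤ n → ∣ cosₙ n x - cosₙ m x ∣ ≤ exp n X - exp m X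
  ∣cosₙ-cosₙ∣ x≤X = ∣sum-sum∣ (∣re*e∣ x≤X)

  ∣sinₙ-sinₙ∣ : ∀ {x X m n} → ∣ x ∣ ≤ X → m ℕ.≤ n → ∣ sinₙ n x - sinₙ m x ∣ ≤ exp n X - exp m X
  ∣sinₙ-sinₙ∣ x≤X = ∣sum-sum∣ (∣im*e∣ x≤X)

-- Alternating series: two-sided bounds for the cosine polynomials.

module Alternating where

  open Rationals
  open Series
  open import Data.Rational.Base using (_+_; _-_; _*_; -_; _≤_)

  open ≡-Reasoning

  alt : (ℕ → ℚ) → ℕ → ℚ
  alt a zero    = 0ℚ
  alt a (suc n) = a 0 - alt (λ k → a (suc k)) n

  -- The Leibniz test: inductively the rest of the sum lies between 0 and a₁ ≤ a₀, so subtracting it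
  -- from a₀ stays between 0 and a₀.
  alt-bounds : ∀ {a} → (∀ k → 0ℚ ≤ a k) → (∀ k → a (suc k) ≤ a k) → ∀ n →
               0ℚ ≤ alt a n × alt a n ≤ a 0
  alt-bounds a≥0 dec zero    = ℚ.≤-refl , a≥0 0
  alt-bounds {a} a≥0 dec (suc n) with alt-bounds (λ k → a≥0 (suc k)) (λ k → dec (suc k)) n
  ... | lower , upper = ≤⇒0≤- (ℚ.≤-trans upper (dec 0)) , ≤-from lower (eq (a 0) (alt (λ k → a (suc k)) n))
    where
    eq : ∀ x y → x - (x - y) ≡ y
    eq = solve-∀ ℚ-ring

  alt-2+ : ∀ a n → alt a (2 ℕ.+ n) ≡ a 0 - (a 1 - alt (λ k → a (2 ℕ.+ k)) n)
  alt-2+ a n = refl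

  alt-- : ∀ a b n → alt a n - alt b n ≡ alt (λ k → a k - b k) n
  alt-- a b zero    = refl
  alt-- a b (suc n) = trans (eq (a 0) (b 0) (alt (λ k → a (suc k)) n) (alt (λ k → b (suc k)) n))
    (cong (λ z → (a 0 - b 0) - z) (alt-- (λ k → a (suc k)) (λ k → b (suc k)) n))
    where
    eq : ∀ a b c d → (a - c) - (b - d) ≡ (a - b) - (c - d)
    eq = solve-∀ ℚ-ring

  -- Each step reduces to two successors, so that sums over `dbl n` unfold two terms at a time by
  -- computation.
  dbl : ℕ → ℕ
  dbl zero    = zero
  dbl (suc n) = suc (suc (dbl n))

  n≤dbl : ∀ n → n ℕ.≤ dbl n
  n≤dbl zero    = ℕ.z≤n
  n≤dbl (suc n) = ℕ.s≤s (ℕ.m≤n⇒m≤1+n (n≤dbl n))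

  sum-alternate : ∀ n f → sum (dbl n) (λ i → reⁱ i * f i) ≡ alt (λ k → f (dbl k)) n
  sum-alternate zero    f = refl
  sum-alternate (suc n) f = begin
    sum (2 ℕ.+ dbl n) (λ i → reⁱ i * f i)
      ≡⟨ trans (sum-head (suc (dbl n)) _) (cong (1ℚ * f 0 +_) (sum-head (dbl n) (λ i → reⁱ (suc i) * f (suc i)))) ⟩
    1ℚ * f 0 + ((- 0ℚ) * f 1 + sum (dbl n) (λ i → (- reⁱ i) * f (2 ℕ.+ i)))
      ≡⟨ cong (λ z → 1ℚ * f 0 + ((- 0ℚ) * f 1 + z)) (trans (sum-cong (dbl n) (λ i _ → eq₁ (reⁱ i) (f (2 ℕ.+ i)))) (sum-*ˡ (dbl n) (- 1ℚ) _)) ⟩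
    1ℚ * f 0 + ((- 0ℚ) * f 1 + (- 1ℚ) * sum (dbl n) (λ i → reⁱ i * f (2 ℕ.+ i)))
      ≡⟨ eq₂ (f 0) (f 1) (sum (dbl n) (λ i → reⁱ i * f (2 ℕ.+ i))) ⟩
    f 0 - sum (dbl n) (λ i → reⁱ i * f (2 ℕ.+ i))
      ≡⟨ cong (λ z → f 0 - z) (sum-alternate n (λ i → f (2 ℕ.+ i))) ⟩
    f 0 - alt (λ k → f (2 ℕ.+ dbl k)) n ∎
    where
    eq₁ : ∀ r x → (- r) * x ≡ (- 1ℚ) * (r * x)
    eq₁ = solve-∀ ℚ-ring
    eq₂ : ∀ a b s → 1ℚ * a + ((- 0ℚ) * b + (- 1ℚ) * s) ≡ a - s
    eq₂ = solve-∀ ℚ-ring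

  1/3ℚ 1/6ℚ 1/12ℚ 1/24ℚ : ℚ
  1/3ℚ = ℤ.1ℤ / 3
  1/6ℚ = ℤ.1ℤ / 6
  1/12ℚ = ℤ.1ℤ / 12
  1/24ℚ = ℤ.1ℤ / 24

  even : ℕ → ℚ → ℚ
  even k x = e (dbl k) x

  private
    w : ℕ → ℚ
    w k = inv (dbl k) * inv (suc (dbl k))

    w≥0 : ∀ k → 0ℚ ≤ w k
    w≥0 k = inv≥0 (dbl k) ⊗ inv≥0 (suc (dbl k))

    w≤1/12 : ∀ k → w (suc k) ≤ 1/12ℚ
    w≤1/12 k = *-mono (inv≥0 (2 ℕ.+ dbl k)) (ℚ.≤-trans (inv-antimono (ℕ.s≤s (ℕ.s≤s ℕ.z≤n))) (ℚ.≤-reflexive (inv≡/ 2)))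
      (inv≥0 (3 ℕ.+ dbl k)) (ℚ.≤-trans (inv-antimono (ℕ.s≤s (ℕ.s≤s (ℕ.s≤s ℕ.z≤n)))) (ℚ.≤-reflexive (inv≡/ 3)))

  even-suc : ∀ k x → even (suc k) x ≡ x * x * even k x * (inv (dbl k) * inv (suc (dbl k)))
  even-suc k x = eq x (even k x) (inv (dbl k)) (inv (suc (dbl k)))
    where
    eq : ∀ x a i j → x * (x * a * i) * j ≡ x * x * a * (i * j)
    eq = solve-∀ ℚ-ring

  even≥0 : ∀ k x → 0ℚ ≤ even k x
  even≥0 zero    x = 0≤1
  even≥0 (suc k) x = subst (0ℚ ≤_) (sym (even-suc k x)) (square≥0 x ⊗ even≥0 k x ⊗ w≥0 k)

  even-1 : ∀ x → even 1 x ≡ ½ * (x * x)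
  even-1 x = trans (even-suc 0 x) (trans (cong (x * x * 1ℚ *_) (cong₂ _*_ (inv≡/ 0) (inv≡/ 1))) (eq x))
    where
    eq : ∀ x → x * x * 1ℚ * ½ ≡ ½ * (x * x)
    eq = solve-∀ ℚ-ring

  even-2 : ∀ x → even 2 x ≡ 1/24ℚ * (x * x * (x * x))
  even-2 x = trans (even-suc 1 x) (trans (cong₂ (λ z w → x * x * z * w) (even-1 x) (cong₂ _*_ (inv≡/ 2) (inv≡/ 3))) (eq x))
    where
    eq : ∀ x → x * x * (½ * (x * x)) * 1/12ℚ ≡ 1/24ℚ * (x * x * (x * x))
    eq = solve-∀ ℚ-ring

  -- From k = 1 on, consecutive terms x²ᵏ/(2k)! have a ratio of at most x²/(3 · 4), so they decrease
  -- once x² ≤ 12. The terms 1 and x²/2 are kept apart, as the second may exceed the first.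
  12ℚ : ℚ
  12ℚ = ℤ.+ 12 / 1

  module _ {x : ℚ} (x²≤12 : x * x ≤ 12ℚ) where
    private
      even-decreasing : ∀ k → even (2 ℕ.+ k) x ≤ even (suc k) x
      even-decreasing k = subst (_≤ even (suc k) x) (sym (even-suc (suc k) x))
        (ℚ.≤-trans (*-mono (square≥0 x ⊗ even≥0 (suc k) x)
            (*-mono (square≥0 x) x²≤12 (even≥0 (suc k) x) ℚ.≤-refl) (w≥0 (suc k)) (w≤1/12 k))
          (ℚ.≤-reflexive (eq (even (suc k) x))))
        where
        eq : ∀ a → 12ℚ * a * 1/12ℚ ≡ a
        eq = solve-∀ ℚ-ring

      R : ℕ → ℚ
      R n = alt (λ k → even (2 ℕ.+ k) x) n

      remainder : ∀ n → 0ℚ ≤ R n × R n ≤ 1/24ℚ * (x * x * (x * x)) ×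
        1ℚ - cosₙ (dbl (2 ℕ.+ n)) x ≡ ½ * (x * x) - R n
      remainder n = let lower , upper = alt-bounds {λ k → even (2 ℕ.+ k) x} (λ k → even≥0 (2 ℕ.+ k) x) (λ k → even-decreasing (suc k)) n in
        lower , subst (R n ≤_) (even-2 x) upper , (begin
        1ℚ - cosₙ (dbl (2 ℕ.+ n)) x
          ≡⟨ cong (λ z → 1ℚ - z) (sum-alternate (2 ℕ.+ n) (λ i → e i x)) ⟩
        1ℚ - alt (λ k → even k x) (2 ℕ.+ n)
          ≡⟨ cong (λ z → 1ℚ - z) (alt-2+ (λ k → even k x) n) ⟩
        1ℚ - (1ℚ - (even 1 x - R n))
          ≡⟨ eq (even 1 x) (R n) ⟩
        even 1 x - R n
          ≡⟨ cong (λ z → z - R n) (even-1 x) ⟩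
        ½ * (x * x) - R n ∎)
        where
        eq : ∀ a r → 1ℚ - (1ℚ - (a - r)) ≡ a - r
        eq = solve-∀ ℚ-ring

    1-cosₙ-upper : ∀ n → 1ℚ - cosₙ (dbl (2 ℕ.+ n)) x ≤ ½ * (x * x)
    1-cosₙ-upper n = let R≥0 , _ , eq = remainder n in
      subst (_≤ ½ * (x * x)) (sym eq) (≤-from R≥0 (lem (½ * (x * x)) (R n)))
      where
      lem : ∀ a r → a - (a - r) ≡ r
      lem = solve-∀ ℚ-ring

    1-cosₙ-lower : ∀ n → ½ * (x * x) - 1/24ℚ * (x * x * (x * x)) ≤ 1ℚ - cosₙ (dbl (2 ℕ.+ n)) x
    1-cosₙ-lower n = let _ , R≤ , eq = remainder n in
      subst (½ * (x * x) - 1/24ℚ * (x * x * (x * x)) ≤_) (sym eq) (ℚ.+-monoʳ-≤ (½ * (x * x)) (ℚ.neg-antimono-≤ R≤))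

  module _ {x y : ℚ} (0≤x : 0ℚ ≤ x) (x≤y : x ≤ y) (y≤2 : y ≤ 2ℚ) where
    private
      D : ℕ → ℚ
      D k = even k y - even k x

      0≤y : 0ℚ ≤ y
      0≤y = ℚ.≤-trans 0≤x x≤y

      even-mono : ∀ k → even k x ≤ even k y
      even-mono k = ℚ.≤-trans (p≤∣p∣ (even k x))
        (∣e∣ (subst (_≤ y) (sym (ℚ.0≤p⇒∣p∣≡p 0≤x)) x≤y) (dbl k))

      D≥0 : ∀ k → 0ℚ ≤ D k
      D≥0 k = ≤⇒0≤- (even-mono k)

      x²≤y² : x * x ≤ y * y
      x²≤y² = *-mono 0≤x x≤y 0≤x x≤y

      -- Up to a common constant the left side is the right side times (x / y)²ᵏ ≤ 1.
      cross : ∀ k → y * y * even (suc k) x ≤ x * x * even (suc k) y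
      cross zero    = ℚ.≤-reflexive (trans (cong (y * y *_) (even-1 x)) (trans (eq x y) (cong (x * x *_) (sym (even-1 y)))))
        where
        eq : ∀ x y → y * y * (½ * (x * x)) ≡ x * x * (½ * (y * y))
        eq = solve-∀ ℚ-ring
      cross (suc k) = subst₂ _≤_
        (trans (eq₁ (x * x) (y * y) (even (suc k) x) (w (suc k))) (cong (y * y *_) (sym (even-suc (suc k) x))))
        (trans (eq₂ (x * x) (y * y) (even (suc k) y) (w (suc k))) (cong (x * x *_) (sym (even-suc (suc k) y))))
        (*-mono (square≥0 y ⊗ w≥0 (suc k) ⊗ square≥0 x)
          (*-mono (square≥0 y ⊗ w≥0 (suc k)) ℚ.≤-refl (square≥0 x) ℚ.≤-refl)
          (even≥0 (suc k) x) (even-mono (suc k)))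
        where
        eq₁ : ∀ u v a w → v * w * u * a ≡ v * (u * a * w)
        eq₁ = solve-∀ ℚ-ring
        eq₂ : ∀ u v a w → v * w * u * a ≡ u * (v * a * w)
        eq₂ = solve-∀ ℚ-ring

      -- With u = x² and v = y² at most 4, and a, b the terms at x and y, `cross` gives v b - u a ≤
      -- (u + v)(b - a) ≤ 8 (b - a); the weight 1/12 turns 8 into 2/3.
      D-suc : ∀ k → D (2 ℕ.+ k) ≤ 2ℚ * 1/3ℚ * D (suc k)
      D-suc k = ℚ.≤-trans (ℚ.≤-reflexive (trans (cong₂ _-_ (even-suc (suc k) y) (even-suc (suc k) x)) (eq₁ (x * x) (y * y) (even (suc k) x) (even (suc k) y) (w (suc k)))))
        (ℚ.≤-trans (*-mono numerator≥0 numerator≤ (w≥0 (suc k)) (w≤1/12 k)) (ℚ.≤-reflexive (eq₂ (D (suc k)))))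
        where
        eq₁ : ∀ u v a b w → v * b * w - u * a * w ≡ (v * b - u * a) * w
        eq₁ = solve-∀ ℚ-ring
        8ℚ : ℚ
        8ℚ = 4ℚ + 4ℚ
        eq₂ : ∀ d → 8ℚ * d * 1/12ℚ ≡ 2ℚ * 1/3ℚ * d
        eq₂ = solve-∀ ℚ-ring
        v≤4 : y * y ≤ 4ℚ
        v≤4 = *-mono 0≤y y≤2 0≤y y≤2
        numerator≥0 : 0ℚ ≤ y * y * even (suc k) y - x * x * even (suc k) x
        numerator≥0 = ≤⇒0≤- (*-mono (square≥0 x) x²≤y² (even≥0 (suc k) x) (even-mono (suc k)))
        numerator≤ : y * y * even (suc k) y - x * x * even (suc k) x ≤ 8ℚ * D (suc k)
        numerator≤ = ≤-from (≤⇒0≤- (cross k) ⊕ (≤⇒0≤- v≤4 ⊕ ≤⇒0≤- (ℚ.≤-trans x²≤y² v≤4)) ⊗ D≥0 (suc k))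
          (eq₃ (x * x) (y * y) (even (suc k) x) (even (suc k) y))
          where
          eq₃ : ∀ u v a b → 8ℚ * (b - a) - (v * b - u * a) ≡ (u * b - v * a) + ((4ℚ - v) + (4ℚ - u)) * (b - a)
          eq₃ = solve-∀ ℚ-ring

      D-decreasing : ∀ k → D (2 ℕ.+ k) ≤ D (suc k)
      D-decreasing k = ℚ.≤-trans (D-suc k) (≤-from (ℚ.nonNegative⁻¹ 1/3ℚ ⊗ D≥0 (suc k)) (eq (D (suc k))))
        where
        eq : ∀ d → d - 2ℚ * 1/3ℚ * d ≡ 1/3ℚ * d
        eq = solve-∀ ℚ-ring

      D₁ : D 1 ≡ ½ * (y * y - x * x)
      D₁ = trans (cong₂ _-_ (even-1 y) (even-1 x)) (eq (x * x) (y * y))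
        where
        eq : ∀ u v → ½ * v - ½ * u ≡ ½ * (v - u)
        eq = solve-∀ ℚ-ring

      R : ℕ → ℚ
      R n = alt (λ k → D (2 ℕ.+ k)) n

      difference : ∀ n → 0ℚ ≤ R n × R n ≤ 2ℚ * 1/3ℚ * D 1 ×
        cosₙ (dbl (2 ℕ.+ n)) x - cosₙ (dbl (2 ℕ.+ n)) y ≡ D 1 - R n
      difference n = let lower , upper = alt-bounds {λ k → D (2 ℕ.+ k)} (λ k → D≥0 (2 ℕ.+ k)) (λ k → D-decreasing (suc k)) n in
        lower , ℚ.≤-trans upper (D-suc 0) , (begin
        cosₙ (dbl (2 ℕ.+ n)) x - cosₙ (dbl (2 ℕ.+ n)) y
          ≡⟨ cong₂ _-_ (sum-alternate (2 ℕ.+ n) (λ i → e i x)) (sum-alternate (2 ℕ.+ n) (λ i → e i y)) ⟩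
        alt (λ k → even k x) (2 ℕ.+ n) - alt (λ k → even k y) (2 ℕ.+ n)
          ≡⟨ alt-- (λ k → even k x) (λ k → even k y) (2 ℕ.+ n) ⟩
        alt (λ k → even k x - even k y) (2 ℕ.+ n)
          ≡⟨ alt-2+ (λ k → even k x - even k y) n ⟩
        (1ℚ - 1ℚ) - ((even 1 x - even 1 y) - alt (λ k → even (2 ℕ.+ k) x - even (2 ℕ.+ k) y) n)
          ≡⟨ cong (λ z → (1ℚ - 1ℚ) - ((even 1 x - even 1 y) - z)) (alt-neg (λ k → even (2 ℕ.+ k) x) (λ k → even (2 ℕ.+ k) y) n) ⟩
        (1ℚ - 1ℚ) - ((even 1 x - even 1 y) - - alt (λ k → D (2 ℕ.+ k)) n)
          ≡⟨ eq (even 1 x) (even 1 y) (R n) ⟩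
        D 1 - R n ∎)
        where
        eq : ∀ a b r → (1ℚ - 1ℚ) - ((a - b) - - r) ≡ (b - a) - r
        eq = solve-∀ ℚ-ring
        flip : ∀ a b → a - b ≡ - (b - a)
        flip = solve-∀ ℚ-ring
        alt-neg : ∀ a b n → alt (λ k → a k - b k) n ≡ - alt (λ k → b k - a k) n
        alt-neg a b n = trans (sym (alt-- a b n)) (trans (flip (alt a n) (alt b n)) (cong -_ (alt-- b a n)))

    cosₙ-difference-upper : ∀ n → cosₙ (dbl (2 ℕ.+ n)) x - cosₙ (dbl (2 ℕ.+ n)) y ≤ ½ * (y * y - x * x)
    cosₙ-difference-upper n = let R≥0 , _ , eq = difference n in
      subst₂ _≤_ (sym eq) D₁ (≤-from R≥0 (lem (D 1) (R n)))
      where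
      lem : ∀ a r → a - (a - r) ≡ r
      lem = solve-∀ ℚ-ring

    -- The ratio 2/3 leaves at least a third of the leading difference (y² - x²)/2. This is a
    -- quantitative decrease of the cosine on [0, 2]: it pins down a near-zero up to a proportional
    -- error.
    cosₙ-difference-lower : ∀ n → 1/6ℚ * (y * y - x * x) ≤ cosₙ (dbl (2 ℕ.+ n)) x - cosₙ (dbl (2 ℕ.+ n)) y
    cosₙ-difference-lower n = let _ , R≤ , eq = difference n in
      subst₂ _≤_ (trans (lem (D 1)) (trans (cong (1/3ℚ *_) D₁) (lem′ (x * x) (y * y)))) (sym eq)
      (ℚ.+-monoʳ-≤ (D 1) (ℚ.neg-antimono-≤ R≤))
      where
      lem : ∀ d → d - 2ℚ * 1/3ℚ * d ≡ 1/3ℚ * d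
      lem = solve-∀ ℚ-ring
      lem′ : ∀ u v → 1/3ℚ * (½ * (v - u)) ≡ 1/6ℚ * (v - u)
      lem′ = solve-∀ ℚ-ring

-- The setoid of reals, with cosine and sine as functions on it.

module Reals where

  open Rationals
  open Series
  open Alternating
  open import Data.Rational.Base using (_+_; _-_; _*_; -_; _≤_; _<_; ∣_∣)
  open import Level using (0ℓ)
  open import Relation.Binary.Bundles using (Setoid)
  import Relation.Binary.Reasoning.Setoid as SetoidReasoning

  -- Matches the existential starting index in `_≈_` and `_<_`; facts about reals are stated in this
  -- form on their rational terms.
  Eventually : (ℕ → Set) → Set
  Eventually P = ∃ λ N → ∀ n → N ℕ.≤ n → P n

  module _ {P Q : ℕ → Set} where
    ev-map : (∀ n → P n → Q n) → Eventually P → Eventually Q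
    ev-map f (N , p) = N , λ n N≤n → f n (p n N≤n)

    ev-× : Eventually P → Eventually Q → Eventually (λ n → P n × Q n)
    ev-× (N , p) (M , q) = N ℕ.⊔ M , λ n ≤n →
      p n (ℕ.m⊔n≤o⇒m≤o N M ≤n) , q n (ℕ.m⊔n≤o⇒n≤o N M ≤n)

  ev-witness : ∀ {P : ℕ → Set} → Eventually P → ∃ P
  ev-witness (N , p) = N , p N ℕ.≤-refl

  ≥-from : ∀ N → Eventually (N ℕ.≤_)
  ≥-from N = N , λ n N≤n → N≤n

  shrink : ∀ {K ε} → 0ℚ ≤ K → 0ℚ < ε → ∃ λ δ → 0ℚ < δ × K * δ < ε
  shrink {K} {ε} 0≤K 0<ε =
    -- Dividing by 1 + K allows K = 0 and leaves ε - Kδ = δ as the margin.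
    let r , 0<r , r[1+K]≡1 = reciprocal {1ℚ + K} (0<1 ⁺⊕ 0≤K) in
    r * ε , 0<r ⊗⁺ 0<ε , <-from (0<r ⊗⁺ 0<ε) (trans
      (cong (λ z → z - K * (r * ε)) (trans (sym (ℚ.*-identityˡ ε)) (cong (_* ε) (sym r[1+K]≡1)))) (eq r K ε))
    where
    eq : ∀ r K ε → r * (1ℚ + K) * ε - K * (r * ε) ≡ r * ε
    eq = solve-∀ ℚ-ring

  inv-shrink : ∀ {K ε} → 0ℚ ≤ K → 0ℚ < ε → ∃ λ n → K * inv n < ε
  inv-shrink {K} 0≤K 0<ε =
    let δ , 0<δ , Kδ<ε = shrink 0≤K 0<ε
        n , invn<δ = inv-small 0<δ
    in n , ℚ.≤-<-trans (ℚ.*-monoˡ-≤-nonNeg K {{ℚ.nonNegative 0≤K}} (ℚ.<⇒≤ invn<δ)) Kδ<ε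

  halves : ∀ ε → ½ * ε + ½ * ε ≡ ε
  halves = solve-∀ ℚ-ring

  half-sum : ∀ {a b ε} → a < ½ * ε → b < ½ * ε → a + b < ε
  half-sum {a} {b} {ε} a< b< = subst (a + b <_) (halves ε) (ℚ.+-mono-< a< b<)

  ≤-limit : ∀ {a b} → (∀ ε → 0ℚ < ε → a ≤ b + ε) → a ≤ b
  ≤-limit {a} {b} h = [ (λ le → le) , (λ b≤a → ℚ.≮⇒≥ λ b<a → ℚ.<-irrefl refl (contra b<a)) ]′ (ℚ.≤-total a b)
    where
    eq : ∀ a b → a - (b + ½ * (a - b)) ≡ ½ * (a - b)
    eq = solve-∀ ℚ-ring
    contra : b < a → a < a
    contra b<a = ℚ.≤-<-trans (h (½ * (a - b)) pos) (<-from pos (eq a b))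
      where
      pos : 0ℚ < ½ * (a - b)
      pos = half-positive (<⇒0<- b<a)

  Bounded : (ℕ → ℚ) → Set
  Bounded s = ∃ λ B → 0ℚ ≤ B × Eventually (λ n → ∣ s n ∣ ≤ B)

  bounded : ∀ x → Bounded (seq x)
  bounded x =
    let N , close = cauchy x 1ℚ 0<1 in
    1ℚ + ∣ seq x N ∣ , 0≤1 ⊕ ℚ.0≤∣p∣ (seq x N) , N , λ n N≤n →
      subst (λ z → ∣ z ∣ ≤ 1ℚ + ∣ seq x N ∣) (eq (seq x n) (seq x N))
        (ℚ.≤-trans (ℚ.∣p+q∣≤∣p∣+∣q∣ (seq x n - seq x N) (seq x N))
          (ℚ.+-monoˡ-≤ ∣ seq x N ∣ (ℚ.<⇒≤ (close n N N≤n ℕ.≤-refl))))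
    where
    eq : ∀ a b → (a - b) + b ≡ a
    eq = solve-∀ ℚ-ring

  ≈-pointwise : ∀ {x y} → (∀ n → seq x n ≡ seq y n) → x ≈ y
  ≈-pointwise {x} {y} eq ε 0<ε = 0 , λ n _ →
    subst (_< ε) (sym (trans (cong (λ z → ∣ z - seq y n ∣) (eq n)) (cong ∣_∣ (ℚ.+-inverseʳ (seq y n))))) 0<ε

  ≈-refl : ∀ {x} → x ≈ x
  ≈-refl {x} = ≈-pointwise {x} {x} (λ _ → refl)

  ≈-sym : ∀ {x y} → x ≈ y → y ≈ x
  ≈-sym {x} {y} x≈y ε 0<ε = ev-map (λ n → subst (_< ε) (∣∣-sym (seq x n) (seq y n))) (x≈y ε 0<ε)

  ≈-trans : ∀ {x y z} → x ≈ y → y ≈ z → x ≈ z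
  ≈-trans {x} {y} {z} x≈y y≈z ε 0<ε = ev-map
    (λ { n (a , b) → ℚ.≤-<-trans (∣-∣-triangle (seq x n) (seq y n) (seq z n)) (half-sum a b) })
    (ev-× (x≈y (½ * ε) (half-positive 0<ε)) (y≈z (½ * ε) (half-positive 0<ε)))

  +-cong : ∀ {x x′ y y′} → x ≈ x′ → y ≈ y′ → x +ᴿ y ≈ x′ +ᴿ y′
  +-cong {x} {x′} {y} {y′} x≈ y≈ ε 0<ε = ev-map
    (λ { n (a , b) → subst (λ z → ∣ z ∣ < ε) (eq (seq x n) (seq x′ n) (seq y n) (seq y′ n))
      (ℚ.≤-<-trans (ℚ.∣p+q∣≤∣p∣+∣q∣ (seq x n - seq x′ n) (seq y n - seq y′ n)) (half-sum a b)) })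
    (ev-× (x≈ (½ * ε) (half-positive 0<ε)) (y≈ (½ * ε) (half-positive 0<ε)))
    where
    eq : ∀ a b c d → (a - b) + (c - d) ≡ (a + c) - (b + d)
    eq = solve-∀ ℚ-ring

  -‿cong : ∀ {x y} → x ≈ y → -ᴿ x ≈ -ᴿ y
  -‿cong {x} {y} x≈y ε 0<ε = ev-map
    (λ n → subst (_< ε) (trans (sym (ℚ.∣-p∣≡∣p∣ (seq x n - seq y n))) (cong ∣_∣ (eq (seq x n) (seq y n))))) (x≈y ε 0<ε)
    where
    eq : ∀ a b → - (a - b) ≡ - a - - b
    eq = solve-∀ ℚ-ring

  *-cong : ∀ {x x′ y y′} → x ≈ x′ → y ≈ y′ → x *ᴿ y ≈ x′ *ᴿ y′
  *-cong {x} {x′} {y} {y′} x≈ y≈ ε 0<ε =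
    let X , X≥0 , x≤X = bounded x
        Y , Y≥0 , y≤Y = bounded y′
        δ , 0<δ , Xδ<ε = shrink X≥0 (half-positive 0<ε)
        η , 0<η , Yη<ε = shrink Y≥0 (half-positive 0<ε)
    in ev-map
      (λ { n ((a , b) , (a′ , b′)) → subst (λ z → ∣ z ∣ < ε) (eq (seq x n) (seq x′ n) (seq y n) (seq y′ n))
        (ℚ.≤-<-trans (ℚ.∣p+q∣≤∣p∣+∣q∣ (seq x n * (seq y n - seq y′ n)) (seq y′ n * (seq x n - seq x′ n)))
          (half-sum (ℚ.≤-<-trans (∣*∣-≤ {seq x n} a (ℚ.<⇒≤ b′)) Xδ<ε) (ℚ.≤-<-trans (∣*∣-≤ {seq y′ n} b (ℚ.<⇒≤ a′)) Yη<ε))) })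
      (ev-× (ev-× x≤X y≤Y) (ev-× (x≈ η 0<η) (y≈ δ 0<δ)))
    where
    eq : ∀ a b c d → a * (c - d) + d * (a - b) ≡ a * c - b * d
    eq = solve-∀ ℚ-ring

  -- Wrapping _≈_ in a record lets its two sides be inferred.
  infix 4 _≃_
  record _≃_ (x y : ℝ) : Set where
    constructor ≈⇒≃
    field
      ≃⇒≈ : x ≈ y

  open _≃_ public

  ≃-pointwise : ∀ {x y} → (∀ n → seq x n ≡ seq y n) → x ≃ y
  ≃-pointwise {x} {y} eq = ≈⇒≃ (≈-pointwise {x} {y} eq)

  ≃-refl : ∀ {x} → x ≃ x
  ≃-refl = ≃-pointwise (λ _ → refl)

  ≃-sym : ∀ {x y} → x ≃ y → y ≃ x
  ≃-sym {x} {y} (≈⇒≃ x≈y) = ≈⇒≃ (≈-sym {x} {y} x≈y)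

  ≃-trans : ∀ {x y z} → x ≃ y → y ≃ z → x ≃ z
  ≃-trans {x} {y} {z} (≈⇒≃ x≈y) (≈⇒≃ y≈z) = ≈⇒≃ (≈-trans {x} {y} {z} x≈y y≈z)

  +-≃ : ∀ {x x′ y y′} → x ≃ x′ → y ≃ y′ → x +ᴿ y ≃ x′ +ᴿ y′
  +-≃ {x} {x′} {y} {y′} (≈⇒≃ x≈) (≈⇒≃ y≈) = ≈⇒≃ (+-cong {x} {x′} {y} {y′} x≈ y≈)

  -‿≃ : ∀ {x y} → x ≃ y → -ᴿ x ≃ -ᴿ y
  -‿≃ {x} {y} (≈⇒≃ x≈) = ≈⇒≃ (-‿cong {x} {y} x≈)

  *-≃ : ∀ {x x′ y y′} → x ≃ x′ → y ≃ y′ → x *ᴿ y ≃ x′ *ᴿ y′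
  *-≃ {x} {x′} {y} {y′} (≈⇒≃ x≈) (≈⇒≃ y≈) = ≈⇒≃ (*-cong {x} {x′} {y} {y′} x≈ y≈)

  ℝ-setoid : Setoid 0ℓ 0ℓ
  ℝ-setoid = record
    { Carrier = ℝ
    ; _≈_ = _≃_
    ; isEquivalence = record { refl = ≃-refl ; sym = ≃-sym ; trans = ≃-trans }
    }

  module ≃-Reasoning = SetoidReasoning ℝ-setoid

  -- Degrees are multiples of four: `quad (suc n)` is by computation `dbl (2 + dbl n)`, the form in
  -- which the alternating bounds are stated, and the powers of i return to 1 there.
  quad : ℕ → ℕ
  quad n = dbl (dbl n)

  n≤quad : ∀ n → n ℕ.≤ quad n
  n≤quad n = ℕ.≤-trans (n≤dbl n) (n≤dbl (dbl n))

  -- Cosine and sine share the passage from polynomials to functions on reals: it rests on a tail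
  -- bound and a Lipschitz bound, both with the majorant `exp`.
  module Limit
    (F : ℕ → ℚ → ℚ)
    (F-tail : ∀ {x X m n} → ∣ x ∣ ≤ X → m ℕ.≤ n → ∣ F n x - F m x ∣ ≤ exp n X - exp m X)
    (F-lipschitz : ∀ {x y X} → ∣ x ∣ ≤ X → ∣ y ∣ ≤ X → ∀ n → ∣ F n x - F n y ∣ ≤ ∣ x - y ∣ * exp n X)
    where

    module _ {X : ℚ} (X≥0 : 0ℚ ≤ X) where
      open Tail X≥0

      F-close : ∀ {x y N} M k → ∣ x ∣ ≤ X → ∣ y ∣ ≤ X → suc k ℕ.≤ M → suc k ℕ.≤ N →
                ∣ F M x - F N y ∣ ≤ tail-bound * inv k + ∣ x - y ∣ * exp-bound
      F-close {x} {y} {N} M k x≤X y≤X k<M k<N = ℚ.≤-trans (∣-∣-triangle (F M x) (F N x) (F N y))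
        (ℚ.+-mono-≤ ([ larger , smaller ]′ (ℕ.≤-total M N))
          (ℚ.≤-trans (F-lipschitz x≤X y≤X N) (ℚ.*-monoˡ-≤-nonNeg ∣ x - y ∣ {{ℚ.∣-∣-nonNeg (x - y)}} (exp≤bound N))))
        where
        bound : ∀ {m n} → suc k ℕ.≤ m → m ℕ.≤ n → exp n X - exp m X ≤ tail-bound * inv k
        bound {m} {n} k<m m≤n = ℚ.≤-trans (ℚ.+-monoʳ-≤ (exp n X) (ℚ.neg-antimono-≤ (exp-mono X≥0 k<m)))
          (tail-inv (ℕ.≤-trans k<m m≤n))
        larger : M ℕ.≤ N → ∣ F M x - F N x ∣ ≤ tail-bound * inv k
        larger M≤N = subst (_≤ tail-bound * inv k) (∣∣-sym (F N x) (F M x)) (ℚ.≤-trans (F-tail x≤X M≤N) (bound k<M M≤N))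
        smaller : N ℕ.≤ M → ∣ F M x - F N x ∣ ≤ tail-bound * inv k
        smaller N≤M = ℚ.≤-trans (F-tail x≤X N≤M) (bound k<N N≤M)

      F-closer : ∀ {ε} → 0ℚ < ε → ∃ λ k → ∃ λ δ → 0ℚ < δ × (∀ {x y N} M → ∣ x ∣ ≤ X → ∣ y ∣ ≤ X →
        ∣ x - y ∣ < δ → suc k ℕ.≤ M → suc k ℕ.≤ N → ∣ F M x - F N y ∣ < ε)
      F-closer 0<ε =
        let k , tail< = inv-shrink tail-bound≥0 (half-positive 0<ε)
            δ , 0<δ , lip< = shrink exp-bound≥0 (half-positive 0<ε)
        in k , δ , 0<δ , λ {x} {y} M x≤X y≤X x-y<δ k<M k<N →
          ℚ.≤-<-trans (F-close M k x≤X y≤X k<M k<N) (half-sum tail<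
            (ℚ.≤-<-trans (ℚ.≤-trans (ℚ.≤-reflexive (ℚ.*-comm ∣ x - y ∣ exp-bound))
              (ℚ.*-monoˡ-≤-nonNeg exp-bound {{ℚ.nonNegative exp-bound≥0}} (ℚ.<⇒≤ x-y<δ))) lip<))

    private
      index : ∀ {k n} → k ℕ.≤ n → suc k ℕ.≤ quad (suc n)
      index k≤n = ℕ.≤-trans (ℕ.s≤s k≤n) (n≤quad _)

    -- A diagonal: the index drives both the term of `x` and the degree of the polynomial evaluated
    -- there.
    lim : ℝ → ℝ
    lim x = mkℝ (λ n → F (quad (suc n)) (seq x n)) λ ε 0<ε →
      let X , X≥0 , M , x≤X = bounded x
          k , δ , 0<δ , close = F-closer X≥0 0<ε
          N , near = cauchy x δ 0<δ
      in M ℕ.⊔ (N ℕ.⊔ k) , λ m n ≤m ≤n →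
        close (quad (suc m)) (x≤X m (ℕ.m⊔n≤o⇒m≤o M (N ℕ.⊔ k) ≤m)) (x≤X n (ℕ.m⊔n≤o⇒m≤o M (N ℕ.⊔ k) ≤n))
          (near m n (ℕ.m⊔n≤o⇒m≤o N k (ℕ.m⊔n≤o⇒n≤o M (N ℕ.⊔ k) ≤m)) (ℕ.m⊔n≤o⇒m≤o N k (ℕ.m⊔n≤o⇒n≤o M (N ℕ.⊔ k) ≤n)))
          (index (ℕ.m⊔n≤o⇒n≤o N k (ℕ.m⊔n≤o⇒n≤o M (N ℕ.⊔ k) ≤m))) (index (ℕ.m⊔n≤o⇒n≤o N k (ℕ.m⊔n≤o⇒n≤o M (N ℕ.⊔ k) ≤n)))

    lim-cong : ∀ {x y} → x ≈ y → lim x ≈ lim y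
    lim-cong {x} {y} x≈y ε 0<ε =
      let X , X≥0 , x≤X = bounded x
          Y , Y≥0 , y≤Y = bounded y
          k , δ , 0<δ , close = F-closer (X≥0 ⊕ Y≥0) 0<ε
      in ev-map (λ { n ((a , b) , (c , k≤n)) → close (quad (suc n))
            (ℚ.≤-trans a (≤-from Y≥0 (eq₁ X Y))) (ℚ.≤-trans b (≤-from X≥0 (eq₂ X Y))) c (index k≤n) (index k≤n) })
          (ev-× (ev-× x≤X y≤Y) (ev-× (x≈y δ 0<δ) (≥-from k)))
      where
      eq₁ : ∀ a b → a + b - a ≡ b
      eq₁ = solve-∀ ℚ-ring
      eq₂ : ∀ a b → a + b - b ≡ a
      eq₂ = solve-∀ ℚ-ring

    module _ (x : ℝ) (f : ℕ → ℝ) (f-seq : ∀ n m → seq (f n) m ≡ F (dbl n) (seq x m)) where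

      -- Read at index m, a partial sum of the series evaluates a polynomial of fixed degree at the
      -- same rational as the diagonal does. Past a common degree, `F-closer` makes the two agree up
      -- to ε/2 for all large m.
      lim-unique : ∀ {y} → f ConvergesTo y → lim x ≈ y
      lim-unique {y} conv ε 0<ε =
        let X , X≥0 , x≤X = bounded x
            k , δ , 0<δ , close = F-closer X≥0 (half-positive 0<ε)
            N , fN = conv (½ * ε) (half-positive 0<ε)
            K = suc k ℕ.⊔ N
            η , 0<η , near = fN K (ℕ.m≤n⊔m (suc k) N)
        in ev-map (λ { m ((a , b) , k≤m) → ℚ.≤-<-trans (∣-∣-triangle (F (quad (suc m)) (seq x m)) (seq (f K) m) (seq y m))
            (half-sum
              (subst (λ z → ∣ F (quad (suc m)) (seq x m) - z ∣ < ½ * ε) (sym (f-seq K m))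
                (close (quad (suc m)) a a (subst (_< δ) (sym (cong ∣_∣ (ℚ.+-inverseʳ (seq x m)))) 0<δ) (index k≤m)
                  (ℕ.≤-trans (ℕ.m≤m⊔n (suc k) N) (n≤dbl K))))
              (ℚ.<-≤-trans (<-from 0<η (eq ∣ seq (f K) m - seq y m ∣ η)) b)) })
          (ev-× (ev-× x≤X near) (≥-from k))
        where
        eq : ∀ a b → a + b - a ≡ b
        eq = solve-∀ ℚ-ring

      lim-converges : ∀ {y} → lim x ≈ y → f ConvergesTo y
      lim-converges {y} lim≈y ε 0<ε =
        let X , X≥0 , x≤X = bounded x
            ε/4 = ½ * (½ * ε)
            0<ε/4 = half-positive {½ * ε} (half-positive {ε} 0<ε)
            k , δ , 0<δ , close = F-closer X≥0 0<ε/4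
        in suc k , λ n k<n → ½ * ε , half-positive 0<ε ,
          ev-map (λ { m ((a , b) , k≤m) → subst (∣ seq (f n) m - seq y m ∣ + ½ * ε ≤_) (halves ε) (ℚ.+-monoˡ-≤ (½ * ε) (ℚ.<⇒≤
            (ℚ.≤-<-trans (∣-∣-triangle (seq (f n) m) (F (quad (suc m)) (seq x m)) (seq y m)) (half-sum {ε = ½ * ε}
              (subst (λ z → ∣ z - F (quad (suc m)) (seq x m) ∣ < ε/4) (sym (f-seq n m))
                (close (dbl n) a a (subst (_< δ) (sym (cong ∣_∣ (ℚ.+-inverseʳ (seq x m)))) 0<δ) (ℕ.≤-trans k<n (n≤dbl n)) (index k≤m)))
              b)))) })
          (ev-× (ev-× x≤X (lim≈y ε/4 0<ε/4)) (≥-from k))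

  private
    module Cos = Limit cosₙ ∣cosₙ-cosₙ∣ cosₙ-lipschitz
    module Sin = Limit sinₙ ∣sinₙ-sinₙ∣ sinₙ-lipschitz

  -- Sealed, since unfolding would expose large sums of rationals; `cos-seq` and `sin-seq` are the
  -- window on the terms.
  abstract
    cos sin : ℝ → ℝ
    cos = Cos.lim
    sin = Sin.lim

    cos-seq : ∀ x n → seq (cos x) n ≡ cosₙ (quad (suc n)) (seq x n)
    cos-seq x n = refl

    sin-seq : ∀ x n → seq (sin x) n ≡ sinₙ (quad (suc n)) (seq x n)
    sin-seq x n = refl

    cos-≃ : ∀ {x y} → x ≃ y → cos x ≃ cos y
    cos-≃ {x} {y} (≈⇒≃ x≈y) = ≈⇒≃ (Cos.lim-cong {x} {y} x≈y)

    sin-≃ : ∀ {x y} → x ≃ y → sin x ≃ sin y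
    sin-≃ {x} {y} (≈⇒≃ x≈y) = ≈⇒≃ (Sin.lim-cong {x} {y} x≈y)

  private
    sign : ℕ → ℚ
    sign k = fromℤ (ℤ.-1ℤ ℤ.^ k)

    /-* : ∀ a n .{{_ : ℕ.NonZero n}} → (a / n) * fromℕ n ≡ fromℤ a
    /-* a (suc d) = /-*-fromℕ a d

    e-! : ∀ x m k → e k (seq x m) * fromℕ (k !) ≡ seq (x ^ᴿ k) m
    e-! x m zero    = refl
    e-! x m (suc k) = trans (cong (e (suc k) (seq x m) *_) (fromℕ-* (suc k) (k !)))
      (trans (eq (e (suc k) (seq x m)) (fromℕ (suc k)) (fromℕ (k !)))
      (trans (cong (_* fromℕ (k !)) (e-suc k (seq x m)))
      (trans (ℚ.*-assoc (seq x m) (e k (seq x m)) (fromℕ (k !))) (cong (seq x m *_) (e-! x m k)))))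
      where
      eq : ∀ a b c → a * (b * c) ≡ b * a * c
      eq = solve-∀ ℚ-ring

    term : ∀ x m k n → coeff k n * seq (x ^ᴿ n) m ≡ sign k * e n (seq x m)
    term x m k n = trans (cong (coeff k n *_) (sym (e-! x m n)))
      (trans (eq (coeff k n) (e n (seq x m)) (fromℕ (n !)))
        (cong (_* e n (seq x m)) (/-* (ℤ.-1ℤ ℤ.^ k) (n !) {{n ℕ.!≢0}})))
      where
      eq : ∀ a b c → a * (b * c) ≡ a * c * b
      eq = solve-∀ ℚ-ring

    2*≡dbl : ∀ k → 2 ℕ.* k ≡ dbl k
    2*≡dbl zero    = refl
    2*≡dbl (suc k) = cong suc (trans (ℕ.+-suc k (k ℕ.+ 0)) (cong suc (2*≡dbl k)))

    iᵈᵇˡ : ∀ k → reⁱ (dbl k) ≡ sign k × imⁱ (dbl k) ≡ 0ℚ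
    iᵈᵇˡ zero    = refl , refl
    iᵈᵇˡ (suc k) = let re , im = iᵈᵇˡ k in
      trans (cong -_ re) (trans (eq (sign k)) (sym (fromℤ-* ℤ.-1ℤ (ℤ.-1ℤ ℤ.^ k)))) , cong -_ im
      where
      eq : ∀ s → - s ≡ (- (1ℚ + 0ℚ)) * s
      eq = solve-∀ ℚ-ring

  cos-series sin-series : ℝ → ℕ → ℝ
  cos-series x = partialSum (λ k → ι (coeff k (2 ℕ.* k)) *ᴿ x ^ᴿ (2 ℕ.* k))
  sin-series x = partialSum (λ k → ι (coeff k (suc (2 ℕ.* k))) *ᴿ x ^ᴿ suc (2 ℕ.* k))

  cos-partialSum : ∀ x n m → seq (cos-series x n) m ≡ cosₙ (dbl n) (seq x m)
  cos-partialSum x zero    m = refl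
  cos-partialSum x (suc n) m = trans
    (cong₂ _+_ (cos-partialSum x n m) (trans (term x m n (2 ℕ.* n))
      (cong₂ _*_ (sym (proj₁ (iᵈᵇˡ n))) (cong (λ k → e k (seq x m)) (2*≡dbl n)))))
    (trans (eq (cosₙ (dbl n) (seq x m) + reⁱ (dbl n) * e (dbl n) (seq x m)) (e (suc (dbl n)) (seq x m)))
      (cong (λ z → cosₙ (dbl n) (seq x m) + reⁱ (dbl n) * e (dbl n) (seq x m) + (- z) * e (suc (dbl n)) (seq x m))
        (sym (proj₂ (iᵈᵇˡ n)))))
    where
    eq : ∀ a b → a ≡ a + (- 0ℚ) * b
    eq = solve-∀ ℚ-ring

  sin-partialSum : ∀ x n m → seq (sin-series x n) m ≡ sinₙ (dbl n) (seq x m)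
  sin-partialSum x zero    m = refl
  sin-partialSum x (suc n) m = trans
    (cong₂ _+_ (sin-partialSum x n m) (trans (term x m n (suc (2 ℕ.* n)))
      (cong₂ _*_ (sym (proj₁ (iᵈᵇˡ n))) (cong (λ k → e (suc k) (seq x m)) (2*≡dbl n)))))
    (trans (eq (sinₙ (dbl n) (seq x m)) (e (dbl n) (seq x m)) (reⁱ (dbl n) * e (suc (dbl n)) (seq x m)))
      (cong (λ z → sinₙ (dbl n) (seq x m) + z * e (dbl n) (seq x m) + reⁱ (dbl n) * e (suc (dbl n)) (seq x m))
        (sym (proj₂ (iᵈᵇˡ n)))))
    where
    eq : ∀ a b c → a + c ≡ a + 0ℚ * b + c
    eq = solve-∀ ℚ-ring

  abstract
    Cos⇒cos : ∀ {x y} → Cos x ≈ y → cos x ≃ y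
    Cos⇒cos {x} {y} h = ≈⇒≃ (Cos.lim-unique x (cos-series x) (cos-partialSum x) {y} h)

    Sin⇒sin : ∀ {x y} → Sin x ≈ y → sin x ≃ y
    Sin⇒sin {x} {y} h = ≈⇒≃ (Sin.lim-unique x (sin-series x) (sin-partialSum x) {y} h)

    sin⇒Sin : ∀ {x y} → sin x ≃ y → Sin x ≈ y
    sin⇒Sin {x} {y} (≈⇒≃ h) = Sin.lim-converges x (sin-series x) (sin-partialSum x) {y} h

  private
    -- The error of the truncated addition formulas is twice a segment of `exp` from N to 2N, which
    -- tends to 0 along N = `quad (suc n)`.
    module Addition (x y : ℝ) {f g : ℕ → ℕ → ℚ}
      (close : ∀ {A B} n → ∣ seq x n ∣ ≤ A → ∣ seq y n ∣ ≤ B → ∀ N →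
        ∣ f n N - g n N ∣ ≤ 2ℚ * (exp (N ℕ.+ N) (A + B) - exp N (A + B))) where

      vanishing : ∀ ε → 0ℚ < ε → Eventually (λ n → ∣ f n (quad (suc n)) - g n (quad (suc n)) ∣ < ε)
      vanishing ε 0<ε =
        let A , A≥0 , x≤A = bounded x
            B , B≥0 , y≤B = bounded y
            open Tail (A≥0 ⊕ B≥0)
            k , small = inv-shrink (0≤2 ⊗ tail-bound≥0) 0<ε
        in ev-map (λ { n ((a , b) , k≤n) → ℚ.≤-<-trans (close n a b (quad (suc n)))
             (ℚ.≤-<-trans (ℚ.*-monoˡ-≤-nonNeg 2ℚ (bound A≥0 B≥0 k n k≤n))
               (ℚ.≤-<-trans (ℚ.≤-reflexive (sym (ℚ.*-assoc 2ℚ tail-bound (inv k)))) small)) })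
           (ev-× (ev-× x≤A y≤B) (≥-from k))
        where
        bound : ∀ {A B} (A≥0 : 0ℚ ≤ A) (B≥0 : 0ℚ ≤ B) k n → k ℕ.≤ n → let N = quad (suc n) in
          exp (N ℕ.+ N) (A + B) - exp N (A + B) ≤ Tail.tail-bound (A≥0 ⊕ B≥0) * inv k
        bound {A} {B} A≥0 B≥0 k n k≤n = ℚ.≤-trans
          (ℚ.+-monoʳ-≤ (exp (N ℕ.+ N) (A + B)) (ℚ.neg-antimono-≤ (exp-mono (A≥0 ⊕ B≥0) k<N)))
          (tail-inv (ℕ.≤-trans k<N (ℕ.m≤m+n N N)))
          where
          open Tail (A≥0 ⊕ B≥0)
          N = quad (suc n)
          k<N : suc k ℕ.≤ N
          k<N = ℕ.≤-trans (ℕ.s≤s k≤n) (n≤quad (suc n))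

  abstract
    cos-+ : ∀ x y → cos (x +ᴿ y) ≃ cos x *ᴿ cos y -ᴿ sin x *ᴿ sin y
    cos-+ x y = ≈⇒≃ (Addition.vanishing x y
      {λ n N → cosₙ N (seq x n + seq y n)} {λ n N → cosₙ N (seq x n) * cosₙ N (seq y n) - sinₙ N (seq x n) * sinₙ N (seq y n)}
      (λ n a b N → cosₙ-+ a b N))

    sin-+ : ∀ x y → sin (x +ᴿ y) ≃ sin x *ᴿ cos y +ᴿ cos x *ᴿ sin y
    sin-+ x y = ≈⇒≃ (Addition.vanishing x y
      {λ n N → sinₙ N (seq x n + seq y n)} {λ n N → sinₙ N (seq x n) * cosₙ N (seq y n) + cosₙ N (seq x n) * sinₙ N (seq y n)}
      (λ n a b N → sinₙ-+ a b N))

    -- At 0 the upper and the lower alternating bound coincide.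
    cos-0 : cos (ι 0ℚ) ≃ ι 1ℚ
    cos-0 = ≃-pointwise {cos (ι 0ℚ)} {ι 1ℚ} λ n → ℚ.≤-antisym (le₁ n) (le₂ n)
      where
      0≤12 : 0ℚ * 0ℚ ≤ 12ℚ
      0≤12 = ℚ.nonNegative⁻¹ 12ℚ
      eq : ∀ c → c - 1ℚ ≡ - (1ℚ - c)
      eq = solve-∀ ℚ-ring
      eq′ : ∀ c → ½ * (0ℚ * 0ℚ) - (1ℚ - c) ≡ c - 1ℚ
      eq′ = solve-∀ ℚ-ring
      eq″ : ∀ c → 1ℚ - c ≡ (1ℚ - c) - (½ * (0ℚ * 0ℚ) - 1/24ℚ * (0ℚ * 0ℚ * (0ℚ * 0ℚ)))
      eq″ = solve-∀ ℚ-ring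
      le₂ : ∀ n → 1ℚ ≤ cosₙ (quad (suc n)) 0ℚ
      le₂ n = ≤-from (≤⇒0≤- (1-cosₙ-upper {0ℚ} 0≤12 (dbl n))) (sym (eq′ (cosₙ (quad (suc n)) 0ℚ)))
      le₁ : ∀ n → cosₙ (quad (suc n)) 0ℚ ≤ 1ℚ
      le₁ n = ≤-from (≤⇒0≤- (1-cosₙ-lower {0ℚ} 0≤12 (dbl n))) (eq″ (cosₙ (quad (suc n)) 0ℚ))

  -- The addition formula for x and -x, with the cosine even and the sine odd.
  pythagoras : ∀ x → cos x *ᴿ cos x +ᴿ sin x *ᴿ sin x ≃ ι 1ℚ
  pythagoras x = begin
    cos x *ᴿ cos x +ᴿ sin x *ᴿ sin x              ≈⟨ ≃-pointwise parity ⟨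
    cos x *ᴿ cos (-ᴿ x) -ᴿ sin x *ᴿ sin (-ᴿ x)    ≈⟨ cos-+ x (-ᴿ x) ⟨
    cos (x +ᴿ -ᴿ x)                               ≈⟨ cos-≃ (≃-pointwise (λ n → ℚ.+-inverseʳ (seq x n))) ⟩
    cos (ι 0ℚ)                                    ≈⟨ cos-0 ⟩
    ι 1ℚ                                          ∎
    where
    open ≃-Reasoning
    eq : ∀ c s → c * c - s * (- s) ≡ c * c + s * s
    eq = solve-∀ ℚ-ring
    cos-even : ∀ n → seq (cos (-ᴿ x)) n ≡ seq (cos x) n
    cos-even n = trans (cos-seq (-ᴿ x) n) (trans (cosₙ-neg (quad (suc n)) (seq x n)) (sym (cos-seq x n)))
    sin-odd : ∀ n → seq (sin (-ᴿ x)) n ≡ - seq (sin x) n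
    sin-odd n = trans (sin-seq (-ᴿ x) n) (trans (sinₙ-neg (quad (suc n)) (seq x n)) (cong -_ (sym (sin-seq x n))))
    parity : ∀ n → seq (cos x *ᴿ cos (-ᴿ x) -ᴿ sin x *ᴿ sin (-ᴿ x)) n ≡ seq (cos x *ᴿ cos x +ᴿ sin x *ᴿ sin x) n
    parity n = trans
      (cong₂ (λ c s → seq (cos x) n * c - seq (sin x) n * s) (cos-even n) (sin-odd n))
      (eq (seq (cos x) n) (seq (sin x) n))

-- Consequences of refuted strict inequalities between reals.

module RealOrder where

  open Rationals
  open Series
  open Alternating
  open Reals
  open import Data.Rational.Base using (_+_; _-_; _*_; -_; _≤_; _<_; ∣_∣)

  ∣-∣<⇒≤ : ∀ {a b q} → ∣ a - b ∣ < q → a ≤ b + q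
  ∣-∣<⇒≤ {a} {b} {q} lt = ≤-from (≤⇒0≤- (ℚ.≤-trans (p≤∣p∣ (a - b)) (ℚ.<⇒≤ lt))) (eq a b q)
    where
    eq : ∀ a b q → (b + q) - a ≡ q - (a - b)
    eq = solve-∀ ℚ-ring

  ∣-∣<⇒≥ : ∀ {a b q} → ∣ a - b ∣ < q → b ≤ a + q
  ∣-∣<⇒≥ {a} {b} {q} lt = ∣-∣<⇒≤ {b} {a} (subst (_< q) (∣∣-sym a b) lt)

  -- One comparison of rationals decides: past the Cauchy indices for ε/4, the terms at `K` tell
  -- whether x exceeds y by more than ε/2. If so, the rest of the excess witnesses y < x; if not,
  -- the drift adds at most another ε/2.
  ≮⇒eventually-≤ : ∀ x y → ¬ (y <ᴿ x) → ∀ ε → 0ℚ < ε → Eventually (λ n → seq x n ≤ seq y n + ε)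
  ≮⇒eventually-≤ x y y≮x ε 0<ε =
    let q    = ½ * (½ * ε)
        0<q  = half-positive {½ * ε} (half-positive {ε} 0<ε)
        N , cx = cauchy x q 0<q
        M , cy = cauchy y q 0<q
    in decide (N ℕ.⊔ M) q
        (λ n K≤n → cx n (N ℕ.⊔ M) (ℕ.m⊔n≤o⇒m≤o N M K≤n) (ℕ.m≤m⊔n N M))
        (λ n K≤n → cy n (N ℕ.⊔ M) (ℕ.m⊔n≤o⇒n≤o N M K≤n) (ℕ.m≤n⊔m N M))
        (seq x (N ℕ.⊔ M) ℚ.≤? seq y (N ℕ.⊔ M) + (q + q)) (eq₀ ε)
    where
    eq₀ : ∀ ε → ε ≡ (½ * (½ * ε) + ½ * (½ * ε)) + (½ * (½ * ε) + ½ * (½ * ε))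
    eq₀ = solve-∀ ℚ-ring
    eq₁ : ∀ a b A B q → b + ((q + q) + (q + q)) - a ≡ (A + q - a) + (B + (q + q) - A) + (b + q - B)
    eq₁ = solve-∀ ℚ-ring
    eq₂ : ∀ a b A B q → a - (b + (A - (B + (q + q)))) ≡ (a + q - A) + (B + q - b)
    eq₂ = solve-∀ ℚ-ring
    decide : ∀ K q → (∀ n → K ℕ.≤ n → ∣ seq x n - seq x K ∣ < q) → (∀ n → K ℕ.≤ n → ∣ seq y n - seq y K ∣ < q) →
      Dec (seq x K ≤ seq y K + (q + q)) → ε ≡ (q + q) + (q + q) → Eventually (λ n → seq x n ≤ seq y n + ε)
    decide K q cx cy (yes le) ε≡ = K , λ n K≤n → subst (λ ε → seq x n ≤ seq y n + ε) (sym ε≡)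
      (≤-from (≤⇒0≤- (∣-∣<⇒≤ {seq x n} {seq x K} (cx n K≤n)) ⊕ ≤⇒0≤- le ⊕ ≤⇒0≤- (∣-∣<⇒≥ {seq y n} {seq y K} (cy n K≤n)))
        (eq₁ (seq x n) (seq y n) (seq x K) (seq y K) q))
    decide K q cx cy (no ≰) ε≡ = ⊥-elim (y≮x (seq x K - (seq y K + (q + q)) , <⇒0<- (ℚ.≰⇒> ≰) , K , λ n K≤n →
      ≤-from (≤⇒0≤- (∣-∣<⇒≥ {seq x n} {seq x K} (cx n K≤n)) ⊕ ≤⇒0≤- (∣-∣<⇒≤ {seq y n} {seq y K} (cy n K≤n)))
        (eq₂ (seq x n) (seq y n) (seq x K) (seq y K) q)))

  ≮≯⇒≃ : ∀ {x y} → ¬ (x <ᴿ y) → ¬ (y <ᴿ x) → x ≃ y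
  ≮≯⇒≃ {x} {y} x≮y y≮x = ≈⇒≃ λ ε 0<ε →
    let 0<½ε = half-positive {ε} 0<ε in
    ev-map (λ { n (a , b) → ℚ.≤-<-trans (∣∣-≤ (≤-from (≤⇒0≤- a) (eq₁ (seq x n) (seq y n) (½ * ε))) (≤-from (≤⇒0≤- b) (eq₂ (seq x n) (seq y n) (½ * ε))))
             (<-from 0<½ε (eq₃ ε)) })
      (ev-× (≮⇒eventually-≤ x y y≮x (½ * ε) 0<½ε) (≮⇒eventually-≤ y x x≮y (½ * ε) 0<½ε))
    where
    eq₁ : ∀ a b h → h - (a - b) ≡ (b + h) - a
    eq₁ = solve-∀ ℚ-ring
    eq₂ : ∀ a b h → h - - (a - b) ≡ (a + h) - b
    eq₂ = solve-∀ ℚ-ring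
    eq₃ : ∀ ε → ε - ½ * ε ≡ ½ * ε
    eq₃ = solve-∀ ℚ-ring

  -- With c = cos y and s = sin y: if sin 2y = 2 s c vanishes then so does c or
  -- s, and s = 0 forces c = 1.
  no-small-zero : ∀ {c s κ c₀} → 0ℚ < κ → 0ℚ < c₀ → c₀ ≤ c → c ≤ 1ℚ - κ →
    ∣ c * c + s * s - 1ℚ ∣ < ½ * κ → ¬ ∣ s * c + c * s ∣ < c₀ * c₀ * κ
  no-small-zero {c} {s} {κ} {c₀} 0<κ 0<c₀ c₀≤c c≤1-κ unit small = <⇒≱ square-small square-large
    where
    c₀≥0 = ℚ.<⇒≤ 0<c₀
    κ≥0 = ℚ.<⇒≤ 0<κ
    c≥0 = ℚ.≤-trans c₀≥0 c₀≤c
    c≤1 : c ≤ 1ℚ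
    c≤1 = ≤-from (≤⇒0≤- c≤1-κ ⊕ κ≥0) (eq c κ)
      where
      eq : ∀ c k → 1ℚ - c ≡ (1ℚ - k - c) + k
      eq = solve-∀ ℚ-ring
    κ≤1 : κ ≤ 1ℚ
    κ≤1 = ≤-from (≤⇒0≤- c≤1-κ ⊕ c≥0) (eq c κ)
      where
      eq : ∀ c k → 1ℚ - k ≡ (1ℚ - k - c) + c
      eq = solve-∀ ℚ-ring
    δ = c₀ * c₀ * κ
    0<δ : 0ℚ < δ
    0<δ = 0<c₀ ⊗⁺ 0<c₀ ⊗⁺ 0<κ
    δ≤1 : δ ≤ 1ℚ
    δ≤1 = *-mono {c₀ * c₀} {1ℚ * 1ℚ} (c₀≥0 ⊗ c₀≥0) (*-mono c₀≥0 (ℚ.≤-trans c₀≤c c≤1) c₀≥0 (ℚ.≤-trans c₀≤c c≤1)) κ≥0 κ≤1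
    s²≥ : ½ * κ ≤ s * s
    s²≥ = ≤-from (≤⇒0≤- (ℚ.≤-trans (-p≤∣p∣ (c * c + s * s - 1ℚ)) (ℚ.<⇒≤ unit)) ⊕ c≥0 ⊗ ≤⇒0≤- c≤1 ⊕ ≤⇒0≤- c≤1-κ) (eq c s κ)
      where
      eq : ∀ c s k → s * s - ½ * k ≡ (½ * k - - (c * c + s * s - 1ℚ)) + c * (1ℚ - c) + (1ℚ - k - c)
      eq = solve-∀ ℚ-ring
    P = ∣ s * c + c * s ∣
    P≥0 : 0ℚ ≤ P
    P≥0 = ℚ.0≤∣p∣ (s * c + c * s)
    -- As P < δ ≤ 1, squaring only shrinks P.
    square-small : P * P < δ
    square-small = ℚ.≤-<-trans (*-mono {P} {P} {P} {1ℚ} P≥0 ℚ.≤-refl P≥0 (ℚ.≤-trans (ℚ.<⇒≤ small) δ≤1)) (subst (_< δ) (sym (ℚ.*-identityʳ P)) small)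
    square-large : δ ≤ P * P
    square-large = subst (δ ≤_) (sym (∣∣² (s * c + c * s))) (≤-from
      (0≤2 ⊗ (c₀≥0 ⊗ c₀≥0) ⊗ κ≥0 ⊗ 0≤½ ⊕ ℚ.nonNegative⁻¹ 4ℚ ⊗ (square≥0 c ⊗ ≤⇒0≤- s²≥)
        ⊕ 0≤2 ⊗ (κ≥0 ⊗ (≤⇒0≤- c₀≤c ⊗ (c≥0 ⊕ c₀≥0))))
      (eq c s κ c₀))
      where
      eq : ∀ c s k d → (s * c + c * s) * (s * c + c * s) - d * d * k ≡
        2ℚ * (d * d) * k * ½ + 4ℚ * (c * c * (s * s - ½ * k)) + 2ℚ * (k * ((c - d) * (c + d)))
      eq = solve-∀ ℚ-ring

-- A computable zero of the cosine, and its identification with π/2.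

module HalfPi where

  open Rationals
  open Series
  open Alternating
  open Reals
  open RealOrder
  open Recursive
  open import Data.Rational.Base using (_+_; _-_; _*_; -_; _≤_; _<_; ∣_∣)
  open import Data.Fin.Base using (Fin; zero; suc)
  open import Data.Vec.Base using (Vec; []; _∷_; lookup)

  four : ℕ → ℕ
  four n = (n ℕ.+ n) ℕ.+ (n ℕ.+ n)

  quad≡four : ∀ n → quad n ≡ four n
  quad≡four n = trans (cong dbl (dbl≡ n)) (dbl≡ (n ℕ.+ n))
    where
    dbl≡ : ∀ n → dbl n ≡ n ℕ.+ n
    dbl≡ zero    = refl
    dbl≡ (suc n) = cong suc (trans (cong suc (dbl≡ n)) (sym (ℕ.+-suc n n)))

  -- cosₙ (4n) (j / N) = (pos n j N − neg n j N) / scale n N.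
  late step : ℕ → ℕ → ℕ
  late q N = (3 ℕ.+ q) ℕ.* (4 ℕ.+ q) ℕ.* (N ℕ.* N)
  step q N = (1 ℕ.+ q) ℕ.* (2 ℕ.+ q) ℕ.* (N ℕ.* N) ℕ.* late q N

  scale : ℕ → ℕ → ℕ
  scale zero    N = 1
  scale (suc n) N = scale n N ℕ.* step (four n) N

  pow⁴ : ℕ → ℕ → ℕ → ℕ
  pow⁴ zero    j N = 1
  pow⁴ (suc n) j N = pow⁴ n j N ℕ.* (j ℕ.* j ℕ.* (j ℕ.* j))

  pos neg : ℕ → ℕ → ℕ → ℕ
  pos zero    j N = 0
  pos (suc n) j N = (pos n j N ℕ.+ pow⁴ n j N) ℕ.* step (four n) N
  neg zero    j N = 0
  neg (suc n) j N = neg n j N ℕ.* step (four n) N ℕ.+ pow⁴ n j N ℕ.* (j ℕ.* j) ℕ.* late (four n) N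

  module _ (j N′ : ℕ) where
    private
      N = suc N′
      x = fromℕ j * inv N′

      xN≡j : x * fromℕ N ≡ fromℕ j
      xN≡j = trans (ℚ.*-assoc (fromℕ j) (inv N′) (fromℕ N)) (trans (cong (fromℕ j *_) (inv-* N′)) (ℚ.*-identityʳ (fromℕ j)))

      e-2 : ∀ q → e (2 ℕ.+ q) x * fromℕ ((1 ℕ.+ q) ℕ.* (2 ℕ.+ q) ℕ.* (N ℕ.* N)) ≡ fromℕ (j ℕ.* j) * e q x
      e-2 q = begin
        e (2 ℕ.+ q) x * fromℕ ((1 ℕ.+ q) ℕ.* (2 ℕ.+ q) ℕ.* (N ℕ.* N))
          ≡⟨ cong (e (2 ℕ.+ q) x *_) (trans (fromℕ-* ((1 ℕ.+ q) ℕ.* (2 ℕ.+ q)) (N ℕ.* N)) (cong₂ _*_ (fromℕ-* (1 ℕ.+ q) (2 ℕ.+ q)) (fromℕ-* N N))) ⟩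
        e (2 ℕ.+ q) x * (fromℕ (1 ℕ.+ q) * fromℕ (2 ℕ.+ q) * (fromℕ N * fromℕ N))
          ≡⟨ eq₁ (e (2 ℕ.+ q) x) (fromℕ (1 ℕ.+ q)) (fromℕ (2 ℕ.+ q)) (fromℕ N) ⟩
        (fromℕ (2 ℕ.+ q) * e (2 ℕ.+ q) x) * (fromℕ (1 ℕ.+ q) * (fromℕ N * fromℕ N))
          ≡⟨ cong (_* (fromℕ (1 ℕ.+ q) * (fromℕ N * fromℕ N))) (e-suc (suc q) x) ⟩
        (x * e (1 ℕ.+ q) x) * (fromℕ (1 ℕ.+ q) * (fromℕ N * fromℕ N))
          ≡⟨ eq₂ x (e (1 ℕ.+ q) x) (fromℕ (1 ℕ.+ q)) (fromℕ N) ⟩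
        (fromℕ (1 ℕ.+ q) * e (1 ℕ.+ q) x) * (x * (fromℕ N * fromℕ N))
          ≡⟨ cong (_* (x * (fromℕ N * fromℕ N))) (e-suc q x) ⟩
        (x * e q x) * (x * (fromℕ N * fromℕ N))
          ≡⟨ eq₃ x (e q x) (fromℕ N) ⟩
        (x * fromℕ N) * (x * fromℕ N) * e q x
          ≡⟨ cong (λ z → z * z * e q x) xN≡j ⟩
        fromℕ j * fromℕ j * e q x
          ≡⟨ cong (_* e q x) (sym (fromℕ-* j j)) ⟩
        fromℕ (j ℕ.* j) * e q x ∎
        where
        open ≡-Reasoning
        eq₁ : ∀ a b c n → a * (b * c * (n * n)) ≡ (c * a) * (b * (n * n))
        eq₁ = solve-∀ ℚ-ring
        eq₂ : ∀ x a b n → (x * a) * (b * (n * n)) ≡ (b * a) * (x * (n * n))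
        eq₂ = solve-∀ ℚ-ring
        eq₃ : ∀ x a n → (x * a) * (x * (n * n)) ≡ (x * n) * (x * n) * a
        eq₃ = solve-∀ ℚ-ring

      e-step : ∀ q → e (4 ℕ.+ q) x * fromℕ (step q N) ≡ fromℕ (j ℕ.* j ℕ.* (j ℕ.* j)) * e q x
      e-step q = begin
        e (4 ℕ.+ q) x * fromℕ (step q N)
          ≡⟨ cong (e (4 ℕ.+ q) x *_) (fromℕ-* ((1 ℕ.+ q) ℕ.* (2 ℕ.+ q) ℕ.* (N ℕ.* N)) (late q N)) ⟩
        e (4 ℕ.+ q) x * (A * fromℕ (late q N))
          ≡⟨ eq (e (4 ℕ.+ q) x) A (fromℕ (late q N)) ⟩
        (e (4 ℕ.+ q) x * fromℕ (late q N)) * A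
          ≡⟨ cong (_* A) (e-2 (2 ℕ.+ q)) ⟩
        fromℕ (j ℕ.* j) * e (2 ℕ.+ q) x * A
          ≡⟨ trans (ℚ.*-assoc (fromℕ (j ℕ.* j)) (e (2 ℕ.+ q) x) A) (cong (fromℕ (j ℕ.* j) *_) (e-2 q)) ⟩
        fromℕ (j ℕ.* j) * (fromℕ (j ℕ.* j) * e q x)
          ≡⟨ trans (sym (ℚ.*-assoc (fromℕ (j ℕ.* j)) (fromℕ (j ℕ.* j)) (e q x))) (cong (_* e q x) (sym (fromℕ-* (j ℕ.* j) (j ℕ.* j)))) ⟩
        fromℕ (j ℕ.* j ℕ.* (j ℕ.* j)) * e q x ∎
        where
        open ≡-Reasoning
        A = fromℕ ((1 ℕ.+ q) ℕ.* (2 ℕ.+ q) ℕ.* (N ℕ.* N))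
        eq : ∀ a b c → a * (b * c) ≡ (a * c) * b
        eq = solve-∀ ℚ-ring

      e-quad : ∀ n → e (quad n) x * fromℕ (scale n N) ≡ fromℕ (pow⁴ n j N)
      e-quad zero    = refl
      e-quad (suc n) = begin
        e (4 ℕ.+ quad n) x * fromℕ (scale n N ℕ.* step (four n) N)
          ≡⟨ cong (e (4 ℕ.+ quad n) x *_) (trans (fromℕ-* (scale n N) (step (four n) N)) (cong (λ q → fromℕ (scale n N) * fromℕ (step q N)) (sym (quad≡four n)))) ⟩
        e (4 ℕ.+ quad n) x * (fromℕ (scale n N) * fromℕ (step (quad n) N))
          ≡⟨ eq (e (4 ℕ.+ quad n) x) (fromℕ (scale n N)) (fromℕ (step (quad n) N)) ⟩
        (e (4 ℕ.+ quad n) x * fromℕ (step (quad n) N)) * fromℕ (scale n N)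
          ≡⟨ cong (_* fromℕ (scale n N)) (e-step (quad n)) ⟩
        fromℕ (j ℕ.* j ℕ.* (j ℕ.* j)) * e (quad n) x * fromℕ (scale n N)
          ≡⟨ trans (ℚ.*-assoc (fromℕ (j ℕ.* j ℕ.* (j ℕ.* j))) (e (quad n) x) (fromℕ (scale n N))) (cong (fromℕ (j ℕ.* j ℕ.* (j ℕ.* j)) *_) (e-quad n)) ⟩
        fromℕ (j ℕ.* j ℕ.* (j ℕ.* j)) * fromℕ (pow⁴ n j N)
          ≡⟨ trans (ℚ.*-comm (fromℕ (j ℕ.* j ℕ.* (j ℕ.* j))) (fromℕ (pow⁴ n j N))) (sym (fromℕ-* (pow⁴ n j N) (j ℕ.* j ℕ.* (j ℕ.* j)))) ⟩
        fromℕ (pow⁴ n j N ℕ.* (j ℕ.* j ℕ.* (j ℕ.* j))) ∎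
        where
        open ≡-Reasoning
        eq : ∀ a b c → a * (b * c) ≡ (a * c) * b
        eq = solve-∀ ℚ-ring

      i-quad : ∀ n → reⁱ (quad n) ≡ 1ℚ × imⁱ (quad n) ≡ 0ℚ
      i-quad zero    = refl , refl
      i-quad (suc n) = let re , im = i-quad n in
        cong (λ z → - - z) re , cong (λ z → - - z) im

      cosₙ-4 : ∀ n → cosₙ (quad (suc n)) x ≡ cosₙ (quad n) x + e (quad n) x - e (2 ℕ.+ quad n) x
      cosₙ-4 n = let re , im = i-quad n in
        trans (cong₂ (λ r s → cosₙ (quad n) x + r * e (quad n) x + (- s) * e (1 ℕ.+ quad n) x + (- r) * e (2 ℕ.+ quad n) x + (- (- s)) * e (3 ℕ.+ quad n) x) re im)
          (eq (cosₙ (quad n) x) (e (quad n) x) (e (1 ℕ.+ quad n) x) (e (2 ℕ.+ quad n) x) (e (3 ℕ.+ quad n) x))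
        where
        eq : ∀ c a b d f → c + 1ℚ * a + (- 0ℚ) * b + (- 1ℚ) * d + (- (- 0ℚ)) * f ≡ c + a - d
        eq = solve-∀ ℚ-ring

    cosₙ-scaled : ∀ n → cosₙ (quad n) x * fromℕ (scale n N) ≡ fromℕ (pos n j N) - fromℕ (neg n j N)
    cosₙ-scaled zero    = refl
    cosₙ-scaled (suc n) = begin
      cosₙ (quad (suc n)) x * fromℕ (scale n N ℕ.* step (four n) N)
        ≡⟨ cong₂ _*_ (cosₙ-4 n) (trans (fromℕ-* (scale n N) (step (four n) N)) (cong (fromℕ (scale n N) *_) (trans (cong (λ q → fromℕ (step q N)) (sym (quad≡four n))) (fromℕ-* ((1 ℕ.+ q) ℕ.* (2 ℕ.+ q) ℕ.* (N ℕ.* N)) (late q N))))) ⟩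
      (C + e q x - e (2 ℕ.+ q) x) * (S * (A * L))
        ≡⟨ eq₁ C (e q x) (e (2 ℕ.+ q) x) S A L ⟩
      (C * S + e q x * S) * (A * L) - (e (2 ℕ.+ q) x * A) * S * L
        ≡⟨ cong₂ (λ y z → y * (A * L) - z * S * L) (cong₂ _+_ (cosₙ-scaled n) (e-quad n)) (e-2 q) ⟩
      (fromℕ (pos n j N) - fromℕ (neg n j N) + W) * (A * L) - fromℕ (j ℕ.* j) * e q x * S * L
        ≡⟨ cong (λ z → (fromℕ (pos n j N) - fromℕ (neg n j N) + W) * (A * L) - z * L) (trans (ℚ.*-assoc (fromℕ (j ℕ.* j)) (e q x) S) (cong (fromℕ (j ℕ.* j) *_) (e-quad n))) ⟩
      (fromℕ (pos n j N) - fromℕ (neg n j N) + W) * (A * L) - fromℕ (j ℕ.* j) * W * L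
        ≡⟨ eq₂ (fromℕ (pos n j N)) (fromℕ (neg n j N)) W (A * L) L (fromℕ (j ℕ.* j)) ⟩
      (fromℕ (pos n j N) + W) * (A * L) - (fromℕ (neg n j N) * (A * L) + W * fromℕ (j ℕ.* j) * L)
        ≡⟨ cong₂ _-_ (trans (cong₂ _*_ (sym (fromℕ-+ (pos n j N) (pow⁴ n j N))) AL≡) (sym (fromℕ-* (pos n j N ℕ.+ pow⁴ n j N) (step (four n) N))))
             (trans (cong₂ _+_ (trans (cong (fromℕ (neg n j N) *_) AL≡) (sym (fromℕ-* (neg n j N) (step (four n) N))))
               (trans (cong₂ _*_ (sym (fromℕ-* (pow⁴ n j N) (j ℕ.* j))) (cong (λ q → fromℕ (late q N)) (quad≡four n))) (sym (fromℕ-* (pow⁴ n j N ℕ.* (j ℕ.* j)) (late (four n) N)))))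
               (sym (fromℕ-+ (neg n j N ℕ.* step (four n) N) (pow⁴ n j N ℕ.* (j ℕ.* j) ℕ.* late (four n) N)))) ⟩
      fromℕ (pos (suc n) j N) - fromℕ (neg (suc n) j N) ∎
      where
      open ≡-Reasoning
      q = quad n
      C = cosₙ (quad n) x
      S = fromℕ (scale n N)
      A = fromℕ ((1 ℕ.+ q) ℕ.* (2 ℕ.+ q) ℕ.* (N ℕ.* N))
      L = fromℕ (late q N)
      W = fromℕ (pow⁴ n j N)
      AL≡ : A * L ≡ fromℕ (step (four n) N)
      AL≡ = trans (sym (fromℕ-* ((1 ℕ.+ q) ℕ.* (2 ℕ.+ q) ℕ.* (N ℕ.* N)) (late q N))) (cong (λ q → fromℕ (step q N)) (quad≡four n))
      eq₁ : ∀ c a b s A L → (c + a - b) * (s * (A * L)) ≡ (c * s + a * s) * (A * L) - (b * A) * s * L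
      eq₁ = solve-∀ ℚ-ring
      eq₂ : ∀ p n w a l j → (p - n + w) * a - j * w * l ≡ (p + w) * a - (n * a + w * j * l)
      eq₂ = solve-∀ ℚ-ring

    scale>0 : ∀ n → 0ℚ < fromℕ (scale n N)
    scale>0 zero    = 0<1
    scale>0 (suc n) = subst (0ℚ <_) (sym (fromℕ-* (scale n N) (step (four n) N)))
      (scale>0 n ⊗⁺ fromℕ-mono-< {0} {step (four n) N} (ℕ.s≤s ℕ.z≤n))

    pos≤neg⇒cosₙ≤0 : ∀ n → pos n j N ℕ.≤ neg n j N → cosₙ (quad n) x ≤ 0ℚ
    pos≤neg⇒cosₙ≤0 n le = *-cancel-≤ (scale>0 n) (subst₂ _≤_ (sym (cosₙ-scaled n)) (sym (ℚ.*-zeroˡ (fromℕ (scale n N))))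
      (≤-from (≤⇒0≤- (fromℕ-mono le)) (eq (fromℕ (pos n j N)) (fromℕ (neg n j N)))))
      where
      eq : ∀ p n → 0ℚ - (p - n) ≡ n - p
      eq = solve-∀ ℚ-ring

    cosₙ≤0⇒pos≤neg : ∀ n → cosₙ (quad n) x ≤ 0ℚ → pos n j N ℕ.≤ neg n j N
    cosₙ≤0⇒pos≤neg n le = fromℕ-cancel-≤ (≤-from (≤⇒0≤- scaled) (eq (fromℕ (pos n j N)) (fromℕ (neg n j N))))
      where
      scaled : fromℕ (pos n j N) - fromℕ (neg n j N) ≤ 0ℚ
      scaled = subst₂ _≤_ (cosₙ-scaled n) (ℚ.*-zeroˡ (fromℕ (scale n N)))
        (ℚ.*-monoʳ-≤-nonNeg (fromℕ (scale n N)) {{ℚ.nonNegative (fromℕ≥0 (scale n N))}} le)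
      eq : ∀ p n → n - p ≡ 0ℚ - (p - n)
      eq = solve-∀ ℚ-ring

  -- The index `n` sets both the degree and the mesh 1/(n + 1). The truncated difference vanishes
  -- exactly when the polynomial is ≤ 0 at the grid point, which is the form in which `min` looks
  -- for a zero.
  positivity : ℕ → ℕ → ℕ
  positivity n j = pos (suc n) j (suc n) ℕ.∸ neg (suc n) j (suc n)

  module _ where
    private
      lateᶜ : ∀ {n} {f g : Vec ℕ n → ℕ} → Computable f → Computable g → Computable (λ xs → late (f xs) (g xs))
      lateᶜ cf cg = sucᶜ (sucᶜ (sucᶜ cf)) *ᶜ sucᶜ (sucᶜ (sucᶜ (sucᶜ cf))) *ᶜ (cg *ᶜ cg)

      stepᶜ : ∀ {n} {f g : Vec ℕ n → ℕ} → Computable f → Computable g → Computable (λ xs → step (f xs) (g xs))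
      stepᶜ cf cg = sucᶜ cf *ᶜ sucᶜ (sucᶜ cf) *ᶜ (cg *ᶜ cg) *ᶜ lateᶜ cf cg

      fourᶜ : ∀ {n} {f : Vec ℕ n → ℕ} → Computable f → Computable (λ xs → four (f xs))
      fourᶜ cf = (cf +ᶜ cf) +ᶜ (cf +ᶜ cf)

      ternary : (ℕ → ℕ → ℕ → ℕ) → Vec ℕ 3 → ℕ
      ternary f (n ∷ j ∷ N ∷ []) = f n j N

      pow⁴ᶜ : Computable (ternary pow⁴)
      pow⁴ᶜ = cast eq (iterateᶜ (const 1) body)
        where
        k r j N : Fin 4
        k = zero
        r = suc zero
        j = suc (suc zero)
        N = suc (suc (suc zero))
        body = var r *ᶜ (var j *ᶜ var j *ᶜ (var j *ᶜ var j))
        eq : ∀ xs → iterate (λ _ → 1) (λ xs → lookup xs r ℕ.* (lookup xs j ℕ.* lookup xs j ℕ.* (lookup xs j ℕ.* lookup xs j))) xs ≡ ternary pow⁴ xs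
        eq (zero ∷ j ∷ N ∷ [])  = refl
        eq (suc n ∷ j ∷ N ∷ []) = cong (ℕ._* (j ℕ.* j ℕ.* (j ℕ.* j))) (eq (n ∷ j ∷ N ∷ []))

      posᶜ : Computable (ternary pos)
      posᶜ = cast eq (iterateᶜ (const 0) ((var r +ᶜ sub₃ pow⁴ᶜ (var k) (var j) (var N)) *ᶜ stepᶜ (fourᶜ (var k)) (var N)))
        where
        k r j N : Fin 4
        k = zero
        r = suc zero
        j = suc (suc zero)
        N = suc (suc (suc zero))
        eq : ∀ xs → iterate (λ _ → 0) (λ xs → (lookup xs r ℕ.+ pow⁴ (lookup xs k) (lookup xs j) (lookup xs N)) ℕ.* step (four (lookup xs k)) (lookup xs N)) xs ≡ ternary pos xs
        eq (zero ∷ j ∷ N ∷ [])  = refl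
        eq (suc n ∷ j ∷ N ∷ []) = cong (λ z → (z ℕ.+ pow⁴ n j N) ℕ.* step (four n) N) (eq (n ∷ j ∷ N ∷ []))

      negᶜ : Computable (ternary neg)
      negᶜ = cast eq (iterateᶜ (const 0) (var r *ᶜ stepᶜ (fourᶜ (var k)) (var N) +ᶜ sub₃ pow⁴ᶜ (var k) (var j) (var N) *ᶜ (var j *ᶜ var j) *ᶜ lateᶜ (fourᶜ (var k)) (var N)))
        where
        k r j N : Fin 4
        k = zero
        r = suc zero
        j = suc (suc zero)
        N = suc (suc (suc zero))
        eq : ∀ xs → iterate (λ _ → 0) (λ xs → lookup xs r ℕ.* step (four (lookup xs k)) (lookup xs N) ℕ.+ pow⁴ (lookup xs k) (lookup xs j) (lookup xs N) ℕ.* (lookup xs j ℕ.* lookup xs j) ℕ.* late (four (lookup xs k)) (lookup xs N)) xs ≡ ternary neg xs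
        eq (zero ∷ j ∷ N ∷ [])  = refl
        eq (suc n ∷ j ∷ N ∷ []) = cong (λ z → z ℕ.* step (four n) N ℕ.+ pow⁴ n j N ℕ.* (j ℕ.* j) ℕ.* late (four n) N) (eq (n ∷ j ∷ N ∷ []))

    positivityᶜ : Computable {2} (λ xs → positivity (lookup xs (suc zero)) (lookup xs zero))
    positivityᶜ = sub₃ posᶜ (sucᶜ n) j (sucᶜ n) ∸ᶜ sub₃ negᶜ (sucᶜ n) j (sucᶜ n)
      where
      n = var (suc zero)
      j = var zero

  private
    cosAt : ℕ → ℚ → ℚ
    cosAt n x = cosₙ (quad (suc n)) x

    grid : ℕ → ℕ → ℚ
    grid n j = fromℕ j * inv n

    grid-2 : ∀ n → grid n (suc n ℕ.+ suc n) ≡ 2ℚ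
    grid-2 n = trans (cong (_* inv n) (fromℕ-+ (suc n) (suc n)))
      (trans (eq (fromℕ (suc n)) (inv n)) (trans (cong (2ℚ *_) (inv-* n)) refl))
      where
      eq : ∀ a b → (a + a) * b ≡ 2ℚ * (b * a)
      eq = solve-∀ ℚ-ring

    -- Here 1 - 2²/2 + 2⁴/24 = -1/3, so the search stops at the grid point 2 at the latest.
    cosAt-2 : ∀ n → cosAt n 2ℚ ≤ 0ℚ
    cosAt-2 n = ≤-from (≤⇒0≤- (1-cosₙ-lower {2ℚ} (ℚ.≤ᵇ⇒≤ _) (dbl n)) ⊕ ℚ.nonNegative⁻¹ 1/3ℚ) (eq (cosAt n 2ℚ))
      where
      eq : ∀ c → 0ℚ - c ≡ (1ℚ - c - (½ * (2ℚ * 2ℚ) - 1/24ℚ * (2ℚ * 2ℚ * (2ℚ * 2ℚ)))) + 1/3ℚ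
      eq = solve-∀ ℚ-ring

    search : ∀ n → ∃ λ k → k ℕ.≤ suc n ℕ.+ suc n × positivity n k ≡ 0 × (∀ j → j ℕ.< k → positivity n j ≢ 0)
    search n = least-zero (positivity n) (suc n ℕ.+ suc n)
      (ℕ.m≤n⇒m∸n≡0 (cosₙ≤0⇒pos≤neg (suc n ℕ.+ suc n) n (suc n)
        (subst (λ x → cosAt n x ≤ 0ℚ) (sym (grid-2 n)) (cosAt-2 n))))

  -- A record, because conversion checks would otherwise unfold the search.
  record HalfPiSearch : Set where
    field
      zeroIndex       : ℕ → ℕ
      zeroIndexᶜ      : Computable {1} (λ xs → zeroIndex (lookup xs zero))
      zeroIndex-≤     : ∀ n → zeroIndex n ℕ.≤ suc n ℕ.+ suc n
      zeroIndex-zero  : ∀ n → positivity n (zeroIndex n) ≡ 0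
      zeroIndex-least : ∀ n j → j ℕ.< zeroIndex n → positivity n j ≢ 0
      T               : ℚ
      T≥0             : 0ℚ ≤ T
      T-tail          : ∀ {n m} → suc n ℕ.≤ m → exp m 2ℚ - exp (suc n) 2ℚ ≤ T * inv n

  halfPiSearch : HalfPiSearch
  halfPiSearch = record
    { zeroIndex       = λ n → proj₁ (search n)
    ; zeroIndexᶜ      = minᶜ positivityᶜ (λ xs → proj₁ (search (lookup xs zero)))
        (λ xs → proj₁ (proj₂ (proj₂ (search (lookup xs zero)))))
        (λ xs → proj₂ (proj₂ (proj₂ (search (lookup xs zero)))))
    ; zeroIndex-≤     = λ n → proj₁ (proj₂ (search n))
    ; zeroIndex-zero  = λ n → proj₁ (proj₂ (proj₂ (search n)))
    ; zeroIndex-least = λ n → proj₂ (proj₂ (proj₂ (search n)))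
    ; T               = Tail.tail-bound {2ℚ} 0≤2
    ; T≥0             = Tail.tail-bound≥0 {2ℚ} 0≤2
    ; T-tail          = Tail.tail-inv {2ℚ} 0≤2
    }

  module HalfPiFrom (S : HalfPiSearch) where
    open HalfPiSearch S

    h : ℕ → ℚ
    h n = fromℕ (zeroIndex n) * inv n

    h≤2 : ∀ n → h n ≤ 2ℚ
    h≤2 n = subst (h n ≤_) (grid-2 n) (ℚ.*-monoʳ-≤-nonNeg (inv n) {{ℚ.nonNegative (inv≥0 n)}}
      (fromℕ-mono (zeroIndex-≤ n)))

    h≥0 : ∀ n → 0ℚ ≤ h n
    h≥0 n = fromℕ≥0 (zeroIndex n) ⊗ inv≥0 n

    private
      cosAt-h≤0 : ∀ n → cosAt n (h n) ≤ 0ℚ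
      cosAt-h≤0 n = pos≤neg⇒cosₙ≤0 (zeroIndex n) n (suc n) (ℕ.m∸n≡0⇒m≤n (zeroIndex-zero n))

      square≤12 : ∀ {x} → 0ℚ ≤ x → x ≤ 2ℚ → x * x ≤ 12ℚ
      square≤12 0≤x x≤2 = ℚ.≤-trans (*-mono 0≤x x≤2 0≤x x≤2) (ℚ.≤ᵇ⇒≤ _)

    -- For 0 ≤ x ≤ 1 the polynomial is at least 1 - x²/2 ≥ 1/2, so it cannot be ≤ 0 there.
    h≥1 : ∀ n → 1ℚ ≤ h n
    h≥1 n = [ (λ le → le) , (λ h≤1 → ⊥-elim (absurd h≤1)) ]′ (ℚ.≤-total 1ℚ (h n))
      where
      eq : ∀ c x → (0ℚ - c) + (½ * (x * x) - (1ℚ - c)) + ½ * (1ℚ - x * x) ≡ - ½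
      eq = solve-∀ ℚ-ring
      absurd : ¬ (h n ≤ 1ℚ)
      absurd h≤1 = <⇒≱ (ℚ.negative⁻¹ (- ½)) (subst (0ℚ ≤_) (eq (cosAt n (h n)) (h n))
        (≤⇒0≤- (cosAt-h≤0 n) ⊕ ≤⇒0≤- (1-cosₙ-upper {h n} (square≤12 (h≥0 n) (h≤2 n)) (dbl n))
          ⊕ 0≤½ ⊗ ≤⇒0≤- (*-mono (h≥0 n) h≤1 (h≥0 n) h≤1)))

    private
      -- By minimality the value at the preceding grid point is positive, and on [0, 2] one mesh
      -- lowers it by at most (y² - x²)/2 ≤ 2 (y - x). The index is a separate variable so that it
      -- can be split into zero and successor.
      before : ∀ n j → j ≡ zeroIndex n → - (2ℚ * inv n) ≤ cosAt n (grid n j)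
      before n zero    eq = ⊥-elim (<⇒≱ 0<1 (ℚ.≤-trans (h≥1 n)
        (ℚ.≤-reflexive (trans (cong (λ j → grid n j) (sym eq)) (ℚ.*-zeroˡ (inv n))))))
      before n (suc j) eq = ≤-from
        (ℚ.<⇒≤ positive ⊕ ≤⇒0≤- (cosₙ-difference-upper x≥0 x≤y y≤2 (dbl n)) ⊕ 0≤½ ⊗ inv≥0 n ⊗ (≤⇒0≤- (ℚ.≤-trans x≤y y≤2) ⊕ ≤⇒0≤- y≤2))
        (trans (cong (λ z → cosAt n y - - (2ℚ * z)) inv≡) (trans (lem (cosAt n x) (cosAt n y) x y) (cong (λ z → cosAt n x + (½ * (y * y - x * x) - (cosAt n x - cosAt n y)) + ½ * z * ((2ℚ - x) + (2ℚ - y))) (sym inv≡))))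
        where
        x = grid n j
        y = grid n (suc j)
        x≥0 : 0ℚ ≤ x
        x≥0 = fromℕ≥0 j ⊗ inv≥0 n
        y≤2 : y ≤ 2ℚ
        y≤2 = subst (_≤ 2ℚ) (cong (grid n) (sym eq)) (h≤2 n)
        inv≡ : inv n ≡ y - x
        inv≡ = lem₀ (fromℕ j) (inv n)
          where
          lem₀ : ∀ a i → i ≡ (1ℚ + a) * i - a * i
          lem₀ = solve-∀ ℚ-ring
        x≤y : x ≤ y
        x≤y = ≤-from (inv≥0 n) (sym inv≡)
        positive : 0ℚ < cosAt n x
        positive = ℚ.≰⇒> (λ le → zeroIndex-least n j (subst (j ℕ.<_) eq (ℕ.n<1+n j))
          (ℕ.m≤n⇒m∸n≡0 (cosₙ≤0⇒pos≤neg j n (suc n) le)))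
        lem : ∀ c d x y → d - - (2ℚ * (y - x)) ≡ c + (½ * (y * y - x * x) - (c - d)) + ½ * (y - x) * ((2ℚ - x) + (2ℚ - y))
        lem = solve-∀ ℚ-ring

      cosAt-h≥ : ∀ n → - (2ℚ * inv n) ≤ cosAt n (h n)
      cosAt-h≥ n = before n (zeroIndex n) refl

    private
      nearby : ∀ {n m} → n ℕ.≤ m → ∣ cosAt m (h n) ∣ ≤ (2ℚ + T) * inv n
      nearby {n} {m} n≤m = ℚ.≤-trans (subst (λ z → ∣ z ∣ ≤ ∣ cosAt m (h n) - cosAt n (h n) ∣ + ∣ cosAt n (h n) ∣) (eq (cosAt m (h n)) (cosAt n (h n)))
          (ℚ.∣p+q∣≤∣p∣+∣q∣ (cosAt m (h n) - cosAt n (h n)) (cosAt n (h n))))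
        (ℚ.≤-trans (ℚ.+-mono-≤
          (ℚ.≤-trans (∣cosₙ-cosₙ∣ {h n} {2ℚ} (∣∣-≤ (h≤2 n) (≤-from (0≤2 ⊕ h≥0 n) (eq₃ (h n)))) (mono (ℕ.s≤s n≤m)))
            (ℚ.≤-trans (ℚ.+-monoʳ-≤ (exp (quad (suc m)) 2ℚ) (ℚ.neg-antimono-≤ (exp-mono 0≤2 (n≤quad (suc n)))))
              (T-tail (ℕ.≤-trans (ℕ.s≤s n≤m) (n≤quad (suc m))))))
          (∣∣-≤ (ℚ.≤-trans (cosAt-h≤0 n) (0≤2 ⊗ inv≥0 n)) (≤-from (≤⇒0≤- (cosAt-h≥ n)) (eq₄ (cosAt n (h n)) (inv n)))))
          (ℚ.≤-reflexive (eq₂ T (inv n))))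
        where
        eq : ∀ a b → (a - b) + b ≡ a
        eq = solve-∀ ℚ-ring
        eq₂ : ∀ t i → t * i + 2ℚ * i ≡ (2ℚ + t) * i
        eq₂ = solve-∀ ℚ-ring
        eq₃ : ∀ x → 2ℚ - - x ≡ 2ℚ + x
        eq₃ = solve-∀ ℚ-ring
        eq₄ : ∀ c i → 2ℚ * i - - c ≡ c - - (2ℚ * i)
        eq₄ = solve-∀ ℚ-ring
        mono : ∀ {m n} → m ℕ.≤ n → quad m ℕ.≤ quad n
        mono {m} {n} m≤n = subst₂ ℕ._≤_ (sym (quad≡four m)) (sym (quad≡four n))
          (ℕ.+-mono-≤ (ℕ.+-mono-≤ m≤n m≤n) (ℕ.+-mono-≤ m≤n m≤n))

    h-rate : ℚ
    h-rate = 3ℚ * (4ℚ + T)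

    h-rate≥0 : 0ℚ ≤ h-rate
    h-rate≥0 = ℚ.nonNegative⁻¹ 3ℚ ⊗ (ℚ.nonNegative⁻¹ 4ℚ ⊕ T≥0)

    private
      -- The values differ by at least (y² - x²)/6 ≥ (y - x)/3, as x + y ≥ 2; for the computed zeros
      -- this is where `h≥1` enters.
      separate : ∀ m {x y δ} → 1ℚ ≤ x → x ≤ y → y ≤ 2ℚ → ∣ cosAt m x ∣ + ∣ cosAt m y ∣ ≤ δ → y - x ≤ 3ℚ * δ
      separate m {x} {y} {δ} 1≤x x≤y y≤2 small = ≤-from
        (ℚ.nonNegative⁻¹ 3ℚ ⊗ ≤⇒0≤- small ⊕ ℚ.nonNegative⁻¹ 3ℚ ⊗ (≤⇒0≤- (p≤∣p∣ (cosAt m x)) ⊕ ≤⇒0≤- (-p≤∣p∣ (cosAt m y)))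
          ⊕ ℚ.nonNegative⁻¹ 3ℚ ⊗ ≤⇒0≤- (cosₙ-difference-lower (ℚ.≤-trans 0≤1 1≤x) x≤y y≤2 (dbl m))
          ⊕ 0≤½ ⊗ (≤⇒0≤- x≤y ⊗ (≤⇒0≤- 1≤x ⊕ ≤⇒0≤- (ℚ.≤-trans 1≤x x≤y))))
        (eq x y δ (cosAt m x) (cosAt m y) ∣ cosAt m x ∣ ∣ cosAt m y ∣)
        where
        eq : ∀ x y δ c d c′ d′ → 3ℚ * δ - (y - x) ≡ 3ℚ * (δ - (c′ + d′)) + 3ℚ * ((c′ - c) + (d′ - - d))
          + 3ℚ * ((c - d) - 1/6ℚ * (y * y - x * x)) + ½ * ((y - x) * ((x - 1ℚ) + (y - 1ℚ)))
        eq = solve-∀ ℚ-ring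

    -- `h n` is a near-zero of the polynomial of index n; passing to index m costs a tail
    -- `T * inv n`. Then `h n` and `h m` are near-zeros of one polynomial and `separate` applies.
    h-close : ∀ {n m} → n ℕ.≤ m → ∣ h n - h m ∣ ≤ h-rate * inv n
    h-close {n} {m} n≤m = [ below , above ]′ (ℚ.≤-total (h n) (h m))
      where
      δ = (4ℚ + T) * inv n
      small : ∣ cosAt m (h n) ∣ + ∣ cosAt m (h m) ∣ ≤ δ
      small = ℚ.≤-trans (ℚ.+-mono-≤ (nearby n≤m) at-m) (ℚ.≤-reflexive (eq T (inv n)))
        where
        eq : ∀ t i → (2ℚ + t) * i + 2ℚ * i ≡ (4ℚ + t) * i
        eq = solve-∀ ℚ-ring
        eq₂ : ∀ c i → 2ℚ * i - - c ≡ c - - (2ℚ * i)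
        eq₂ = solve-∀ ℚ-ring
        at-m : ∣ cosAt m (h m) ∣ ≤ 2ℚ * inv n
        at-m = ℚ.≤-trans
          (∣∣-≤ (ℚ.≤-trans (cosAt-h≤0 m) (0≤2 ⊗ inv≥0 m)) (≤-from (≤⇒0≤- (cosAt-h≥ m)) (eq₂ (cosAt m (h m)) (inv m))))
          (ℚ.*-monoˡ-≤-nonNeg 2ℚ (inv-antimono n≤m))
      3δ≡ : 3ℚ * δ ≡ h-rate * inv n
      3δ≡ = sym (ℚ.*-assoc 3ℚ (4ℚ + T) (inv n))
      below : h n ≤ h m → ∣ h n - h m ∣ ≤ h-rate * inv n
      below le = subst₂ _≤_ (trans (sym (ℚ.0≤p⇒∣p∣≡p (≤⇒0≤- le))) (∣∣-sym (h m) (h n))) 3δ≡ (separate m (h≥1 n) le (h≤2 m) small)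
      above : h m ≤ h n → ∣ h n - h m ∣ ≤ h-rate * inv n
      above le = subst₂ _≤_ (sym (ℚ.0≤p⇒∣p∣≡p (≤⇒0≤- le))) 3δ≡ (separate m (h≥1 m) le (h≤2 n)
        (subst (_≤ δ) (ℚ.+-comm ∣ cosAt m (h n) ∣ ∣ cosAt m (h m) ∣) small))

    half : ℝ
    half = mkℝ h λ ε 0<ε →
      let N , small = inv-shrink h-rate≥0 (half-positive 0<ε) in
      N , λ m n N≤m N≤n → ℚ.≤-<-trans (∣-∣-triangle (h m) (h N) (h n))
        (half-sum (ℚ.≤-<-trans (ℚ.≤-trans (ℚ.≤-reflexive (∣∣-sym (h m) (h N))) (h-close N≤m)) small)
                  (ℚ.≤-<-trans (h-close N≤n) small))

    cos-half : cos half ≃ ι 0ℚ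
    cos-half = ≈⇒≃ λ ε 0<ε →
      let N , small = inv-shrink 0≤2 0<ε in
      N , λ n N≤n → subst (λ c → ∣ c - 0ℚ ∣ < ε) (sym (cos-seq half n))
        (ℚ.≤-<-trans (bound n) (ℚ.≤-<-trans (ℚ.*-monoˡ-≤-nonNeg 2ℚ (inv-antimono N≤n)) small))
      where
      eq : ∀ c i → 2ℚ * i - (c - 0ℚ) ≡ 2ℚ * i + (0ℚ - c)
      eq = solve-∀ ℚ-ring
      eq₂ : ∀ c i → 2ℚ * i - - (c - 0ℚ) ≡ c - - (2ℚ * i)
      eq₂ = solve-∀ ℚ-ring
      bound : ∀ n → ∣ cosAt n (h n) - 0ℚ ∣ ≤ 2ℚ * inv n
      bound n = ∣∣-≤ (≤-from (0≤2 ⊗ inv≥0 n ⊕ ≤⇒0≤- (cosAt-h≤0 n)) (eq (cosAt n (h n)) (inv n)))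
        (≤-from (≤⇒0≤- (cosAt-h≥ n)) (eq₂ (cosAt n (h n)) (inv n)))

    sin-π₀ : sin (half +ᴿ half) ≃ ι 0ℚ
    sin-π₀ = begin
      sin (half +ᴿ half)                              ≈⟨ sin-+ half half ⟩
      sin half *ᴿ cos half +ᴿ cos half *ᴿ sin half    ≈⟨ +-≃ {sin half *ᴿ cos half} {sin half *ᴿ ι 0ℚ} {cos half *ᴿ sin half} {ι 0ℚ *ᴿ sin half}
                                                          (*-≃ {sin half} {sin half} {cos half} {ι 0ℚ} ≃-refl cos-half)
                                                          (*-≃ {cos half} {ι 0ℚ} {sin half} {sin half} cos-half ≃-refl) ⟩
      sin half *ᴿ ι 0ℚ +ᴿ ι 0ℚ *ᴿ sin half            ≈⟨ ≃-pointwise (λ n → eq (seq (sin half) n)) ⟩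
      ι 0ℚ                                            ∎
      where
      open ≃-Reasoning
      eq : ∀ s → s * 0ℚ + 0ℚ * s ≡ 0ℚ
      eq = solve-∀ ℚ-ring

    π₀≮π : ∀ {π} → IsPi π → ¬ (half +ᴿ half <ᴿ π)
    π₀≮π (_ , _ , least) π₀<π = least (half +ᴿ half)
      (1ℚ , 0<1 , 0 , λ n _ → ≤-from (≤⇒0≤- (h≥1 n) ⊕ h≥0 n) (eq (h n))) π₀<π (sin⇒Sin {half +ᴿ half} {ι 0ℚ} sin-π₀)
      where
      eq : ∀ h → (h + h) - (0ℚ + 1ℚ) ≡ (h - 1ℚ) + h
      eq = solve-∀ ℚ-ring

    -- If π is below twice `half`, then y = π/2 lies strictly between 0 and a zero of the decreasing
    -- cosine. So cos y stays away from 1 and from 0, and sin π = 2 sin y cos y cannot vanish.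
    π≮π₀ : ∀ {π} → IsPi π → ¬ (π <ᴿ half +ᴿ half)
    π≮π₀ {π} ((ε₀ , 0<ε₀ , π≥ε₀) , Sinπ , _) (ε₁ , 0<ε₁ , gap) =
      let n , (((a , b) , d) , (u , v)) = ev-witness (ev-× (ev-× (ev-× π≥ε₀ gap) cos-half-small) (ev-× unit sin-small))
      in no-small-zero {seq (cos y) n} {seq (sin y) n} 0<κ 0<c₀ (c-lower n b d a) (c-upper n a b) u
           (subst (λ z → ∣ z ∣ < c₀ * c₀ * κ) (minus-0 (seq (sin y) n * seq (cos y) n + seq (cos y) n * seq (sin y) n)) v)
      where
      minus-0 : ∀ x → x - 0ℚ ≡ x
      minus-0 = solve-∀ ℚ-ring
      y : ℝ
      y = ι ½ *ᴿ π
      κ c₀ : ℚ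
      -- For z = π/2 ≤ 2 one has z²/2 - z⁴/24 ≥ z²/3 = π²/12, which gives `κ`. The cosine drops from
      -- z to `h n` by at least (h² - z²)/6 ≥ ε₁/12; its value at `half` may take away ε₁/24, which
      -- leaves `c₀`.
      κ = 1/12ℚ * (ε₀ * ε₀)
      c₀ = 1/24ℚ * ε₁
      0<κ : 0ℚ < κ
      0<κ = ℚ.positive⁻¹ 1/12ℚ ⊗⁺ (0<ε₀ ⊗⁺ 0<ε₀)
      0<c₀ : 0ℚ < c₀
      0<c₀ = ℚ.positive⁻¹ 1/24ℚ ⊗⁺ 0<ε₁
      cos-half-small : Eventually (λ n → ∣ seq (cos half) n - 0ℚ ∣ < c₀)
      cos-half-small = ≃⇒≈ cos-half c₀ 0<c₀
      unit : Eventually (λ n → ∣ seq (cos y) n * seq (cos y) n + seq (sin y) n * seq (sin y) n - 1ℚ ∣ < ½ * κ)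
      unit = ≃⇒≈ (pythagoras y) (½ * κ) (half-positive 0<κ)
      sin-2y : sin y *ᴿ cos y +ᴿ cos y *ᴿ sin y ≃ ι 0ℚ
      sin-2y = ≃-trans {y = sin (y +ᴿ y)} (≃-sym (sin-+ y y))
        (≃-trans {y = sin π} (sin-≃ {y +ᴿ y} {π} (≃-pointwise {y +ᴿ y} {π} (λ n → halves (seq π n)))) (Sin⇒sin {π} {ι 0ℚ} Sinπ))
      sin-small : Eventually (λ n → ∣ seq (sin y) n * seq (cos y) n + seq (cos y) n * seq (sin y) n - 0ℚ ∣ < c₀ * c₀ * κ)
      sin-small = ≃⇒≈ sin-2y (c₀ * c₀ * κ) (0<c₀ ⊗⁺ 0<c₀ ⊗⁺ 0<κ)
      module At (n : ℕ) (ε₀≤π : 0ℚ + ε₀ ≤ seq π n) (π+ε₁≤ : seq π n + ε₁ ≤ h n + h n) where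
        z : ℚ
        z = ½ * seq π n
        π≥0 : 0ℚ ≤ seq π n
        π≥0 = ℚ.≤-trans (ℚ.<⇒≤ 0<ε₀) (subst (_≤ seq π n) (ℚ.+-identityˡ ε₀) ε₀≤π)
        z≥0 : 0ℚ ≤ z
        z≥0 = 0≤½ ⊗ π≥0
        z≤h : z ≤ h n
        z≤h = ≤-from (0≤½ ⊗ (≤⇒0≤- π+ε₁≤ ⊕ ℚ.<⇒≤ 0<ε₁)) (eq (seq π n) (h n) ε₁)
          where
          eq : ∀ p h e → h - ½ * p ≡ ½ * ((h + h - (p + e)) + e)
          eq = solve-∀ ℚ-ring
        z≤2 : z ≤ 2ℚ
        z≤2 = ℚ.≤-trans z≤h (h≤2 n)
      c-upper : ∀ n → 0ℚ + ε₀ ≤ seq π n → seq π n + ε₁ ≤ h n + h n → seq (cos y) n ≤ 1ℚ - κ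
      c-upper n a b = subst (_≤ 1ℚ - κ) (sym (cos-seq y n)) (≤-from
        (≤⇒0≤- (1-cosₙ-lower {z} (ℚ.≤-trans (*-mono z≥0 z≤2 z≥0 z≤2) (ℚ.≤ᵇ⇒≤ _)) (dbl n))
          ⊕ ℚ.nonNegative⁻¹ 1/24ℚ ⊗ (square≥0 z ⊗ ≤⇒0≤- (*-mono z≥0 z≤2 z≥0 z≤2))
          ⊕ ℚ.nonNegative⁻¹ 1/12ℚ ⊗ ≤⇒0≤- (*-mono (ℚ.<⇒≤ 0<ε₀) ε₀≤π′ (ℚ.<⇒≤ 0<ε₀) ε₀≤π′))
        (eq (seq π n) ε₀ (cosₙ (quad (suc n)) z)))
        where
        open At n a b
        ε₀≤π′ : ε₀ ≤ seq π n
        ε₀≤π′ = subst (_≤ seq π n) (ℚ.+-identityˡ ε₀) a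
        eq : ∀ p e c → 1ℚ - 1/12ℚ * (e * e) - c ≡
          ((1ℚ - c) - (½ * ((½ * p) * (½ * p)) - 1/24ℚ * ((½ * p) * (½ * p) * ((½ * p) * (½ * p)))))
          + 1/24ℚ * ((½ * p) * (½ * p) * (2ℚ * 2ℚ - (½ * p) * (½ * p))) + 1/12ℚ * (p * p - e * e)
        eq = solve-∀ ℚ-ring
      c-lower : ∀ n → seq π n + ε₁ ≤ h n + h n → ∣ seq (cos half) n - 0ℚ ∣ < c₀ → 0ℚ + ε₀ ≤ seq π n → c₀ ≤ seq (cos y) n
      c-lower n b d a = subst (c₀ ≤_) (sym (cos-seq y n)) (≤-from
        (≤⇒0≤- (cosₙ-difference-lower z≥0 z≤h (h≤2 n) (dbl n))
         ⊕ ≤⇒0≤- (∣-∣<⇒≥ {cosₙ (quad (suc n)) (h n)} {0ℚ} (subst (λ c → ∣ c - 0ℚ ∣ < c₀) (cos-seq half n) d))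
         ⊕ 1/12≥0 ⊗ (≤⇒0≤- b ⊗ (h≥0 n ⊕ z≥0)) ⊕ 1/12≥0 ⊗ (ℚ.<⇒≤ 0<ε₁ ⊗ (≤⇒0≤- (h≥1 n) ⊕ z≥0)))
        (eq (seq π n) (h n) ε₁ (cosₙ (quad (suc n)) z) (cosₙ (quad (suc n)) (h n))))
        where
        open At n a b
        1/12≥0 = ℚ.nonNegative⁻¹ 1/12ℚ
        eq : ∀ p h e c d → c - 1/24ℚ * e ≡ ((c - d) - 1/6ℚ * (h * h - (½ * p) * (½ * p))) + (d + 1/24ℚ * e - 0ℚ)
          + 1/12ℚ * ((h + h - (p + e)) * (h + ½ * p)) + 1/12ℚ * (e * ((h - 1ℚ) + ½ * p))
        eq = solve-∀ ℚ-ring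

    π≃π₀ : ∀ {π} → IsPi π → π ≃ half +ᴿ half
    π≃π₀ {π} isPi = ≮≯⇒≃ {π} {half +ᴿ half} (π≮π₀ {π} isPi) (π₀≮π {π} isPi)

    π-rate : ℚ
    π-rate = 2ℚ * h-rate

    π-rate≥0 : 0ℚ ≤ π-rate
    π-rate≥0 = 0≤2 ⊗ h-rate≥0

    π-close : ∀ {π} → IsPi π → ∀ n ε → 0ℚ < ε → Eventually (λ k → ∣ seq π k - 2ℚ * h n ∣ ≤ π-rate * inv n + ε)
    π-close {π} isPi n ε 0<ε = ev-map (λ { k (a , n≤k) → near k a n≤k }) (ev-× limit (≥-from n))
      where
      eq : ∀ a b → - (2ℚ * (b - a)) ≡ a + a - 2ℚ * b
      eq = solve-∀ ℚ-ring
      bound : ∀ k → n ℕ.≤ k → ∣ h k + h k - 2ℚ * h n ∣ ≤ π-rate * inv n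
      bound k n≤k = subst₂ _≤_
        (trans (sym (ℚ.∣p*q∣≡∣p∣*∣q∣ 2ℚ (h n - h k))) (trans (sym (ℚ.∣-p∣≡∣p∣ (2ℚ * (h n - h k)))) (cong ∣_∣ (eq (h k) (h n)))))
        (sym (ℚ.*-assoc 2ℚ h-rate (inv n)))
        (ℚ.*-monoˡ-≤-nonNeg 2ℚ (h-close n≤k))
      limit : Eventually (λ k → ∣ seq π k - (h k + h k) ∣ < ε)
      limit = ≃⇒≈ (π≃π₀ {π} isPi) ε 0<ε
      near : ∀ k → ∣ seq π k - (h k + h k) ∣ < ε → n ℕ.≤ k → ∣ seq π k - 2ℚ * h n ∣ ≤ π-rate * inv n + ε
      near k a n≤k = ℚ.≤-trans (∣-∣-triangle (seq π k) (h k + h k) (2ℚ * h n))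
        (subst (∣ seq π k - (h k + h k) ∣ + ∣ h k + h k - 2ℚ * h n ∣ ≤_) (ℚ.+-comm ε (π-rate * inv n))
          (ℚ.+-mono-≤ (ℚ.<⇒≤ a) (bound k n≤k)))

    5/3ℚ : ℚ
    5/3ℚ = ℤ.+ 5 / 3

    -- The bound h ≤ 2 yields only π ≤ 4, with which the angle x = 2π(mt - k) at |mt - k| near 1/2
    -- could violate x² ≤ 12; the bound 5/3 yields about 10/3. From n = 39 on the value at `h n` is
    -- at least -2/40.
    h≤5/3 : ∀ n → 39 ℕ.≤ n → h n ≤ 5/3ℚ
    h≤5/3 n 39≤n = [ (λ le → le) , (λ 5/3≤h → ⊥-elim (absurd 5/3≤h)) ]′ (ℚ.≤-total (h n) 5/3ℚ)
      where
      inv≤ : inv n ≤ ℤ.1ℤ / 40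
      inv≤ = ℚ.≤-trans (inv-antimono 39≤n) (ℚ.≤-reflexive (inv≡/ 39))
      -- 1 − y/2 + y²/24 is convex in y = h², and below −1/20 at y = 25/9 and at y = 4.
      eq : ∀ c x i → ((1ℚ - c) - (½ * (x * x) - 1/24ℚ * (x * x * (x * x)))) + (c - - (2ℚ * i))
        + 2ℚ * (ℤ.1ℤ / 40 - i) + 1/24ℚ * ((x * x - 5/3ℚ * 5/3ℚ) * (2ℚ * 2ℚ - x * x)) + (ℤ.+ 47 / 216) * (x * x - 5/3ℚ * 5/3ℚ) ≡ - (ℤ.+ 169 / 9720)
      eq = solve-∀ ℚ-ring
      absurd : ¬ (5/3ℚ ≤ h n)
      absurd 5/3≤h = <⇒≱ (ℚ.negative⁻¹ (- (ℤ.+ 169 / 9720))) (subst (0ℚ ≤_) (eq (cosAt n (h n)) (h n) (inv n))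
        (≤⇒0≤- (1-cosₙ-lower {h n} (square≤12 (h≥0 n) (h≤2 n)) (dbl n)) ⊕ ≤⇒0≤- (cosAt-h≥ n)
          ⊕ 0≤2 ⊗ ≤⇒0≤- inv≤ ⊕ ℚ.nonNegative⁻¹ 1/24ℚ ⊗ (≤⇒0≤- h²≥ ⊗ ≤⇒0≤- (*-mono (h≥0 n) (h≤2 n) (h≥0 n) (h≤2 n)))
          ⊕ ℚ.nonNegative⁻¹ (ℤ.+ 47 / 216) ⊗ ≤⇒0≤- h²≥))
        where
        h²≥ : 5/3ℚ * 5/3ℚ ≤ h n * h n
        h²≥ = *-mono (ℚ.nonNegative⁻¹ 5/3ℚ) 5/3≤h (ℚ.nonNegative⁻¹ 5/3ℚ) 5/3≤h

-- Powers of a rational point of the unit circle, and why they avoid 1.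

module Rotations where

  open Rationals
  open import Data.Nat.Divisibility using (_∣_; divides)
  import Data.Nat.Divisibility as ℕ
  open import Data.Nat.Coprimality as Coprime using (Coprime)
  open import Data.Nat.Induction using (<-rec)
  import Data.Nat.Tactic.RingSolver as ℕ-Solver
  import Data.Integer.Tactic.RingSolver as ℤ-Solver
  open import Data.Rational.Base using (_+_; _-_; _*_; -_; _≤_; _<_; ∣_∣)

  parity : ∀ n → (∃ λ k → n ≡ 2 ℕ.* k) ⊎ (∃ λ k → n ≡ suc (2 ℕ.* k))
  parity zero    = inj₁ (0 , refl)
  parity (suc n) with parity n
  ... | inj₁ (k , eq) = inj₂ (k , cong suc eq)
  ... | inj₂ (k , eq) = inj₁ (suc k , trans (cong suc eq) (sym (ℕ.*-suc 2 k)))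

  private
    4∤1 : ∀ a b → ¬ 4 ℕ.* a ℕ.+ 1 ≡ 4 ℕ.* b
    4∤1 a b eq = ℕ.>⇒∤ (ℕ.s≤s (ℕ.s≤s ℕ.z≤n))
      (ℕ.∣m+n∣m⇒∣n (subst (4 ∣_) (sym eq) (ℕ.m∣m*n b)) (ℕ.m∣m*n a))

    4∤2 : ∀ a b → ¬ 4 ℕ.* a ℕ.+ 2 ≡ 4 ℕ.* b
    4∤2 a b eq = ℕ.>⇒∤ (ℕ.s≤s (ℕ.s≤s (ℕ.s≤s ℕ.z≤n)))
      (ℕ.∣m+n∣m⇒∣n (subst (4 ∣_) (sym eq) (ℕ.m∣m*n b)) (ℕ.m∣m*n a))

  -- d² − a² ≡ 3 (mod 4) when a is odd and d even, so it is not a rational square.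
  no-even-hypotenuse : ∀ i m e → e ≢ 0 → ∀ y → let a = suc (2 ℕ.* i) ; d = 2 ℕ.* m in
    ¬ a ℕ.* a ℕ.* (e ℕ.* e) ℕ.+ y ℕ.* y ≡ d ℕ.* d ℕ.* (e ℕ.* e)
  no-even-hypotenuse i m = <-rec _ go
    where
    a = suc (2 ℕ.* i)
    d = 2 ℕ.* m
    go : ∀ e → (∀ {e′} → e′ ℕ.< e → e′ ≢ 0 → ∀ y → ¬ a ℕ.* a ℕ.* (e′ ℕ.* e′) ℕ.+ y ℕ.* y ≡ d ℕ.* d ℕ.* (e′ ℕ.* e′)) →
         e ≢ 0 → ∀ y → ¬ a ℕ.* a ℕ.* (e ℕ.* e) ℕ.+ y ℕ.* y ≡ d ℕ.* d ℕ.* (e ℕ.* e)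
    go e rec e≢0 y eq with parity e | parity y
    ... | inj₂ (k , refl) | inj₁ (l , refl) = 4∤1 ((i ℕ.* i ℕ.+ i) ℕ.* (4 ℕ.* (k ℕ.* k ℕ.+ k) ℕ.+ 1) ℕ.+ (k ℕ.* k ℕ.+ k) ℕ.+ l ℕ.* l) (m ℕ.* m ℕ.* (suc (2 ℕ.* k) ℕ.* suc (2 ℕ.* k))) (trans (sym (lem i k l)) (trans eq (lem′ m k)))
      where
      lem : ∀ i k l → suc (2 ℕ.* i) ℕ.* suc (2 ℕ.* i) ℕ.* (suc (2 ℕ.* k) ℕ.* suc (2 ℕ.* k)) ℕ.+ 2 ℕ.* l ℕ.* (2 ℕ.* l) ≡
        4 ℕ.* ((i ℕ.* i ℕ.+ i) ℕ.* (4 ℕ.* (k ℕ.* k ℕ.+ k) ℕ.+ 1) ℕ.+ (k ℕ.* k ℕ.+ k) ℕ.+ l ℕ.* l) ℕ.+ 1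
      lem = ℕ-Solver.solve-∀
      lem′ : ∀ m k → 2 ℕ.* m ℕ.* (2 ℕ.* m) ℕ.* (suc (2 ℕ.* k) ℕ.* suc (2 ℕ.* k)) ≡ 4 ℕ.* (m ℕ.* m ℕ.* (suc (2 ℕ.* k) ℕ.* suc (2 ℕ.* k)))
      lem′ = ℕ-Solver.solve-∀
    ... | inj₂ (k , refl) | inj₂ (l , refl) = 4∤2 ((i ℕ.* i ℕ.+ i) ℕ.* (4 ℕ.* (k ℕ.* k ℕ.+ k) ℕ.+ 1) ℕ.+ (k ℕ.* k ℕ.+ k) ℕ.+ (l ℕ.* l ℕ.+ l)) (m ℕ.* m ℕ.* (suc (2 ℕ.* k) ℕ.* suc (2 ℕ.* k))) (trans (sym (lem i k l)) (trans eq (lem′ m k)))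
      where
      lem : ∀ i k l → suc (2 ℕ.* i) ℕ.* suc (2 ℕ.* i) ℕ.* (suc (2 ℕ.* k) ℕ.* suc (2 ℕ.* k)) ℕ.+ suc (2 ℕ.* l) ℕ.* suc (2 ℕ.* l) ≡
        4 ℕ.* ((i ℕ.* i ℕ.+ i) ℕ.* (4 ℕ.* (k ℕ.* k ℕ.+ k) ℕ.+ 1) ℕ.+ (k ℕ.* k ℕ.+ k) ℕ.+ (l ℕ.* l ℕ.+ l)) ℕ.+ 2
      lem = ℕ-Solver.solve-∀
      lem′ : ∀ m k → 2 ℕ.* m ℕ.* (2 ℕ.* m) ℕ.* (suc (2 ℕ.* k) ℕ.* suc (2 ℕ.* k)) ≡ 4 ℕ.* (m ℕ.* m ℕ.* (suc (2 ℕ.* k) ℕ.* suc (2 ℕ.* k)))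
      lem′ = ℕ-Solver.solve-∀
    ... | inj₁ (k , refl) | inj₂ (l , refl) = 4∤1 (suc (2 ℕ.* i) ℕ.* suc (2 ℕ.* i) ℕ.* (k ℕ.* k) ℕ.+ (l ℕ.* l ℕ.+ l)) (m ℕ.* m ℕ.* (2 ℕ.* k ℕ.* (2 ℕ.* k))) (trans (sym (lem i k l)) (trans eq (lem′ m k)))
      where
      lem : ∀ i k l → suc (2 ℕ.* i) ℕ.* suc (2 ℕ.* i) ℕ.* (2 ℕ.* k ℕ.* (2 ℕ.* k)) ℕ.+ suc (2 ℕ.* l) ℕ.* suc (2 ℕ.* l) ≡
        4 ℕ.* (suc (2 ℕ.* i) ℕ.* suc (2 ℕ.* i) ℕ.* (k ℕ.* k) ℕ.+ (l ℕ.* l ℕ.+ l)) ℕ.+ 1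
      lem = ℕ-Solver.solve-∀
      lem′ : ∀ m k → 2 ℕ.* m ℕ.* (2 ℕ.* m) ℕ.* (2 ℕ.* k ℕ.* (2 ℕ.* k)) ≡ 4 ℕ.* (m ℕ.* m ℕ.* (2 ℕ.* k ℕ.* (2 ℕ.* k)))
      lem′ = ℕ-Solver.solve-∀
    -- If e and y are both even, halving them gives a smaller solution: infinite descent. The other
    -- parities contradict residues modulo 4.
    ... | inj₁ (k , refl) | inj₁ (l , refl) = rec {k} k<2k k≢0 l (ℕ.*-cancelˡ-≡ (suc (2 ℕ.* i) ℕ.* suc (2 ℕ.* i) ℕ.* (k ℕ.* k) ℕ.+ l ℕ.* l) (2 ℕ.* m ℕ.* (2 ℕ.* m) ℕ.* (k ℕ.* k)) 4 (trans (sym (lem i k l)) (trans eq (lem′ m k))))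
      where
      k≢0 : k ≢ 0
      k≢0 refl = e≢0 refl
      k<2k : k ℕ.< 2 ℕ.* k
      k<2k = subst (k ℕ.<_) (cong (k ℕ.+_) (sym (ℕ.+-identityʳ k))) (ℕ.m<m+n k (ℕ.n≢0⇒n>0 k≢0))
      lem : ∀ i k l → suc (2 ℕ.* i) ℕ.* suc (2 ℕ.* i) ℕ.* (2 ℕ.* k ℕ.* (2 ℕ.* k)) ℕ.+ 2 ℕ.* l ℕ.* (2 ℕ.* l) ≡
        4 ℕ.* (suc (2 ℕ.* i) ℕ.* suc (2 ℕ.* i) ℕ.* (k ℕ.* k) ℕ.+ l ℕ.* l)
      lem = ℕ-Solver.solve-∀
      lem′ : ∀ m k → 2 ℕ.* m ℕ.* (2 ℕ.* m) ℕ.* (2 ℕ.* k ℕ.* (2 ℕ.* k)) ≡ 4 ℕ.* (2 ℕ.* m ℕ.* (2 ℕ.* m) ℕ.* (k ℕ.* k))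
      lem′ = ℕ-Solver.solve-∀

  fromℤ-² : ∀ z → fromℤ z * fromℤ z ≡ fromℕ (ℤ.∣ z ∣ ℕ.* ℤ.∣ z ∣)
  fromℤ-² (ℤ.+ n)      = sym (fromℕ-* n n)
  fromℤ-² (ℤ.-[1+ n ]) = trans (eq (fromℕ (suc n))) (sym (fromℕ-* (suc n) (suc n)))
    where
    eq : ∀ x → (- x) * (- x) ≡ x * x
    eq = solve-∀ ℚ-ring

  fromℕ-injective : ∀ {m n} → fromℕ m ≡ fromℕ n → m ≡ n
  fromℕ-injective eq = ℕ.≤-antisym (fromℕ-cancel-≤ (ℚ.≤-reflexive eq)) (fromℕ-cancel-≤ (ℚ.≤-reflexive (sym eq)))

  numerator-eq : ∀ p → p * fromℕ (ℚ.↧ₙ p) ≡ fromℤ (ℚ.↥ p)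
  numerator-eq p = trans (cong (_* fromℕ (ℚ.↧ₙ p)) (sym (ℚ.↥p/↧p≡p p))) (/-*-fromℕ (ℚ.↥ p) (ℚ.denominator-1 p))

  coprime-^ : ∀ {d a} → Coprime d a → ∀ n x → d ∣ a ℕ.^ n ℕ.* x → d ∣ x
  coprime-^ {d} {a} co zero    x d∣ = subst (d ∣_) (ℕ.+-identityʳ x) d∣
  coprime-^ {d} {a} co (suc n) x d∣ = coprime-^ co n x
    (Coprime.coprime-divisor co (subst (d ∣_) (ℕ.*-assoc a (a ℕ.^ n) x) d∣))

  lowest-terms : ∀ p → Coprime ℤ.∣ ℚ.↥ p ∣ (ℚ.↧ₙ p)
  lowest-terms (ℚ.mkℚ _ _ isCoprime) = Coprime.recompute isCoprime

  module Rotation (p q : ℚ) (unit : p * p + q * q ≡ 1ℚ) where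

    -- Real and imaginary part of (p + q i)ⁿ.
    c s : ℕ → ℚ
    c zero    = 1ℚ
    c (suc n) = c n * p - s n * q
    s zero    = 0ℚ
    s (suc n) = s n * p + c n * q

    c²+s² : ∀ n → c n * c n + s n * s n ≡ 1ℚ
    c²+s² zero    = refl
    c²+s² (suc n) = trans (eq (c n) (s n) p q) (trans (cong₂ _*_ (c²+s² n) unit) refl)
      where
      eq : ∀ c s p q → (c * p - s * q) * (c * p - s * q) + (s * p + c * q) * (s * p + c * q) ≡ (c * c + s * s) * (p * p + q * q)
      eq = solve-∀ ℚ-ring

    c-recurrence : ∀ n → c (2 ℕ.+ n) ≡ 2ℚ * p * c (1 ℕ.+ n) - c n
    c-recurrence n = trans (eq (c n) (s n) p q) (trans (cong (λ u → 2ℚ * p * c (1 ℕ.+ n) - u * c n) unit) (eq′ (2ℚ * p * c (1 ℕ.+ n)) (c n)))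
      where
      eq : ∀ c s p q → (c * p - s * q) * p - (s * p + c * q) * q ≡ 2ℚ * p * (c * p - s * q) - (p * p + q * q) * c
      eq = solve-∀ ℚ-ring
      eq′ : ∀ a c → a - 1ℚ * c ≡ a - c
      eq′ = solve-∀ ℚ-ring

    c≤1 : ∀ n → c n ≤ 1ℚ
    c≤1 n = [ (λ c≤1 → c≤1) , (λ 1≤c → ≤-from (square≥0 (s n) ⊕ square≥0 (c n - 1ℚ) ⊕ ≤⇒0≤- 1≤c)
        (trans (eq (c n) (s n)) (trans (cong (λ u → s n * s n + (c n - 1ℚ) * (c n - 1ℚ) + (c n - 1ℚ) + (1ℚ - u)) (c²+s² n))
          (eq′ (s n * s n + (c n - 1ℚ) * (c n - 1ℚ) + (c n - 1ℚ)))))) ]′ (ℚ.≤-total (c n) 1ℚ)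
      where
      eq′ : ∀ x → x + (1ℚ - 1ℚ) ≡ x
      eq′ = solve-∀ ℚ-ring
      eq : ∀ c s → 1ℚ - c ≡ s * s + (c - 1ℚ) * (c - 1ℚ) + (c - 1ℚ) + (1ℚ - (c * c + s * s))
      eq = solve-∀ ℚ-ring

    -- Write p = a/d in lowest terms. For n ≥ 1 the integer dⁿ `c n` is congruent to a (2a)ⁿ⁻¹
    -- modulo d, so `c n` = 1 forces d to divide aⁿ 2ⁿ⁻¹, hence 2ⁿ⁻¹. But d is odd, so d = 1 and p
    -- is an integer, against p ≠ 0 and q ≠ 0.
    module NotRootOfUnity (p≢0 : p ≢ 0ℚ) (q≢0 : q ≢ 0ℚ) where

      private
        a : ℤ
        a = ℚ.↥ p
        d : ℕ
        d = ℚ.↧ₙ p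
        D : ℚ
        D = fromℕ d

        coprime : Coprime d ℤ.∣ a ∣
        coprime = Coprime.sym (lowest-terms p)

        A : ℕ → ℤ
        A zero          = ℤ.1ℤ
        A (suc zero)    = a
        A (suc (suc n)) = ℤ.+ 2 ℤ.* a ℤ.* A (suc n) ℤ.- ℤ.+ d ℤ.* (ℤ.+ d ℤ.* A n)

        D^ : ℕ → ℚ
        D^ zero    = 1ℚ
        D^ (suc n) = D * D^ n

        A≡ : ∀ n → fromℤ (A n) ≡ D^ n * c n
        A≡ zero          = refl
        A≡ (suc zero)    = trans (sym (numerator-eq p)) (eq p q D)
          where
          eq : ∀ p q d → p * d ≡ d * 1ℚ * (1ℚ * p - 0ℚ * q)
          eq = solve-∀ ℚ-ring
        A≡ (suc (suc n)) = begin
          fromℤ (ℤ.+ 2 ℤ.* a ℤ.* A (suc n) ℤ.- ℤ.+ d ℤ.* (ℤ.+ d ℤ.* A n))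
            ≡⟨ fromℤ-- (ℤ.+ 2 ℤ.* a ℤ.* A (suc n)) (ℤ.+ d ℤ.* (ℤ.+ d ℤ.* A n)) ⟩
          fromℤ (ℤ.+ 2 ℤ.* a ℤ.* A (suc n)) - fromℤ (ℤ.+ d ℤ.* (ℤ.+ d ℤ.* A n))
            ≡⟨ cong₂ _-_ (trans (fromℤ-* (ℤ.+ 2 ℤ.* a) (A (suc n))) (cong₂ _*_ (fromℤ-* (ℤ.+ 2) a) (A≡ (suc n))))
                 (trans (fromℤ-* (ℤ.+ d) (ℤ.+ d ℤ.* A n)) (cong (D *_) (trans (fromℤ-* (ℤ.+ d) (A n)) (cong (D *_) (A≡ n))))) ⟩
          2ℚ * fromℤ a * (D^ (suc n) * c (suc n)) - D * (D * (D^ n * c n))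
            ≡⟨ cong (λ z → 2ℚ * z * (D^ (suc n) * c (suc n)) - D * (D * (D^ n * c n))) (sym (numerator-eq p)) ⟩
          2ℚ * (p * D) * (D^ (suc n) * c (suc n)) - D * (D * (D^ n * c n))
            ≡⟨ eq p D (D^ n) (c (suc n)) (c n) ⟩
          D^ (suc (suc n)) * (2ℚ * p * c (suc n) - c n)
            ≡⟨ cong (D^ (suc (suc n)) *_) (sym (c-recurrence n)) ⟩
          D^ (suc (suc n)) * c (suc (suc n)) ∎
          where
          open ≡-Reasoning
          eq : ∀ p d e x y → 2ℚ * (p * d) * (d * e * x) - d * (d * (e * y)) ≡ d * (d * e) * (2ℚ * p * x - y)
          eq = solve-∀ ℚ-ring

        D^≡ : ∀ n → D^ n ≡ fromℤ (ℤ.+ (d ℕ.^ n))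
        D^≡ zero    = refl
        D^≡ (suc n) = trans (cong (D *_) (D^≡ n)) (sym (fromℕ-* d (d ℕ.^ n)))

        B : ℕ → ℤ
        B zero    = a
        B (suc n) = ℤ.+ 2 ℤ.* a ℤ.* B n

        A-mod : ∀ n → ∃ λ k → A (suc n) ≡ B n ℤ.+ ℤ.+ d ℤ.* k
        A-mod zero    = ℤ.0ℤ , trans (sym (ℤ.+-identityʳ a)) (cong (λ z → a ℤ.+ z) (sym (ℤ.*-zeroʳ (ℤ.+ d))))
        A-mod (suc n) = let k , eq = A-mod n in
          ℤ.+ 2 ℤ.* a ℤ.* k ℤ.- ℤ.+ d ℤ.* A n ,
          trans (cong (λ z → ℤ.+ 2 ℤ.* a ℤ.* z ℤ.- ℤ.+ d ℤ.* (ℤ.+ d ℤ.* A n)) eq) (lem (ℤ.+ 2 ℤ.* a) (B n) (ℤ.+ d) k (A n))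
          where
          lem : ∀ a b d k x → a ℤ.* (b ℤ.+ d ℤ.* k) ℤ.- d ℤ.* (d ℤ.* x) ≡ a ℤ.* b ℤ.+ d ℤ.* (a ℤ.* k ℤ.- d ℤ.* x)
          lem = ℤ-Solver.solve-∀

        ∣B∣ : ∀ n → ℤ.∣ B n ∣ ≡ ℤ.∣ a ∣ ℕ.^ suc n ℕ.* 2 ℕ.^ n
        ∣B∣ zero    = trans (sym (ℕ.*-identityʳ ℤ.∣ a ∣)) (sym (trans (ℕ.*-identityʳ (ℤ.∣ a ∣ ℕ.* 1)) refl))
        ∣B∣ (suc n) = trans (ℤ.∣i*j∣≡∣i∣*∣j∣ (ℤ.+ 2 ℤ.* a) (B n))
          (trans (cong₂ ℕ._*_ (ℤ.∣i*j∣≡∣i∣*∣j∣ (ℤ.+ 2) a) (∣B∣ n)) (lem ℤ.∣ a ∣ (ℤ.∣ a ∣ ℕ.^ suc n) (2 ℕ.^ n)))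
          where
          lem : ∀ a b c → 2 ℕ.* a ℕ.* (b ℕ.* c) ≡ a ℕ.* b ℕ.* (2 ℕ.* c)
          lem = ℕ-Solver.solve-∀

        d∣2^ : ∀ n → c (suc n) ≡ 1ℚ → d ∣ 2 ℕ.^ n
        d∣2^ n c≡1 = coprime-^ coprime (suc n) (2 ℕ.^ n) (subst (d ∣_) (∣B∣ n) d∣B)
          where
          k = proj₁ (A-mod n)
          A≡d^ : A (suc n) ≡ ℤ.+ d ℤ.* ℤ.+ (d ℕ.^ n)
          A≡d^ = fromℤ-injective (trans (A≡ (suc n)) (trans (cong (D^ (suc n) *_) c≡1) (trans (ℚ.*-identityʳ (D^ (suc n)))
            (trans (cong (D *_) (D^≡ n)) (sym (fromℤ-* (ℤ.+ d) (ℤ.+ (d ℕ.^ n))))))))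
          lem : ∀ b d k → b ≡ (b ℤ.+ d ℤ.* k) ℤ.- d ℤ.* k
          lem = ℤ-Solver.solve-∀
          lem′ : ∀ d e k → d ℤ.* e ℤ.- d ℤ.* k ≡ (e ℤ.- k) ℤ.* d
          lem′ = ℤ-Solver.solve-∀
          d∣B : d ∣ ℤ.∣ B n ∣
          d∣B = divides ℤ.∣ ℤ.+ (d ℕ.^ n) ℤ.- k ∣ (trans (cong ℤ.∣_∣ (trans (lem (B n) (ℤ.+ d) k)
            (trans (cong (λ z → z ℤ.- ℤ.+ d ℤ.* k) (trans (sym (proj₂ (A-mod n))) A≡d^)) (lem′ (ℤ.+ d) (ℤ.+ (d ℕ.^ n)) k))))
            (ℤ.∣i*j∣≡∣i∣*∣j∣ (ℤ.+ (d ℕ.^ n) ℤ.- k) (ℤ.+ d)))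

        pythagorean : let e = ℚ.↧ₙ q in
          ℤ.∣ a ∣ ℕ.* ℤ.∣ a ∣ ℕ.* (e ℕ.* e) ℕ.+ (ℤ.∣ ℚ.↥ q ∣ ℕ.* d) ℕ.* (ℤ.∣ ℚ.↥ q ∣ ℕ.* d) ≡ d ℕ.* d ℕ.* (e ℕ.* e)
        pythagorean = fromℕ-injective (begin
          fromℕ (x ℕ.* x ℕ.* (e ℕ.* e) ℕ.+ (b ℕ.* d) ℕ.* (b ℕ.* d))
            ≡⟨ trans (fromℕ-+ (x ℕ.* x ℕ.* (e ℕ.* e)) ((b ℕ.* d) ℕ.* (b ℕ.* d))) (cong₂ _+_
                 (trans (fromℕ-* (x ℕ.* x) (e ℕ.* e)) (cong₂ _*_ (trans (sym (fromℤ-² a)) (cong (λ z → z * z) (sym (numerator-eq p)))) (fromℕ-* e e)))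
                 (trans (cong fromℕ (lem b d)) (trans (fromℕ-* (b ℕ.* b) (d ℕ.* d)) (cong₂ _*_ (trans (sym (fromℤ-² (ℚ.↥ q))) (cong (λ z → z * z) (sym (numerator-eq q)))) (fromℕ-* d d))))) ⟩
          (p * D) * (p * D) * (E * E) + (q * E) * (q * E) * (D * D)
            ≡⟨ eq p q D E ⟩
          (p * p + q * q) * (D * D * (E * E))
            ≡⟨ trans (cong (_* (D * D * (E * E))) unit) (ℚ.*-identityˡ (D * D * (E * E))) ⟩
          D * D * (E * E)
            ≡⟨ sym (trans (fromℕ-* (d ℕ.* d) (e ℕ.* e)) (cong₂ _*_ (fromℕ-* d d) (fromℕ-* e e))) ⟩
          fromℕ (d ℕ.* d ℕ.* (e ℕ.* e)) ∎)
          where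
          open ≡-Reasoning
          e = ℚ.↧ₙ q
          E = fromℕ e
          x = ℤ.∣ a ∣
          b = ℤ.∣ ℚ.↥ q ∣
          eq : ∀ p q d e → (p * d) * (p * d) * (e * e) + (q * e) * (q * e) * (d * d) ≡ (p * p + q * q) * (d * d * (e * e))
          eq = solve-∀ ℚ-ring
          lem : ∀ b d → (b ℕ.* d) ℕ.* (b ℕ.* d) ≡ (b ℕ.* b) ℕ.* (d ℕ.* d)
          lem = ℕ-Solver.solve-∀

        -- If d were even, a would be odd by coprimality, and clearing denominators in p² + q² = 1
        -- would make d² - a² the square of a rational.
        d-odd : ∀ m → d ≢ 2 ℕ.* m
        d-odd m d≡2m = [ (λ { (i , ∣a∣≡) → ℕ.1+n≢n (coprime {2} (divides m (trans d≡2m (ℕ.*-comm 2 m)) , divides i (trans ∣a∣≡ (ℕ.*-comm 2 i)))) })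
          , (λ { (i , ∣a∣≡) → no-even-hypotenuse i m (ℚ.↧ₙ q) ℕ.1+n≢0 (ℤ.∣ ℚ.↥ q ∣ ℕ.* d)
              (subst₂ (λ x y → x ℕ.* x ℕ.* (ℚ.↧ₙ q ℕ.* ℚ.↧ₙ q) ℕ.+ (ℤ.∣ ℚ.↥ q ∣ ℕ.* d) ℕ.* (ℤ.∣ ℚ.↥ q ∣ ℕ.* d) ≡ y ℕ.* y ℕ.* (ℚ.↧ₙ q ℕ.* ℚ.↧ₙ q)) ∣a∣≡ d≡2m pythagorean) }) ]′ (parity ℤ.∣ a ∣)

        d≢1 : d ≢ 1
        d≢1 d≡1 = q≢0 (q²≡0 q (trans (lem p q) (trans (cong₂ _-_ unit p²≡1) refl)))
          where
          lem : ∀ p q → q * q ≡ (p * p + q * q) - p * p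
          lem = solve-∀ ℚ-ring
          p≡a : p ≡ fromℤ a
          p≡a = trans (lem₁ p) (trans (cong (λ n → p * fromℕ n) (sym d≡1)) (numerator-eq p))
            where
            lem₁ : ∀ p → p ≡ p * (1ℚ + 0ℚ)
            lem₁ = solve-∀ ℚ-ring
          p²≡ : p * p ≡ fromℕ (ℤ.∣ a ∣ ℕ.* ℤ.∣ a ∣)
          p²≡ = trans (cong (λ z → z * z) p≡a) (fromℤ-² a)
          p²≤1 : p * p ≤ 1ℚ
          p²≤1 = ≤-from (square≥0 q) (trans (cong (λ z → z - p * p) (sym unit)) (lem₂ p q))
            where
            lem₂ : ∀ p q → (p * p + q * q) - p * p ≡ q * q
            lem₂ = solve-∀ ℚ-ring
          a²≤1 : ℤ.∣ a ∣ ℕ.* ℤ.∣ a ∣ ℕ.≤ 1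
          a²≤1 = fromℕ-cancel-≤ {n = 1} (subst (_≤ 1ℚ) p²≡ p²≤1)
          small : ∀ n → n ℕ.* n ℕ.≤ 1 → n ≡ 0 ⊎ n ≡ 1
          small zero          _ = inj₁ refl
          small (suc zero)    _ = inj₂ refl
          small (suc (suc n)) (ℕ.s≤s ())
          p²≡1 : p * p ≡ 1ℚ
          p²≡1 = [ (λ a≡0 → ⊥-elim (p≢0 (trans p≡a (cong fromℤ (ℤ.∣i∣≡0⇒i≡0 {a} a≡0))))) , (λ a≡1 → trans p²≡ (cong (λ n → fromℕ (n ℕ.* n)) a≡1)) ]′ (small ℤ.∣ a ∣ a²≤1)
          q²≡0 : ∀ q → q * q ≡ 0ℚ → q ≡ 0ℚ
          q²≡0 q eq = [ (λ 0≤q → ℚ.≤-antisym (ℚ.≮⇒≥ (λ 0<q → ℚ.<-irrefl (sym eq) (0<q ⊗⁺ 0<q))) 0≤q)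
            , (λ q≤0 → ℚ.≤-antisym q≤0 (ℚ.≮⇒≥ (λ q<0 → ℚ.<-irrefl (sym (trans (sym (lem₃ q)) eq)) (ℚ.neg-antimono-< q<0 ⊗⁺ ℚ.neg-antimono-< q<0)))) ]′ (ℚ.≤-total 0ℚ q)
            where
            lem₃ : ∀ q → q * q ≡ (- q) * (- q)
            lem₃ = solve-∀ ℚ-ring

      c≢1 : ∀ n → c (suc n) ≢ 1ℚ
      c≢1 n c≡1 = [ (λ { (m , eq) → d-odd m eq }) , (λ { (m , eq) → d≢1 (odd m eq) }) ]′ (parity d)
        where
        odd : ∀ m → d ≡ suc (2 ℕ.* m) → d ≡ 1
        odd m eq = ℕ.∣1⇒≡1 (coprime-^ co n 1 (subst (d ∣_) (sym (ℕ.*-identityʳ (2 ℕ.^ n))) (d∣2^ n c≡1)))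
          where
          1-common : ∀ {i} → i ∣ d → i ∣ 2 → i ≡ 1
          1-common {i} i∣d i∣2 = ℕ.∣1⇒≡1 (ℕ.∣m+n∣m⇒∣n (subst (i ∣_) (trans eq (sym (ℕ.+-comm (2 ℕ.* m) 1))) i∣d) (ℕ.∣m⇒∣m*n m i∣2))
          co : Coprime d 2
          co (i∣d , i∣2) = 1-common i∣d i∣2

      c<1 : ∀ n → c (suc n) < 1ℚ
      c<1 n = ℚ.≰⇒> (λ 1≤c → c≢1 n (ℚ.≤-antisym (c≤1 (suc n)) 1≤c))

-- The integer recurrences of order 6, and what the oracle decides about them.

module Sequences where

  open Rationals
  open Recursive
  open Rotations
  open import Data.Fin.Base using (Fin; zero; suc; toℕ; opposite)
  open import Data.Vec.Base using (Vec; []; _∷_; _++_)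
  open import Algebra.Definitions.RawMonoid ℤ.+-0-rawMonoid using (sum)
  import Data.Integer.Tactic.RingSolver as ℤ-Solver
  open import Data.Rational.Base using (_+_; _-_; _*_; -_; _≤_; _<_)

  -- At most one of the two truncated differences is nonzero, so the codes can be added: 2k for k ≥
  -- 0 and 2k - 1 for -k, where truncation turns the case k = 0 into 0.
  code-⊖ : ∀ m n → ⌜ m ⊖ n ⌝ ≡ 2 ℕ.* (m ℕ.∸ n) ℕ.+ (2 ℕ.* (n ℕ.∸ m) ℕ.∸ 1)
  code-⊖ zero    zero    = refl
  code-⊖ zero    (suc n) = sym (ℕ.+-suc n (n ℕ.+ 0))
  code-⊖ (suc m) zero    = sym (ℕ.+-identityʳ (2 ℕ.* suc m))
  code-⊖ (suc m) (suc n) = trans (cong ⌜_⌝ (ℤ.[1+m]⊖[1+n]≡m⊖n m n)) (code-⊖ m n)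

  codeᶜ : ∀ {n} {f g : Vec ℕ n → ℕ} → Computable f → Computable g → Computable (λ xs → ⌜ f xs ⊖ g xs ⌝)
  codeᶜ {f = f} {g} cf cg = cast (λ xs → sym (code-⊖ (f xs) (g xs)))
    (const 2 *ᶜ (cf ∸ᶜ cg) +ᶜ (const 2 *ᶜ (cg ∸ᶜ cf) ∸ᶜ const 1))

  private
    pos neg : ℤ → ℕ
    pos (ℤ.+ n)    = n
    pos (-[1+ n ]) = 0
    neg (ℤ.+ n)    = 0
    neg (-[1+ n ]) = suc n

    pos-neg : ∀ z → z ≡ ℤ.+ pos z ℤ.- ℤ.+ neg z
    pos-neg (ℤ.+ n)    = sym (ℤ.+-identityʳ (ℤ.+ n))
    pos-neg (-[1+ n ]) = refl

  linear : ℤ → ℤ → ℕ → ℕ → ℤ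
  linear x y S R = ℤ.+ S ℤ.* x ℤ.+ ℤ.+ R ℤ.* y

  -- Splitting the fixed integers into positive and negative parts keeps the arithmetic within ℕ;
  -- only the two multipliers vary.
  linearᶜ : ∀ {n} {f g : Vec ℕ n → ℕ} x y → Computable f → Computable g → Computable (λ xs → ⌜ linear x y (f xs) (g xs) ⌝)
  linearᶜ {f = f} {g} x y cf cg = cast (λ xs → cong ⌜_⌝ (eq (f xs) (g xs)))
    (codeᶜ (cf *ᶜ const (pos x) +ᶜ cg *ᶜ const (pos y)) (cf *ᶜ const (neg x) +ᶜ cg *ᶜ const (neg y)))
    where
    lem : ∀ S R a b c d → S ℤ.* a ℤ.+ R ℤ.* c ℤ.- (S ℤ.* b ℤ.+ R ℤ.* d) ≡ S ℤ.* (a ℤ.- b) ℤ.+ R ℤ.* (c ℤ.- d)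
    lem = ℤ-Solver.solve-∀
    cast-+* : ∀ S R a c → ℤ.+ (S ℕ.* a ℕ.+ R ℕ.* c) ≡ ℤ.+ S ℤ.* ℤ.+ a ℤ.+ ℤ.+ R ℤ.* ℤ.+ c
    cast-+* S R a c = trans (ℤ.pos-+ (S ℕ.* a) (R ℕ.* c)) (cong₂ ℤ._+_ (ℤ.pos-* S a) (ℤ.pos-* R c))
    eq : ∀ S R → (S ℕ.* pos x ℕ.+ R ℕ.* pos y) ⊖ (S ℕ.* neg x ℕ.+ R ℕ.* neg y) ≡ linear x y S R
    eq S R = trans (sym (ℤ.m-n≡m⊖n (S ℕ.* pos x ℕ.+ R ℕ.* pos y) (S ℕ.* neg x ℕ.+ R ℕ.* neg y)))
      (trans (cong₂ ℤ._-_ (cast-+* S R (pos x) (pos y)) (cast-+* S R (neg x) (neg y)))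
      (trans (lem (ℤ.+ S) (ℤ.+ R) (ℤ.+ pos x) (ℤ.+ neg x) (ℤ.+ pos y) (ℤ.+ neg y))
        (cong₂ (λ x y → ℤ.+ S ℤ.* x ℤ.+ ℤ.+ R ℤ.* y) (sym (pos-neg x)) (sym (pos-neg y)))))

  private
    step₆ : (Fin 6 → ℤ) → ℤ → ℤ → ℤ → ℤ → ℤ → ℤ → ℤ
    step₆ κ x₅ x₄ x₃ x₂ x₁ x₀ = κ zero ℤ.* x₅ ℤ.+ (κ (suc zero) ℤ.* x₄ ℤ.+ (κ (suc (suc zero)) ℤ.* x₃
      ℤ.+ (κ (suc (suc (suc zero))) ℤ.* x₂ ℤ.+ (κ (suc (suc (suc (suc zero)))) ℤ.* x₁
      ℤ.+ (κ (suc (suc (suc (suc (suc zero))))) ℤ.* x₀ ℤ.+ 0ℤ)))))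

    recurrence₆ : (κ : Fin 6 → ℤ) (u : ℕ → ℤ) →
      (∀ n → u (6 ℕ.+ n) ≡ step₆ κ (u (5 ℕ.+ n)) (u (4 ℕ.+ n)) (u (3 ℕ.+ n)) (u (2 ℕ.+ n)) (u (1 ℕ.+ n)) (u n)) →
      ∀ n → u (n ℕ.+ 6) ≡ sum (λ i → κ i ℤ.* u (n ℕ.+ toℕ (opposite i)))
    recurrence₆ κ u rec n
      rewrite ℕ.+-comm n 6 | ℕ.+-comm n 5 | ℕ.+-comm n 4 | ℕ.+-comm n 3 | ℕ.+-comm n 2 | ℕ.+-comm n 1 | ℕ.+-comm n 0 = rec n

  ++-⇓ : ∀ {n k l} {xs : Vec ℕ n} {rs : Vec (Rec n) k} {ys ts zs} → rs [ xs ]⇓* ys → ts [ xs ]⇓* zs →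
    _[_]⇓*_ {m = k ℕ.+ l} (rs ++ ts) xs (ys ++ zs)
  ++-⇓ []       ts = ts
  ++-⇓ (r ∷ rs) ts = r ∷ ++-⇓ rs ts

  -- The characteristic polynomial is (x − d)² (x² − 2 a x + d²)².
  module Recurrence (a b : ℤ) (d : ℕ) (d≢0 : d ≢ 0) (norm : a ℤ.* a ℤ.+ b ℤ.* b ≡ ℤ.+ d ℤ.* ℤ.+ d) where

    private
      δ e : ℤ
      δ = ℤ.+ d
      e = δ ℤ.* δ

    A B : ℕ → ℤ
    A zero    = ℤ.1ℤ
    A (suc n) = A n ℤ.* a ℤ.- B n ℤ.* b
    B zero    = ℤ.0ℤ
    B (suc n) = B n ℤ.* a ℤ.+ A n ℤ.* b

    power : ℕ → ℤ
    power zero    = ℤ.1ℤ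
    power (suc n) = δ ℤ.* power n

    coefficient : Fin 6 → ℤ
    coefficient zero                               = ℤ.+ 4 ℤ.* a ℤ.+ ℤ.+ 2 ℤ.* δ
    coefficient (suc zero)                         = ℤ.- (ℤ.+ 4 ℤ.* a ℤ.* a ℤ.+ ℤ.+ 3 ℤ.* e ℤ.+ ℤ.+ 8 ℤ.* a ℤ.* δ)
    coefficient (suc (suc zero))                   = ℤ.+ 8 ℤ.* a ℤ.* e ℤ.+ ℤ.+ 8 ℤ.* a ℤ.* a ℤ.* δ ℤ.+ ℤ.+ 4 ℤ.* δ ℤ.* e
    coefficient (suc (suc (suc zero)))             = ℤ.- (ℤ.+ 3 ℤ.* e ℤ.* e ℤ.+ ℤ.+ 8 ℤ.* a ℤ.* δ ℤ.* e ℤ.+ ℤ.+ 4 ℤ.* a ℤ.* a ℤ.* e)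
    coefficient (suc (suc (suc (suc zero))))       = ℤ.+ 2 ℤ.* δ ℤ.* e ℤ.* e ℤ.+ ℤ.+ 4 ℤ.* a ℤ.* e ℤ.* e
    coefficient (suc (suc (suc (suc (suc zero))))) = ℤ.- (e ℤ.* e ℤ.* e)

    private
      κ : Fin 6 → ℤ
      κ = coefficient

      step : ℤ → ℤ → ℤ → ℤ → ℤ → ℤ → ℤ
      step = step₆ κ

      Satisfies : (ℕ → ℤ) → Set
      Satisfies x = ∀ n → x (6 ℕ.+ n) ≡ step (x (5 ℕ.+ n)) (x (4 ℕ.+ n)) (x (3 ℕ.+ n)) (x (2 ℕ.+ n)) (x (1 ℕ.+ n)) (x n)

      double-root : (x : ℕ → ℤ) → (∀ n → x (2 ℕ.+ n) ≡ ℤ.+ 2 ℤ.* δ ℤ.* x (1 ℕ.+ n) ℤ.- e ℤ.* x n) → Satisfies x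
      double-root x rec n
        rewrite rec (4 ℕ.+ n) | rec (3 ℕ.+ n) | rec (2 ℕ.+ n) | rec (1 ℕ.+ n) | rec n = lem a δ (x (1 ℕ.+ n)) (x n)
        where
        lem : ∀ a δ x₁ x₀ → let e  = δ ℤ.* δ
                                x₂ = ℤ.+ 2 ℤ.* δ ℤ.* x₁ ℤ.- e ℤ.* x₀
                                x₃ = ℤ.+ 2 ℤ.* δ ℤ.* x₂ ℤ.- e ℤ.* x₁
                                x₄ = ℤ.+ 2 ℤ.* δ ℤ.* x₃ ℤ.- e ℤ.* x₂
                                x₅ = ℤ.+ 2 ℤ.* δ ℤ.* x₄ ℤ.- e ℤ.* x₃ in
          ℤ.+ 2 ℤ.* δ ℤ.* x₅ ℤ.- e ℤ.* x₄ ≡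
          (ℤ.+ 4 ℤ.* a ℤ.+ ℤ.+ 2 ℤ.* δ) ℤ.* x₅ ℤ.+ (ℤ.- (ℤ.+ 4 ℤ.* a ℤ.* a ℤ.+ ℤ.+ 3 ℤ.* e ℤ.+ ℤ.+ 8 ℤ.* a ℤ.* δ) ℤ.* x₄
            ℤ.+ ((ℤ.+ 8 ℤ.* a ℤ.* e ℤ.+ ℤ.+ 8 ℤ.* a ℤ.* a ℤ.* δ ℤ.+ ℤ.+ 4 ℤ.* δ ℤ.* e) ℤ.* x₃
            ℤ.+ (ℤ.- (ℤ.+ 3 ℤ.* e ℤ.* e ℤ.+ ℤ.+ 8 ℤ.* a ℤ.* δ ℤ.* e ℤ.+ ℤ.+ 4 ℤ.* a ℤ.* a ℤ.* e) ℤ.* x₂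
            ℤ.+ ((ℤ.+ 2 ℤ.* δ ℤ.* e ℤ.* e ℤ.+ ℤ.+ 4 ℤ.* a ℤ.* e ℤ.* e) ℤ.* x₁ ℤ.+ (ℤ.- (e ℤ.* e ℤ.* e) ℤ.* x₀ ℤ.+ 0ℤ)))))
        lem = ℤ-Solver.solve-∀

      -- With E the shift, y is (E² - 2aE + e) x and is killed by the same operator, so x is killed
      -- by its square; `lem` writes the defect of the order-6 recurrence as (E - δ)² applied to
      -- that square.
      double-roots : (x y : ℕ → ℤ) → (∀ n → y (2 ℕ.+ n) ≡ ℤ.+ 2 ℤ.* a ℤ.* y (1 ℕ.+ n) ℤ.- e ℤ.* y n) →
        (∀ n → x (2 ℕ.+ n) ≡ ℤ.+ 2 ℤ.* a ℤ.* x (1 ℕ.+ n) ℤ.- e ℤ.* x n ℤ.+ y n) → Satisfies x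
      double-roots x y rec-y rec n = trans
        (lem a δ (x n) (x (1 ℕ.+ n)) (x (2 ℕ.+ n)) (x (3 ℕ.+ n)) (x (4 ℕ.+ n)) (x (5 ℕ.+ n)) (x (6 ℕ.+ n)))
        (trans (cong (λ r → step (x (5 ℕ.+ n)) (x (4 ℕ.+ n)) (x (3 ℕ.+ n)) (x (2 ℕ.+ n)) (x (1 ℕ.+ n)) (x n) ℤ.+ r)
          (cong₂ ℤ._+_ (cong₂ ℤ._-_ (vanish (2 ℕ.+ n)) (cong (ℤ.+ 2 ℤ.* δ ℤ.*_) (vanish (1 ℕ.+ n)))) (cong (e ℤ.*_) (vanish n))))
          (lem₃ (step (x (5 ℕ.+ n)) (x (4 ℕ.+ n)) (x (3 ℕ.+ n)) (x (2 ℕ.+ n)) (x (1 ℕ.+ n)) (x n)) δ e))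
        where
        z : ℕ → ℤ
        z n = x (2 ℕ.+ n) ℤ.- (ℤ.+ 2 ℤ.* a ℤ.* x (1 ℕ.+ n) ℤ.- e ℤ.* x n)
        lem₁ : ∀ a e x₁ x₀ y → (ℤ.+ 2 ℤ.* a ℤ.* x₁ ℤ.- e ℤ.* x₀ ℤ.+ y) ℤ.- (ℤ.+ 2 ℤ.* a ℤ.* x₁ ℤ.- e ℤ.* x₀) ≡ y
        lem₁ = ℤ-Solver.solve-∀
        lem₂ : ∀ a e y₁ y₀ → (ℤ.+ 2 ℤ.* a ℤ.* y₁ ℤ.- e ℤ.* y₀) ℤ.- ℤ.+ 2 ℤ.* a ℤ.* y₁ ℤ.+ e ℤ.* y₀ ≡ 0ℤ
        lem₂ = ℤ-Solver.solve-∀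
        lem₃ : ∀ s δ e → s ℤ.+ (0ℤ ℤ.- ℤ.+ 2 ℤ.* δ ℤ.* 0ℤ ℤ.+ e ℤ.* 0ℤ) ≡ s
        lem₃ = ℤ-Solver.solve-∀
        z≡y : ∀ n → z n ≡ y n
        z≡y n = trans (cong (ℤ._- (ℤ.+ 2 ℤ.* a ℤ.* x (1 ℕ.+ n) ℤ.- e ℤ.* x n)) (rec n)) (lem₁ a e (x (1 ℕ.+ n)) (x n) (y n))
        vanish : ∀ n → z (2 ℕ.+ n) ℤ.- ℤ.+ 2 ℤ.* a ℤ.* z (1 ℕ.+ n) ℤ.+ e ℤ.* z n ≡ 0ℤ
        vanish n = trans (cong₂ ℤ._+_ (cong₂ ℤ._-_ (trans (z≡y (2 ℕ.+ n)) (rec-y n)) (cong (ℤ.+ 2 ℤ.* a ℤ.*_) (z≡y (1 ℕ.+ n)))) (cong (e ℤ.*_) (z≡y n)))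
          (lem₂ a e (y (1 ℕ.+ n)) (y n))
        lem : ∀ a δ x₀ x₁ x₂ x₃ x₄ x₅ x₆ → let e  = δ ℤ.* δ
                                               z₀ = x₂ ℤ.- (ℤ.+ 2 ℤ.* a ℤ.* x₁ ℤ.- e ℤ.* x₀)
                                               z₁ = x₃ ℤ.- (ℤ.+ 2 ℤ.* a ℤ.* x₂ ℤ.- e ℤ.* x₁)
                                               z₂ = x₄ ℤ.- (ℤ.+ 2 ℤ.* a ℤ.* x₃ ℤ.- e ℤ.* x₂)
                                               z₃ = x₅ ℤ.- (ℤ.+ 2 ℤ.* a ℤ.* x₄ ℤ.- e ℤ.* x₃)
                                               z₄ = x₆ ℤ.- (ℤ.+ 2 ℤ.* a ℤ.* x₅ ℤ.- e ℤ.* x₄) in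
          x₆ ≡
          (ℤ.+ 4 ℤ.* a ℤ.+ ℤ.+ 2 ℤ.* δ) ℤ.* x₅ ℤ.+ (ℤ.- (ℤ.+ 4 ℤ.* a ℤ.* a ℤ.+ ℤ.+ 3 ℤ.* e ℤ.+ ℤ.+ 8 ℤ.* a ℤ.* δ) ℤ.* x₄
            ℤ.+ ((ℤ.+ 8 ℤ.* a ℤ.* e ℤ.+ ℤ.+ 8 ℤ.* a ℤ.* a ℤ.* δ ℤ.+ ℤ.+ 4 ℤ.* δ ℤ.* e) ℤ.* x₃
            ℤ.+ (ℤ.- (ℤ.+ 3 ℤ.* e ℤ.* e ℤ.+ ℤ.+ 8 ℤ.* a ℤ.* δ ℤ.* e ℤ.+ ℤ.+ 4 ℤ.* a ℤ.* a ℤ.* e) ℤ.* x₂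
            ℤ.+ ((ℤ.+ 2 ℤ.* δ ℤ.* e ℤ.* e ℤ.+ ℤ.+ 4 ℤ.* a ℤ.* e ℤ.* e) ℤ.* x₁ ℤ.+ (ℤ.- (e ℤ.* e ℤ.* e) ℤ.* x₀ ℤ.+ 0ℤ)))))
          ℤ.+ ((z₄ ℤ.- ℤ.+ 2 ℤ.* a ℤ.* z₃ ℤ.+ e ℤ.* z₂) ℤ.- ℤ.+ 2 ℤ.* δ ℤ.* (z₃ ℤ.- ℤ.+ 2 ℤ.* a ℤ.* z₂ ℤ.+ e ℤ.* z₁)
            ℤ.+ e ℤ.* (z₂ ℤ.- ℤ.+ 2 ℤ.* a ℤ.* z₁ ℤ.+ e ℤ.* z₀))
        lem = ℤ-Solver.solve-∀

      combination : (x y : ℕ → ℤ) (S R : ℤ) → Satisfies x → Satisfies y → Satisfies (λ n → S ℤ.* x n ℤ.+ R ℤ.* y n)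
      combination x y S R x-sat y-sat n = trans (cong₂ (λ x y → S ℤ.* x ℤ.+ R ℤ.* y) (x-sat n) (y-sat n))
        (add (κ zero) (add (κ (suc zero)) (add (κ (suc (suc zero))) (add (κ (suc (suc (suc zero))))
          (add (κ (suc (suc (suc (suc zero))))) (add (κ (suc (suc (suc (suc (suc zero)))))) (lem₀ S R)))))))
        where
        lem₀ : ∀ S R → S ℤ.* 0ℤ ℤ.+ R ℤ.* 0ℤ ≡ 0ℤ
        lem₀ = ℤ-Solver.solve-∀
        lem : ∀ k S R x y r t → S ℤ.* (k ℤ.* x ℤ.+ r) ℤ.+ R ℤ.* (k ℤ.* y ℤ.+ t) ≡ k ℤ.* (S ℤ.* x ℤ.+ R ℤ.* y) ℤ.+ (S ℤ.* r ℤ.+ R ℤ.* t)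
        lem = ℤ-Solver.solve-∀
        add : ∀ k {x y r t w} → S ℤ.* r ℤ.+ R ℤ.* t ≡ w →
          S ℤ.* (k ℤ.* x ℤ.+ r) ℤ.+ R ℤ.* (k ℤ.* y ℤ.+ t) ≡ k ℤ.* (S ℤ.* x ℤ.+ R ℤ.* y) ℤ.+ w
        add k {x} {y} {r} {t} eq = trans (lem k S R x y r t) (cong (λ w → k ℤ.* (S ℤ.* x ℤ.+ R ℤ.* y) ℤ.+ w) eq)

      A-rec : ∀ n → A (2 ℕ.+ n) ≡ ℤ.+ 2 ℤ.* a ℤ.* A (1 ℕ.+ n) ℤ.- e ℤ.* A n
      A-rec n = trans (lem a b (A n) (B n)) (cong (λ z → ℤ.+ 2 ℤ.* a ℤ.* A (1 ℕ.+ n) ℤ.- z ℤ.* A n) norm)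
        where
        lem : ∀ a b x y → (x ℤ.* a ℤ.- y ℤ.* b) ℤ.* a ℤ.- (y ℤ.* a ℤ.+ x ℤ.* b) ℤ.* b ≡
          ℤ.+ 2 ℤ.* a ℤ.* (x ℤ.* a ℤ.- y ℤ.* b) ℤ.- (a ℤ.* a ℤ.+ b ℤ.* b) ℤ.* x
        lem = ℤ-Solver.solve-∀

      B-rec : ∀ n → B (2 ℕ.+ n) ≡ ℤ.+ 2 ℤ.* a ℤ.* B (1 ℕ.+ n) ℤ.- e ℤ.* B n
      B-rec n = trans (lem a b (A n) (B n)) (cong (λ z → ℤ.+ 2 ℤ.* a ℤ.* B (1 ℕ.+ n) ℤ.- z ℤ.* B n) norm)
        where
        lem : ∀ a b x y → (y ℤ.* a ℤ.+ x ℤ.* b) ℤ.* a ℤ.+ (x ℤ.* a ℤ.- y ℤ.* b) ℤ.* b ≡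
          ℤ.+ 2 ℤ.* a ℤ.* (y ℤ.* a ℤ.+ x ℤ.* b) ℤ.- (a ℤ.* a ℤ.+ b ℤ.* b) ℤ.* y
        lem = ℤ-Solver.solve-∀

      nP nA : ℕ → ℤ
      nP n = ℤ.+ n ℤ.* power n
      nA n = ℤ.+ n ℤ.* A n

      nP-sat : Satisfies nP
      nP-sat = double-root nP (λ n → lem (ℤ.+ n) δ (power n))
        where
        lem : ∀ n δ p → (ℤ.+ 2 ℤ.+ n) ℤ.* (δ ℤ.* (δ ℤ.* p)) ≡ ℤ.+ 2 ℤ.* δ ℤ.* ((ℤ.+ 1 ℤ.+ n) ℤ.* (δ ℤ.* p)) ℤ.- δ ℤ.* δ ℤ.* (n ℤ.* p)
        lem = ℤ-Solver.solve-∀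

      -- Applying E² - 2aE + e to n · A n leaves 2 (A (n + 2) - a A (n + 1)), which again solves the
      -- second-order recurrence: a factor n doubles the characteristic roots.
      nA-sat : Satisfies nA
      nA-sat = double-roots nA y rec-y (λ n → trans (lem (ℤ.+ n) a e (A (2 ℕ.+ n)) (A (1 ℕ.+ n)) (A n))
          (trans (cong (λ z → nA-part n ℤ.+ ℤ.+ n ℤ.* (A (2 ℕ.+ n) ℤ.- z)) (sym (A-rec n))) (lem′ (nA-part n) (ℤ.+ n) (A (2 ℕ.+ n)))))
        where
        y : ℕ → ℤ
        y n = ℤ.+ 2 ℤ.* A (2 ℕ.+ n) ℤ.- ℤ.+ 2 ℤ.* a ℤ.* A (1 ℕ.+ n)
        nA-part : ℕ → ℤ
        nA-part n = ℤ.+ 2 ℤ.* a ℤ.* nA (1 ℕ.+ n) ℤ.- e ℤ.* nA n ℤ.+ y n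
        lem : ∀ n a e A₂ A₁ A₀ → (ℤ.+ 2 ℤ.+ n) ℤ.* A₂ ≡
          (ℤ.+ 2 ℤ.* a ℤ.* ((ℤ.+ 1 ℤ.+ n) ℤ.* A₁) ℤ.- e ℤ.* (n ℤ.* A₀) ℤ.+ (ℤ.+ 2 ℤ.* A₂ ℤ.- ℤ.+ 2 ℤ.* a ℤ.* A₁))
            ℤ.+ n ℤ.* (A₂ ℤ.- (ℤ.+ 2 ℤ.* a ℤ.* A₁ ℤ.- e ℤ.* A₀))
        lem = ℤ-Solver.solve-∀
        lem′ : ∀ p n x → p ℤ.+ n ℤ.* (x ℤ.- x) ≡ p
        lem′ = ℤ-Solver.solve-∀
        rec-y : ∀ n → y (2 ℕ.+ n) ≡ ℤ.+ 2 ℤ.* a ℤ.* y (1 ℕ.+ n) ℤ.- e ℤ.* y n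
        rec-y n = trans (cong₂ (λ u v → ℤ.+ 2 ℤ.* u ℤ.- ℤ.+ 2 ℤ.* a ℤ.* v) (trans (A-rec (2 ℕ.+ n)) (cong (λ v → ℤ.+ 2 ℤ.* a ℤ.* v ℤ.- e ℤ.* A (2 ℕ.+ n)) (A-rec (1 ℕ.+ n)))) (A-rec (1 ℕ.+ n)))
          (trans (lem″ a e (A (2 ℕ.+ n)) (A (1 ℕ.+ n)))
            (cong (λ v → ℤ.+ 2 ℤ.* a ℤ.* (ℤ.+ 2 ℤ.* v ℤ.- ℤ.+ 2 ℤ.* a ℤ.* A (2 ℕ.+ n)) ℤ.- e ℤ.* y n) (sym (A-rec (1 ℕ.+ n)))))
          where
          lem″ : ∀ a e A₂ A₁ → let A₃ = ℤ.+ 2 ℤ.* a ℤ.* A₂ ℤ.- e ℤ.* A₁ in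
            ℤ.+ 2 ℤ.* (ℤ.+ 2 ℤ.* a ℤ.* A₃ ℤ.- e ℤ.* A₂) ℤ.- ℤ.+ 2 ℤ.* a ℤ.* A₃ ≡
            ℤ.+ 2 ℤ.* a ℤ.* (ℤ.+ 2 ℤ.* A₃ ℤ.- ℤ.+ 2 ℤ.* a ℤ.* A₂) ℤ.- e ℤ.* (ℤ.+ 2 ℤ.* A₂ ℤ.- ℤ.+ 2 ℤ.* a ℤ.* A₁)
          lem″ = ℤ-Solver.solve-∀

      B-sat : Satisfies B
      B-sat = double-roots B (λ _ → 0ℤ) (λ n → lem a e) (λ n → trans (B-rec n) (sym (ℤ.+-identityʳ _)))
        where
        lem : ∀ a e → 0ℤ ≡ ℤ.+ 2 ℤ.* a ℤ.* 0ℤ ℤ.- e ℤ.* 0ℤ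
        lem = ℤ-Solver.solve-∀

    -- For α = (a + b i)/d this is dⁿ (S n (1 - Re αⁿ) + σ R Im αⁿ), with σ = ±1. Writing r = R / S
    -- and multiplying by S keeps it an integer, linear in S and R.
    term : ℤ → ℕ → ℕ → ℕ → ℤ
    term σ S R n = linear (ℤ.+ n ℤ.* (power n ℤ.- A n)) (σ ℤ.* B n) S R

    private
      term-sat : ∀ σ S R → Satisfies (term σ S R)
      term-sat σ S R n = trans (split (6 ℕ.+ n)) (trans
        (combination (λ n → ℤ.+ S ℤ.* nP n ℤ.+ (ℤ.- ℤ.+ S) ℤ.* nA n) B ℤ.1ℤ (ℤ.+ R ℤ.* σ)
          (combination nP nA (ℤ.+ S) (ℤ.- ℤ.+ S) nP-sat nA-sat) B-sat n)
        (step-cong (sym (split (5 ℕ.+ n))) (sym (split (4 ℕ.+ n))) (sym (split (3 ℕ.+ n))) (sym (split (2 ℕ.+ n))) (sym (split (1 ℕ.+ n))) (sym (split n))))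
        where
        split : ∀ n → term σ S R n ≡ ℤ.1ℤ ℤ.* (ℤ.+ S ℤ.* nP n ℤ.+ (ℤ.- ℤ.+ S) ℤ.* nA n) ℤ.+ ℤ.+ R ℤ.* σ ℤ.* B n
        split n = lem (ℤ.+ S) (ℤ.+ R) (ℤ.+ n) (power n) (A n) σ (B n)
          where
          lem : ∀ S R n p A σ B → S ℤ.* (n ℤ.* (p ℤ.- A)) ℤ.+ R ℤ.* (σ ℤ.* B) ≡
            ℤ.1ℤ ℤ.* (S ℤ.* (n ℤ.* p) ℤ.+ (ℤ.- S) ℤ.* (n ℤ.* A)) ℤ.+ R ℤ.* σ ℤ.* B
          lem = ℤ-Solver.solve-∀
        step-cong : ∀ {x₅ x₄ x₃ x₂ x₁ x₀ y₅ y₄ y₃ y₂ y₁ y₀} → x₅ ≡ y₅ → x₄ ≡ y₄ → x₃ ≡ y₃ → x₂ ≡ y₂ → x₁ ≡ y₁ → x₀ ≡ y₀ →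
          step x₅ x₄ x₃ x₂ x₁ x₀ ≡ step y₅ y₄ y₃ y₂ y₁ y₀
        step-cong refl refl refl refl refl refl = refl

    lrs : ℤ → ℕ → ℕ → LRS 6
    lrs σ S R = record
      { u          = term σ S R
      ; a          = coefficient
      ; last≢0     = last
      ; recurrence = recurrence₆ coefficient (term σ S R) (term-sat σ S R)
      }
      where
      δ≢0 : δ ≢ 0ℤ
      δ≢0 eq = d≢0 (ℤ.+-injective eq)
      nonzero : e ℤ.* e ℤ.* e ≢ 0ℤ
      nonzero eq = [ (λ ee≡0 → [ e≢0 , e≢0 ]′ (ℤ.i*j≡0⇒i≡0∨j≡0 e ee≡0)) , e≢0 ]′ (ℤ.i*j≡0⇒i≡0∨j≡0 (e ℤ.* e) eq)
        where
        e≢0 : e ≢ 0ℤ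
        e≢0 eq = [ δ≢0 , δ≢0 ]′ (ℤ.i*j≡0⇒i≡0∨j≡0 δ eq)
      last : ∀ i → suc (toℕ i) ≡ 6 → coefficient i ≢ 0ℤ
      last (suc (suc (suc (suc (suc zero))))) _ eq = nonzero (ℤ.neg-injective {e ℤ.* e ℤ.* e} {0ℤ} eq)

    inputᶜ : ∀ {n} {f g : Vec ℕ n → ℕ} σ → Computable f → Computable g →
      Σ (Vec (Rec n) 12) λ rs → ∀ xs → rs [ xs ]⇓* LRS.input (lrs σ (f xs) (g xs))
    inputᶜ {f = f} {g} σ cf cg =
      let as , a⇓ = subs {fs = λ i _ → ⌜ coefficient i ⌝} (λ i → const ⌜ coefficient i ⌝)
          us , u⇓ = subs {fs = λ i xs → ⌜ term σ (f xs) (g xs) (toℕ i) ⌝}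
            (λ i → linearᶜ (ℤ.+ toℕ i ℤ.* (power (toℕ i) ℤ.- A (toℕ i))) (σ ℤ.* B (toℕ i)) cf cg)
      in as ++ us , λ xs → ++-⇓ (a⇓ xs) (u⇓ xs)

  -- Far r below is n (1 − cₙ) ≥ r |sₙ| for large n, squared and divided by 1 − cₙ.
  module Decision (p q : ℚ) (unit : p * p + q * q ≡ 1ℚ) (p≢0 : p ≢ 0ℚ) (q≢0 : q ≢ 0ℚ) where

    open Rotation p q unit
    open NotRootOfUnity p≢0 q≢0

    Far : ℚ → Set
    Far r = ∃ λ N → ∀ n → N ℕ.≤ n → r * r * (1ℚ + c n) ≤ fromℕ n * fromℕ n * (1ℚ - c n)

    private
      d : ℕ
      d = ℚ.↧ₙ p ℕ.* ℚ.↧ₙ q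
      a b : ℤ
      a = ℚ.↥ p ℤ.* ℤ.+ ℚ.↧ₙ q
      b = ℚ.↥ q ℤ.* ℤ.+ ℚ.↧ₙ p

      D : ℚ
      D = fromℕ d

      a≡ : fromℤ a ≡ p * D
      a≡ = trans (fromℤ-* (ℚ.↥ p) (ℤ.+ ℚ.↧ₙ q)) (trans (cong (_* fromℕ (ℚ.↧ₙ q)) (sym (numerator-eq p)))
        (trans (ℚ.*-assoc p (fromℕ (ℚ.↧ₙ p)) (fromℕ (ℚ.↧ₙ q))) (cong (p *_) (sym (fromℕ-* (ℚ.↧ₙ p) (ℚ.↧ₙ q))))))

      b≡ : fromℤ b ≡ q * D
      b≡ = trans (fromℤ-* (ℚ.↥ q) (ℤ.+ ℚ.↧ₙ p)) (trans (cong (_* fromℕ (ℚ.↧ₙ p)) (sym (numerator-eq q)))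
        (trans (ℚ.*-assoc q (fromℕ (ℚ.↧ₙ q)) (fromℕ (ℚ.↧ₙ p)))
          (cong (q *_) (trans (sym (fromℕ-* (ℚ.↧ₙ q) (ℚ.↧ₙ p))) (cong fromℕ (ℕ.*-comm (ℚ.↧ₙ q) (ℚ.↧ₙ p)))))))

      norm : a ℤ.* a ℤ.+ b ℤ.* b ≡ ℤ.+ d ℤ.* ℤ.+ d
      norm = fromℤ-injective (trans (fromℤ-+ (a ℤ.* a) (b ℤ.* b))
        (trans (cong₂ _+_ (trans (fromℤ-* a a) (cong (λ z → z * z) a≡)) (trans (fromℤ-* b b) (cong (λ z → z * z) b≡)))
        (trans (lem p q D) (trans (cong (_* (D * D)) unit) (trans (ℚ.*-identityˡ (D * D)) (sym (fromℤ-* (ℤ.+ d) (ℤ.+ d))))))))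
        where
        lem : ∀ p q d → (p * d) * (p * d) + (q * d) * (q * d) ≡ (p * p + q * q) * (d * d)
        lem = solve-∀ ℚ-ring

      d≢0 : d ≢ 0
      d≢0 ()

    open Recurrence a b d d≢0 norm

    private
      D^ : ℕ → ℚ
      D^ zero    = 1ℚ
      D^ (suc n) = D * D^ n

      D^>0 : ∀ n → 0ℚ < D^ n
      D^>0 zero    = 0<1
      D^>0 (suc n) = fromℕ-mono-< {0} {d} (ℕ.n≢0⇒n>0 d≢0) ⊗⁺ D^>0 n

      power≡ : ∀ n → fromℤ (power n) ≡ D^ n
      power≡ zero    = refl
      power≡ (suc n) = trans (fromℤ-* (ℤ.+ d) (power n)) (cong (D *_) (power≡ n))

      A≡ : ∀ n → fromℤ (A n) ≡ D^ n * c n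
      B≡ : ∀ n → fromℤ (B n) ≡ D^ n * s n
      A≡ zero    = refl
      A≡ (suc n) = trans (fromℤ-- (A n ℤ.* a) (B n ℤ.* b))
        (trans (cong₂ _-_ (trans (fromℤ-* (A n) a) (cong₂ _*_ (A≡ n) a≡)) (trans (fromℤ-* (B n) b) (cong₂ _*_ (B≡ n) b≡)))
          (lem (D^ n) D (c n) (s n) p q))
        where
        lem : ∀ e d c s p q → e * c * (p * d) - e * s * (q * d) ≡ d * e * (c * p - s * q)
        lem = solve-∀ ℚ-ring
      B≡ zero    = refl
      B≡ (suc n) = trans (fromℤ-+ (B n ℤ.* a) (A n ℤ.* b))
        (trans (cong₂ _+_ (trans (fromℤ-* (B n) a) (cong₂ _*_ (B≡ n) a≡)) (trans (fromℤ-* (A n) b) (cong₂ _*_ (A≡ n) b≡)))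
          (lem (D^ n) D (c n) (s n) p q))
        where
        lem : ∀ e d c s p q → e * s * (p * d) + e * c * (q * d) ≡ d * e * (s * p + c * q)
        lem = solve-∀ ℚ-ring

      X Y : ℕ → ℕ → ℚ
      X S n = fromℕ S * (fromℕ n * (1ℚ - c n))
      Y R n = fromℕ R * s n

      term≡ : ∀ σ S R n → fromℤ (term σ S R n) ≡ D^ n * (X S n + fromℤ σ * Y R n)
      term≡ σ S R n = begin
        fromℤ (ℤ.+ S ℤ.* (ℤ.+ n ℤ.* (power n ℤ.- A n)) ℤ.+ ℤ.+ R ℤ.* (σ ℤ.* B n))
          ≡⟨ fromℤ-+ (ℤ.+ S ℤ.* (ℤ.+ n ℤ.* (power n ℤ.- A n))) (ℤ.+ R ℤ.* (σ ℤ.* B n)) ⟩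
        fromℤ (ℤ.+ S ℤ.* (ℤ.+ n ℤ.* (power n ℤ.- A n))) + fromℤ (ℤ.+ R ℤ.* (σ ℤ.* B n))
          ≡⟨ cong₂ _+_
               (trans (fromℤ-* (ℤ.+ S) (ℤ.+ n ℤ.* (power n ℤ.- A n))) (cong (fromℕ S *_) (trans (fromℤ-* (ℤ.+ n) (power n ℤ.- A n))
                 (cong (fromℕ n *_) (trans (fromℤ-- (power n) (A n)) (cong₂ _-_ (power≡ n) (A≡ n)))))))
               (trans (fromℤ-* (ℤ.+ R) (σ ℤ.* B n)) (cong (fromℕ R *_) (trans (fromℤ-* σ (B n)) (cong (fromℤ σ *_) (B≡ n))))) ⟩
        fromℕ S * (fromℕ n * (D^ n - D^ n * c n)) + fromℕ R * (fromℤ σ * (D^ n * s n))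
          ≡⟨ lem (fromℕ S) (fromℕ R) (fromℕ n) (D^ n) (c n) (s n) (fromℤ σ) ⟩
        D^ n * (X S n + fromℤ σ * Y R n) ∎
        where
        open ≡-Reasoning
        lem : ∀ S R n e c s σ → S * (n * (e - e * c)) + R * (σ * (e * s)) ≡ e * (S * (n * (1ℚ - c)) + σ * (R * s))
        lem = solve-∀ ℚ-ring

      scaled≥0 : ∀ {e z} → 0ℚ < e → 0ℚ ≤ e * z → 0ℚ ≤ z
      scaled≥0 {e} {z} 0<e h = *-cancel-≤ {e} {0ℚ} {z} 0<e
        (subst₂ _≤_ (sym (ℚ.*-zeroˡ e)) (ℚ.*-comm e z) h)

      σ-term≥0 : ∀ σ S R n → ℤ.0ℤ ℤ.≤ term σ S R n → 0ℚ ≤ X S n + fromℤ σ * Y R n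
      σ-term≥0 σ S R n h = scaled≥0 {D^ n} {X S n + fromℤ σ * Y R n} (D^>0 n) (subst (0ℚ ≤_) (term≡ σ S R n) (fromℤ≥0 h))

      term≥0-σ : ∀ σ S R n → 0ℚ ≤ X S n + fromℤ σ * Y R n → ℤ.0ℤ ℤ.≤ term σ S R n
      term≥0-σ σ S R n h = fromℤ-cancel-≥0 (term σ S R n) (subst (0ℚ ≤_) (sym (term≡ σ S R n)) (ℚ.<⇒≤ (D^>0 n) ⊗ h))

      -- (S n (1 − c))² − (R s)² = (1 − c) (S² n² (1 − c) − R² (1 + c)) as s² = 1 − c².
      difference-of-squares : ∀ S R n → X S n * X S n - Y R n * Y R n ≡
        (1ℚ - c n) * (fromℕ S * fromℕ S * (fromℕ n * fromℕ n * (1ℚ - c n)) - fromℕ R * fromℕ R * (1ℚ + c n))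
      difference-of-squares S R n = trans (lem (fromℕ S) (fromℕ R) (fromℕ n) (c n) (s n))
        (trans (cong (λ u → L + fromℕ R * fromℕ R * (1ℚ - u)) (c²+s² n)) (lem′ L (fromℕ R * fromℕ R)))
        where
        L : ℚ
        L = (1ℚ - c n) * (fromℕ S * fromℕ S * (fromℕ n * fromℕ n * (1ℚ - c n)) - fromℕ R * fromℕ R * (1ℚ + c n))
        lem : ∀ S R n c s → (S * (n * (1ℚ - c))) * (S * (n * (1ℚ - c))) - (R * s) * (R * s) ≡
          (1ℚ - c) * (S * S * (n * n * (1ℚ - c)) - R * R * (1ℚ + c)) + R * R * (1ℚ - (c * c + s * s))
        lem = solve-∀ ℚ-ring
        lem′ : ∀ l r → l + r * (1ℚ - 1ℚ) ≡ l
        lem′ = solve-∀ ℚ-ring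

    ratio : ℕ → ℕ → ℚ
    ratio R S = fromℕ R * inv S

    private
      ratio-* : ∀ R S → ratio R S * fromℕ (suc S) ≡ fromℕ R
      ratio-* R S = trans (ℚ.*-assoc (fromℕ R) (inv S) (fromℕ (suc S))) (trans (cong (fromℕ R *_) (inv-* S)) (ℚ.*-identityʳ (fromℕ R)))

      lem₁ : ∀ S n c r → S * S * (n * n * (1ℚ - c)) - (r * S) * (r * S) * (1ℚ + c) ≡ (n * n * (1ℚ - c) - r * r * (1ℚ + c)) * (S * S)
      lem₁ = solve-∀ ℚ-ring

      squares : ∀ R S n → fromℕ (suc S) * fromℕ (suc S) * (fromℕ n * fromℕ n * (1ℚ - c n)) - fromℕ R * fromℕ R * (1ℚ + c n)
        ≡ (fromℕ n * fromℕ n * (1ℚ - c n) - ratio R S * ratio R S * (1ℚ + c n)) * (fromℕ (suc S) * fromℕ (suc S))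
      squares R S n = trans (cong (λ z → fromℕ (suc S) * fromℕ (suc S) * (fromℕ n * fromℕ n * (1ℚ - c n)) - z * z * (1ℚ + c n)) (sym (ratio-* R S)))
        (lem₁ (fromℕ (suc S)) (fromℕ n) (c n) (ratio R S))

      -- Multiplying X + Y ≥ 0 and X - Y ≥ 0 gives Y² ≤ X², and the positive factor 1 - c in the
      -- difference of squares cancels.
      both⇒far : ∀ R S → UltimatelyPositive (term ℤ.1ℤ (suc S) R) → UltimatelyPositive (term ℤ.-1ℤ (suc S) R) → Far (ratio R S)
      -- The successor keeps n ≥ 1: at n = 0 the factor 1 - c is zero.
      both⇒far R S (N , up) (M , um) = suc (N ℕ.⊔ M) , λ { (suc n) (ℕ.s≤s le) → far n
          (σ-term≥0 ℤ.1ℤ (suc S) R (suc n) (up (suc n) (ℕ.m≤n⇒m≤1+n (ℕ.m⊔n≤o⇒m≤o N M le))))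
          (σ-term≥0 ℤ.-1ℤ (suc S) R (suc n) (um (suc n) (ℕ.m≤n⇒m≤1+n (ℕ.m⊔n≤o⇒n≤o N M le)))) }
        where
        lem : ∀ x y → (x + (1ℚ + 0ℚ) * y) * (x + (- (1ℚ + 0ℚ)) * y) ≡ x * x - y * y
        lem = solve-∀ ℚ-ring
        far : ∀ n → 0ℚ ≤ X (suc S) (suc n) + fromℤ ℤ.1ℤ * Y R (suc n) → 0ℚ ≤ X (suc S) (suc n) + fromℤ ℤ.-1ℤ * Y R (suc n) →
          ratio R S * ratio R S * (1ℚ + c (suc n)) ≤ fromℕ (suc n) * fromℕ (suc n) * (1ℚ - c (suc n))
        far n h₊ h₋ = ≤-from {G} (scaled≥0 {fromℕ (suc S) * fromℕ (suc S)} {G} (fromℕ>0 S ⊗⁺ fromℕ>0 S)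
            (subst (0ℚ ≤_) (trans (squares R S (suc n)) (ℚ.*-comm G _))
              (scaled≥0 {1ℚ - c (suc n)} (<⇒0<- (c<1 n))
                (subst (0ℚ ≤_) (trans (lem (X (suc S) (suc n)) (Y R (suc n))) (difference-of-squares (suc S) R (suc n))) (h₊ ⊗ h₋))))) refl
          where
          G : ℚ
          G = fromℕ (suc n) * fromℕ (suc n) * (1ℚ - c (suc n)) - ratio R S * ratio R S * (1ℚ + c (suc n))

      -- Conversely Y² ≤ X² with X ≥ 0 bounds Y on both sides, so both signs σ are covered at once.
      far⇒positive : ∀ σ R S → fromℤ σ * fromℤ σ ≡ 1ℚ → Far (ratio R S) → UltimatelyPositive (term σ (suc S) R)
      far⇒positive σ R S σ²≡1 (N , far) = N , λ n N≤n → term≥0-σ σ (suc S) R n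
        (square-≤⇒0≤+ {X (suc S) n} {fromℤ σ * Y R n} (fromℕ≥0 (suc S) ⊗ (fromℕ≥0 n ⊗ ≤⇒0≤- (c≤1 n)))
          (0≤-⇒≤ (subst (0ℚ ≤_) (sym (trans (lem (X (suc S) n) (Y R n) (fromℤ σ)) (trans (cong (λ z → X (suc S) n * X (suc S) n - z * (Y R n * Y R n)) σ²≡1)
              (trans (lem′ (X (suc S) n) (Y R n)) (trans (difference-of-squares (suc S) R n) (cong ((1ℚ - c n) *_) (squares R S n)))))))
            (≤⇒0≤- (c≤1 n) ⊗ (≤⇒0≤- (far n N≤n) ⊗ (fromℕ≥0 (suc S) ⊗ fromℕ≥0 (suc S)))))))
        where
        lem : ∀ x y σ → x * x - (σ * y) * (σ * y) ≡ x * x - σ * σ * (y * y)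
        lem = solve-∀ ℚ-ring
        lem′ : ∀ x y → x * x - 1ℚ * (y * y) ≡ x * x - y * y
        lem′ = solve-∀ ℚ-ring

    module Oracle (decidable : UltimatePositivityDecidable 6) where

      private
        f : Rec 12
        f = proj₁ decidable

        Outcome : ℤ → ℕ → ℕ → Set
        Outcome σ R S = (f [ LRS.input (lrs σ (suc S) R) ]⇓ 1 × UltimatelyPositive (term σ (suc S) R)) ⊎
                        (f [ LRS.input (lrs σ (suc S) R) ]⇓ 0 × ¬ UltimatelyPositive (term σ (suc S) R))

        outcome : ∀ σ R S → Outcome σ R S
        outcome σ R S = proj₂ decidable (lrs σ (suc S) R)

        bit : ∀ σ R S → Outcome σ R S → ℕ
        bit σ R S (inj₁ _) = 1
        bit σ R S (inj₂ _) = 0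

        bit⇓ : ∀ σ R S (o : Outcome σ R S) → f [ LRS.input (lrs σ (suc S) R) ]⇓ bit σ R S o
        bit⇓ σ R S (inj₁ (h , _)) = h
        bit⇓ σ R S (inj₂ (h , _)) = h

        decide : ∀ R S → (o₊ : Outcome ℤ.1ℤ R S) (o₋ : Outcome ℤ.-1ℤ R S) →
          (bit ℤ.1ℤ R S o₊ ℕ.* bit ℤ.-1ℤ R S o₋ ≢ 0 × Far (ratio R S)) ⊎
          (bit ℤ.1ℤ R S o₊ ℕ.* bit ℤ.-1ℤ R S o₋ ≡ 0 × ¬ Far (ratio R S))
        decide R S (inj₁ (_ , u)) (inj₁ (_ , v)) = inj₁ ((λ ()) , both⇒far R S u v)
        decide R S (inj₁ _)       (inj₂ (_ , v)) = inj₂ (refl , λ far → v (far⇒positive ℤ.-1ℤ R S refl far))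
        decide R S (inj₂ (_ , u)) _              = inj₂ (refl , λ far → u (far⇒positive ℤ.1ℤ R S refl far))

      -- The product serves as conjunction of the answers for the two signs; 0 means that `Far`
      -- fails, as a search by `min` wants.
      farBit : ℕ → ℕ → ℕ
      farBit R S = bit ℤ.1ℤ R S (outcome ℤ.1ℤ R S) ℕ.* bit ℤ.-1ℤ R S (outcome ℤ.-1ℤ R S)

      far? : ∀ R S → (farBit R S ≢ 0 × Far (ratio R S)) ⊎ (farBit R S ≡ 0 × ¬ Far (ratio R S))
      far? R S = decide R S (outcome ℤ.1ℤ R S) (outcome ℤ.-1ℤ R S)

      farBitᶜ : ∀ {n} {R S : Vec ℕ n → ℕ} → Computable R → Computable S → Computable (λ xs → farBit (R xs) (S xs))
      farBitᶜ {R = R} {S} cR cS = half ℤ.1ℤ *ᶜ half ℤ.-1ℤ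
        where
        half : ∀ σ → Computable (λ xs → bit σ (R xs) (S xs) (outcome σ (R xs) (S xs)))
        half σ = let rs , rs⇓ = inputᶜ {f = λ xs → suc (S xs)} {g = R} σ (sucᶜ cS) cR in
          comp f rs , λ xs → ⇓comp (rs⇓ xs) (bit⇓ σ (R xs) (S xs) (outcome σ (R xs) (S xs)))

-- Dirichlet's theorem, by the pigeonhole principle on the circle.

module DirichletBound where

  open Rationals
  open Rotations
  open Sequences using (module Decision)
  import Data.Nat.Tactic.RingSolver as ℕ-Solver
  open import Data.Fin.Base as Fin using (Fin; zero; suc; toℕ)
  import Data.Fin.Properties as Fin
  open import Data.Rational.Base using (_+_; _-_; _*_; -_; _≤_; _<_)

  place : Fin 4 → ℚ → ℚ → ℚ × ℚ
  place zero                   u v = u , v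
  place (suc zero)             u v = - u , v
  place (suc (suc zero))       u v = v , u
  place (suc (suc (suc zero))) u v = v , - u

  -- The octants of the unit circle are paired into four arcs, on each of which
  -- the smaller coordinate v is a coordinate with bounded distortion.
  record Arc (x y : ℚ) : Set where
    field
      arc     : Fin 4
      u v     : ℚ
      placed  : place arc u v ≡ (x , y)
      u≥0     : 0ℚ ≤ u
      v²≤u²   : v * v ≤ u * u

  arcOf : ∀ x y → Arc x y
  arcOf x y = [ (λ y²≤x² → [ (λ 0≤x → record { arc = zero ; u = x ; v = y ; placed = refl ; u≥0 = 0≤x ; v²≤u² = y²≤x² })
                          , (λ x≤0 → record { arc = suc zero ; u = - x ; v = y ; placed = cong (_, y) (neg-neg x) ; u≥0 = ℚ.neg-antimono-≤ x≤0
                                            ; v²≤u² = subst (y * y ≤_) (neg² x) y²≤x² }) ]′ (ℚ.≤-total 0ℚ x))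
              , (λ x²≤y² → [ (λ 0≤y → record { arc = suc (suc zero) ; u = y ; v = x ; placed = refl ; u≥0 = 0≤y ; v²≤u² = x²≤y² })
                          , (λ y≤0 → record { arc = suc (suc (suc zero)) ; u = - y ; v = x ; placed = cong (x ,_) (neg-neg y) ; u≥0 = ℚ.neg-antimono-≤ y≤0
                                            ; v²≤u² = subst (x * x ≤_) (neg² y) x²≤y² }) ]′ (ℚ.≤-total 0ℚ y)) ]′ (ℚ.≤-total (y * y) (x * x))
    where
    neg-neg : ∀ x → - - x ≡ x
    neg-neg = solve-∀ ℚ-ring
    neg² : ∀ x → x * x ≡ (- x) * (- x)
    neg² = solve-∀ ℚ-ring

  norm² : ℚ × ℚ → ℚ
  norm² (x , y) = x * x + y * y

  distance² : ℚ × ℚ → ℚ × ℚ → ℚ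
  distance² (x , y) (x′ , y′) = (x - x′) * (x - x′) + (y - y′) * (y - y′)

  norm²-place : ∀ t u v → norm² (place t u v) ≡ u * u + v * v
  norm²-place zero                   u v = refl
  norm²-place (suc zero)             u v = eq u v
    where
    eq : ∀ u v → (- u) * (- u) + v * v ≡ u * u + v * v
    eq = solve-∀ ℚ-ring
  norm²-place (suc (suc zero))       u v = ℚ.+-comm (v * v) (u * u)
  norm²-place (suc (suc (suc zero))) u v = eq u v
    where
    eq : ∀ u v → v * v + (- u) * (- u) ≡ u * u + v * v
    eq = solve-∀ ℚ-ring

  distance²-place : ∀ t u v u′ v′ → distance² (place t u v) (place t u′ v′) ≡ (u - u′) * (u - u′) + (v - v′) * (v - v′)
  distance²-place zero                   u v u′ v′ = refl
  distance²-place (suc zero)             u v u′ v′ = eq u v u′ v′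
    where
    eq : ∀ u v u′ v′ → (- u - - u′) * (- u - - u′) + (v - v′) * (v - v′) ≡ (u - u′) * (u - u′) + (v - v′) * (v - v′)
    eq = solve-∀ ℚ-ring
  distance²-place (suc (suc zero))       u v u′ v′ = ℚ.+-comm ((v - v′) * (v - v′)) ((u - u′) * (u - u′))
  distance²-place (suc (suc (suc zero))) u v u′ v′ = eq u v u′ v′
    where
    eq : ∀ u v u′ v′ → (v - v′) * (v - v′) + (- u - - u′) * (- u - - u′) ≡ (u - u′) * (u - u′) + (v - v′) * (v - v′)
    eq = solve-∀ ℚ-ring

  placed-distance : ∀ t u v u′ v′ P P′ → place t u v ≡ P → place t u′ v′ ≡ P′ → ∀ D → distance² P P′ ≡ D →
    (u - u′) * (u - u′) + (v - v′) * (v - v′) ≡ D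
  placed-distance t u v u′ v′ _ _ refl refl D eq = trans (sym (distance²-place t u v u′ v′)) eq

  -- On the circle (u - u′)(u + u′) = (v′ - v)(v′ + v), and |v + v′| ≤ u + u′ on the arc. Squares
  -- replace the absolute values.
  distortion : ∀ {u v u′ v′} → 0ℚ ≤ u → 0ℚ ≤ u′ → v * v ≤ u * u → v′ * v′ ≤ u′ * u′ →
    u * u + v * v ≡ 1ℚ → u′ * u′ + v′ * v′ ≡ 1ℚ → (u - u′) * (u - u′) ≤ (v - v′) * (v - v′)
  distortion {u} {v} {u′} {v′} 0≤u 0≤u′ v≤u v′≤u′ unit unit′ = *-cancel-≤ W>0
    (ℚ.≤-trans (ℚ.≤-reflexive equal) (*-mono (square≥0 (v - v′)) ℚ.≤-refl (square≥0 (v + v′)) sums))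
    where
    W : ℚ
    W = (u + u′) * (u + u′)
    cross : 0ℚ ≤ u * u′ + - (v * v′)
    cross = square-≤⇒0≤+ (0≤u ⊗ 0≤u′) (subst₂ _≤_ (lem v v′) (lem′ u u′)
      (*-mono (square≥0 v) v≤u (square≥0 v′) v′≤u′))
      where
      lem : ∀ a b → a * a * (b * b) ≡ (- (a * b)) * (- (a * b))
      lem = solve-∀ ℚ-ring
      lem′ : ∀ a b → a * a * (b * b) ≡ (a * b) * (a * b)
      lem′ = solve-∀ ℚ-ring
    sums : (v + v′) * (v + v′) ≤ W
    sums = ≤-from (≤⇒0≤- v≤u ⊕ ≤⇒0≤- v′≤u′ ⊕ 0≤2 ⊗ cross) (lem u v u′ v′)
      where
      lem : ∀ u v x y → (u + x) * (u + x) - (v + y) * (v + y) ≡ (u * u - v * v) + (x * x - y * y) + 2ℚ * (u * x + - (v * y))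
      lem = solve-∀ ℚ-ring
    W>0 : 0ℚ < W
    W>0 = subst (0ℚ <_) (sym (trans (lem u v u′) (cong (λ n → ½ * (u * u - v * v) + u′ * u′ + 2ℚ * (u * u′) + ½ * n) unit)))
      ((0≤½ ⊗ ≤⇒0≤- v≤u ⊕ square≥0 u′ ⊕ 0≤2 ⊗ (0≤u ⊗ 0≤u′)) ⊕⁺ (0<½ ⊗⁺ 0<1))
      where
      lem : ∀ u v x → (u + x) * (u + x) ≡ ½ * (u * u - v * v) + x * x + 2ℚ * (u * x) + ½ * (u * u + v * v)
      lem = solve-∀ ℚ-ring
    equal : (u - u′) * (u - u′) * W ≡ (v - v′) * (v - v′) * ((v + v′) * (v + v′))
    equal = trans (lem u u′) (trans (cong (λ z → z * z) (trans (lem′ u v u′ v′) (trans (cong₂ (λ m n → (m - n) + (v′ * v′ - v * v)) unit unit′) (lem″ (v′ * v′ - v * v))))) (lem‴ v v′))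
      where
      lem : ∀ u x → (u - x) * (u - x) * ((u + x) * (u + x)) ≡ (u * u - x * x) * (u * u - x * x)
      lem = solve-∀ ℚ-ring
      lem′ : ∀ u v x y → u * u - x * x ≡ ((u * u + v * v) - (x * x + y * y)) + (y * y - v * v)
      lem′ = solve-∀ ℚ-ring
      lem″ : ∀ z → (1ℚ - 1ℚ) + z ≡ z
      lem″ = solve-∀ ℚ-ring
      lem‴ : ∀ v y → (y * y - v * v) * (y * y - v * v) ≡ (v - y) * (v - y) * ((v + y) * (v + y))
      lem‴ = solve-∀ ℚ-ring

  repetition : ∀ m (f : ℕ → Fin m) → ∃₂ λ i n → suc n ℕ.+ i ℕ.≤ m × f i ≡ f (suc n ℕ.+ i)
  repetition m f = let i , j , i<j , eq = Fin.pigeonhole (ℕ.n<1+n m) (λ (i : Fin (suc m)) → f (toℕ i)) in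
    result (toℕ i) (toℕ j) i<j (ℕ.s≤s⁻¹ (Fin.toℕ<n j)) eq
    where
    result : ∀ i j → i ℕ.< j → j ℕ.≤ m → f i ≡ f j → ∃₂ λ i n → suc n ℕ.+ i ℕ.≤ m × f i ≡ f (suc n ℕ.+ i)
    result i j i<j j≤m eq = i , n , subst (ℕ._≤ m) (sym j≡) j≤m , trans eq (cong f (sym j≡))
      where
      n = j ℕ.∸ suc i
      j≡ : suc n ℕ.+ i ≡ j
      j≡ = trans (sym (ℕ.+-suc n i)) (ℕ.m∸n+n≡m i<j)

  module Dirichlet (p q : ℚ) (unit : p * p + q * q ≡ 1ℚ) (p≢0 : p ≢ 0ℚ) (q≢0 : q ≢ 0ℚ) where

    open Rotation p q unit
    open NotRootOfUnity p≢0 q≢0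
    open Decision p q unit p≢0 q≢0 using (Far)

    private
      cs-+ : ∀ i n → c (n ℕ.+ i) ≡ c i * c n - s i * s n × s (n ℕ.+ i) ≡ s i * c n + c i * s n
      cs-+ i zero    = eq (c i) (s i) , eq′ (c i) (s i)
        where
        eq : ∀ c s → c ≡ c * 1ℚ - s * 0ℚ
        eq = solve-∀ ℚ-ring
        eq′ : ∀ c s → s ≡ s * 1ℚ + c * 0ℚ
        eq′ = solve-∀ ℚ-ring
      cs-+ i (suc n) = let hc , hs = cs-+ i n in
        trans (cong₂ (λ x y → x * p - y * q) hc hs) (eq (c i) (s i) (c n) (s n) p q) ,
        trans (cong₂ (λ x y → y * p + x * q) hc hs) (eq′ (c i) (s i) (c n) (s n) p q)
        where
        eq : ∀ c s x y p q → (c * x - s * y) * p - (s * x + c * y) * q ≡ c * (x * p - y * q) - s * (y * p + x * q)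
        eq = solve-∀ ℚ-ring
        eq′ : ∀ c s x y p q → (s * x + c * y) * p + (c * x - s * y) * q ≡ s * (x * p - y * q) + c * (y * p + x * q)
        eq′ = solve-∀ ℚ-ring

      distance²-c : ∀ i n → distance² (c i , s i) (c (n ℕ.+ i) , s (n ℕ.+ i)) ≡ 2ℚ * (1ℚ - c n)
      distance²-c i n = let hc , hs = cs-+ i n in
        trans (cong₂ (λ x y → (c i - x) * (c i - x) + (s i - y) * (s i - y)) hc hs)
          (trans (eq (c i) (s i) (c n) (s n)) (trans (cong₂ (λ m k → m * (1ℚ + k - 2ℚ * c n)) (c²+s² i) (c²+s² n)) (eq′ (c n))))
        where
        eq : ∀ c s x y → (c - (c * x - s * y)) * (c - (c * x - s * y)) + (s - (s * x + c * y)) * (s - (s * x + c * y))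
          ≡ (c * c + s * s) * (1ℚ + (x * x + y * y) - 2ℚ * x)
        eq = solve-∀ ℚ-ring
        eq′ : ∀ x → 1ℚ * (1ℚ + 1ℚ - 2ℚ * x) ≡ 2ℚ * (1ℚ - x)
        eq′ = solve-∀ ℚ-ring

      open Arc

      -- Four arcs, each cut by the height K (v + 1) in [0, 2K] into 2K + 1 unit cells; the last one
      -- holds the endpoint.
      cells : ℕ → ℕ
      cells K = 4 ℕ.* suc (K ℕ.+ K)

      module Cells (α : ∀ i → Arc (c i) (s i)) (K : ℕ) where

        unit-uv : ∀ i → u (α i) * u (α i) + v (α i) * v (α i) ≡ 1ℚ
        unit-uv i = trans (sym (norm²-place (arc (α i)) (u (α i)) (v (α i)))) (trans (cong norm² (placed (α i))) (c²+s² i))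

        height : ℕ → ℚ
        height i = fromℕ K * (v (α i) + 1ℚ)

        v≤1 : ∀ i → v (α i) ≤ 1ℚ
        v≤1 i = ≤-from (square-≤⇒0≤+ {1ℚ} { - v (α i)} 0≤1 (≤-from (square≥0 (u (α i)))
            (trans (cong (λ z → z - (- v (α i)) * (- v (α i))) (sym (unit-uv i))) (lem (u (α i)) (v (α i)))))) refl
          where
          lem : ∀ u v → (u * u + v * v) - (- v) * (- v) ≡ u * u
          lem = solve-∀ ℚ-ring

        0≤1+v : ∀ i → 0ℚ ≤ v (α i) + 1ℚ
        0≤1+v i = subst (0ℚ ≤_) (ℚ.+-comm 1ℚ (v (α i))) (square-≤⇒0≤+ {1ℚ} {v (α i)} 0≤1 (≤-from (square≥0 (u (α i)))
            (trans (cong (λ z → z - v (α i) * v (α i)) (sym (unit-uv i))) (lem (u (α i)) (v (α i))))))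
          where
          lem : ∀ u v → (u * u + v * v) - v * v ≡ u * u
          lem = solve-∀ ℚ-ring

        cell : ∀ i → ∃ λ k → k ℕ.< suc (K ℕ.+ K) × fromℕ k ≤ height i × height i < fromℕ (suc k)
        cell i = floor (K ℕ.+ K) (fromℕ≥0 K ⊗ 0≤1+v i)
          (<-from ((fromℕ≥0 K ⊗ ≤⇒0≤- (v≤1 i)) ⊕⁺ 0<1)
            (trans (cong (λ z → 1ℚ + z - height i) (fromℕ-+ K K)) (lem (fromℕ K) (v (α i)))))
          where
          lem : ∀ k v → 1ℚ + (k + k) - k * (v + 1ℚ) ≡ k * (1ℚ - v) + 1ℚ
          lem = solve-∀ ℚ-ring

        label : ℕ → Fin (cells K)
        label i = Fin.combine (arc (α i)) (Fin.fromℕ< (proj₁ (proj₂ (cell i))))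

        same-cell : ∀ i j → label i ≡ label j → arc (α i) ≡ arc (α j) × proj₁ (cell i) ≡ proj₁ (cell j)
        same-cell i j eq = let arcs , indices = Fin.combine-injective (arc (α i)) (Fin.fromℕ< (proj₁ (proj₂ (cell i)))) (arc (α j)) (Fin.fromℕ< (proj₁ (proj₂ (cell j)))) eq in
          arcs , trans (sym (Fin.toℕ-fromℕ< (proj₁ (proj₂ (cell i))))) (trans (cong toℕ indices) (Fin.toℕ-fromℕ< (proj₁ (proj₂ (cell j)))))

        -- By rotation the squared chord between the points i and n + i is 2 (1 - c n). Within a
        -- cell, K times the v-difference is at most 1 in size, and by `distortion` so is K times
        -- the u-difference.
        close : ∀ i j n → n ℕ.+ i ≡ j → arc (α i) ≡ arc (α j) → proj₁ (cell i) ≡ proj₁ (cell j) →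
          fromℕ K * fromℕ K * (1ℚ - c n) ≤ 1ℚ
        close i j n n+i≡j arcs≡ cells≡ = ≤-from
          (0≤½ ⊗ (K²≥0 ⊗ ≤⇒0≤- (distortion {u (α i)} {v (α i)} {u (α j)} {v (α j)} (u≥0 (α i)) (u≥0 (α j)) (v²≤u² (α i)) (v²≤u² (α j)) (unit-uv i) (unit-uv j))) ⊕ ≤⇒0≤- v-close)
          (trans (cong (λ z → 1ℚ - fromℕ K * fromℕ K * z) (trans (halve (1ℚ - c n)) (cong (½ *_) (sym dist))))
            (lem (fromℕ K) (u (α i)) (u (α j)) (v (α i)) (v (α j))))
          where
          k : ℕ
          k = proj₁ (cell i)
          K²≥0 : 0ℚ ≤ fromℕ K * fromℕ K
          K²≥0 = square≥0 (fromℕ K)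
          halve : ∀ x → x ≡ ½ * (2ℚ * x)
          halve = solve-∀ ℚ-ring
          dist : (u (α i) - u (α j)) * (u (α i) - u (α j)) + (v (α i) - v (α j)) * (v (α i) - v (α j)) ≡ 2ℚ * (1ℚ - c n)
          dist = placed-distance (arc (α i)) (u (α i)) (v (α i)) (u (α j)) (v (α j)) (c i , s i) (c j , s j)
            (placed (α i)) (subst (λ t → place t (u (α j)) (v (α j)) ≡ (c j , s j)) (sym arcs≡) (placed (α j)))
            (2ℚ * (1ℚ - c n)) (subst (λ j → distance² (c i , s i) (c j , s j) ≡ 2ℚ * (1ℚ - c n)) n+i≡j (distance²-c i n))
          lem : ∀ K u x v y → 1ℚ - K * K * (½ * ((u - x) * (u - x) + (v - y) * (v - y))) ≡
            ½ * (K * K * ((v - y) * (v - y) - (u - x) * (u - x))) + (1ℚ - (K * (v + 1ℚ) - K * (y + 1ℚ)) * (K * (v + 1ℚ) - K * (y + 1ℚ)))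
          lem = solve-∀ ℚ-ring
          hi = proj₂ (proj₂ (cell i))
          hj : fromℕ k ≤ height j × height j < fromℕ (suc k)
          hj = subst (λ k → fromℕ k ≤ height j × height j < fromℕ (suc k)) (sym cells≡) (proj₂ (proj₂ (cell j)))
          v-close : (height i - height j) * (height i - height j) ≤ 1ℚ
          v-close = ≤-from
            ((≤⇒0≤- (proj₁ hi) ⊕ ≤⇒0≤- (ℚ.<⇒≤ (proj₂ hj))) ⊗ (≤⇒0≤- (proj₁ hj) ⊕ ≤⇒0≤- (ℚ.<⇒≤ (proj₂ hi))))
            (lem′ (fromℕ k) (height i) (height j))
            where
            lem′ : ∀ k x y → 1ℚ - (x - y) * (x - y) ≡ ((x - k) + (1ℚ + k - y)) * ((y - k) + (1ℚ + k - x))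
            lem′ = solve-∀ ℚ-ring

        approximation : ∃ λ n → suc n ℕ.≤ cells K × fromℕ K * fromℕ K * (1ℚ - c (suc n)) ≤ 1ℚ
        approximation = let i , n , n≤ , eq = repetition (cells K) label in
          let arcs≡ , cells≡ = same-cell i (suc n ℕ.+ i) eq in
          n , ℕ.≤-trans (ℕ.m≤m+n (suc n) i) n≤ , close i (suc n ℕ.+ i) (suc n) refl arcs≡ cells≡

      -- `Far` speaks of large n only, whereas the pigeonhole may return a small one. Since 1 - c n
      -- is positive for each n ≥ 1, a fine enough subdivision rules out all n below `N`.
      large : ∀ N → ∃ λ K → ∀ n → suc n ℕ.< N → 1ℚ < fromℕ (suc K) * (1ℚ - c (suc n))
      large zero    = 0 , λ n ()
      large (suc N) =
        let K , h = large N
            -- `pred` gives a value at N = 0, where `suc n ≡ N` is impossible.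
            w , 0<w , w*≡1 = reciprocal (<⇒0<- (c<1 (ℕ.pred N)))
            M , w≤M = archimedean w
        in K ℕ.⊔ M , λ n → λ { (ℕ.s≤s n<N) → bound K h w w*≡1 M w≤M n (ℕ.m≤n⇒m<n∨m≡n n<N) }
        where
        bound : ∀ K → (∀ n → suc n ℕ.< N → 1ℚ < fromℕ (suc K) * (1ℚ - c (suc n))) → ∀ w → w * (1ℚ - c (suc (ℕ.pred N))) ≡ 1ℚ →
          ∀ M → w ≤ fromℕ M → ∀ n → suc n ℕ.< N ⊎ suc n ≡ N → 1ℚ < fromℕ (suc (K ℕ.⊔ M)) * (1ℚ - c (suc n))
        bound K h w w*≡1 M w≤M n (inj₁ n<N) = ℚ.<-≤-trans (h n n<N)
          (*-mono (fromℕ≥0 (suc K)) (fromℕ-mono (ℕ.s≤s (ℕ.m≤m⊔n K M))) (≤⇒0≤- (c≤1 (suc n))) ℚ.≤-refl)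
        bound K h w w*≡1 M w≤M n (inj₂ refl) = subst (_< fromℕ (suc (K ℕ.⊔ M)) * (1ℚ - c (suc n))) w*≡1
          (*-mono-< (<⇒0<- (c<1 n)) (ℚ.≤-<-trans w≤M (ℚ.≤-<-trans (fromℕ-mono (ℕ.m≤n⊔m K M)) (fromℕ-mono-< (ℕ.n<1+n (K ℕ.⊔ M))))))

    13ℚ : ℚ
    13ℚ = ℤ.+ 13 / 1

    -- With k for `suc K`, there are 4 (2k + 1) ≤ 12k cells, so some m ≤ 12k has k² (1 - c m) ≤ 1,
    -- hence m² (1 - c m) ≤ 144. It also has c m ≥ 0, so r ≥ 13 makes r² (1 + c m) at least 169.
    not-far : ∀ {r} → 13ℚ ≤ r → ¬ Far r
    not-far {r} 13≤r (N , far) =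
      let K , K-large = large N
          n , n≤ , close = Cells.approximation (λ i → arcOf (c i) (s i)) (suc K)
      in contra K n n≤ close (far (suc n) (ℕ.≮⇒≥ (λ n<N → <⇒≱ (K-large n n<N) (smaller K n close))))
      where
      smaller : ∀ K n → fromℕ (suc K) * fromℕ (suc K) * (1ℚ - c (suc n)) ≤ 1ℚ → fromℕ (suc K) * (1ℚ - c (suc n)) ≤ 1ℚ
      smaller K n close = ℚ.≤-trans (≤-from ((fromℕ≥0 (suc K) ⊗ ≤⇒0≤- (c≤1 (suc n))) ⊗ fromℕ≥0 K) (lem (fromℕ K) (c (suc n)))) close
        where
        lem : ∀ k c → (1ℚ + k) * (1ℚ + k) * (1ℚ - c) - (1ℚ + k) * (1ℚ - c) ≡ ((1ℚ + k) * (1ℚ - c)) * k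
        lem = solve-∀ ℚ-ring
      12ℚ 144ℚ : ℚ
      12ℚ = ℤ.+ 12 / 1
      144ℚ = ℤ.+ 144 / 1
      contra : ∀ K n → suc n ℕ.≤ cells (suc K) → fromℕ (suc K) * fromℕ (suc K) * (1ℚ - c (suc n)) ≤ 1ℚ →
        ¬ r * r * (1ℚ + c (suc n)) ≤ fromℕ (suc n) * fromℕ (suc n) * (1ℚ - c (suc n))
      contra K n n≤ close far = <⇒≱ (ℚ.positive⁻¹ (ℤ.+ 25 / 1)) (≤-from
          (≤⇒0≤- far ⊕ ≤⇒0≤- (*-mono (fromℕ≥0 m) n≤12k (fromℕ≥0 m) n≤12k) ⊗ ≤⇒0≤- (c≤1 m) ⊕ ℚ.nonNegative⁻¹ 144ℚ ⊗ ≤⇒0≤- close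
            ⊕ ≤⇒0≤- (*-mono (ℚ.nonNegative⁻¹ 13ℚ) 13≤r (ℚ.nonNegative⁻¹ 13ℚ) 13≤r) ⊗ (0≤1 ⊕ c≥0) ⊕ ℚ.nonNegative⁻¹ (13ℚ * 13ℚ) ⊗ c≥0)
          (lem (fromℕ m) k (c m) r))
        where
        m = suc n
        k = fromℕ (suc K)
        c≥0 : 0ℚ ≤ c m
        c≥0 = ≤-from (≤⇒0≤- close ⊕ (fromℕ≥0 K ⊗ (0≤1 ⊕ k≥0)) ⊗ ≤⇒0≤- (c≤1 m)) (lem₀ (fromℕ K) (c m))
          where
          k≥0 = fromℕ≥0 (suc K)
          lem₀ : ∀ K c → c - 0ℚ ≡ (1ℚ - (1ℚ + K) * (1ℚ + K) * (1ℚ - c)) + (K * (1ℚ + (1ℚ + K))) * (1ℚ - c)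
          lem₀ = solve-∀ ℚ-ring
        n≤12k : fromℕ m ≤ 12ℚ * k
        n≤12k = ℚ.≤-trans (fromℕ-mono (ℕ.≤-trans n≤ cells≤)) (ℚ.≤-reflexive (trans (fromℕ-* 12 (suc K)) refl))
          where
          lem₁ : ∀ K → 4 ℕ.* suc (suc K ℕ.+ suc K) ℕ.+ 4 ℕ.* K ≡ 12 ℕ.* suc K
          lem₁ = ℕ-Solver.solve-∀
          cells≤ : cells (suc K) ℕ.≤ 12 ℕ.* suc K
          cells≤ = subst (cells (suc K) ℕ.≤_) (lem₁ K) (ℕ.m≤m+n (cells (suc K)) (4 ℕ.* K))
        lem : ∀ m k c r → 0ℚ - (ℤ.+ 25 / 1) ≡ (m * m * (1ℚ - c) - r * r * (1ℚ + c)) + (12ℚ * k * (12ℚ * k) - m * m) * (1ℚ - c)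
          + 144ℚ * (1ℚ - k * k * (1ℚ - c)) + (r * r - 13ℚ * 13ℚ) * (1ℚ + c) + 13ℚ * 13ℚ * c
        lem = solve-∀ ℚ-ring

-- Angles with rational cosine and sine; 1 - cos against the distance from mt to an integer.

module Angles where

  open Rationals
  open Series
  open Alternating
  open Reals
  open Rotations
  open import Data.Rational.Base using (_+_; _-_; _*_; -_; _≤_; _<_; ∣_∣)

  record HasAngle (x : ℝ) (a b : ℚ) : Set where
    constructor hasAngle
    field
      cos≃ : cos x ≃ ι a
      sin≃ : sin x ≃ ι b

  angle-≃ : ∀ {x y a b} → x ≃ y → HasAngle x a b → HasAngle y a b
  angle-≃ {x} {y} {a} {b} x≃y (hasAngle c s) =
    hasAngle (≃-trans {cos y} {cos x} {ι a} (≃-sym (cos-≃ x≃y)) c) (≃-trans {sin y} {sin x} {ι b} (≃-sym (sin-≃ x≃y)) s)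

  private
    ι-cross : ∀ u v w z {a b a′ b′} → u ≃ ι a → v ≃ ι b → w ≃ ι a′ → z ≃ ι b′ →
      u *ᴿ w -ᴿ v *ᴿ z ≃ ι (a * a′ - b * b′) × v *ᴿ w +ᴿ u *ᴿ z ≃ ι (b * a′ + a * b′)
    ι-cross u v w z {a} {b} {a′} {b′} u≃ v≃ w≃ z≃ =
      ≃-trans {u *ᴿ w -ᴿ v *ᴿ z} {ι a *ᴿ ι a′ -ᴿ ι b *ᴿ ι b′} {ι (a * a′ - b * b′)}
        (+-≃ {u *ᴿ w} {ι a *ᴿ ι a′} { -ᴿ (v *ᴿ z)} { -ᴿ (ι b *ᴿ ι b′)} (*-≃ {u} {ι a} {w} {ι a′} u≃ w≃)
          (-‿≃ {v *ᴿ z} {ι b *ᴿ ι b′} (*-≃ {v} {ι b} {z} {ι b′} v≃ z≃))) (≃-pointwise (λ _ → refl)) ,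
      ≃-trans {v *ᴿ w +ᴿ u *ᴿ z} {ι b *ᴿ ι a′ +ᴿ ι a *ᴿ ι b′} {ι (b * a′ + a * b′)}
        (+-≃ {v *ᴿ w} {ι b *ᴿ ι a′} {u *ᴿ z} {ι a *ᴿ ι b′} (*-≃ {v} {ι b} {w} {ι a′} v≃ w≃)
          (*-≃ {u} {ι a} {z} {ι b′} u≃ z≃)) (≃-pointwise (λ _ → refl))

  angle-+ : ∀ {x y a b a′ b′} → HasAngle x a b → HasAngle y a′ b′ → HasAngle (x +ᴿ y) (a * a′ - b * b′) (b * a′ + a * b′)
  angle-+ {x} {y} {a} {b} {a′} {b′} (hasAngle cx sx) (hasAngle cy sy) =
    let hc , hs = ι-cross (cos x) (sin x) (cos y) (sin y) cx sx cy sy in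
    hasAngle (≃-trans {cos (x +ᴿ y)} {cos x *ᴿ cos y -ᴿ sin x *ᴿ sin y} {ι (a * a′ - b * b′)} (cos-+ x y) hc)
             (≃-trans {sin (x +ᴿ y)} {sin x *ᴿ cos y +ᴿ cos x *ᴿ sin y} {ι (b * a′ + a * b′)} (sin-+ x y) hs)

  angle-0 : ∀ {x} → (∀ n → seq x n ≡ 0ℚ) → HasAngle x 1ℚ 0ℚ
  angle-0 {x} x≡0 = angle-≃ {ι 0ℚ} {x} (≃-pointwise {ι 0ℚ} {x} (λ n → sym (x≡0 n)))
    (hasAngle cos-0 (≃-pointwise {sin (ι 0ℚ)} {ι 0ℚ} (λ n → trans (sin-seq (ι 0ℚ) n) (odd (sinₙ-neg (quad (suc n)) 0ℚ)))))
    where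
    odd : ∀ {z} → z ≡ - z → z ≡ 0ℚ
    odd {z} eq = trans (half z) (trans (cong (λ w → ½ * (z + w)) eq) (cancel z))
      where
      half : ∀ z → z ≡ ½ * (z + z)
      half = solve-∀ ℚ-ring
      cancel : ∀ z → ½ * (z + - z) ≡ 0ℚ
      cancel = solve-∀ ℚ-ring

  private
    next-multiple : ∀ m τ → ι (fromℕ m) *ᴿ τ +ᴿ τ ≃ ι (fromℕ (suc m)) *ᴿ τ
    next-multiple m τ = ≃-pointwise (λ n → eq (fromℕ m) (seq τ n))
      where
      eq : ∀ m x → m * x + x ≡ (1ℚ + m) * x
      eq = solve-∀ ℚ-ring

    zero-multiple : ∀ z τ → z ≡ 0ℚ → HasAngle (ι z *ᴿ τ) 1ℚ 0ℚ
    zero-multiple z τ z≡0 = angle-0 {ι z *ᴿ τ} (λ n → trans (cong (_* seq τ n) z≡0) (ℚ.*-zeroˡ (seq τ n)))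

  module _ {p q : ℚ} (unit : p * p + q * q ≡ 1ℚ) where
    open Rotation p q unit

    multiples : ∀ (τ : ℝ) → HasAngle τ p q → ∀ m → HasAngle (ι (fromℕ m) *ᴿ τ) (c m) (s m)
    multiples τ base zero    = zero-multiple (fromℕ zero) τ refl
    multiples τ base (suc m) = angle-≃ {ι (fromℕ m) *ᴿ τ +ᴿ τ} {ι (fromℕ (suc m)) *ᴿ τ} {c m * p - s m * q} {s m * p + c m * q} (next-multiple m τ)
      (angle-+ {ι (fromℕ m) *ᴿ τ} {τ} {c m} {s m} {p} {q} (multiples τ base m) base)

  full-turns : ∀ ω → HasAngle ω 1ℚ 0ℚ → ∀ k → HasAngle (ι (fromℕ k) *ᴿ ω) 1ℚ 0ℚ
  full-turns ω base zero    = zero-multiple (fromℕ zero) ω refl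
  full-turns ω base (suc k) = angle-≃ {ι (fromℕ k) *ᴿ ω +ᴿ ω} {ι (fromℕ (suc k)) *ᴿ ω} {1ℚ * 1ℚ - 0ℚ * 0ℚ} {0ℚ * 1ℚ + 1ℚ * 0ℚ} (next-multiple k ω)
    (angle-+ {ι (fromℕ k) *ᴿ ω} {ω} {1ℚ} {0ℚ} {1ℚ} {0ℚ} (full-turns ω base k) base)

  private
    sin=0⇒double : ∀ u v → v ≃ ι 0ℚ → u *ᴿ u +ᴿ v *ᴿ v ≃ ι 1ℚ → u *ᴿ u -ᴿ v *ᴿ v ≃ ι 1ℚ × v *ᴿ u +ᴿ u *ᴿ v ≃ ι 0ℚ
    sin=0⇒double u v v≃0 unit =
      ≃-trans {u *ᴿ u -ᴿ v *ᴿ v} {u *ᴿ u +ᴿ v *ᴿ v -ᴿ ι 2ℚ *ᴿ (v *ᴿ v)} {ι 1ℚ}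
        (≃-pointwise (λ n → eq (seq u n) (seq v n)))
        (≃-trans {u *ᴿ u +ᴿ v *ᴿ v -ᴿ ι 2ℚ *ᴿ (v *ᴿ v)} {ι 1ℚ -ᴿ ι 2ℚ *ᴿ (ι 0ℚ *ᴿ ι 0ℚ)} {ι 1ℚ}
          (+-≃ {u *ᴿ u +ᴿ v *ᴿ v} {ι 1ℚ} { -ᴿ (ι 2ℚ *ᴿ (v *ᴿ v))} { -ᴿ (ι 2ℚ *ᴿ (ι 0ℚ *ᴿ ι 0ℚ))} unit
            (-‿≃ {ι 2ℚ *ᴿ (v *ᴿ v)} {ι 2ℚ *ᴿ (ι 0ℚ *ᴿ ι 0ℚ)} (*-≃ {ι 2ℚ} {ι 2ℚ} {v *ᴿ v} {ι 0ℚ *ᴿ ι 0ℚ} (≃-refl {ι 2ℚ}) (*-≃ {v} {ι 0ℚ} {v} {ι 0ℚ} v≃0 v≃0))))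
          (≃-pointwise (λ _ → refl))) ,
      ≃-trans {v *ᴿ u +ᴿ u *ᴿ v} {ι 0ℚ *ᴿ u +ᴿ u *ᴿ ι 0ℚ} {ι 0ℚ}
        (+-≃ {v *ᴿ u} {ι 0ℚ *ᴿ u} {u *ᴿ v} {u *ᴿ ι 0ℚ} (*-≃ {v} {ι 0ℚ} {u} {u} v≃0 (≃-refl {u})) (*-≃ {u} {u} {v} {ι 0ℚ} (≃-refl {u}) v≃0))
        (≃-pointwise (λ n → eq′ (seq u n)))
      where
      eq : ∀ u v → u * u - v * v ≡ u * u + v * v - 2ℚ * (v * v)
      eq = solve-∀ ℚ-ring
      eq′ : ∀ u → 0ℚ * u + u * 0ℚ ≡ 0ℚ
      eq′ = solve-∀ ℚ-ring

  angle-2π : ∀ π → sin π ≃ ι 0ℚ → HasAngle (π +ᴿ π) 1ℚ 0ℚ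
  angle-2π π sin-π = let hc , hs = sin=0⇒double (cos π) (sin π) sin-π (pythagoras π) in
    hasAngle (≃-trans {cos (π +ᴿ π)} {cos π *ᴿ cos π -ᴿ sin π *ᴿ sin π} {ι 1ℚ} (cos-+ π π) hc)
             (≃-trans {sin (π +ᴿ π)} {sin π *ᴿ cos π +ᴿ cos π *ᴿ sin π} {ι 0ℚ} (sin-+ π π) hs)

  cos-full-turn : ∀ x y → HasAngle y 1ℚ 0ℚ → cos (x +ᴿ y) ≃ cos x
  cos-full-turn x y (hasAngle cos-y sin-y) = ≃-trans {cos (x +ᴿ y)} {cos x *ᴿ cos y -ᴿ sin x *ᴿ sin y} {cos x} (cos-+ x y)
    (unwind (cos x) (sin x) (cos y) (sin y) cos-y sin-y)
    where
    unwind : ∀ u v w z → w ≃ ι 1ℚ → z ≃ ι 0ℚ → u *ᴿ w -ᴿ v *ᴿ z ≃ u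
    unwind u v w z w≃1 z≃0 = ≃-trans {u *ᴿ w -ᴿ v *ᴿ z} {u *ᴿ ι 1ℚ -ᴿ v *ᴿ ι 0ℚ} {u}
      (+-≃ {u *ᴿ w} {u *ᴿ ι 1ℚ} { -ᴿ (v *ᴿ z)} { -ᴿ (v *ᴿ ι 0ℚ)} (*-≃ {u} {u} {w} {ι 1ℚ} (≃-refl {u}) w≃1)
        (-‿≃ {v *ᴿ z} {v *ᴿ ι 0ℚ} (*-≃ {v} {v} {z} {ι 0ℚ} (≃-refl {v}) z≃0)))
      (≃-pointwise (λ n → eq (seq u n) (seq v n)))
      where
      eq : ∀ u v → u * 1ℚ - v * 0ℚ ≡ u
      eq = solve-∀ ℚ-ring

  -- `τ` is a variable with a termwise equation, so that multiples of it and 2π(mt - k) can be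
  -- compared by ring identities on rational terms.
  module Angle
    (π t τ : ℝ) (τ-seq : ∀ n → seq τ n ≡ 2ℚ * seq π n * seq t n)
    (p q : ℚ) (unit : p * p + q * q ≡ 1ℚ) (sin-π : sin π ≃ ι 0ℚ) (base : HasAngle τ p q)
    where

    open Rotation p q unit

    private
      turns : ℕ → ℝ
      turns k = ι (fromℕ k) *ᴿ (π +ᴿ π)

      whole : ∀ k → HasAngle (turns k) 1ℚ 0ℚ
      whole = full-turns (π +ᴿ π) (angle-2π π sin-π)

      steps : ℕ → ℝ
      steps m = ι (fromℕ m) *ᴿ τ

      cos-steps : ∀ m → cos (steps m) ≃ ι (c m)
      cos-steps m = HasAngle.cos≃ (multiples unit τ base m)

    offset : ℕ → ℤ → ℕ → ℚ
    offset m k n = fromℕ m * seq t n - fromℤ k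

    reduced : ℕ → ℤ → ℝ
    reduced m k = ι 2ℚ *ᴿ π *ᴿ (ι (fromℕ m) *ᴿ t -ᴿ ι (fromℤ k))

    -- The angle 2π(mt - k) differs from mτ by |k| full turns. Turns are counted by naturals, so the
    -- sign of k decides on which side they are added.
    cos-reduced : ∀ m k → cos (reduced m k) ≃ ι (c m)
    cos-reduced m (ℤ.+ j) = ≃-trans {cos x} {cos (x +ᴿ turns j)} {ι (c m)} (≃-sym (cos-full-turn x (turns j) (whole j)))
      (≃-trans {cos (x +ᴿ turns j)} {cos (steps m)} {ι (c m)} (cos-≃ {x +ᴿ turns j} {steps m} (≃-pointwise pointwise)) (cos-steps m))
      where
      x : ℝ
      x = reduced m (ℤ.+ j)
      eq : ∀ m j π t → 2ℚ * π * (m * t - j) + j * (π + π) ≡ m * (2ℚ * π * t)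
      eq = solve-∀ ℚ-ring
      pointwise : ∀ n → seq (x +ᴿ turns j) n ≡ seq (steps m) n
      pointwise n = trans (eq (fromℕ m) (fromℕ j) (seq π n) (seq t n)) (cong (fromℕ m *_) (sym (τ-seq n)))
    cos-reduced m (-[1+ j ]) = ≃-trans {cos x} {cos (steps m +ᴿ turns (suc j))} {ι (c m)}
      (cos-≃ {x} {steps m +ᴿ turns (suc j)} (≃-pointwise pointwise))
      (≃-trans {cos (steps m +ᴿ turns (suc j))} {cos (steps m)} {ι (c m)}
        (cos-full-turn (steps m) (turns (suc j)) (whole (suc j))) (cos-steps m))
      where
      x : ℝ
      x = reduced m (-[1+ j ])
      eq : ∀ m j π t → 2ℚ * π * (m * t - - j) ≡ m * (2ℚ * π * t) + j * (π + π)
      eq = solve-∀ ℚ-ring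
      pointwise : ∀ n → seq x n ≡ seq (steps m +ᴿ turns (suc j)) n
      pointwise n = trans (eq (fromℕ m) (fromℕ (suc j)) (seq π n) (seq t n))
        (cong (λ z → fromℕ m * z + fromℕ (suc j) * (seq π n + seq π n)) (sym (τ-seq n)))

    private
      x : ℕ → ℤ → ℕ → ℚ
      x m k n = 2ℚ * seq π n * offset m k n

      C : ℕ → ℤ → ℕ → ℚ
      C m k n = cosₙ (quad (suc n)) (x m k n)

      cos-limit : ∀ m k ε → 0ℚ < ε → Eventually (λ n → ∣ C m k n - c m ∣ < ε)
      cos-limit m k ε 0<ε = ev-map (λ n → subst (λ z → ∣ z - c m ∣ < ε) (cos-seq (reduced m k) n)) (≃⇒≈ (cos-reduced m k) ε 0<ε)

      square-bound : ∀ {π o ρ κ} → 0ℚ ≤ π → π ≤ ρ → ∣ o ∣ ≤ κ → (2ℚ * π * o) * (2ℚ * π * o) ≤ 4ℚ * (ρ * ρ * (κ * κ))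
      square-bound {π} {o} {ρ} {κ} 0≤π π≤ρ o≤κ = ℚ.≤-trans (ℚ.≤-reflexive (eq π o))
        (ℚ.*-monoˡ-≤-nonNeg 4ℚ (*-mono (0≤π ⊗ 0≤π) (*-mono 0≤π π≤ρ 0≤π π≤ρ) (square≥0 o)
          (subst (_≤ κ * κ) (∣∣² o) (*-mono (ℚ.0≤∣p∣ o) o≤κ (ℚ.0≤∣p∣ o) o≤κ))))
        where
        eq : ∀ π o → (2ℚ * π * o) * (2ℚ * π * o) ≡ 4ℚ * (π * π * (o * o))
        eq = solve-∀ ℚ-ring

      square-bound′ : ∀ {π o ρ β} → 0ℚ ≤ ρ → 0ℚ ≤ β → ρ ≤ π → β ≤ ∣ o ∣ → 4ℚ * (ρ * ρ * (β * β)) ≤ (2ℚ * π * o) * (2ℚ * π * o)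
      square-bound′ {π} {o} {ρ} {β} 0≤ρ 0≤β ρ≤π β≤o = ℚ.≤-trans
        (ℚ.*-monoˡ-≤-nonNeg 4ℚ (*-mono (0≤ρ ⊗ 0≤ρ) (*-mono 0≤ρ ρ≤π 0≤ρ ρ≤π) (0≤β ⊗ 0≤β)
          (subst (β * β ≤_) (∣∣² o) (*-mono 0≤β β≤o 0≤β β≤o))))
        (ℚ.≤-reflexive (sym (eq π o)))
        where
        eq : ∀ π o → (2ℚ * π * o) * (2ℚ * π * o) ≡ 4ℚ * (π * π * (o * o))
        eq = solve-∀ ℚ-ring

    -- Rests on 1 - cos x ≤ x²/2 with |x| ≤ 2ρκ; the last hypothesis puts x² into the range where
    -- that bound is available.
    angle-upper : ∀ m k {κ ρ} → Eventually (λ n → ∣ offset m k n ∣ ≤ κ) → Eventually (λ n → 0ℚ ≤ seq π n × seq π n ≤ ρ) →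
      4ℚ * (ρ * ρ * (κ * κ)) ≤ 12ℚ → 1ℚ - c m ≤ 2ℚ * (ρ * ρ * (κ * κ))
    angle-upper m k {κ} {ρ} near π≤ small = ≤-limit λ ε 0<ε →
      let n , (o , π-bounds) , cos-close = ev-witness (ev-× (ev-× near π≤) (cos-limit m k ε 0<ε)) in bound n ε o π-bounds cos-close
      where
      bound : ∀ n ε → ∣ offset m k n ∣ ≤ κ → 0ℚ ≤ seq π n × seq π n ≤ ρ → ∣ C m k n - c m ∣ < ε → 1ℚ - c m ≤ 2ℚ * (ρ * ρ * (κ * κ)) + ε
      bound n ε o (0≤π , π≤ρ) cos-close = ≤-from
        (≤⇒0≤- (1-cosₙ-upper {x m k n} (ℚ.≤-trans x²≤ small) (dbl n)) ⊕ 0≤½ ⊗ ≤⇒0≤- x²≤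
          ⊕ ≤⇒0≤- (ℚ.≤-trans (p≤∣p∣ (C m k n - c m)) (ℚ.<⇒≤ cos-close)))
        (eq (ρ * ρ * (κ * κ)) ε (c m) (C m k n) (x m k n))
        where
        x²≤ : x m k n * x m k n ≤ 4ℚ * (ρ * ρ * (κ * κ))
        x²≤ = square-bound {seq π n} {offset m k n} 0≤π π≤ρ o
        eq : ∀ B ε c C x → 2ℚ * B + ε - (1ℚ - c) ≡ (½ * (x * x) - (1ℚ - C)) + ½ * (4ℚ * B - x * x) + (ε - (C - c))
        eq = solve-∀ ℚ-ring

    -- These are 10/3 + 1/150 and 1/2 + 1/500. The slack absorbs the error in π and in rounding to
    -- the nearest integer, and the square of twice their product is still at most 34/3 < 12.
    π-bound offset-bound : ℚ
    π-bound = ℤ.+ 167 / 50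
    offset-bound = ℤ.+ 251 / 500

    -- With y = x² ≤ 34/3 we have 1 − y/12 ≥ 1/18, so y ≤ 36 (1 − cos x); feeding
    -- this back, (y/2) (1 − 3 (1 − cos x)) ≤ (y/2) (1 − y/12) ≤ 1 − cos x.
    angle-lower : ∀ m k {β ρ} → 0ℚ ≤ β → 0ℚ ≤ ρ → Eventually (λ n → β ≤ ∣ offset m k n ∣ × ∣ offset m k n ∣ ≤ offset-bound) →
      Eventually (λ n → ρ ≤ seq π n × seq π n ≤ π-bound) →
      2ℚ * (ρ * ρ * (β * β)) * (1ℚ - 3ℚ * (1ℚ - c m)) ≤ 1ℚ - c m
    angle-lower m k {β} {ρ} 0≤β 0≤ρ near π≤ = ≤-limit λ ε 0<ε →
      -- In `bound`, `v` exceeds 1 - c by δ; returning from `v` to 1 - c costs (1 + 3A) δ.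
      let δ , 0<δ , small = shrink {1ℚ + 3ℚ * A} {ε} (0≤1 ⊕ ℚ.nonNegative⁻¹ 3ℚ ⊗ A≥0) 0<ε
          n , (o , π-bounds) , cos-close = ev-witness (ev-× (ev-× near π≤) (cos-limit m k δ 0<δ))
      in bound n ε δ (ℚ.<⇒≤ small) o π-bounds cos-close
      where
      A : ℚ
      A = 2ℚ * (ρ * ρ * (β * β))
      A≥0 : 0ℚ ≤ A
      A≥0 = 0≤2 ⊗ ((0≤ρ ⊗ 0≤ρ) ⊗ (0≤β ⊗ 0≤β))
      34/3ℚ : ℚ
      34/3ℚ = ℤ.+ 34 / 3
      bound : ∀ n ε δ → (1ℚ + 3ℚ * A) * δ ≤ ε → β ≤ ∣ offset m k n ∣ × ∣ offset m k n ∣ ≤ offset-bound → ρ ≤ seq π n × seq π n ≤ π-bound →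
        ∣ C m k n - c m ∣ < δ → A * (1ℚ - 3ℚ * (1ℚ - c m)) ≤ 1ℚ - c m + ε
      bound n ε δ small (β≤o , o≤) (ρ≤π , π≤) cos-close = ≤-from
        (≤⇒0≤- small ⊕ ≤⇒0≤- v-bound) (eq₀ A δ ε (c m))
        where
        y v : ℚ
        y = x m k n * x m k n
        v = 1ℚ - c m + δ
        eq₀ : ∀ A δ ε c → 1ℚ - c + ε - A * (1ℚ - 3ℚ * (1ℚ - c)) ≡
          (ε - (1ℚ + 3ℚ * A) * δ) + ((1ℚ - c + δ) - A * (1ℚ - 3ℚ * (1ℚ - c + δ)))
        eq₀ = solve-∀ ℚ-ring
        y≤34/3 : y ≤ 34/3ℚ
        y≤34/3 = ℚ.≤-trans (square-bound {seq π n} {offset m k n} {π-bound} {offset-bound} (ℚ.≤-trans 0≤ρ ρ≤π) π≤ o≤) (ℚ.≤ᵇ⇒≤ _)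
        2A≤y : 2ℚ * A ≤ y
        2A≤y = ℚ.≤-trans (ℚ.≤-reflexive (eq₁ (ρ * ρ * (β * β)))) (square-bound′ {seq π n} {offset m k n} 0≤ρ 0≤β ρ≤π β≤o)
          where
          eq₁ : ∀ B → 2ℚ * (2ℚ * B) ≡ 4ℚ * B
          eq₁ = solve-∀ ℚ-ring
        lower : ½ * y - 1/24ℚ * (y * y) ≤ v
        lower = ≤-from (≤⇒0≤- (1-cosₙ-lower {x m k n} (ℚ.≤-trans y≤34/3 (ℚ.≤ᵇ⇒≤ _)) (dbl n)) ⊕ ≤⇒0≤- (ℚ.≤-trans (-p≤∣p∣ (C m k n - c m)) (ℚ.<⇒≤ cos-close)))
          (eq₁ y (c m) (C m k n) δ)
          where
          eq₁ : ∀ y c C δ → 1ℚ - c + δ - (½ * y - 1/24ℚ * (y * y)) ≡ ((1ℚ - C) - (½ * y - 1/24ℚ * (y * y))) + (δ - - (C - c))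
          eq₁ = solve-∀ ℚ-ring
        36ℚ : ℚ
        36ℚ = ℤ.+ 36 / 1
        y≥0 : 0ℚ ≤ y
        y≥0 = square≥0 (x m k n)
        y≤36v : y ≤ 36ℚ * v
        y≤36v = ≤-from (ℚ.nonNegative⁻¹ 36ℚ ⊗ ≤⇒0≤- lower ⊕ ℚ.nonNegative⁻¹ (ℤ.+ 3 / 2) ⊗ (y≥0 ⊗ ≤⇒0≤- y≤34/3)) (eq₁ y v)
          where
          eq₁ : ∀ y v → 36ℚ * v - y ≡ 36ℚ * (v - (½ * y - 1/24ℚ * (y * y))) + (ℤ.+ 3 / 2) * (y * (34/3ℚ - y))
          eq₁ = solve-∀ ℚ-ring
        v≥0 : 0ℚ ≤ v
        v≥0 = *-cancel-≤ {36ℚ} {0ℚ} {v} (ℚ.positive⁻¹ 36ℚ) (subst₂ _≤_ (sym (ℚ.*-zeroˡ 36ℚ)) (ℚ.*-comm 36ℚ v) (ℚ.≤-trans y≥0 y≤36v))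
        v-bound : A * (1ℚ - 3ℚ * v) ≤ v
        -- Multiplying 2A ≤ y by 1 - 3v requires 1 - 3v ≥ 0; otherwise the left side is ≤ 0 ≤ v.
        v-bound = [ (λ 0≤1-3v → ≤-from
              (≤⇒0≤- lower ⊕ 0≤½ ⊗ (≤⇒0≤- 2A≤y ⊗ 0≤1-3v) ⊕ 1/24≥0 ⊗ (y≥0 ⊗ (ℚ.≤-trans (≤⇒0≤- y≤36v) ℚ.≤-refl)))
              (eq₁ A y v))
          , (λ 1-3v≤0 → ≤-from (v≥0 ⊕ A≥0 ⊗ ≤⇒0≤- 1-3v≤0) (eq₂ A v)) ]′ (ℚ.≤-total 0ℚ (1ℚ - 3ℚ * v))
          where
          1/24≥0 = ℚ.nonNegative⁻¹ 1/24ℚ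
          eq₁ : ∀ A y v → v - A * (1ℚ - 3ℚ * v) ≡ (v - (½ * y - 1/24ℚ * (y * y))) + ½ * ((y - 2ℚ * A) * (1ℚ - 3ℚ * v)) + 1/24ℚ * (y * (36ℚ * v - y))
          eq₁ = solve-∀ ℚ-ring
          eq₂ : ∀ A v → v - A * (1ℚ - 3ℚ * v) ≡ v + A * (0ℚ - (1ℚ - 3ℚ * v))
          eq₂ = solve-∀ ℚ-ring

-- Rational approximations of a real, and finiteness of sets of them.

module Approximation where

  open Rationals
  open Reals
  open RealOrder
  open import Data.Rational.Base using (_+_; _-_; _*_; -_; _≤_; _<_; ∣_∣)
  open import Data.List.Base using (List; []; _∷_; _++_; map; upTo; cartesianProduct)
  open import Data.List.Membership.Propositional using (_∈_)
  open import Data.List.Membership.Propositional.Properties using (∈-++⁺ˡ; ∈-++⁺ʳ; ∈-map⁺; ∈-upTo⁺; ∈-cartesianProduct⁺)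
  open import Data.List.Relation.Unary.Any using (here; there)

  -- A real cannot be compared with a single rational, but a gap a < b leaves room: one late term is
  -- compared with the midpoint, and later terms drift by less than half the gap.
  dichotomy : ∀ x {a b} → a < b → Eventually (λ n → a ≤ seq x n) ⊎ Eventually (λ n → seq x n ≤ b)
  dichotomy x {a} {b} a<b =
    let N , close = cauchy x (½ * (b - a)) (half-positive (<⇒0<- a<b)) in
    decide N (λ n N≤n → close n N N≤n ℕ.≤-refl) (½ * (a + b) ℚ.≤? seq x N)
    where
    eq₁ : ∀ a b z w → z - a ≡ (z + ½ * (b - a) - w) + (w - ½ * (a + b))
    eq₁ = solve-∀ ℚ-ring
    eq₂ : ∀ a b z w → b - z ≡ (w + ½ * (b - a) - z) + (½ * (a + b) - w)
    eq₂ = solve-∀ ℚ-ring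
    decide : ∀ N → (∀ n → N ℕ.≤ n → ∣ seq x n - seq x N ∣ < ½ * (b - a)) → Dec (½ * (a + b) ≤ seq x N) →
      Eventually (λ n → a ≤ seq x n) ⊎ Eventually (λ n → seq x n ≤ b)
    decide N close (yes le) = inj₁ (N , λ n N≤n → ≤-from
      (≤⇒0≤- (∣-∣<⇒≥ {seq x n} {seq x N} (close n N≤n)) ⊕ ≤⇒0≤- le) (eq₁ a b (seq x n) (seq x N)))
    decide N close (no ≰) = inj₂ (N , λ n N≤n → ≤-from
      (≤⇒0≤- (∣-∣<⇒≤ {seq x n} {seq x N} (close n N≤n)) ⊕ ≤⇒0≤- (ℚ.<⇒≤ (ℚ.≰⇒> ≰))) (eq₂ a b (seq x n) (seq x N)))

  -- Rounds one late term; the slack δ covers the drift of the later ones.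
  nearest-eventually : ∀ x {δ} → 0ℚ < δ → ∃ λ k → Eventually (λ n → ∣ seq x n - fromℤ k ∣ ≤ ½ + δ)
  nearest-eventually x {δ} 0<δ =
    let N , close = cauchy x δ 0<δ
        k , near = nearest (seq x N)
    in k , N , λ n N≤n → ℚ.≤-trans (∣-∣-triangle (seq x n) (seq x N) (fromℤ k))
      (subst (∣ seq x n - seq x N ∣ + ∣ seq x N - fromℤ k ∣ ≤_) (ℚ.+-comm δ ½)
        (ℚ.+-mono-≤ (ℚ.<⇒≤ (close n N N≤n ℕ.≤-refl)) near))

  inv-square : ∀ j → ℤ.1ℤ / (suc j ℕ.* suc j) ≡ inv j * inv j
  inv-square j = trans (sym (inv≡/ (j ℕ.+ j ℕ.* suc j))) (ℚ.≤-antisym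
    (*-cancel-≤ pos (ℚ.≤-reflexive scaled)) (*-cancel-≤ pos (ℚ.≤-reflexive (sym scaled))))
    where
    M : ℕ
    M = j ℕ.+ j ℕ.* suc j
    pos : 0ℚ < fromℕ (suc M)
    pos = fromℕ>0 M
    eq : ∀ i n → (i * i) * (n * n) ≡ (i * n) * (i * n)
    eq = solve-∀ ℚ-ring
    scaled : inv M * fromℕ (suc M) ≡ inv j * inv j * fromℕ (suc M)
    scaled = trans (inv-* M) (sym (trans (cong (inv j * inv j *_) (fromℕ-* (suc j) (suc j)))
      (trans (eq (inv j) (fromℕ (suc j))) (cong (λ z → z * z) (inv-* j)))))

  private
    multiply : ∀ j t k → fromℕ (suc j) * (t - fromℤ k * inv j) ≡ fromℕ (suc j) * t - fromℤ k
    multiply j t k = trans (eq (fromℕ (suc j)) t (fromℤ k) (inv j))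
      (trans (cong (λ z → fromℕ (suc j) * t - fromℤ k * z) (inv-* j)) (cong (λ z → fromℕ (suc j) * t - z) (ℚ.*-identityʳ (fromℤ k))))
      where
      eq : ∀ m t k i → m * (t - k * i) ≡ m * t - k * (i * m)
      eq = solve-∀ ℚ-ring

    scale-up : ∀ j t k c → ∣ t - fromℤ k * inv j ∣ ≤ c * (inv j * inv j) → ∣ fromℕ (suc j) * t - fromℤ k ∣ ≤ c * inv j
    scale-up j t k c h = subst₂ _≤_
      (trans (sym (cong (_* ∣ t - fromℤ k * inv j ∣) (ℚ.0≤p⇒∣p∣≡p (fromℕ≥0 (suc j)))))
        (trans (sym (ℚ.∣p*q∣≡∣p∣*∣q∣ (fromℕ (suc j)) (t - fromℤ k * inv j))) (cong ∣_∣ (multiply j t k))))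
      (trans (eq (fromℕ (suc j)) c (inv j)) (trans (cong (c * inv j *_) (inv-* j)) (ℚ.*-identityʳ (c * inv j))))
      (ℚ.*-monoˡ-≤-nonNeg (fromℕ (suc j)) {{ℚ.nonNegative (fromℕ≥0 (suc j))}} h)
      where
      eq : ∀ m c i → m * (c * (i * i)) ≡ c * i * (i * m)
      eq = solve-∀ ℚ-ring

    scale-down : ∀ j t k c → ∣ fromℕ (suc j) * t - fromℤ k ∣ ≤ c * inv j → ∣ t - fromℤ k * inv j ∣ ≤ c * (inv j * inv j)
    scale-down j t k c h = subst₂ _≤_
      (trans (sym (cong (_* ∣ fromℕ (suc j) * t - fromℤ k ∣) (ℚ.0≤p⇒∣p∣≡p (inv≥0 j))))
        (trans (sym (ℚ.∣p*q∣≡∣p∣*∣q∣ (inv j) (fromℕ (suc j) * t - fromℤ k))) (cong ∣_∣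
          (trans (eq₁ (inv j) (fromℕ (suc j)) t (fromℤ k)) (trans (cong (λ z → z * t - fromℤ k * inv j) (inv-* j)) (cong (λ z → z - fromℤ k * inv j) (ℚ.*-identityˡ t)))))))
      (eq₂ (inv j) c)
      (ℚ.*-monoˡ-≤-nonNeg (inv j) {{ℚ.nonNegative (inv≥0 j)}} h)
      where
      eq₁ : ∀ i m t k → i * (m * t - k) ≡ (i * m) * t - k * i
      eq₁ = solve-∀ ℚ-ring
      eq₂ : ∀ i c → i * (c * i) ≡ c * (i * i)
      eq₂ = solve-∀ ℚ-ring

  -- A fraction k / m with m of either sign, written with positive denominator.
  approximates⇒ : ∀ {t c} k m → Approximates t (ι c) (k , m) → ∃₂ λ j k′ →
    ℤ.∣ m ∣ ≡ suc j × ℤ.∣ k ∣ ≡ ℤ.∣ k′ ∣ × Eventually (λ n → ∣ fromℕ (suc j) * seq t n - fromℤ k′ ∣ ≤ c * inv j)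
  approximates⇒ k (ℤ.+ zero) (() , _)
  approximates⇒ {t} {c} k +[1+ j ] (_ , ε , 0<ε , h) = j , k , refl , refl , ev-map
    (λ n h → scale-up j (seq t n) k c (subst₂ (λ a b → ∣ seq t n - a ∣ ≤ c * b) (/≡*inv k j) (inv-square j)
      (ℚ.≤-trans (≤-from (ℚ.<⇒≤ 0<ε) (eq ∣ seq t n - k / suc j ∣ ε)) h))) h
    where
    eq : ∀ x ε → x + ε - x ≡ ε
    eq = solve-∀ ℚ-ring
  approximates⇒ {t} {c} k -[1+ j ] (_ , ε , 0<ε , h) = j , ℤ.- k , refl , sym (ℤ.∣-i∣≡∣i∣ k) , ev-map
    (λ n h → scale-up j (seq t n) (ℤ.- k) c (subst₂ (λ a b → ∣ seq t n - a ∣ ≤ c * b) (/≡*inv (ℤ.- k) j) (inv-square j)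
      (ℚ.≤-trans (≤-from (ℚ.<⇒≤ 0<ε) (eq ∣ seq t n - (ℤ.- k) / suc j ∣ ε)) h))) h
    where
    eq : ∀ x ε → x + ε - x ≡ ε
    eq = solve-∀ ℚ-ring

  -- The strict order on reals demands a fixed margin; the room c - b supplies (c - b)/m².
  ⇒approximates : ∀ {t c b} j k → b < c → Eventually (λ n → ∣ fromℕ (suc j) * seq t n - fromℤ k ∣ ≤ b * inv j) →
    Approximates t (ι c) (k , +[1+ j ])
  ⇒approximates {t} {c} {b} j k b<c h = _ , (c - b) * (inv j * inv j) , (<⇒0<- b<c ⊗⁺ (inv>0 j ⊗⁺ inv>0 j)) ,
    ev-map (λ n h → subst₂ (λ u v → ∣ seq t n - u ∣ + (c - b) * (inv j * inv j) ≤ c * v) (sym (/≡*inv k j)) (sym (inv-square j))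
      (≤-from (≤⇒0≤- (scale-down j (seq t n) k b h)) (eq ∣ seq t n - fromℤ k * inv j ∣ c b (inv j * inv j)))) h
    where
    eq : ∀ x c b i → c * i - (x + (c - b) * i) ≡ b * i - x
    eq = solve-∀ ℚ-ring

  integers : ℕ → List ℤ
  integers B = map ℤ.+_ (upTo (suc B)) ++ map -[1+_] (upTo B)

  ∈-integers : ∀ {B} z → ℤ.∣ z ∣ ℕ.≤ B → z ∈ integers B
  ∈-integers {B} (ℤ.+ n)    le = ∈-++⁺ˡ (∈-map⁺ ℤ.+_ (∈-upTo⁺ (ℕ.s≤s le)))
  ∈-integers {B} (-[1+ n ]) le = ∈-++⁺ʳ (map ℤ.+_ (upTo (suc B))) (∈-map⁺ -[1+_] (∈-upTo⁺ le))

  bounded⇒finite : ∀ {P : ℤ × ℤ → Set} B → (∀ k m → P (k , m) → ℤ.∣ k ∣ ℕ.≤ B × ℤ.∣ m ∣ ℕ.≤ B) → Finite P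
  bounded⇒finite B bound = cartesianProduct (integers B) (integers B) , λ { (k , m) Pkm →
    let k≤ , m≤ = bound k m Pkm in ∈-cartesianProduct⁺ (∈-integers k k≤) (∈-integers m m≤) }

  denominator-bound : (xs : List (ℤ × ℤ)) → ∃ λ B → ∀ k m → (k , m) ∈ xs → ℤ.∣ m ∣ ℕ.≤ B
  denominator-bound []             = 0 , λ k m ()
  denominator-bound ((k , m) ∷ xs) =
    let B , h = denominator-bound xs in
    ℤ.∣ m ∣ ℕ.⊔ B , λ { k′ m′ (here refl) → ℕ.m≤m⊔n ℤ.∣ m ∣ B ; k′ m′ (there ∈xs) → ℕ.≤-trans (h k′ m′ ∈xs) (ℕ.m≤n⊔m ℤ.∣ m ∣ B) }

  ∣fromℤ∣ : ∀ z → ∣ fromℤ z ∣ ≡ fromℕ ℤ.∣ z ∣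
  ∣fromℤ∣ (ℤ.+ n)    = ℚ.0≤p⇒∣p∣≡p (fromℕ≥0 n)
  ∣fromℤ∣ (-[1+ n ]) = trans (ℚ.∣-p∣≡∣p∣ (fromℕ (suc n))) (ℚ.0≤p⇒∣p∣≡p (fromℕ≥0 (suc n)))

  -- Denominators up to J give numerators |k| ≤ J T + c with T a bound for |t|, so only a finite box
  -- of pairs remains.
  bounded-denominator⇒finite : ∀ {t c} → 0ℚ ≤ c → ∀ J → (∀ k m → Approximates t (ι c) (k , m) → ℤ.∣ m ∣ ℕ.≤ J) →
    Finite (Approximates t (ι c))
  bounded-denominator⇒finite {t} {c} 0≤c J h =
    let T , T≥0 , t≤T = bounded t
        B , B≥ = archimedean (fromℕ J * T + c)
    in bounded⇒finite (J ℕ.⊔ B) (λ k m approx → ℕ.≤-trans (numerator T t≤T B B≥ k m approx (approximates⇒ {t} {c} k m approx)) (ℕ.m≤n⊔m J B) ,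
         ℕ.≤-trans (h k m approx) (ℕ.m≤m⊔n J B))
    where
    numerator : ∀ T → Eventually (λ n → ∣ seq t n ∣ ≤ T) → ∀ B → fromℕ J * T + c ≤ fromℕ B → ∀ k m → Approximates t (ι c) (k , m) →
      (∃₂ λ j k′ → ℤ.∣ m ∣ ≡ suc j × ℤ.∣ k ∣ ≡ ℤ.∣ k′ ∣ × Eventually (λ n → ∣ fromℕ (suc j) * seq t n - fromℤ k′ ∣ ≤ c * inv j)) → ℤ.∣ k ∣ ℕ.≤ B
    numerator T t≤T B B≥ k m approx (j , k′ , m≡ , k≡ , near) =
      let n , t≤ , near = ev-witness (ev-× t≤T near) in
      subst (ℕ._≤ B) (sym k≡) (fromℕ-cancel-≤ (subst (_≤ fromℕ B) (∣fromℤ∣ k′) (ℚ.≤-trans (size n t≤ near) B≥)))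
      where
      size : ∀ n → ∣ seq t n ∣ ≤ T → ∣ fromℕ (suc j) * seq t n - fromℤ k′ ∣ ≤ c * inv j → ∣ fromℤ k′ ∣ ≤ fromℕ J * T + c
      size n t≤ near = subst (λ z → ∣ z ∣ ≤ fromℕ J * T + c) (eq (fromℕ (suc j) * seq t n) (fromℤ k′))
        (ℚ.≤-trans (ℚ.∣p-q∣≤∣p∣+∣q∣ (fromℕ (suc j) * seq t n) (fromℕ (suc j) * seq t n - fromℤ k′))
          (ℚ.+-mono-≤ (subst (_≤ fromℕ J * T) (sym (trans (ℚ.∣p*q∣≡∣p∣*∣q∣ (fromℕ (suc j)) (seq t n)) (cong (_* ∣ seq t n ∣) (ℚ.0≤p⇒∣p∣≡p (fromℕ≥0 (suc j))))))
              (*-mono (fromℕ≥0 (suc j)) (fromℕ-mono (subst (ℕ._≤ J) m≡ (h k m approx))) (ℚ.0≤∣p∣ (seq t n)) t≤))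
            (ℚ.≤-trans near (subst (c * inv j ≤_) (ℚ.*-identityʳ c)
              (ℚ.*-monoˡ-≤-nonNeg c {{ℚ.nonNegative 0≤c}} (ℚ.≤-trans (inv-antimono ℕ.z≤n) (ℚ.≤-reflexive (inv≡/ 0))))))))
        where
        eq : ∀ a k → a - (a - k) ≡ k
        eq = solve-∀ ℚ-ring

-- `Far` against finitely or infinitely many approximations.

module Criteria where

  open Rationals
  open Reals
  open Approximation
  open Angles
  open Sequences using (module Decision)
  open Rotations
  open import Data.Rational.Base using (_+_; _-_; _*_; -_; _≤_; _<_; ∣_∣)
  open import Data.List.Membership.Propositional using (_∈_)

  private
    inv≤1 : ∀ j → inv j ≤ 1ℚ
    inv≤1 j = ℚ.≤-trans (inv-antimono ℕ.z≤n) (ℚ.≤-reflexive (inv≡/ 0))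

    n*inv : ∀ j x → fromℕ (suc j) * fromℕ (suc j) * (x * (inv j * inv j)) ≡ x
    n*inv j x = trans (eq (fromℕ (suc j)) x (inv j)) (trans (cong (λ z → x * (z * z)) (inv-* j)) (eq′ x))
      where
      eq : ∀ n x i → n * n * (x * (i * i)) ≡ x * ((i * n) * (i * n))
      eq = solve-∀ ℚ-ring
      eq′ : ∀ x → x * (1ℚ * 1ℚ) ≡ x
      eq′ = solve-∀ ℚ-ring

    -- With G = ρ c: from r² (2 − w) ≤ n² w and n² w ≤ 2 G² one gets 2 r² ≤ 2 G² + 2 r² G² / n².
    far-contradiction : ∀ {r G w} j → 0ℚ ≤ G → 0ℚ ≤ w →
      r * r * (G * G) * inv j < r * r - G * G → w ≤ 2ℚ * (G * G * (inv j * inv j)) →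
      ¬ r * r * (2ℚ - w) ≤ fromℕ (suc j) * fromℕ (suc j) * w
    far-contradiction {r} {G} {w} j 0≤G 0≤w small w≤ far = <⇒≱ small
      (≤-from (0≤½ ⊗ ≤⇒0≤- far ⊕ 0≤½ ⊗ (square≥0 (fromℕ (suc j)) ⊗ ≤⇒0≤- w≤) ⊕ 0≤½ ⊗ (square≥0 r ⊗ ≤⇒0≤- w≤)
          ⊕ square≥0 r ⊗ square≥0 G ⊗ (inv≥0 j ⊗ ≤⇒0≤- (inv≤1 j)))
        (trans (cong (λ z → r * r * (G * G) * inv j - (r * r - z)) (sym (n*inv j (G * G)))) (eq r G w (fromℕ (suc j)) (inv j))))
      where
      eq : ∀ r G w n i → r * r * (G * G) * i - (r * r - n * n * (G * G * (i * i))) ≡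
        ½ * (n * n * w - r * r * (2ℚ - w)) + ½ * (n * n * (2ℚ * (G * G * (i * i)) - w)) + ½ * (r * r * (2ℚ * (G * G * (i * i)) - w))
          + r * r * (G * G) * (i * (1ℚ - i))
      eq = solve-∀ ℚ-ring

    -- With G = ρ b: n² w < 2 r² and 2 G² (1 − 3w) ≤ n² w give G² − r² < 3 w G² ≤ 6 r² G² / n².
    near-contradiction : ∀ {r ρ b w} j → 0ℚ ≤ w →
      6ℚ * (r * r * ((ρ * b) * (ρ * b))) * inv j ≤ (ρ * b) * (ρ * b) - r * r →
      fromℕ (suc j) * fromℕ (suc j) * w < r * r * (2ℚ - w) →
      ¬ 2ℚ * (ρ * ρ * ((b * inv j) * (b * inv j))) * (1ℚ - 3ℚ * w) ≤ w
    near-contradiction {r} {ρ} {b} {w} j 0≤w small not-far low = <⇒≱ n²w<2r²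
        (≤-from (≤⇒0≤- low′ ⊕ 0≤2 ⊗ ≤⇒0≤- small
            ⊕ 6≥0 ⊗ (square≥0 (ρ * b) ⊗ ≤⇒0≤- w≤) ⊕ 0≤12 ⊗ (square≥0 r ⊗ square≥0 (ρ * b)) ⊗ (inv≥0 j ⊗ ≤⇒0≤- (inv≤1 j)))
          (eq (r * r) ((ρ * b) * (ρ * b)) w n (inv j)))
      where
      n : ℚ
      n = fromℕ (suc j)
      n²≥0 : 0ℚ ≤ n * n
      n²≥0 = square≥0 n
      6≥0 = ℚ.nonNegative⁻¹ 6ℚ
      0≤12 : 0ℚ ≤ 6ℚ * 2ℚ
      0≤12 = ℚ.nonNegative⁻¹ (6ℚ * 2ℚ)
      n²w<2r² : n * n * w < 2ℚ * (r * r)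
      n²w<2r² = ℚ.<-≤-trans not-far (≤-from (square≥0 r ⊗ 0≤w) (eq₀ r w))
        where
        eq₀ : ∀ r w → 2ℚ * (r * r) - r * r * (2ℚ - w) ≡ r * r * w
        eq₀ = solve-∀ ℚ-ring
      low′ : 2ℚ * ((ρ * b) * (ρ * b)) * (1ℚ - 3ℚ * w) ≤ n * n * w
      low′ = subst (_≤ n * n * w) (trans (cong (n * n *_) (eq₁ ρ b (inv j) w)) (n*inv j (2ℚ * ((ρ * b) * (ρ * b)) * (1ℚ - 3ℚ * w))))
        (ℚ.*-monoˡ-≤-nonNeg (n * n) {{ℚ.nonNegative n²≥0}} low)
        where
        eq₁ : ∀ ρ b i w → 2ℚ * (ρ * ρ * ((b * i) * (b * i))) * (1ℚ - 3ℚ * w) ≡ 2ℚ * ((ρ * b) * (ρ * b)) * (1ℚ - 3ℚ * w) * (i * i)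
        eq₁ = solve-∀ ℚ-ring
      w≤ : w ≤ 2ℚ * (r * r) * (inv j * inv j)
      w≤ = *-cancel-≤ {n * n} (fromℕ>0 j ⊗⁺ fromℕ>0 j) (≤-from (≤⇒0≤- (ℚ.<⇒≤ not-far) ⊕ square≥0 r ⊗ 0≤w)
        (trans (cong (λ z → z - w * (n * n)) (trans (ℚ.*-comm (2ℚ * (r * r) * (inv j * inv j)) (n * n)) (n*inv j (2ℚ * (r * r))))) (eq₁ r n w)))
        where
        eq₁ : ∀ r n w → 2ℚ * (r * r) - w * (n * n) ≡ (r * r * (2ℚ - w) - n * n * w) + r * r * w
        eq₁ = solve-∀ ℚ-ring
      eq : ∀ r² B w n i → n * n * w - 2ℚ * r² ≡
        (n * n * w - 2ℚ * B * (1ℚ - 3ℚ * w)) + 2ℚ * (B - r² - 6ℚ * (r² * B) * i) + 6ℚ * (B * (2ℚ * r² * (i * i) - w))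
          + 6ℚ * 2ℚ * (r² * B) * (i * (1ℚ - i))
      eq = solve-∀ ℚ-ring

  module Criterion
    (π t τ : ℝ) (τ-seq : ∀ n → seq τ n ≡ 2ℚ * seq π n * seq t n)
    (p q : ℚ) (unit : p * p + q * q ≡ 1ℚ) (p≢0 : p ≢ 0ℚ) (q≢0 : q ≢ 0ℚ)
    (sin-π : sin π ≃ ι 0ℚ) (base : HasAngle τ p q)
    where

    open Rotation p q unit
    open Decision p q unit p≢0 q≢0 using (Far)
    open Angle π t τ τ-seq p q unit sin-π base

    private
      eq-2-w : ∀ c → 1ℚ + c ≡ 2ℚ - (1ℚ - c)
      eq-2-w = solve-∀ ℚ-ring

      square-< : ∀ {x y} → 0ℚ ≤ x → x < y → x * x < y * y
      square-< {x} {y} 0≤x x<y = <-from {b = y * y} {a = x * x} (<⇒0<- x<y ⊗⁺ ((0≤x ⊕ 0≤x) ⊕⁺ <⇒0<- x<y)) (eq x y)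
        where
        eq : ∀ x y → y * y - x * x ≡ (y - x) * ((x + x) + (y - x))
        eq = solve-∀ ℚ-ring

    far⇒finite : ∀ {r ρ c′} → Far r → 0ℚ ≤ ρ → 0ℚ ≤ c′ → Eventually (λ n → 0ℚ ≤ seq π n × seq π n ≤ ρ) → ρ * c′ < r →
      Finite (Approximates t (ι c′))
    far⇒finite {r} {ρ} {c′} (N , far) 0≤ρ 0≤c′ π≤ρ ρc′<r =
      -- `J₁` brings the angle into the range x² ≤ 12; `J₂` makes the error r² G² / m smaller than
      -- the gap r² - G².
      let J₁ , small₁ = inv-shrink G≥0 0<1
          J₂ , small₂ = inv-shrink (square≥0 r ⊗ square≥0 G) (<⇒0<- (square-< G≥0 ρc′<r))
      in bounded-denominator⇒finite {t} {c′} 0≤c′ (N ℕ.⊔ (J₁ ℕ.⊔ J₂)) (λ k m approx → ℕ.≮⇒≥ (λ J<m →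
           contradiction J₁ J₂ small₁ small₂ m J<m k (approximates⇒ {t} {c′} k m approx)))
      where
      G : ℚ
      G = ρ * c′
      G≥0 : 0ℚ ≤ G
      G≥0 = 0≤ρ ⊗ 0≤c′
      shrink-to : ∀ {K ε J j} → 0ℚ ≤ K → K * inv J < ε → J ℕ.≤ j → K * inv j < ε
      shrink-to {K} 0≤K lt J≤j = ℚ.≤-<-trans (ℚ.*-monoˡ-≤-nonNeg K {{ℚ.nonNegative 0≤K}} (inv-antimono J≤j)) lt
      contradiction : ∀ J₁ J₂ → G * inv J₁ < 1ℚ → r * r * (G * G) * inv J₂ < r * r - G * G → ∀ m → N ℕ.⊔ (J₁ ℕ.⊔ J₂) ℕ.< ℤ.∣ m ∣ → ∀ k →
        ¬ (∃₂ λ j k′ → ℤ.∣ m ∣ ≡ suc j × ℤ.∣ k ∣ ≡ ℤ.∣ k′ ∣ × Eventually (λ n → ∣ fromℕ (suc j) * seq t n - fromℤ k′ ∣ ≤ c′ * inv j))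
      contradiction J₁ J₂ small₁ small₂ m J<m k (j , k′ , m≡ , _ , near) =
        far-contradiction {r} {G} {1ℚ - c (suc j)} j G≥0 (≤⇒0≤- (c≤1 (suc j)))
          (shrink-to (square≥0 r ⊗ square≥0 G) small₂ (ℕ.m⊔n≤o⇒n≤o J₁ J₂ J≤j))
          (subst (1ℚ - c (suc j) ≤_) (cong (2ℚ *_) (eq₁ ρ c′ (inv j))) (angle-upper (suc j) k′ {c′ * inv j} {ρ} near π≤ρ small))
          (subst (λ z → r * r * z ≤ fromℕ (suc j) * fromℕ (suc j) * (1ℚ - c (suc j))) (eq-2-w (c (suc j))) (far (suc j) (ℕ.m≤n⇒m≤1+n (ℕ.m⊔n≤o⇒m≤o N (J₁ ℕ.⊔ J₂) J≤))))
        where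
        J≤ : N ℕ.⊔ (J₁ ℕ.⊔ J₂) ℕ.≤ j
        J≤ = ℕ.s≤s⁻¹ (subst (N ℕ.⊔ (J₁ ℕ.⊔ J₂) ℕ.<_) m≡ J<m)
        J≤j : J₁ ℕ.⊔ J₂ ℕ.≤ j
        J≤j = ℕ.m⊔n≤o⇒n≤o N (J₁ ℕ.⊔ J₂) J≤
        eq₁ : ∀ ρ c i → ρ * ρ * ((c * i) * (c * i)) ≡ (ρ * c) * (ρ * c) * (i * i)
        eq₁ = solve-∀ ℚ-ring
        Gi≤1 : G * inv j ≤ 1ℚ
        Gi≤1 = ℚ.<⇒≤ (shrink-to G≥0 small₁ (ℕ.m⊔n≤o⇒m≤o J₁ J₂ J≤j))
        small : 4ℚ * (ρ * ρ * ((c′ * inv j) * (c′ * inv j))) ≤ ℤ.+ 12 / 1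
        small = ℚ.≤-trans (ℚ.≤-reflexive (eq₂ ρ c′ (inv j))) (ℚ.≤-trans
          (ℚ.*-monoˡ-≤-nonNeg 4ℚ (*-mono {G * inv j} {1ℚ} {G * inv j} {1ℚ} (G≥0 ⊗ inv≥0 j) Gi≤1 (G≥0 ⊗ inv≥0 j) Gi≤1)) (ℚ.≤ᵇ⇒≤ _))
          where
          eq₂ : ∀ ρ c i → 4ℚ * (ρ * ρ * ((c * i) * (c * i))) ≡ 4ℚ * ((ρ * c * i) * (ρ * c * i))
          eq₂ = solve-∀ ℚ-ring

    private
      1/500>0 : 0ℚ < ℤ.1ℤ / 500
      1/500>0 = ℚ.positive⁻¹ (ℤ.1ℤ / 500)

      distance : ℕ → ℤ → ℝ
      distance m k = ∣_∣ᴿ (ι (fromℕ m) *ᴿ t -ᴿ ι (fromℤ k))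

    -- A finite list bounds the denominators, so for larger m even the fraction k/m next to t
    -- misses. The lower angle bound then gives the inequality of `Far r` at every large m, against
    -- the hypothesis.
    not-far⇒infinite : ∀ {r ρ b c′} → ¬ Far r → 0ℚ ≤ r → 0ℚ ≤ ρ → 0ℚ ≤ b → Eventually (λ n → ρ ≤ seq π n × seq π n ≤ π-bound) →
      r < ρ * b → b < c′ → Infinite (Approximates t (ι c′))
    not-far⇒infinite {r} {ρ} {b} {c′} not-far 0≤r 0≤ρ 0≤b ρ≤π r<ρb b<c′ (xs , complete) =
      let M , M-bound = denominator-bound xs
          J , small = inv-shrink {6ℚ * (r * r * ((ρ * b) * (ρ * b)))} (ℚ.nonNegative⁻¹ 6ℚ ⊗ (square≥0 r ⊗ square≥0 (ρ * b))) (<⇒0<- (square-< 0≤r r<ρb))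
      in not-far (suc (M ℕ.⊔ J) , λ { (suc j) (ℕ.s≤s le) → ℚ.≮⇒≥ (λ not-far-j → contradiction M M-bound J small j le not-far-j) })
      where
      -- The midpoint leaves a gap on either side: `dichotomy` uses b < d, and `⇒approximates` uses
      -- d < c′.
      d : ℚ
      d = ½ * (b + c′)
      eq-d₁ : ∀ b c → ½ * (b + c) - b ≡ ½ * (c - b)
      eq-d₁ = solve-∀ ℚ-ring
      eq-d₂ : ∀ b c → c - ½ * (b + c) ≡ ½ * (c - b)
      eq-d₂ = solve-∀ ℚ-ring
      b<d : b < d
      b<d = <-from (half-positive (<⇒0<- b<c′)) (eq-d₁ b c′)
      d<c′ : d < c′
      d<c′ = <-from (half-positive (<⇒0<- b<c′)) (eq-d₂ b c′)
      contradiction : ∀ M → (∀ k m → (k , m) ∈ xs → ℤ.∣ m ∣ ℕ.≤ M) → ∀ J → 6ℚ * (r * r * ((ρ * b) * (ρ * b))) * inv J < (ρ * b) * (ρ * b) - r * r →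
        ∀ j → M ℕ.⊔ J ℕ.≤ j → ¬ fromℕ (suc j) * fromℕ (suc j) * (1ℚ - c (suc j)) < r * r * (1ℚ + c (suc j))
      contradiction M M-bound J small j le not-far-j =
        let k , near = nearest-eventually (ι (fromℕ (suc j)) *ᴿ t) 1/500>0 in
        [ too-far k near , too-near k ]′ (dichotomy (distance (suc j) k) {b * inv j} {d * inv j} (*-mono-< (inv>0 j) b<d))
        where
        too-near : ∀ k → ¬ Eventually (λ n → ∣ fromℕ (suc j) * seq t n - fromℤ k ∣ ≤ d * inv j)
        too-near k close = ℕ.<⇒≱ (ℕ.s≤s (ℕ.m⊔n≤o⇒m≤o M J le))
          (M-bound k +[1+ j ] (complete (k , +[1+ j ]) (⇒approximates {t} {c′} {d} j k d<c′ close)))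
        too-far : ∀ k → Eventually (λ n → ∣ fromℕ (suc j) * seq t n - fromℤ k ∣ ≤ ½ + ℤ.1ℤ / 500) →
          ¬ Eventually (λ n → b * inv j ≤ ∣ fromℕ (suc j) * seq t n - fromℤ k ∣)
        too-far k near far = near-contradiction {r} {ρ} {b} {1ℚ - c (suc j)} j (≤⇒0≤- (c≤1 (suc j)))
          (ℚ.≤-trans (ℚ.*-monoˡ-≤-nonNeg (6ℚ * (r * r * ((ρ * b) * (ρ * b)))) {{ℚ.nonNegative K≥0}} (inv-antimono (ℕ.m⊔n≤o⇒n≤o M J le))) (ℚ.<⇒≤ small))
          (subst (λ z → fromℕ (suc j) * fromℕ (suc j) * (1ℚ - c (suc j)) < r * r * z) (eq-2-w (c (suc j))) not-far-j)
          (angle-lower (suc j) k {b * inv j} {ρ} (0≤b ⊗ inv≥0 j) 0≤ρ (ev-× far near) ρ≤π)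
          where
          K≥0 : 0ℚ ≤ 6ℚ * (r * r * ((ρ * b) * (ρ * b)))
          K≥0 = ℚ.nonNegative⁻¹ 6ℚ ⊗ (square≥0 r ⊗ square≥0 (ρ * b))

-- The threshold of `Far` as a computable Lagrange constant.

module Thresholds where

  open Rationals
  open Recursive
  open Reals
  open Approximation using (inv-square)
  open import Data.Fin.Base using (zero; suc)
  open import Data.Vec.Base using (Vec; []; _∷_; lookup)
  open import Data.Rational.Base using (_+_; _-_; _*_; -_; _≤_; _<_; ∣_∣)
  open import Data.List.Base using ([])

  13ℚ 7ℚ : ℚ
  13ℚ = ℤ.+ 13 / 1
  7ℚ = ℤ.+ 7 / 1

  -- A threshold of the predicate Far, in units of the limit of the sequence η,
  -- found by a linear search on the grid of mesh 1 / (n + 1).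
  module Construction
    (Far : ℚ → Set)
    (far-antitone : ∀ {r r′} → 0ℚ ≤ r′ → r′ ≤ r → Far r → Far r′)
    (far-0 : Far 0ℚ)
    (not-far : ∀ {r} → 13ℚ ≤ r → ¬ Far r)
    (farBit : ℕ → ℕ → ℕ)
    (far? : ∀ R S → (farBit R S ≢ 0 × Far (fromℕ R * inv S)) ⊎ (farBit R S ≡ 0 × ¬ Far (fromℕ R * inv S)))
    (farBitᶜ : ∀ {n} {R S : Vec ℕ n → ℕ} → Computable R → Computable S → Computable (λ xs → farBit (R xs) (S xs)))
    (z : ℕ → ℕ) (zᶜ : Computable {1} (λ xs → z (lookup xs zero)))
    (z≥ : ∀ n → 1ℚ ≤ fromℕ (z n) * inv n) (z≤ : ∀ n → fromℕ (z n) * inv n ≤ 2ℚ)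
    (C : ℚ) (C≥0 : 0ℚ ≤ C)
    (η-close : ∀ {n m} → n ℕ.≤ m → ∣ 2ℚ * (fromℕ (z n) * inv n) - 2ℚ * (fromℕ (z m) * inv m) ∣ ≤ C * inv n)
    where

    η : ℕ → ℚ
    η n = 2ℚ * (fromℕ (z n) * inv n)

    private
      -- Since `S n j` + 1 is (n + 1)², the ratio put to the oracle is j/(n + 1) times `η n`.
      R S : ℕ → ℕ → ℕ
      R n j = j ℕ.* (2 ℕ.* z n)
      S n j = n ℕ.+ n ℕ.* suc n

      grid : ℕ → ℕ → ℚ
      grid n j = fromℕ j * inv n * η n

      grid≡ : ∀ n j → fromℕ (R n j) * inv (S n j) ≡ grid n j
      grid≡ n j = trans (cong₂ _*_ (trans (fromℕ-* j (2 ℕ.* z n)) (cong (fromℕ j *_) (fromℕ-* 2 (z n)))) (trans (inv≡/ (S n j)) (inv-square n)))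
        (eq (fromℕ j) (fromℕ (z n)) (inv n))
        where
        eq : ∀ j z i → j * (2ℚ * z) * (i * i) ≡ j * i * (2ℚ * (z * i))
        eq = solve-∀ ℚ-ring

      bit : ℕ → ℕ → ℕ
      bit n j = farBit (R n j) (S n j)

      bit-far : ∀ n j → (bit n j ≢ 0 × Far (grid n j)) ⊎ (bit n j ≡ 0 × ¬ Far (grid n j))
      bit-far n j = subst (λ r → (bit n j ≢ 0 × Far r) ⊎ (bit n j ≡ 0 × ¬ Far r)) (grid≡ n j) (far? (R n j) (S n j))

      η≥2 : ∀ n → 2ℚ ≤ η n
      η≥2 n = ℚ.*-monoˡ-≤-nonNeg 2ℚ (z≥ n)

      η≤4 : ∀ n → η n ≤ 4ℚ
      η≤4 n = ℚ.*-monoˡ-≤-nonNeg 2ℚ (z≤ n)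

      η≥0 : ∀ n → 0ℚ ≤ η n
      η≥0 n = ℚ.≤-trans 0≤2 (η≥2 n)

      -- The grid reaches 7, where η ≥ 2 makes the value at least 14 ≥ 13, so that `not-far` ends
      -- the search.
      bound : ℕ → ℕ
      bound n = 7 ℕ.* suc n

      bound-inv : ∀ n → fromℕ (bound n) * inv n ≡ 7ℚ
      bound-inv n = trans (cong (_* inv n) (fromℕ-* 7 (suc n)))
        (trans (eq (fromℕ 7) (fromℕ (suc n)) (inv n)) (trans (cong (fromℕ 7 *_) (inv-* n)) refl))
        where
        eq : ∀ a b c → a * b * c ≡ a * (c * b)
        eq = solve-∀ ℚ-ring

      search : ∀ n → ∃ λ k → k ℕ.≤ bound n × bit n k ≡ 0 × (∀ j → j ℕ.< k → bit n j ≢ 0)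
      search n = least-zero (bit n) (bound n) ([ (λ { (_ , far) → ⊥-elim (not-far 13≤ far) }) , proj₁ ]′ (bit-far n (bound n)))
        where
        13≤ : 13ℚ ≤ grid n (bound n)
        13≤ = ℚ.≤-trans (ℚ.≤ᵇ⇒≤ _) (subst (7ℚ * 2ℚ ≤_) (cong (_* η n) (sym (bound-inv n)))
          (ℚ.*-monoˡ-≤-nonNeg 7ℚ (η≥2 n)))

    -- As with `HalfPiSearch`, a variable of this type keeps the search from being unfolded later.
    record Threshold : Set where
      field
        index      : ℕ → ℕ
        indexᶜ     : Computable {1} (λ xs → index (lookup xs zero))
        index≤     : ∀ n → fromℕ (index n) * inv n ≤ 7ℚ
        not-far-at : ∀ n → ¬ Far (fromℕ (index n) * inv n * η n)
        far-below  : ∀ n → Far ((fromℕ (index n) * inv n - inv n) * η n)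

    threshold : Threshold
    threshold = record
      { index      = index
      ; indexᶜ     = minᶜ bitᶜ (λ xs → index (lookup xs zero)) (λ xs → proj₁ (proj₂ (proj₂ (search (lookup xs zero)))))
          (λ xs → proj₂ (proj₂ (proj₂ (search (lookup xs zero)))))
      ; index≤     = λ n → subst (fromℕ (index n) * inv n ≤_) (bound-inv n)
          (ℚ.*-monoʳ-≤-nonNeg (inv n) {{ℚ.nonNegative (inv≥0 n)}} (fromℕ-mono (proj₁ (proj₂ (search n)))))
      ; not-far-at = λ n → not-far-index n
      ; far-below  = λ n → below n (index n) refl
      }
      where
      index : ℕ → ℕ
      index n = proj₁ (search n)
      bitᶜ : Computable {2} (λ xs → bit (lookup xs (suc zero)) (lookup xs zero))
      bitᶜ = farBitᶜ (j *ᶜ (const 2 *ᶜ sub₁ zᶜ n)) (n +ᶜ n *ᶜ sucᶜ n)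
        where
        j = var zero
        n = var (suc zero)
      not-far-index : ∀ n → ¬ Far (grid n (index n))
      not-far-index n = [ (λ { (≢0 , _) → ⊥-elim (≢0 (proj₁ (proj₂ (proj₂ (search n))))) }) , proj₂ ]′ (bit-far n (index n))
      below : ∀ n k → k ≡ index n → Far ((fromℕ k * inv n - inv n) * η n)
      -- Index 0 would give the value 0, where `Far` holds.
      below n zero    eq = ⊥-elim (not-far-index n (subst (λ k → Far (grid n k)) eq (subst Far (sym (lem (inv n) (η n))) far-0)))
        where
        lem : ∀ i e → 0ℚ * i * e ≡ 0ℚ
        lem = solve-∀ ℚ-ring
      below n (suc k) eq = subst Far (lem (fromℕ k) (inv n) (η n))
        ([ proj₂ , (λ { (≡0 , _) → ⊥-elim (proj₂ (proj₂ (proj₂ (search n))) k (subst (k ℕ.<_) eq (ℕ.n<1+n k)) ≡0) }) ]′ (bit-far n k))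
        where
        lem : ∀ k i e → k * i * e ≡ ((1ℚ + k) * i - i) * e
        lem = solve-∀ ℚ-ring

    module FromThreshold (T : Threshold) where
      open Threshold T

      a : ℕ → ℚ
      a n = fromℕ (index n) * inv n

      a≥0 : ∀ n → 0ℚ ≤ a n
      a≥0 n = fromℕ≥0 (index n) ⊗ inv≥0 n

      a≤7 : ∀ n → a n ≤ 7ℚ
      a≤7 = index≤

      private
        -- The searches at n and m use different grids and different η but probe one antitone
        -- predicate, so a value where it holds lies below a value where it fails.
        crossing : ∀ n m → (a n - inv n) * η n ≤ a m * η m
        crossing n m = ℚ.<⇒≤ (ℚ.≰⇒> λ le → not-far-at m (far-antitone (a≥0 m ⊗ η≥0 m) le (far-below n)))

      -- If aₙ ≥ aₘ, `crossing` gives (aₙ - aₘ) ηₙ ≤ aₘ (ηₘ - ηₙ) + ηₙ `inv n`; with a ≤ 7 and η ≤ 4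
      -- this is at most (7C + 4) i, and ηₙ ≥ 2 allows dropping the factor on the left.
      E : ℚ
      E = 4ℚ + 7ℚ * C

      E≥0 : 0ℚ ≤ E
      E≥0 = ℚ.nonNegative⁻¹ 4ℚ ⊕ ℚ.nonNegative⁻¹ 7ℚ ⊗ C≥0

      private
        one-sided : ∀ n m {i} → inv n ≤ i → ∣ η n - η m ∣ ≤ C * i → a n - a m ≤ E * i
        one-sided n m {i} inv≤i close = [ (λ 0≤ → ≤-from
              (≤⇒0≤- (crossing n m) ⊕ ≤⇒0≤- (a≤7 m) ⊗ ℚ.≤-trans (ℚ.0≤∣p∣ (η n - η m)) close ⊕ a≥0 m ⊗ (≤⇒0≤- close ⊕ ≤⇒0≤- (-p≤∣p∣ (η n - η m)))
                ⊕ 0≤ ⊗ (≤⇒0≤- (η≥2 n) ⊕ 0≤1) ⊕ inv≥0 n ⊗ ≤⇒0≤- (η≤4 n) ⊕ ℚ.nonNegative⁻¹ 4ℚ ⊗ ≤⇒0≤- inv≤i)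
              (eq (a n) (a m) (η n) (η m) (inv n) i C ∣ η n - η m ∣))
            , (λ ≤0 → ℚ.≤-trans ≤0 (E≥0 ⊗ ℚ.≤-trans (inv≥0 n) inv≤i)) ]′ (ℚ.≤-total 0ℚ (a n - a m))
          where
          eq : ∀ x y e f j i C d → (4ℚ + 7ℚ * C) * i - (x - y) ≡
            (y * f - (x - j) * e) + (7ℚ - y) * (C * i) + y * ((C * i - d) + (d - - (e - f))) + (x - y) * ((e - 2ℚ) + 1ℚ)
              + j * (4ℚ - e) + 4ℚ * (i - j)
          eq = solve-∀ ℚ-ring

      a-close : ∀ {n m} → n ℕ.≤ m → ∣ a n - a m ∣ ≤ E * inv n
      a-close {n} {m} n≤m = ∣∣-≤ (one-sided n m ℚ.≤-refl (η-close n≤m))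
        (subst (_≤ E * inv n) (flip (a n) (a m)) (one-sided m n (inv-antimono n≤m) (subst (_≤ C * inv n) (∣∣-sym (η n) (η m)) (η-close n≤m))))
        where
        flip : ∀ x y → y - x ≡ - (x - y)
        flip = solve-∀ ℚ-ring

      L : ℝ
      L = mkℝ a λ ε 0<ε →
        let N , small = inv-shrink E≥0 (half-positive {ε} 0<ε) in
        N , λ m n N≤m N≤n → ℚ.≤-<-trans (∣-∣-triangle (a m) (a N) (a n))
          (half-sum {∣ a m - a N ∣} {∣ a N - a n ∣} {ε}
            (ℚ.≤-<-trans (subst (_≤ E * inv N) (∣∣-sym (a N) (a m)) (a-close N≤m)) small)
            (ℚ.≤-<-trans (a-close N≤n) small))

      computable : ComputableReal L
      computable = proj₁ numeratorᶜ ∷ proj₁ denominatorᶜ ∷ [] , λ ε 0<ε c codes → answer c codes 0<ε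
        where
        K : ℕ
        K = proj₁ (archimedean E)
        -- A positive ε with denominator d + 1 is at least 1/(d + 1), whatever its numerator. The
        -- index n = 2K (d + 1) with K ≥ E keeps the error within half of that; the other half is
        -- the margin of the strict order.
        precision : ℕ → ℕ
        precision d = 2 ℕ.* K ℕ.* suc d
        precisionᶜ : Computable {2} (λ xs → precision (lookup xs (suc zero)))
        precisionᶜ = const (2 ℕ.* K) *ᶜ sucᶜ (var (suc zero))
        -- The factor 2 is the coding of a nonnegative integer.
        numeratorᶜ : Computable {2} (λ xs → 2 ℕ.* index (precision (lookup xs (suc zero))))
        numeratorᶜ = const 2 *ᶜ sub₁ indexᶜ precisionᶜ
        denominatorᶜ : Computable {2} (λ xs → precision (lookup xs (suc zero)))
        denominatorᶜ = precisionᶜ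
        accurate : ∀ d → E * inv (precision d) ≤ ½ * inv d
        accurate d = *-cancel-≤ {fromℕ (suc n)} (fromℕ>0 n) (*-cancel-≤ {fromℕ (suc d)} (fromℕ>0 d) (subst₂ _≤_
            (sym (trans (eq₁ E (inv n) (fromℕ (suc n)) (fromℕ (suc d))) (cong (λ u → E * u * fromℕ (suc d)) (inv-* n))))
            (sym (trans (eq₂ (inv d) (fromℕ (suc n)) (fromℕ (suc d))) (cong (λ u → ½ * fromℕ (suc n) * u) (inv-* d))))
            (≤-from (≤⇒0≤- (proj₂ (archimedean E)) ⊗ fromℕ≥0 (suc d) ⊕ 0≤½)
              (trans (cong (λ u → ½ * (1ℚ + u) * 1ℚ - E * 1ℚ * fromℕ (suc d)) (trans (fromℕ-* (2 ℕ.* K) (suc d)) (cong (_* fromℕ (suc d)) (fromℕ-* 2 K))))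
                (eq₃ E (fromℕ K) (fromℕ (suc d)))))))
          where
          n : ℕ
          n = precision d
          eq₁ : ∀ e i n d → e * i * n * d ≡ e * (i * n) * d
          eq₁ = solve-∀ ℚ-ring
          eq₂ : ∀ i n d → ½ * i * n * d ≡ ½ * n * (i * d)
          eq₂ = solve-∀ ℚ-ring
          eq₃ : ∀ e k d → ½ * (1ℚ + 2ℚ * k * d) * 1ℚ - e * 1ℚ * d ≡ (k - e) * d + ½
          eq₃ = solve-∀ ℚ-ring
        positive⇒inv≤ : ∀ b d → 0ℚ < b / suc d → inv d ≤ b / suc d
        positive⇒inv≤ b d 0<b = subst₂ _≤_ (ℚ.*-identityˡ (inv d)) (sym (/≡*inv b d))
          (ℚ.*-monoʳ-≤-nonNeg (inv d) {{ℚ.nonNegative (inv≥0 d)}} (one≤ b (*-cancel-< (inv≥0 d) (subst₂ _<_ (sym (ℚ.*-zeroˡ (inv d))) (/≡*inv b d) 0<b))))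
          where
          one≤ : ∀ b → 0ℚ < fromℤ b → 1ℚ ≤ fromℤ b
          one≤ (ℤ.+ zero)  0<0 = ⊥-elim (ℚ.<-irrefl refl 0<0)
          one≤ +[1+ n ]    _   = fromℕ-≥1 n
          one≤ (-[1+ n ])  0<  = ⊥-elim (<⇒≱ 0< (ℚ.neg-antimono-≤ (fromℕ≥0 (suc n))))
        answer : ∀ {ε} c → c Codes ε → 0ℚ < ε → ∃₂ λ d q → (proj₁ numeratorᶜ ∷ proj₁ denominatorᶜ ∷ []) [ c ]⇓* d × d Codes q × _<ᴿ_ (∣_∣ᴿ (ι q -ᴿ L)) (ι ε)
        answer c (fraction b d) 0<ε = (2 ℕ.* index n ∷ n ∷ []) , (ℤ.+ index n) / suc n ,
          (proj₂ numeratorᶜ c ∷ proj₂ denominatorᶜ c ∷ []) , fraction (ℤ.+ index n) n ,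
          ½ * inv d , half-positive (inv>0 d) , n , λ m n≤m → subst (λ q → ∣ q - a m ∣ + ½ * inv d ≤ b / suc d) (sym (/≡*inv (ℤ.+ index n) n))
            (ℚ.≤-trans (subst (∣ a n - a m ∣ + ½ * inv d ≤_) (halves (inv d)) (ℚ.+-monoˡ-≤ (½ * inv d) (ℚ.≤-trans (a-close n≤m) (accurate d))))
              (positive⇒inv≤ b d 0<ε))
          where
          n : ℕ
          n = precision d

      -- In the application η ± (C + 1) `inv n` encloses π: C is the rate of the approximations, and
      -- one more mesh pays for the passage to the limit.
      module Infimum
        (t : ℝ)
        (far⇒finite : ∀ n {r c} → Far r → 0ℚ ≤ c → (η n + (C + 1ℚ) * inv n) * c < r → Finite (Approximates t (ι c)))
        (not-far⇒infinite : ∀ n {r b c} → ¬ Far r → 0ℚ ≤ r → 0ℚ ≤ b → 0ℚ ≤ η n - (C + 1ℚ) * inv n →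
          r < (η n - (C + 1ℚ) * inv n) * b → b < c → Infinite (Approximates t (ι c)))
        where

        private
          unit-fraction : (m : ℤ) → .{{ℤ.NonZero m}} → ℚ
          unit-fraction m = ((ℤ.1ℤ ÷ (m ℤ.* m)) {{ℤ.i*j≢0 m m}})

          unit-fraction>0 : ∀ m → (m≢0 : ℤ.NonZero m) → 0ℚ < unit-fraction m {{m≢0}}
          unit-fraction>0 +[1+ j ]  _ = subst (0ℚ <_) (sym (inv-square j)) (inv>0 j ⊗⁺ inv>0 j)
          unit-fraction>0 -[1+ j ]  _ = subst (0ℚ <_) (sym (inv-square j)) (inv>0 j ⊗⁺ inv>0 j)

          weaken : ∀ c {c′} → Eventually (λ n → seq c n ≤ c′) → ∀ x → Approximates t c x → Approximates t (ι c′) x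
          weaken c {c′} c≤c′ (k , m) (m≢0 , ε , 0<ε , h) = m≢0 , ε , 0<ε ,
            ev-map (λ { n (h , le) → ℚ.≤-trans h (ℚ.*-monoʳ-≤-nonNeg (unit-fraction m {{m≢0}}) {{ℚ.nonNegative (ℚ.<⇒≤ (unit-fraction>0 m m≢0))}} le) })
              (ev-× h c≤c′)

          nonpositive⇒finite : ∀ {c} → c ≤ 0ℚ → Finite (Approximates t (ι c))
          nonpositive⇒finite {c} c≤0 = [] , λ { (k , m) (m≢0 , ε , 0<ε , h) → ⊥-elim (absurd k m m≢0 ε 0<ε (ev-witness h)) }
            where
            absurd : ∀ k m (m≢0 : ℤ.NonZero m) ε → 0ℚ < ε →
              ¬ ∃ (λ n → ∣ seq t n - (k ÷ m) {{m≢0}} ∣ + ε ≤ c * unit-fraction m {{m≢0}})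
            absurd k m m≢0 ε 0<ε (n , le) = <⇒≱ (ℚ.0≤∣p∣ (seq t n - (k ÷ m) {{m≢0}}) ⊕⁺ 0<ε) (ℚ.≤-trans le
              (≤-from (≤⇒0≤- c≤0 ⊗ ℚ.<⇒≤ (unit-fraction>0 m m≢0)) (eq c (unit-fraction m {{m≢0}}))))
              where
              eq : ∀ c v → 0ℚ - c * v ≡ (0ℚ - c) * v
              eq = solve-∀ ℚ-ring

          finite-⊆ : ∀ {P Q : ℤ × ℤ → Set} → (∀ x → P x → Q x) → Finite Q → Finite P
          finite-⊆ P⊆Q (xs , complete) = xs , λ x Px → complete x (P⊆Q x Px)

          a-drift : ∀ {n m} → n ℕ.≤ m → a m ≤ a n + E * inv n × a n ≤ a m + E * inv n
          a-drift {n} {m} n≤m = ≤-from (≤⇒0≤- (a-close n≤m) ⊕ ≤⇒0≤- (-p≤∣p∣ (a n - a m))) (eq₁ (a n) (a m) (E * inv n) ∣ a n - a m ∣) ,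
            ≤-from (≤⇒0≤- (a-close n≤m) ⊕ ≤⇒0≤- (p≤∣p∣ (a n - a m))) (eq₂ (a n) (a m) (E * inv n) ∣ a n - a m ∣)
            where
            eq₁ : ∀ x y e d → x + e - y ≡ (e - d) + (d - - (x - y))
            eq₁ = solve-∀ ℚ-ring
            eq₂ : ∀ x y e d → y + e - x ≡ (e - d) + (d - (x - y))
            eq₂ = solve-∀ ℚ-ring

        -- If c < L, some rational aₙ - ε/2 eventually bounds the terms of c, and its product with
        -- the upper bound of π lies below the grid value where `Far` was seen. So it admits only
        -- finitely many approximations, and c no more than that.
        lower-bound : ∀ c → Infinite (Approximates t c) → ¬ _<ᴿ_ c L
        lower-bound c infinite (ε , 0<ε , gap) =
          let N , small = inv-shrink E≥0 (half-positive {ε} 0<ε)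
              M , small′ = inv-shrink {4ℚ + (C + 1ℚ) * 7ℚ} (ℚ.nonNegative⁻¹ 4ℚ ⊕ (C≥0 ⊕ 0≤1) ⊗ ℚ.nonNegative⁻¹ 7ℚ) 0<ε
          in infinite (finite-⊆ (weaken c {a (N ℕ.⊔ M) - ½ * ε} (below (N ℕ.⊔ M) (ℚ.≤-trans (ℚ.*-monoˡ-≤-nonNeg E {{ℚ.nonNegative E≥0}} (inv-antimono (ℕ.m≤m⊔n N M))) (ℚ.<⇒≤ small))))
               (finite (N ℕ.⊔ M) (ℚ.≤-<-trans (ℚ.*-monoˡ-≤-nonNeg (4ℚ + (C + 1ℚ) * 7ℚ) {{ℚ.nonNegative (ℚ.nonNegative⁻¹ 4ℚ ⊕ (C≥0 ⊕ 0≤1) ⊗ ℚ.nonNegative⁻¹ 7ℚ)}} (inv-antimono (ℕ.m≤n⊔m N M))) small′)))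
          where
          below : ∀ n → E * inv n ≤ ½ * ε → Eventually (λ m → seq c m ≤ a n - ½ * ε)
          below n small = ev-map (λ { m (h , n≤m) → ≤-from (≤⇒0≤- h ⊕ ≤⇒0≤- (proj₁ (a-drift n≤m)) ⊕ ≤⇒0≤- small) (eq (seq c m) (a n) (a m) (E * inv n) ε) })
            (ev-× gap (≥-from n))
            where
            eq : ∀ c x y e ε → x - ½ * ε - c ≡ (y - (c + ε)) + (x + e - y) + (½ * ε - e)
            eq = solve-∀ ℚ-ring
          finite : ∀ n → (4ℚ + (C + 1ℚ) * 7ℚ) * inv n < ε → Finite (Approximates t (ι (a n - ½ * ε)))
          finite n small = [ (λ 0≤ → far⇒finite n (far-below n) 0≤ (<-from
                (((0≤½ ⊗ (ℚ.<⇒≤ 0<ε ⊗ ≤⇒0≤- (η≥2 n))) ⊕ inv≥0 n ⊗ ≤⇒0≤- (η≤4 n) ⊕ (C≥0 ⊕ 0≤1) ⊗ inv≥0 n ⊗ (≤⇒0≤- (a≤7 n) ⊕ 0≤½ ⊗ ℚ.<⇒≤ 0<ε)) ⊕⁺ <⇒0<- small)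
                (eq (a n) (η n) (inv n) C ε)))
            , nonpositive⇒finite ]′ (ℚ.≤-total 0ℚ (a n - ½ * ε))
            where
            eq : ∀ x e i C ε → (x - i) * e - (e + (C + 1ℚ) * i) * (x - ½ * ε) ≡
              ½ * (ε * (e - 2ℚ)) + i * (4ℚ - e) + (C + 1ℚ) * i * ((7ℚ - x) + ½ * ε) + (ε - (4ℚ + (C + 1ℚ) * 7ℚ) * i)
            eq = solve-∀ ℚ-ring

        -- If L < b, a rational aₙ + ε/2 fits below b with room above aₙ for the error of η. The
        -- failure of `Far` at aₙ ηₙ gives it infinitely many approximations, against the choice of
        -- b.
        greatest : ∀ b → (∀ c → Infinite (Approximates t c) → ¬ _<ᴿ_ c b) → ¬ _<ᴿ_ L b
        greatest b lower (ε , 0<ε , gap) =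
          let N , small = inv-shrink E≥0 (half-positive {½ * ε} (half-positive {ε} 0<ε))
              M , small′ = inv-shrink {(C + 1ℚ) * (7ℚ + ½ * (½ * ε))} K≥0 (half-positive {ε} 0<ε)
              M′ , small″ = inv-shrink {C + 1ℚ} (C≥0 ⊕ 0≤1) 0<2
              n = N ℕ.⊔ (M ℕ.⊔ M′)
              N≤n = ℕ.m≤m⊔n N (M ℕ.⊔ M′)
              M≤n = ℕ.≤-trans (ℕ.m≤m⊔n M M′) (ℕ.m≤n⊔m N (M ℕ.⊔ M′))
              M′≤n = ℕ.≤-trans (ℕ.m≤n⊔m M M′) (ℕ.m≤n⊔m N (M ℕ.⊔ M′))
          in lower (ι (a n + ½ * ε))
               (infinite n (shrinks {(C + 1ℚ) * (7ℚ + ½ * (½ * ε))} K≥0 M≤n small′) (ℚ.<⇒≤ (shrinks {C + 1ℚ} (C≥0 ⊕ 0≤1) M′≤n small″)))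
               (above n (ℚ.<⇒≤ (shrinks {E} E≥0 N≤n small)))
          where
          K≥0 : 0ℚ ≤ (C + 1ℚ) * (7ℚ + ½ * (½ * ε))
          K≥0 = (C≥0 ⊕ 0≤1) ⊗ (ℚ.nonNegative⁻¹ 7ℚ ⊕ 0≤½ ⊗ (0≤½ ⊗ ℚ.<⇒≤ 0<ε))
          shrinks : ∀ {K δ N n} → 0ℚ ≤ K → N ℕ.≤ n → K * inv N < δ → K * inv n < δ
          shrinks {K} 0≤K N≤n lt = ℚ.≤-<-trans (ℚ.*-monoˡ-≤-nonNeg K {{ℚ.nonNegative 0≤K}} (inv-antimono N≤n)) lt
          above : ∀ n → E * inv n ≤ ½ * (½ * ε) → _<ᴿ_ (ι (a n + ½ * ε)) b
          above n small = ½ * (½ * ε) , half-positive {½ * ε} (half-positive {ε} 0<ε) ,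
            ev-map (λ { m (h , n≤m) → ≤-from (≤⇒0≤- h ⊕ ≤⇒0≤- (proj₂ (a-drift n≤m)) ⊕ ≤⇒0≤- small) (eq (seq b m) (a n) (a m) (E * inv n) ε) }) (ev-× gap (≥-from n))
            where
            eq : ∀ b x y e ε → b - (x + ½ * ε + ½ * (½ * ε)) ≡ (b - (y + ε)) + (y + e - x) + (½ * (½ * ε) - e)
            eq = solve-∀ ℚ-ring
          infinite : ∀ n → (C + 1ℚ) * (7ℚ + ½ * (½ * ε)) * inv n < ½ * ε → (C + 1ℚ) * inv n ≤ 2ℚ → Infinite (Approximates t (ι (a n + ½ * ε)))
          infinite n small small″ = not-far⇒infinite n {a n * η n} {a n + ½ * (½ * ε)} {a n + ½ * ε} (not-far-at n) (a≥0 n ⊗ η≥0 n) (a≥0 n ⊕ 0≤½ ⊗ (0≤½ ⊗ ℚ.<⇒≤ 0<ε))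
              (≤⇒0≤- (ℚ.≤-trans small″ (η≥2 n)))
              (<-from ((0≤½ ⊗ (0≤½ ⊗ ℚ.<⇒≤ 0<ε) ⊗ ≤⇒0≤- (η≥2 n) ⊕ (C≥0 ⊕ 0≤1) ⊗ inv≥0 n ⊗ ≤⇒0≤- (a≤7 n)) ⊕⁺ <⇒0<- small) (eq (a n) (η n) (inv n) C ε))
              (<-from (half-positive {½ * ε} (half-positive {ε} 0<ε)) (eq′ (a n) ε))
            where
            eq : ∀ x e i C ε → (e - (C + 1ℚ) * i) * (x + ½ * (½ * ε)) - x * e ≡
              ½ * (½ * ε) * (e - 2ℚ) + (C + 1ℚ) * i * (7ℚ - x) + (½ * ε - (C + 1ℚ) * (7ℚ + ½ * (½ * ε)) * i)
            eq = solve-∀ ℚ-ring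
            eq′ : ∀ x ε → x + ½ * ε - (x + ½ * (½ * ε)) ≡ ½ * (½ * ε)
            eq′ = solve-∀ ℚ-ring

        isLagrangeConstant : IsLagrangeConstant t L
        isLagrangeConstant = lower-bound , greatest

-- The criteria and the search brought together for the angle 2πt.

module Main where

  open Rationals
  open Reals
  open HalfPi
  open Angles
  open Sequences using (module Decision)
  open Rotations
  open DirichletBound using (module Dirichlet)
  open Criteria using (module Criterion)
  open Thresholds using (module Construction)
  open import Data.Rational.Base using (_+_; _-_; _*_; -_; _≤_; _<_; ∣_∣)

  module Main
    (S : HalfPiSearch) (decidable : UltimatePositivityDecidable 6)
    (π t τ : ℝ) (isPi : IsPi π) (τ-seq : ∀ n → seq τ n ≡ 2ℚ * seq π n * seq t n)
    (p q : ℚ) (unit : p * p + q * q ≡ 1ℚ) (p≢0 : p ≢ 0ℚ) (q≢0 : q ≢ 0ℚ)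
    (sin-π : sin π ≃ ι 0ℚ) (base : HasAngle τ p q)
    where

    open HalfPiSearch S
    open HalfPiFrom S using (h≥1; h≤2; h≤5/3; π-rate; π-rate≥0; π-close; h; h-close; h-rate; h-rate≥0)
    open Rotation p q unit using (c; c≤1; c²+s²; s)
    open Decision p q unit p≢0 q≢0 using (Far; module Oracle)
    open Oracle decidable
    open Dirichlet p q unit p≢0 q≢0 using (not-far)
    open Angle π t τ τ-seq p q unit sin-π base using (π-bound)
    open Criterion π t τ τ-seq p q unit p≢0 q≢0 sin-π base

    private
      0≤1+c : ∀ n → 0ℚ ≤ 1ℚ + c n
      0≤1+c n = square-≤⇒0≤+ {1ℚ} {c n} 0≤1 (≤-from (square≥0 (s n)) (trans (cong (λ z → z - c n * c n) (sym (c²+s² n))) (eq (c n) (s n))))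
        where
        eq : ∀ c s → (c * c + s * s) - c * c ≡ s * s
        eq = solve-∀ ℚ-ring

      far-antitone : ∀ {r r′} → 0ℚ ≤ r′ → r′ ≤ r → Far r → Far r′
      far-antitone {r} {r′} 0≤r′ r′≤r (N , far) = N , λ n N≤n → ℚ.≤-trans
        (ℚ.*-monoʳ-≤-nonNeg (1ℚ + c n) {{ℚ.nonNegative (0≤1+c n)}} (*-mono 0≤r′ r′≤r 0≤r′ r′≤r)) (far n N≤n)

      far-0 : Far 0ℚ
      far-0 = 0 , λ n _ → ℚ.≤-trans (ℚ.≤-reflexive (eq (c n))) (square≥0 (fromℕ n) ⊗ ≤⇒0≤- (c≤1 n))
        where
        eq : ∀ c → 0ℚ * 0ℚ * (1ℚ + c) ≡ 0ℚ
        eq = solve-∀ ℚ-ring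

      2h-close : ∀ {n m} → n ℕ.≤ m → ∣ 2ℚ * (fromℕ (zeroIndex n) * inv n) - 2ℚ * (fromℕ (zeroIndex m) * inv m) ∣ ≤ π-rate * inv n
      2h-close {n} {m} n≤m = subst₂ _≤_ (trans (sym (ℚ.∣p*q∣≡∣p∣*∣q∣ 2ℚ (h n - h m))) (cong ∣_∣ (eq (h n) (h m))))
        (sym (ℚ.*-assoc 2ℚ h-rate (inv n))) (ℚ.*-monoˡ-≤-nonNeg 2ℚ (h-close n≤m))
        where
        eq : ∀ a b → 2ℚ * (a - b) ≡ 2ℚ * a - 2ℚ * b
        eq = solve-∀ ℚ-ring

    open Construction Far far-antitone far-0 not-far farBit far? farBitᶜ zeroIndex zeroIndexᶜ h≥1 h≤2 π-rate π-rate≥0 2h-close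

    private
      π-near : ∀ n → Eventually (λ k → η n - (π-rate + 1ℚ) * inv n ≤ seq π k × seq π k ≤ η n + (π-rate + 1ℚ) * inv n)
      π-near n = ev-map (λ k close →
          ≤-from (≤⇒0≤- close ⊕ ≤⇒0≤- (-p≤∣p∣ (seq π k - η n))) (eq₁ (seq π k) (η n) π-rate (inv n) ∣ seq π k - η n ∣) ,
          ≤-from (≤⇒0≤- close ⊕ ≤⇒0≤- (p≤∣p∣ (seq π k - η n))) (eq₂ (seq π k) (η n) π-rate (inv n) ∣ seq π k - η n ∣))
        (π-close {π} isPi n (inv n) (inv>0 n))
        where
        eq₁ : ∀ x e C i d → x - (e - (C + 1ℚ) * i) ≡ (C * i + i - d) + (d - - (x - e))
        eq₁ = solve-∀ ℚ-ring
        eq₂ : ∀ x e C i d → e + (C + 1ℚ) * i - x ≡ (C * i + i - d) + (d - (x - e))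
        eq₂ = solve-∀ ℚ-ring

      π≥0 : Eventually (λ k → 0ℚ ≤ seq π k)
      π≥0 = let ε , 0<ε , positive = proj₁ isPi in
        ev-map (λ k le → ℚ.≤-trans (ℚ.<⇒≤ 0<ε) (subst (_≤ seq π k) (ℚ.+-identityˡ ε) le)) positive

      π≤bound : Eventually (λ k → seq π k ≤ π-bound)
      π≤bound =
        -- 2 · 5/3 + 1/150 = 167/50, where 5/3 bounds `h` from index 39 on.
        let N , small = inv-shrink {π-rate + 1ℚ} (π-rate≥0 ⊕ 0≤1) (ℚ.positive⁻¹ (ℤ.1ℤ / 150)) in
        ev-map (λ { k (_ , le) → upper (N ℕ.⊔ 39) k
          (ℚ.≤-trans (ℚ.*-monoˡ-≤-nonNeg (π-rate + 1ℚ) {{ℚ.nonNegative (π-rate≥0 ⊕ 0≤1)}} (inv-antimono (ℕ.m≤m⊔n N 39))) (ℚ.<⇒≤ small))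
          (ℕ.m≤n⊔m N 39) le }) (π-near (N ℕ.⊔ 39))
        where
        upper : ∀ n k → (π-rate + 1ℚ) * inv n ≤ ℤ.1ℤ / 150 → 39 ℕ.≤ n → seq π k ≤ η n + (π-rate + 1ℚ) * inv n → seq π k ≤ π-bound
        upper n k small 39≤n le = ≤-from (≤⇒0≤- le ⊕ ≤⇒0≤- small ⊕ 0≤2 ⊗ ≤⇒0≤- (h≤5/3 n 39≤n)) (eq (seq π k) (h n) ((π-rate + 1ℚ) * inv n))
          where
          eq : ∀ x h e → ℤ.+ 167 / 50 - x ≡ (2ℚ * h + e - x) + (ℤ.1ℤ / 150 - e) + 2ℚ * (ℤ.+ 5 / 3 - h)
          eq = solve-∀ ℚ-ring

      finite : ∀ n {r c} → Far r → 0ℚ ≤ c → (η n + (π-rate + 1ℚ) * inv n) * c < r → Finite (Approximates t (ι c))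
      finite n {r} {c} far 0≤c lt = far⇒finite {r} {η n + (π-rate + 1ℚ) * inv n} {c} far
        (0≤2 ⊗ (fromℕ≥0 (zeroIndex n) ⊗ inv≥0 n) ⊕ (π-rate≥0 ⊕ 0≤1) ⊗ inv≥0 n) 0≤c
        (ev-map (λ { k (0≤π , (_ , π≤)) → 0≤π , π≤ }) (ev-× π≥0 (π-near n))) lt

      infinite : ∀ n {r b c} → ¬ Far r → 0ℚ ≤ r → 0ℚ ≤ b → 0ℚ ≤ η n - (π-rate + 1ℚ) * inv n →
        r < (η n - (π-rate + 1ℚ) * inv n) * b → b < c → Infinite (Approximates t (ι c))
      infinite n {r} {b} {c} not-far 0≤r 0≤b 0≤ρ lt b<c = not-far⇒infinite {r} {η n - (π-rate + 1ℚ) * inv n} {b} {c} not-far 0≤r 0≤ρ 0≤b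
        (ev-map (λ { k ((≤π , _) , π≤) → ≤π , π≤ }) (ev-× (π-near n) π≤bound)) lt b<c

    open FromThreshold threshold
    open Infimum t finite infinite

    lagrange : ∃ λ L → IsLagrangeConstant t L × ComputableReal L
    lagrange = L , isLagrangeConstant , computable

theorem5p1 : UltimatePositivityDecidable 6 →
    ∀ t → 𝒯 t → ∃ λ L → IsLagrangeConstant t L × ComputableReal L
theorem5p1 decidable t (π , isPi@(_ , Sinπ , _) , α , θ , (_ , _ , Cosθ , Sinθ) , 2πt≈θ) =
  Main.Main.lagrange HalfPi.halfPiSearch decidable π t τ isPi (λ _ → refl) p q unit p≢0 q≢0
    (Reals.Sin⇒sin {π} {ι 0ℚ} Sinπ)
    -- The cosine and sine of θ pass to 2πt itself, whose terms are 2 · π · t by computation; this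
    -- is why the termwise equation above is `refl`.
    (Angles.angle-≃ {θ} {τ} (Reals.≃-sym (Reals.≈⇒≃ 2πt≈θ))
      (Angles.hasAngle (Reals.Cos⇒cos {θ} {ι p} Cosθ) (Reals.Sin⇒sin {θ} {ι q} Sinθ)))
  where
  open 𝒜 α
  τ : ℝ
  τ = ι (1ℚ ℚ.+ 1ℚ) *ᴿ π *ᴿ t
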